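{- The $\mathrm{Hyper^2LTL}$ finite-state satisfiability problem (given a $\mathrm{Hyper^2LTL}$ sentence $\varphi$, is there a finite transition system $\mathfrak T$ with $\mathfrak T\models\varphi$?) is polynomial-time equivalent to truth in third-order arithmetic. The lower bound (i.e. the polynomial-time reduction from truth in third-order arithmetic) holds even for $X_a$-free sentences.
   Context: Syntax. Let $\mathrm{AP}$ be a nonempty finite set of atomic propositions. A trace over $\mathrm{AP}$ is an element $t=t(0)t(1)t(2)\cdots$ of $(2^{\mathrm{AP}})^\omega$. Let $\mathcal V_1$ be a set of trace variables $\pi$ and $\mathcal V_2$ a disjoint set of second-order variables $X$ (ranging over sets of traces), with two distinguished variables $X_a,X_d\in\mathcal V_2$. $\mathrm{Hyper^2LTL}$ formulas are given by $\varphi ::= \exists X.\,\varphi \mid \forall X.\,\varphi \mid \exists \pi\in X.\,\varphi \mid \forall\pi\in X.\,\varphi \mid \psi$ and $\psi ::= p_\pi \mid \neg\psi \mid \psi\vee\psi \mid \mathbf{X}\psi \mid \psi\,\mathbf{U}\,\psi$, with $p\in\mathrm{AP}$, $\pi\in\mathcal V_1$, $X\in\mathcal V_2$. A sentence is a formula in which at most $X_a,X_d$ are free. A sentence is $X_a$-free if $X_a$ does not occur in it. Standard semantics. A variable assignment $\Pi$ is a partial map sending trace variables to traces and second-order variables to sets of traces; $\Pi[\cdot\mapsto\cdot]$ denotes updating; $\Pi[j,\infty)$ maps each trace variable $\pi$ in the domain to the suffix of $\Pi(\pi)$ starting at position $j$. Define $\Pi\models p_\pi$ iff $p\in\Pi(\pi)(0)$;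 Boolean connectives as usual; $\Pi\models\mathbf{X}\psi$ iff $\Pi[1,\infty)\models\psi$; $\Pi\models\psi_1\mathbf{U}\psi_2$ iff there is $j\ge0$ with $\Pi[j,\infty)\models\psi_2$ and $\Pi[j',\infty)\models\psi_1$ for all $0\le j'<j$; $\Pi\models\exists\pi\in X.\varphi$ (resp. $\forall\pi\in X.\varphi$) iff for some (resp. all) $t\in\Pi(X)$, $\Pi[\pi\mapsto t]\models\varphi$; $\Pi\models\exists X.\varphi$ (resp. $\forall X.\varphi$) iff for some (resp. all) $T\subseteq(2^{\mathrm{AP}})^\omega$, $\Pi[X\mapsto T]\models\varphi$. For $T\subseteq(2^{\mathrm{AP}})^\omega$ and a sentence $\varphi$, $T\models\varphi$ means that the assignment with $X_a\mapsto(2^{\mathrm{AP}})^\omega$, $X_d\mapsto T$ (undefined elsewhere) satisfies $\varphi$. Transition systems. A finite transition system $\mathfrak T=(V,E,I,\lambda)$ consists of a finite nonempty set $V$ of vertices, a set $E\subseteq V\times V$ of edges such that every vertex has at least one outgoing edge, a set $I\subseteq V$ of initial vertices, and a labeling $\lambda\colon V\to2^{\mathrm{AP}}$. A path is an infinite sequence $\rho(0)\rho(1)\cdots$ with $\rho(0)\in I$ and $(\rho(n),\rho(n+1))\in E$ for all $n$; its trace is $\lambda(\rho(0))\lambda(\rho(1))\cdots$; $\mathrm{Tr}(\mathfrak T)$ is the set of traces of paths. $\mathfrak T\models\varphi$ means $\mathrm{Tr}(\mathfrak T)\models\varphi$. Arithmetic. Third-order arithmetic is predicate logic over the signature $(+,\cdot,<,\in)$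 with quantification over natural numbers, sets of natural numbers, and sets of sets of natural numbers, evaluated in the structure $(\mathbb N,+,\cdot,<,\in)$. Truth in third-order arithmetic is the problem: given a sentence of third-order arithmetic, does $(\mathbb N,+,\cdot,<,\in)$ satisfy it? Two decision problems are polynomial-time equivalent if each is reducible to the other by a polynomial-time computable many-one reduction. -}

module Defs where

open import Level using (Level; 0ℓ; Lift) renaming (suc to lsuc)
open import Data.Bool.Base using (Bool; true; false; T)
open import Data.Empty using (⊥)
open import Data.Fin.Base using (Fin; zero; suc)
open import Data.Fin.Subset as Subset using (Subset; Nonempty)
open import Data.List.Base using (List; []; _∷_; _++_; map; length; replicate; takeWhileᵇ; allFin)
open import Data.List.Membership.Propositional using (_∈_)
open import Data.List.Membership.Propositional.Properties using (∈-map⁺; ∈-++⁺ʳ; ∈-allFin)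
open import Data.List.Relation.Unary.Any using (here; there)
import Data.List.Relation.Unary.Enumerates.Setoid as Enumerates
open import Data.Maybe.Base as Maybe using (Maybe; just; nothing)
open import Data.Maybe.Relation.Unary.All as MAll using ()
open import Data.Maybe.Relation.Unary.Any as MAny using ()
open import Data.Nat.Base as ℕ using (ℕ; zero; suc; _≤_; _<_)
import Data.Nat.Properties as ℕₚ
open import Data.Product using (Σ; Σ-syntax; ∃; ∃-syntax; _×_; _,_; proj₁)
open import Data.Sum.Base using (_⊎_)
open import Data.Unit.Base using (⊤)
open import Data.Vec.Base as Vec using (Vec; []; _∷_)
open import Function.Base using (_∘_)
open import Function.Bundles using (_⇔_)
open import Relation.Binary.Definitions using (DecidableEquality)
open import Relation.Binary.PropositionalEquality using (_≡_; _≢_; refl; setoid)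
open import Relation.Nullary using (¬_; yes; no)
open import Relation.Unary using (Pred)

private
  variable
    ℓ : Level
    A B I O W : Set

Finite : Set → Set
Finite A = Σ[ xs ∈ List A ] Enumerates.IsEnumeration (setoid A) xs

update : {V : Set} {D : Set ℓ} → DecidableEquality V → (V → D) → V → D → (V → D)
update _≟_ f v d w with v ≟ w
... | yes _ = d
... | no  _ = f w

------------------------------------------------------------------------
-- Polynomial-time computability: deterministic multi-tape Turing machines

-- The tape alphabet is the disjoint union of a blank, the input alphabet, the
-- output alphabet and a finite set of further symbols.
data Cell (I O W : Set) : Set where
  blank  : Cell I O W
  input  : I → Cell I O W
  output : O → Cell I O W
  work   : W → Cell I O W

nonBlank : Cell I O W → Bool
nonBlank blank = false
nonBlank _     = true

data Move : Set where
  left stay right : Move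

-- A two-way infinite tape.  Both lists start next to the head, and all cells
-- beyond their ends are blank.
record Tape (I O W : Set) : Set where
  constructor tape
  field
    before : List (Cell I O W)
    head   : Cell I O W
    after  : List (Cell I O W)

open Tape

load : List (Cell I O W) → Tape I O W
load []       = tape [] blank []
load (c ∷ cs) = tape [] c cs

shift : Move → Tape I O W → Tape I O W
shift left  (tape []       c rs)       = tape [] blank (c ∷ rs)
shift left  (tape (l ∷ ls) c rs)       = tape ls l (c ∷ rs)
shift stay  t                          = t
shift right (tape ls       c [])       = tape (c ∷ ls) blank []
shift right (tape ls       c (r ∷ rs)) = tape (c ∷ ls) r rs

act : Cell I O W × Move → Tape I O W → Tape I O W
act (c , m) t = shift m (record t { head = c })

-- Tape 0 is the input tape, tape 1 the output tape.  The machine halts when δ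
-- returns nothing.
record Machine (I O : Set) : Set₁ where
  field
    State       : Set
    Work        : Set
    stateFinite : Finite State
    workFinite  : Finite Work
    extraTapes  : ℕ

  tapes : ℕ
  tapes = 2 ℕ.+ extraTapes

  field
    start : State
    δ     : State → Vec (Cell I O Work) tapes →
            Maybe (State × Vec (Cell I O Work × Move) tapes)

  Config : Set
  Config = State × Vec (Tape I O Work) tapes

  initial : List I → Config
  initial w = start , load (map input w) ∷ Vec.replicate _ (load [])

  step : Config → Maybe Config
  step (q , ts) = Maybe.map (λ (q′ , as) → q′ , Vec.zipWith act as ts)
                            (δ q (Vec.map head ts))

  -- C ⇓[ s ] D : started in C, the machine halts after exactly s steps, in D.
  data _⇓[_]_ : Config → ℕ → Config → Set where
    halt : ∀ {C} → step C ≡ nothing → C ⇓[ 0 ] C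
    next : ∀ {C C′ D s} → step C ≡ just C′ → C′ ⇓[ s ] D → C ⇓[ suc s ] D

  -- The result extends from the head of the output tape to the first blank.
  result : Config → List (Cell I O Work)
  result (_ , _ ∷ t ∷ _) = takeWhileᵇ nonBlank (head t ∷ after t)

-- The bound c · (1 + |x|)ᵈ dominates every polynomial for suitable c and d.
PolyTime : (A → List I) → (B → List O) → (A → B) → Set₁
PolyTime {I = I} {O = O} encA encB f =
  Σ[ M ∈ Machine I O ] let open Machine M in
  ∃[ c ] ∃[ d ] ∀ x → ∃[ s ] ∃[ D ]
    (initial (encA x) ⇓[ s ] D) ×
    s ≤ c ℕ.* suc (length (encA x)) ℕ.^ d ×
    result D ≡ map output (encB (f x))

record Problem : Set₂ where
  field
    Instance     : Set
    Symbol       : Set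
    symbolFinite : Finite Symbol
    encode       : Instance → List Symbol
    Yes          : Instance → Set₁

open Problem

infix 4 _≤ₚ_ _≡ₚ_

_≤ₚ_ : Problem → Problem → Set₁
P ≤ₚ Q = Σ[ f ∈ (Instance P → Instance Q) ]
  PolyTime (encode P) (encode Q) f × (∀ x → Yes P x ⇔ Yes Q (f x))

_≡ₚ_ : Problem → Problem → Set₁
P ≡ₚ Q = (P ≤ₚ Q) × (Q ≤ₚ P)

_∣ₚ_ : (P : Problem) → (Instance P → Set) → Problem
P ∣ₚ R = record
  { Instance     = Σ (Instance P) R
  ; Symbol       = Symbol P
  ; symbolFinite = symbolFinite P
  ; encode       = encode P ∘ proj₁
  ; Yes          = Yes P ∘ proj₁
  }

------------------------------------------------------------------------
-- Hyper²LTL over the propositions AP = Fin a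

module Hyper²LTL (a : ℕ) where

  AP : Set
  AP = Fin a

  TraceVar : Set
  TraceVar = ℕ

  data SetVar : Set where
    Xa Xd : SetVar
    var   : ℕ → SetVar

  _≟ˢ_ : DecidableEquality SetVar
  Xa    ≟ˢ Xa    = yes refl
  Xa    ≟ˢ Xd    = no λ ()
  Xa    ≟ˢ var _ = no λ ()
  Xd    ≟ˢ Xa    = no λ ()
  Xd    ≟ˢ Xd    = yes refl
  Xd    ≟ˢ var _ = no λ ()
  var _ ≟ˢ Xa    = no λ ()
  var _ ≟ˢ Xd    = no λ ()
  var x ≟ˢ var y with x ℕₚ.≟ y
  ... | yes refl = yes refl
  ... | no  x≢y  = no λ { refl → x≢y refl }

  data LTL : Set where
    ⟨_⟩_     : AP → TraceVar → LTL
    not      : LTL → LTL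
    _or_ _U_ : LTL → LTL → LTL
    X        : LTL → LTL

  data Formula : Set where
    ∃ˢ ∀ˢ : SetVar → Formula → Formula
    ∃ᵗ ∀ᵗ : TraceVar → SetVar → Formula → Formula
    ltl   : LTL → Formula

  OccursLTL : TraceVar → LTL → Set
  OccursLTL π (⟨ _ ⟩ ρ)  = π ≡ ρ
  OccursLTL π (not ψ)    = OccursLTL π ψ
  OccursLTL π (ψ₁ or ψ₂) = OccursLTL π ψ₁ ⊎ OccursLTL π ψ₂
  OccursLTL π (ψ₁ U ψ₂)  = OccursLTL π ψ₁ ⊎ OccursLTL π ψ₂
  OccursLTL π (X ψ)      = OccursLTL π ψ

  FreeTrace : TraceVar → Formula → Set
  FreeTrace π (∃ˢ _ φ)   = FreeTrace π φ
  FreeTrace π (∀ˢ _ φ)   = FreeTrace π φ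
  FreeTrace π (∃ᵗ ρ _ φ) = π ≢ ρ × FreeTrace π φ
  FreeTrace π (∀ᵗ ρ _ φ) = π ≢ ρ × FreeTrace π φ
  FreeTrace π (ltl ψ)    = OccursLTL π ψ

  FreeSet : SetVar → Formula → Set
  FreeSet Y (∃ˢ Z φ)   = Y ≢ Z × FreeSet Y φ
  FreeSet Y (∀ˢ Z φ)   = Y ≢ Z × FreeSet Y φ
  FreeSet Y (∃ᵗ _ Z φ) = Y ≡ Z ⊎ FreeSet Y φ
  FreeSet Y (∀ᵗ _ Z φ) = Y ≡ Z ⊎ FreeSet Y φ
  FreeSet Y (ltl _)    = ⊥

  OccursSet : SetVar → Formula → Set
  OccursSet Y (∃ˢ Z φ)   = Y ≡ Z ⊎ OccursSet Y φ
  OccursSet Y (∀ˢ Z φ)   = Y ≡ Z ⊎ OccursSet Y φ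
  OccursSet Y (∃ᵗ _ Z φ) = Y ≡ Z ⊎ OccursSet Y φ
  OccursSet Y (∀ᵗ _ Z φ) = Y ≡ Z ⊎ OccursSet Y φ
  OccursSet Y (ltl _)    = ⊥

  IsSentence : Formula → Set
  IsSentence φ = (∀ π → ¬ FreeTrace π φ) × (∀ Y → FreeSet Y φ → Y ≡ Xa ⊎ Y ≡ Xd)

  Sentence : Set
  Sentence = Σ Formula IsSentence

  XaFree : Sentence → Set
  XaFree (φ , _) = ¬ OccursSet Xa φ

  Trace : Set
  Trace = ℕ → Subset a

  -- Excluded middle makes every set of traces, whatever its universe level,
  -- pointwise equivalent to one of these.
  TraceSet : Set₁
  TraceSet = Pred Trace 0ℓ

  suffix : ℕ → Trace → Trace
  suffix j t i = t (j ℕ.+ i)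

  record Assignment : Set₁ where
    field
      traceOf : TraceVar → Maybe Trace
      setOf   : SetVar → Maybe TraceSet

  open Assignment

  _[_,∞⟩ : Assignment → ℕ → Assignment
  Π [ j ,∞⟩ = record Π { traceOf = Maybe.map (suffix j) ∘ traceOf Π }

  _[_↦ᵗ_] : Assignment → TraceVar → Trace → Assignment
  Π [ π ↦ᵗ t ] = record Π { traceOf = update ℕₚ._≟_ (traceOf Π) π (just t) }

  _[_↦ˢ_] : Assignment → SetVar → TraceSet → Assignment
  Π [ Y ↦ˢ S ] = record Π { setOf = update _≟ˢ_ (setOf Π) Y (just S) }

  infix 4 _⊨ˡ_ _⊨_ _⊨ˢ_

  -- At a variable outside the domain of Π, an atom is false, and a trace
  -- quantifier ranges over no traces; neither happens when evaluating sentences.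
  _⊨ˡ_ : Assignment → LTL → Set
  Π ⊨ˡ ⟨ p ⟩ π  = MAny.Any (λ t → p Subset.∈ t 0) (traceOf Π π)
  Π ⊨ˡ not ψ    = ¬ (Π ⊨ˡ ψ)
  Π ⊨ˡ ψ₁ or ψ₂ = (Π ⊨ˡ ψ₁) ⊎ (Π ⊨ˡ ψ₂)
  Π ⊨ˡ X ψ      = Π [ 1 ,∞⟩ ⊨ˡ ψ
  Π ⊨ˡ ψ₁ U ψ₂  = ∃[ j ] (Π [ j ,∞⟩ ⊨ˡ ψ₂) × (∀ j′ → j′ < j → Π [ j′ ,∞⟩ ⊨ˡ ψ₁)

  _⊨_ : Assignment → Formula → Set₁
  Π ⊨ ∃ˢ Y φ   = Σ[ S ∈ TraceSet ] (Π [ Y ↦ˢ S ] ⊨ φ)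
  Π ⊨ ∀ˢ Y φ   = (S : TraceSet) → Π [ Y ↦ˢ S ] ⊨ φ
  Π ⊨ ∃ᵗ π Y φ = MAny.Any (λ S → Σ[ t ∈ Trace ] S t × (Π [ π ↦ᵗ t ] ⊨ φ)) (setOf Π Y)
  Π ⊨ ∀ᵗ π Y φ = MAll.All (λ S → (t : Trace) → S t → Π [ π ↦ᵗ t ] ⊨ φ) (setOf Π Y)
  Π ⊨ ltl ψ    = Lift (lsuc 0ℓ) (Π ⊨ˡ ψ)

  emptyAssignment : Assignment
  emptyAssignment = record { traceOf = λ _ → nothing ; setOf = λ _ → nothing }

  _⊨ˢ_ : TraceSet → Sentence → Set₁
  S ⊨ˢ (φ , _) = emptyAssignment [ Xa ↦ˢ (λ _ → ⊤) ] [ Xd ↦ˢ S ] ⊨ φ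

  record TransitionSystem : Set where
    field
      pred-size : ℕ

    Vertex : Set
    Vertex = Fin (suc pred-size)

    field
      successors : Vertex → Subset (suc pred-size)
      total      : ∀ v → Nonempty (successors v)
      initials   : Subset (suc pred-size)
      label      : Vertex → Subset a

    IsPath : (ℕ → Vertex) → Set
    IsPath ρ = (ρ 0 Subset.∈ initials) × (∀ i → ρ (suc i) Subset.∈ successors (ρ i))

    Tr : TraceSet
    Tr t = ∃[ ρ ] IsPath ρ × (∀ i → t i ≡ label (ρ i))

  -- Formulas are written in prefix notation, variable indices in unary.
  data Sym : Set where
    ∃ˢ ∀ˢ ∃ᵗ ∀ᵗ not or U X xa xd stroke end : Sym
    prop : AP → Sym

  symFinite : Finite Sym
  symFinite = base ++ map prop (allFin a) , enum
    where
    base : List Sym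
    base = ∃ˢ ∷ ∀ˢ ∷ ∃ᵗ ∷ ∀ᵗ ∷ not ∷ or ∷ U ∷ X ∷ xa ∷ xd ∷ stroke ∷ end ∷ []

    enum : ∀ s → s ∈ base ++ map prop (allFin a)
    enum ∃ˢ       = here refl
    enum ∀ˢ       = there (here refl)
    enum ∃ᵗ       = there (there (here refl))
    enum ∀ᵗ       = there (there (there (here refl)))
    enum not      = there (there (there (there (here refl))))
    enum or       = there (there (there (there (there (here refl)))))
    enum U        = there (there (there (there (there (there (here refl))))))
    enum X        = there (there (there (there (there (there (there (here refl)))))))
    enum xa       = there (there (there (there (there (there (there (there (here refl))))))))
    enum xd       = there (there (there (there (there (there (there (there (there (here refl)))))))))
    enum stroke   = there (there (there (there (there (there (there (there (there (there (here refl))))))))))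
    enum end      = there (there (there (there (there (there (there (there (there (there (there (here refl)))))))))))
    enum (prop p) = ∈-++⁺ʳ base (∈-map⁺ prop (∈-allFin p))

  encodeIndex : ℕ → List Sym
  encodeIndex k = replicate k stroke ++ end ∷ []

  encodeSetVar : SetVar → List Sym
  encodeSetVar Xa      = xa ∷ []
  encodeSetVar Xd      = xd ∷ []
  encodeSetVar (var k) = encodeIndex k

  encodeLTL : LTL → List Sym
  encodeLTL (⟨ p ⟩ π)  = prop p ∷ encodeIndex π
  encodeLTL (not ψ)    = not ∷ encodeLTL ψ
  encodeLTL (ψ₁ or ψ₂) = or ∷ encodeLTL ψ₁ ++ encodeLTL ψ₂
  encodeLTL (ψ₁ U ψ₂)  = U ∷ encodeLTL ψ₁ ++ encodeLTL ψ₂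
  encodeLTL (X ψ)      = X ∷ encodeLTL ψ

  encodeFormula : Formula → List Sym
  encodeFormula (∃ˢ Y φ)   = ∃ˢ ∷ encodeSetVar Y ++ encodeFormula φ
  encodeFormula (∀ˢ Y φ)   = ∀ˢ ∷ encodeSetVar Y ++ encodeFormula φ
  encodeFormula (∃ᵗ π Y φ) = ∃ᵗ ∷ encodeIndex π ++ encodeSetVar Y ++ encodeFormula φ
  encodeFormula (∀ᵗ π Y φ) = ∀ᵗ ∷ encodeIndex π ++ encodeSetVar Y ++ encodeFormula φ
  encodeFormula (ltl ψ)    = encodeLTL ψ

FiniteStateSatisfiability : ℕ → Problem
FiniteStateSatisfiability a = record
  { Instance     = Sentence
  ; Symbol       = Sym
  ; symbolFinite = symFinite
  ; encode       = encodeFormula ∘ proj₁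
  ; Yes          = λ φ → Σ[ 𝔗 ∈ TransitionSystem ] (TransitionSystem.Tr 𝔗 ⊨ˢ φ)
  }
  where open Hyper²LTL a

XaFreeFiniteStateSatisfiability : ℕ → Problem
XaFreeFiniteStateSatisfiability a = FiniteStateSatisfiability a ∣ₚ Hyper²LTL.XaFree a

------------------------------------------------------------------------
-- Third-order arithmetic

module Arithmetic where

  data Sort : Set where
    num set family : Sort

  data Term : Set where
    var     : ℕ → Term
    _⊕_ _⊗_ : Term → Term → Term

  data Atom : Set where
    _≐_ _≺_ : Term → Term → Atom
    _∈ˢ_    : Term → ℕ → Atom
    _∈ᶠ_    : ℕ → ℕ → Atom

  -- Each sort has its own variables, indexed by ℕ.
  data Formula : Set where
    atom   : Atom → Formula
    not    : Formula → Formula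
    _and_  : Formula → Formula → Formula
    _or_   : Formula → Formula → Formula
    all ex : Sort → ℕ → Formula → Formula

  OccursTerm : ℕ → Term → Set
  OccursTerm x (var y)   = x ≡ y
  OccursTerm x (t₁ ⊕ t₂) = OccursTerm x t₁ ⊎ OccursTerm x t₂
  OccursTerm x (t₁ ⊗ t₂) = OccursTerm x t₁ ⊎ OccursTerm x t₂

  OccursAtom : Sort → ℕ → Atom → Set
  OccursAtom num    x (t₁ ≐ t₂) = OccursTerm x t₁ ⊎ OccursTerm x t₂
  OccursAtom num    x (t₁ ≺ t₂) = OccursTerm x t₁ ⊎ OccursTerm x t₂
  OccursAtom num    x (t ∈ˢ _)  = OccursTerm x t
  OccursAtom set    x (_ ∈ˢ y)  = x ≡ y
  OccursAtom set    x (y ∈ᶠ _)  = x ≡ y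
  OccursAtom family x (_ ∈ᶠ y)  = x ≡ y
  OccursAtom _      _ _         = ⊥

  Free : Sort → ℕ → Formula → Set
  Free s x (atom α)    = OccursAtom s x α
  Free s x (not φ)     = Free s x φ
  Free s x (φ and χ)   = Free s x φ ⊎ Free s x χ
  Free s x (φ or χ)    = Free s x φ ⊎ Free s x χ
  Free s x (all r y φ) = (s , x) ≢ (r , y) × Free s x φ
  Free s x (ex r y φ)  = (s , x) ≢ (r , y) × Free s x φ

  Sentence : Set
  Sentence = Σ[ φ ∈ Formula ] (∀ s x → ¬ Free s x φ)

  -- A set of numbers is given by its characteristic function.  These are all the
  -- sets of numbers under excluded middle, and function extensionality makes
  -- pointwise equality of characteristic functions the equality that families
  -- respect.
  record Env : Set₁ where
    field
      nums     : ℕ → ℕ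
      sets     : ℕ → (ℕ → Bool)
      families : ℕ → Pred (ℕ → Bool) 0ℓ

  open Env

  Domain : Sort → Set₁
  Domain num    = Lift (lsuc 0ℓ) ℕ
  Domain set    = Lift (lsuc 0ℓ) (ℕ → Bool)
  Domain family = Pred (ℕ → Bool) 0ℓ

  assign : (s : Sort) → Env → ℕ → Domain s → Env
  assign num    e x d = record e { nums     = update ℕₚ._≟_ (nums e) x (Lift.lower d) }
  assign set    e x d = record e { sets     = update ℕₚ._≟_ (sets e) x (Lift.lower d) }
  assign family e x d = record e { families = update ℕₚ._≟_ (families e) x d }

  ⟦_⟧ : Term → Env → ℕ
  ⟦ var x ⟧   e = nums e x
  ⟦ t₁ ⊕ t₂ ⟧ e = ⟦ t₁ ⟧ e ℕ.+ ⟦ t₂ ⟧ e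
  ⟦ t₁ ⊗ t₂ ⟧ e = ⟦ t₁ ⟧ e ℕ.* ⟦ t₂ ⟧ e

  infix 4 _⊨ᵃ_ _⊨_

  _⊨ᵃ_ : Env → Atom → Set
  e ⊨ᵃ t₁ ≐ t₂ = ⟦ t₁ ⟧ e ≡ ⟦ t₂ ⟧ e
  e ⊨ᵃ t₁ ≺ t₂ = ⟦ t₁ ⟧ e < ⟦ t₂ ⟧ e
  e ⊨ᵃ t ∈ˢ x  = T (sets e x (⟦ t ⟧ e))
  e ⊨ᵃ x ∈ᶠ y  = families e y (sets e x)

  _⊨_ : Env → Formula → Set₁
  e ⊨ atom α    = Lift (lsuc 0ℓ) (e ⊨ᵃ α)
  e ⊨ not φ     = ¬ (e ⊨ φ)
  e ⊨ φ and χ   = (e ⊨ φ) × (e ⊨ χ)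
  e ⊨ φ or χ    = (e ⊨ φ) ⊎ (e ⊨ χ)
  e ⊨ all s x φ = (d : Domain s) → assign s e x d ⊨ φ
  e ⊨ ex s x φ  = Σ[ d ∈ Domain s ] (assign s e x d ⊨ φ)

  -- Values for the free variables, of which a sentence has none.
  default : Env
  default = record { nums = λ _ → 0 ; sets = λ _ _ → false ; families = λ _ _ → ⊥ }

  -- Formulas are written in prefix notation, variable indices in unary.
  data Sym : Set where
    all ex                                    : Sort → Sym
    plus times eq lt inˢ inᶠ not and or stroke end : Sym

  symFinite : Finite Sym
  symFinite = syms , enum
    where
    syms : List Sym
    syms = plus ∷ times ∷ eq ∷ lt ∷ inˢ ∷ inᶠ ∷ not ∷ and ∷ or ∷ stroke ∷ end ∷
           all num ∷ all set ∷ all family ∷ ex num ∷ ex set ∷ ex family ∷ []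

    enum : ∀ s → s ∈ syms
    enum plus         = here refl
    enum times        = there (here refl)
    enum eq           = there (there (here refl))
    enum lt           = there (there (there (here refl)))
    enum inˢ          = there (there (there (there (here refl))))
    enum inᶠ          = there (there (there (there (there (here refl)))))
    enum not          = there (there (there (there (there (there (here refl))))))
    enum and          = there (there (there (there (there (there (there (here refl)))))))
    enum or           = there (there (there (there (there (there (there (there (here refl))))))))
    enum stroke       = there (there (there (there (there (there (there (there (there (here refl)))))))))
    enum end          = there (there (there (there (there (there (there (there (there (there (here refl))))))))))
    enum (all num)    = there (there (there (there (there (there (there (there (there (there (there (here refl)))))))))))
    enum (all set)    = there (there (there (there (there (there (there (there (there (there (there (there (here refl))))))))))))
    enum (all family) = there (there (there (there (there (there (there (there (there (there (there (there (there (here refl)))))))))))))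
    enum (ex num)     = there (there (there (there (there (there (there (there (there (there (there (there (there (there (here refl))))))))))))))
    enum (ex set)     = there (there (there (there (there (there (there (there (there (there (there (there (there (there (there (here refl)))))))))))))))
    enum (ex family)  = there (there (there (there (there (there (there (there (there (there (there (there (there (there (there (there (here refl))))))))))))))))

  encodeIndex : ℕ → List Sym
  encodeIndex k = replicate k stroke ++ end ∷ []

  encodeTerm : Term → List Sym
  encodeTerm (var x)   = encodeIndex x
  encodeTerm (t₁ ⊕ t₂) = plus ∷ encodeTerm t₁ ++ encodeTerm t₂
  encodeTerm (t₁ ⊗ t₂) = times ∷ encodeTerm t₁ ++ encodeTerm t₂

  encodeAtom : Atom → List Sym
  encodeAtom (t₁ ≐ t₂) = eq ∷ encodeTerm t₁ ++ encodeTerm t₂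
  encodeAtom (t₁ ≺ t₂) = lt ∷ encodeTerm t₁ ++ encodeTerm t₂
  encodeAtom (t ∈ˢ x)  = inˢ ∷ encodeTerm t ++ encodeIndex x
  encodeAtom (x ∈ᶠ y)  = inᶠ ∷ encodeIndex x ++ encodeIndex y

  encodeFormula : Formula → List Sym
  encodeFormula (atom α)    = encodeAtom α
  encodeFormula (not φ)     = not ∷ encodeFormula φ
  encodeFormula (φ and χ)   = and ∷ encodeFormula φ ++ encodeFormula χ
  encodeFormula (φ or χ)    = or ∷ encodeFormula φ ++ encodeFormula χ
  encodeFormula (all s x φ) = all s ∷ encodeIndex x ++ encodeFormula φ
  encodeFormula (ex s x φ)  = ex s ∷ encodeIndex x ++ encodeFormula φ

ThirdOrderArithmeticTruth : Problem
ThirdOrderArithmeticTruth = record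
  { Instance     = Sentence
  ; Symbol       = Sym
  ; symbolFinite = symFinite
  ; encode       = encodeFormula ∘ proj₁
  ; Yes          = λ (φ , _) → default ⊨ φ
  }
  where open Arithmetic

module Submission where

open import Defs
open import Level using (Level; 0ℓ; _⊔_; Lift; lift; lower) renaming (suc to lsuc)
open import Axiom.ExcludedMiddle using (ExcludedMiddle)
open import Axiom.Extensionality.Propositional using (Extensionality; lower-extensionality)
import Data.Bool.Properties as Boolₚ
open import Data.Bool.Base using (Bool; true; false; T; if_then_else_; _∨_; _∧_) renaming (not to ¬ᵇ_)
open import Data.Empty using (⊥; ⊥-elim)
open import Data.Fin.Base using (Fin; zero; suc; toℕ; fromℕ<)
import Data.Fin.Properties as Finₚ
import Data.Fin.Subset.Properties as Subsetₚ
import Data.Fin.Subset as Subset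
open import Data.List.Base using (List; []; _∷_; _++_; _ʳ++_; map; length; replicate; concatMap; take; takeWhileᵇ)
import Data.List.Properties as Listₚ
open import Data.List.Membership.Propositional using (_∈_)
open import Data.List.Membership.Propositional.Properties using (∈-map⁺; ∈-++⁺ˡ; ∈-++⁺ʳ; ∈-concatMap⁺)
open import Data.List.Relation.Unary.All using (All; []; _∷_)
import Data.List.Relation.Unary.All.Properties as Allₚ
open import Data.List.Relation.Unary.Any using (here; there)
open import Data.Maybe.Base as Maybe using (Maybe; just; nothing)
open import Data.Maybe.Relation.Unary.All as MAll using ()
open import Data.Maybe.Relation.Unary.Any as MAny using ()
open import Data.Nat.Base using (ℕ; zero; suc; _+_; _*_; _^_; _≤_; _<_; z≤n; s≤s)
import Data.Nat.Base as ℕ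
import Data.Nat.Properties as ℕₚ
open import Data.Nat.DivMod using (_/_; _%_; _mod_)
import Data.Nat.DivMod as DivMod
open import Data.Nat.Tactic.RingSolver using (solve-∀)
open import Data.Product using (Σ; Σ-syntax; ∃; ∃-syntax; _×_; _,_; proj₁; proj₂; map₁; map₂)
open import Data.Sum.Base as Sum using (_⊎_; inj₁; inj₂; [_,_]′)
open import Data.Unit.Base using (⊤; tt)
open import Data.Vec.Base as Vec using (Vec; []; _∷_; lookup; _[_]≔_)
import Data.Vec.Properties as Vecₚ
open import Data.Vec.Relation.Binary.Pointwise.Inductive as Pointwise using (Pointwise; []; _∷_)
open import Function.Base using (_∘_; id; case_of_; _$_)
open import Function.Bundles using (_⇔_; mk⇔; Equivalence)
open import Relation.Binary.Definitions using (DecidableEquality; tri<; tri≈; tri>)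
open import Relation.Binary.PropositionalEquality
open import Relation.Nullary using (¬_; Dec; yes; no)
open import Relation.Nullary.Decidable using (True; toWitness; fromWitness; ⌊_⌋)
open import Relation.Unary using (Pred)

-- Both reductions rest on one correspondence. A trace over finitely many propositions is a set of
-- numbers: position i and proposition p become the number i |AP| + p. Hence a set of traces is a
-- set of sets of numbers, and the second-order quantifiers of Hyper²LTL range over the same kind of
-- objects as the third-order quantifiers of arithmetic.
--
-- Upper bound. Trace quantifiers become set quantifiers, set quantifiers become family quantifiers,
-- and LTL is evaluated with a number variable for the current position. A finite transition system
-- is a number of vertices together with sets of numbers for its initial vertices, edges and labels;
-- a trace belongs to it iff some set of pairs (position, vertex) describes a path with that trace.
-- So the existence of the system is expressed by number and set quantifiers, X_d becomes the family
-- of the traces so described, and X_a the family of all sets (`translate-correct`, `system⇔`,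
-- `wrap-correct`).
--
-- Lower bound. The sentence that is built holds in every transition system or in none. An arbitrary
-- trace is an element of an arbitrary set, so quantifying a set and then one of its elements
-- replaces quantification over X_a. A trace carries three sets of numbers, its tracks, interleaved
-- with period 3. A clock trace marking the multiples of 3 is definable in LTL, and relative to it
-- LTL can compare, shift and intersect tracks. A number is a track that is a singleton. Addition
-- and multiplication are existentially quantified sets of traces serving as tables; they are pinned
-- down by conditions of the form "for every entry there are entries such that": closure under the
-- recursion for the operation, starting from (0, 0, 0), and a predecessor for every entry that does
-- not begin the recursion (`plus-table`, `times-table`). A family is represented by a nonempty set
-- of traces, some of which are tagged as members. The arithmetic formula then becomes a tree of
-- quantifiers over traces, Boolean connectives and LTL formulas (`tree-correct`).
--
-- Hyper²LTL formulas are prenex, trees are not. Classically the quantifiers can be pulled out of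
-- all connectives, provided that bound names are distinct and that every set quantified over is
-- nonempty (`prenex`); the tables and the representation of families are arranged so that the
-- latter holds.
--
-- Polynomial time. Machines are obtained by compiling programs that use each tape as a stack, and
-- `Run` is a calculus of timed executions of such programs. For the upper bound, translated
-- connectives have their holes at the end of their prefix notation, so a left-to-right transducer
-- suffices and takes linear time. For the lower bound, the quantifier prefix and the matrix are
-- written simultaneously to two logs, directed by a stack of goals that also stores the
-- environment. The name bound at a node is determined by the length of the input remaining after
-- its first symbol; this makes names easy to compute and disjoint in different subtrees. The time
-- is cubic.

-- Stack programs, their compilation to Turing machines, and timed runs

module StackMachines where

  private
    variable
      A B E F I O W : Set

  -- A record around `Finite A`, so that instance search can supply enumerations.
  record Listed (A : Set) : Set where
    constructor listed
    field finite : Finite A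

  open Listed

  instance
    listed-⊤ : Listed ⊤
    listed-⊤ .finite = tt ∷ [] , λ _ → here refl

    listed-Bool : Listed Bool
    listed-Bool .finite = true ∷ false ∷ [] , λ { true → here refl ; false → there (here refl) }

    listed-Maybe : {{Listed A}} → Listed (Maybe A)
    listed-Maybe {{listed (xs , enum)}} .finite =
      nothing ∷ map just xs , λ { nothing → here refl ; (just x) → there (∈-map⁺ just (enum x)) }

    listed-⊎ : {{Listed A}} → {{Listed B}} → Listed (A ⊎ B)
    listed-⊎ {{listed (xs , enum)}} {{listed (ys , enum′)}} .finite =
      map inj₁ xs ++ map inj₂ ys ,
      λ { (inj₁ x) → ∈-++⁺ˡ (∈-map⁺ inj₁ (enum x))
        ; (inj₂ y) → ∈-++⁺ʳ (map inj₁ xs) (∈-map⁺ inj₂ (enum′ y)) }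

  listed-Σ : {B : A → Set} → Listed A → (∀ x → Listed (B x)) → Listed (Σ A B)
  listed-Σ (listed (xs , enum)) l .finite =
    concatMap (λ x → map (x ,_) (proj₁ (finite (l x)))) xs ,
    λ { (x , y) → ∈-concatMap⁺ (λ x → map (x ,_) (proj₁ (finite (l x))))
                    (∈-any x y (enum x)) }
    where
    open import Data.List.Relation.Unary.Any as Any using (Any)
    ∈-any : ∀ x y {xs} → x ∈ xs → Any (λ z → (x , y) ∈ map (z ,_) (proj₁ (finite (l z)))) xs
    ∈-any x y = Any.map λ { refl → ∈-map⁺ (x ,_) (proj₂ (finite (l x)) y) }

  -- Only the non-blank cells, so that a blank under the head signals the empty stack.
  data Letter (I O W : Set) : Set where
    inp : I → Letter I O W
    out : O → Letter I O W
    wrk : W → Letter I O W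

  instance
    listed-Letter : {{Listed I}} → {{Listed O}} → {{Listed W}} → Listed (Letter I O W)
    listed-Letter {{listed (xs , enum)}} {{listed (ys , enum′)}} {{listed (zs , enum″)}} .finite =
      map inp xs ++ map out ys ++ map wrk zs ,
      λ { (inp x) → ∈-++⁺ˡ (∈-map⁺ inp (enum x))
        ; (out y) → ∈-++⁺ʳ (map inp xs) (∈-++⁺ˡ (∈-map⁺ out (enum′ y)))
        ; (wrk z) → ∈-++⁺ʳ (map inp xs) (∈-++⁺ʳ (map out ys) (∈-map⁺ wrk (enum″ z))) }

  cell : Letter I O W → Cell I O W
  cell (inp i) = input i
  cell (out o) = output o
  cell (wrk w) = work w

  letter : Cell I O W → Maybe (Letter I O W)
  letter blank      = nothing
  letter (input i)  = just (inp i)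
  letter (output o) = just (out o)
  letter (work w)   = just (wrk w)

  Blanks : List (Cell I O W) → Set
  Blanks = All (_≡ blank)

  -- Every tape is used as a stack whose top is at the head: pushing moves left, and popping
  -- erases the head and moves right, so that everything outside the stack stays blank.
  data Stack {I O W} : Tape I O W → List (Letter I O W) → Set where
    stack : ∀ {bs h as xs cs} → Blanks bs → Blanks cs → h ∷ as ≡ map cell xs ++ cs →
            Stack (tape bs h as) xs

  blanks-tail : ∀ {c} {cs : List (Cell I O W)} → Blanks (c ∷ cs) → Blanks cs
  blanks-tail (_ ∷ b) = b

  module _ {I O W : Set} where

    letter-top : ∀ {t : Tape I O W} {x xs} → Stack t (x ∷ xs) → letter (Tape.head t) ≡ just x
    letter-top {x = inp _} (stack _ _ refl) = refl
    letter-top {x = out _} (stack _ _ refl) = refl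
    letter-top {x = wrk _} (stack _ _ refl) = refl

    letter-empty : ∀ {t : Tape I O W} → Stack t [] → letter (Tape.head t) ≡ nothing
    letter-empty (stack _ (refl ∷ _) refl) = refl

    erase-top : ∀ {t : Tape I O W} {x xs} → Stack t (x ∷ xs) → Stack (act (blank , right) t) xs
    erase-top {xs = []}     (stack {cs = []} b c refl)    = stack (refl ∷ b) (refl ∷ []) refl
    erase-top {xs = []}     (stack {cs = _ ∷ _} b c refl) = stack (refl ∷ b) c refl
    erase-top {xs = _ ∷ _}  (stack b c refl)              = stack (refl ∷ b) c refl

    push-onto : ∀ {t : Tape I O W} {xs} x → Stack t xs →
                Stack (act (cell x , stay) (act (Tape.head t , left) t)) (x ∷ xs)
    push-onto x (stack {bs = []}     b c eq) = stack b c (cong (cell x ∷_) eq)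
    push-onto x (stack {bs = _ ∷ _} b c eq) = stack (blanks-tail b) c (cong (cell x ∷_) eq)

  module Programs (I O W : Set) (extra : ℕ) where

    Γ : Set
    Γ = Letter I O W

    k : ℕ
    k = 2 + extra

    Tapes : Set
    Tapes = Vec (Tape I O W) k

    Heads : Set
    Heads = Vec (Cell I O W) k

    Actions : Set
    Actions = Vec (Cell I O W × Move) k

    Stacks : Set
    Stacks = Vec (List Γ) k

    infixl 1 _>>=_ _>>_

    -- Intermediate results and loop values come from finite types because the compiled machine
    -- remembers them in its control state; unbounded data live on the stacks.
    data Prog : Set → Set₁ where
      skip  : E → Prog E
      pop   : Fin k → Prog (Maybe Γ)
      push  : Fin k → Γ → Prog ⊤
      _>>=_ : {{Listed E}} → Prog E → (E → Prog F) → Prog F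
      loop  : {{Listed A}} → (A → Prog (A ⊎ E)) → A → Prog E

    _>>_ : Prog ⊤ → Prog F → Prog F
    P >> P′ = P >>= λ _ → P′

    -- A push has two states: the first step moves left off the old top, the second writes the new
    -- one.
    Q : Prog E → Set
    Q (skip _)              = ⊤
    Q (pop _)               = ⊤
    Q (push _ _)            = Bool
    Q (P >>= f)             = Q P ⊎ (Σ[ e ∈ _ ] Q (f e))
    Q (loop {A = A} body _) = Σ[ a ∈ A ] Q (body a)

    Qlisted : (P : Prog E) → Listed (Q P)
    Qlisted (skip _)           = listed-⊤
    Qlisted (pop _)            = listed-⊤
    Qlisted (push _ _)         = listed-Bool
    Qlisted (_>>=_ {{l}} P f)  = listed-⊎ {{Qlisted P}} {{listed-Σ l (λ e → Qlisted (f e))}}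
    Qlisted (loop {{l}} body _) = listed-Σ l (λ a → Qlisted (body a))

    q₀ : (P : Prog E) → Q P
    q₀ (skip _)      = tt
    q₀ (pop _)       = tt
    q₀ (push _ _)    = false
    q₀ (P >>= _)     = inj₁ (q₀ P)
    q₀ (loop body a) = a , q₀ (body a)

    idle : ∀ {n} → Vec (Cell I O W) n → Vec (Cell I O W × Move) n
    idle = Vec.map (_, stay)

    perform : Actions → Tapes → Tapes
    perform = Vec.zipWith act

    -- A returned value becomes the start state of the continuation within the same step, so
    -- sequencing costs no time of its own.
    hand-over : (P : Prog E) (f : E → Prog F) → Q P ⊎ E → (Q P ⊎ (Σ[ e ∈ E ] Q (f e))) ⊎ F
    hand-over P f (inj₁ q) = inj₁ (inj₁ q)
    hand-over P f (inj₂ e) = inj₁ (inj₂ (e , q₀ (f e)))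

    iterate : (body : A → Prog (A ⊎ E)) → ∀ a → Q (body a) ⊎ (A ⊎ E) → (Σ[ a ∈ A ] Q (body a)) ⊎ E
    iterate body a (inj₁ q)         = inj₁ (a , q)
    iterate body a (inj₂ (inj₁ a′)) = inj₁ (a′ , q₀ (body a′))
    iterate body a (inj₂ (inj₂ e))  = inj₂ e

    δ : (P : Prog E) → Q P → Heads → (Q P ⊎ E) × Actions
    δ (skip e)      _             hs = inj₂ e , idle hs
    δ (pop r)       _             hs = inj₂ (letter (lookup hs r)) ,
                                       idle hs [ r ]≔ (blank , (if nonBlank (lookup hs r) then right else stay))
    δ (push r x)    false         hs = inj₁ true , idle hs [ r ]≔ (lookup hs r , left)
    δ (push r x)    true          hs = inj₂ tt , idle hs [ r ]≔ (cell x , stay)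
    δ (P >>= f)     (inj₁ q)      hs = map₁ (hand-over P f) (δ P q hs)
    δ (P >>= f)     (inj₂ (e , q)) hs = map₁ (Sum.map₁ λ q → inj₂ (e , q)) (δ (f e) q hs)
    δ (loop body _) (a , q)       hs = map₁ (iterate body a) (δ (body a) q hs)

    data Reach (P : Prog E) : Q P → Tapes → ℕ → E → Tapes → Set where
      done : ∀ {q ts e as} → δ P q (Vec.map Tape.head ts) ≡ (inj₂ e , as) →
             Reach P q ts 1 e (perform as ts)
      next : ∀ {q ts q′ as n e ts′} → δ P q (Vec.map Tape.head ts) ≡ (inj₁ q′ , as) →
             Reach P q′ (perform as ts) n e ts′ → Reach P q ts (suc n) e ts′

    bind-reach : {{l : Listed E}} {P : Prog E} {f : E → Prog F} → ∀ {q ts m e ts′ n e′ ts″} →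
                 Reach P q ts m e ts′ → Reach (f e) (q₀ (f e)) ts′ n e′ ts″ →
                 Reach (P >>= f) (inj₁ q) ts (m + n) e′ ts″
    bind-reach {P = P} {f} (done eq) r = next (cong (map₁ (hand-over P f)) eq) (second r)
      where
      second : ∀ {e q ts n e′ ts′} → Reach (f e) q ts n e′ ts′ → Reach (P >>= f) (inj₂ (e , q)) ts n e′ ts′
      second (done eq)   = done (cong (map₁ (Sum.map₁ _)) eq)
      second (next eq r) = next (cong (map₁ (Sum.map₁ _)) eq) (second r)
    bind-reach {P = P} {f} (next eq r) r′ = next (cong (map₁ (hand-over P f)) eq) (bind-reach r r′)

    loop-again : {{l : Listed A}} {body : A → Prog (A ⊎ E)} → ∀ {a q ts m a′ ts′ n e ts″} →
                 Reach (body a) q ts m (inj₁ a′) ts′ → Reach (loop body a′) (a′ , q₀ (body a′)) ts′ n e ts″ →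
                 Reach (loop body a′) (a , q) ts (m + n) e ts″
    loop-again {body = body} (done eq) r    = next (cong (map₁ (iterate body _)) eq) r
    loop-again {body = body} (next eq r) r′ = next (cong (map₁ (iterate body _)) eq) (loop-again r r′)

    loop-exit : {{l : Listed A}} {body : A → Prog (A ⊎ E)} → ∀ {a a₀ q ts m e ts′} →
                Reach (body a) q ts m (inj₂ e) ts′ → Reach (loop body a₀) (a , q) ts m e ts′
    loop-exit {body = body} (done eq)   = done (cong (map₁ (iterate body _)) eq)
    loop-exit {body = body} (next eq r) = next (cong (map₁ (iterate body _)) eq) (loop-exit r)

    -- The initial value of a loop influences only its start state `q₀`; the transitions ignore it.
    reach-start : {{l : Listed A}} {body : A → Prog (A ⊎ E)} → ∀ {a a′ q ts n e ts′} →
                  Reach (loop body a) q ts n e ts′ → Reach (loop body a′) q ts n e ts′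
    reach-start (done eq)   = done eq
    reach-start (next eq r) = next eq (reach-start r)

    Holds : ∀ {n} → Vec (Tape I O W) n → Vec (List Γ) n → Set
    Holds = Pointwise Stack

    -- Tracked because it grows at most as fast as time: the length of a log, and so the cost of
    -- unloading it, can be read off the cost of writing it.
    volume : ∀ {n} → Vec (List Γ) n → ℕ
    volume []       = 0
    volume (x ∷ xs) = length x + volume xs

    -- The time is counted in multiples c of a unit suc b, so that the costs of consecutive programs add up
    -- without any arithmetic on the sizes of the stacks.
    record Run (b : ℕ) (P : Prog E) (σ : Stacks) (c : ℕ) (e : E) (σ′ : Stacks) : Set where
      constructor run
      field
        reach : ∀ {ts} → Holds ts σ →
                ∃[ s ] ∃[ ts′ ] Reach P (q₀ P) ts s e ts′ × s ≤ c * suc b × Holds ts′ σ′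
        grows : volume σ′ ≤ c * suc b + volume σ

    open Run

    perform-idle : ∀ {n} (ts : Vec (Tape I O W) n) → Vec.zipWith act (idle (Vec.map Tape.head ts)) ts ≡ ts
    perform-idle []       = refl
    perform-idle (t ∷ ts) = cong (t ∷_) (perform-idle ts)

    perform-at : ∀ {n} (ts : Vec (Tape I O W) n) r a →
                 Vec.zipWith act (idle (Vec.map Tape.head ts) [ r ]≔ a) ts ≡ ts [ r ]≔ act a (lookup ts r)
    perform-at (t ∷ ts) zero    a = cong (act a t ∷_) (perform-idle ts)
    perform-at (t ∷ ts) (suc r) a = cong (t ∷_) (perform-at ts r a)

    lookup-heads : ∀ {n} (ts : Vec (Tape I O W) n) r → lookup (Vec.map Tape.head ts) r ≡ Tape.head (lookup ts r)
    lookup-heads (t ∷ ts) zero    = refl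
    lookup-heads (t ∷ ts) (suc r) = lookup-heads ts r

    holds-at : ∀ {n t x} {ts : Vec (Tape I O W) n} {σ : Vec (List Γ) n} r → Holds ts σ → Stack t x →
               Holds (ts [ r ]≔ t) (σ [ r ]≔ x)
    holds-at zero    (_ ∷ h) s = s ∷ h
    holds-at (suc r) (t ∷ h) s = t ∷ holds-at r h s

    volume-at : ∀ {n} (σ : Vec (List Γ) n) r xs → length (lookup σ r) + volume (σ [ r ]≔ xs) ≡ length xs + volume σ
    volume-at (x ∷ σ) zero xs = swap (length x) (length xs) (volume σ)
      where
      swap : ∀ a b c → a + (b + c) ≡ b + (a + c)
      swap = solve-∀
    volume-at (x ∷ σ) (suc r) xs = begin
      length (lookup σ r) + (length x + volume (σ [ r ]≔ xs))  ≡⟨ swap (length (lookup σ r)) (length x) _ ⟩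
      length x + (length (lookup σ r) + volume (σ [ r ]≔ xs))  ≡⟨ cong (length x +_) (volume-at σ r xs) ⟩
      length x + (length xs + volume σ)                         ≡⟨ swap (length x) (length xs) _ ⟩
      length xs + (length x + volume σ)                         ∎
      where
      open ≡-Reasoning
      swap : ∀ a b c → a + (b + c) ≡ b + (a + c)
      swap = solve-∀

    module _ {b : ℕ} where

      skip-run : ∀ {σ} {e : E} → Run b (skip e) σ 1 e σ
      skip-run .reach {ts} h = _ , _ , done refl , s≤s z≤n , subst (λ ts → Holds ts _) (sym (perform-idle ts)) h
      skip-run .grows = ℕₚ.m≤n+m _ _

      pop-just : ∀ {σ r x xs} → lookup σ r ≡ x ∷ xs → Run b (pop r) σ 1 (just x) (σ [ r ]≔ xs)
      pop-just {σ} {r} {x} {xs} eq .reach {ts} h = _ , _ , done (cong₂ _,_ (cong inj₂ top) refl) , s≤s z≤n ,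
          subst (λ ts → Holds ts _) (sym (perform-at ts r _)) (holds-at r h (erase (lookup ts r) top′ s))
        where
        s : Stack (lookup ts r) (x ∷ xs)
        s = subst (Stack _) eq (Pointwise.lookup h r)
        top′ : letter (Tape.head (lookup ts r)) ≡ just x
        top′ = letter-top s
        top : letter (lookup (Vec.map Tape.head ts) r) ≡ just x
        top = trans (cong letter (lookup-heads ts r)) top′
        erase : ∀ t → letter (Tape.head t) ≡ just x → Stack t (x ∷ xs) →
                Stack (act (blank , (if nonBlank (lookup (Vec.map Tape.head ts) r) then right else stay)) t) xs
        erase t e s rewrite lookup-heads ts r with Tape.head (lookup ts r) | top′
        ... | blank    | ()
        ... | input _  | _ = erase-top s
        ... | output _ | _ = erase-top s
        ... | work _   | _ = erase-top s
      pop-just {σ} {r} {x} {xs} eq .grows = ℕₚ.≤-trans (ℕₚ.+-cancelˡ-≤ (length xs) _ _ (begin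
        length xs + volume (σ [ r ]≔ xs)                  ≤⟨ ℕₚ.n≤1+n _ ⟩
        length (x ∷ xs) + volume (σ [ r ]≔ xs)            ≡⟨ cong (λ ys → length ys + volume (σ [ r ]≔ xs)) (sym eq) ⟩
        length (lookup σ r) + volume (σ [ r ]≔ xs)        ≡⟨ volume-at σ r xs ⟩
        length xs + volume σ                              ∎)) (ℕₚ.m≤n+m _ _)
        where open ℕₚ.≤-Reasoning

      pop-nothing : ∀ {σ r} → lookup σ r ≡ [] → Run b (pop r) σ 1 nothing σ
      pop-nothing {σ} {r} eq .reach {ts} h = _ , _ , done (cong₂ _,_ (cong inj₂ top) refl) , s≤s z≤n ,
          subst (λ ts → Holds ts _) (sym (trans (perform-at ts r _) same)) h
        where
        top′ : letter (Tape.head (lookup ts r)) ≡ nothing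
        top′ = letter-empty (subst (Stack _) eq (Pointwise.lookup h r))
        top : letter (lookup (Vec.map Tape.head ts) r) ≡ nothing
        top = trans (cong letter (lookup-heads ts r)) top′
        idem : ∀ t → letter (Tape.head t) ≡ nothing →
               act (blank , (if nonBlank (Tape.head t) then right else stay)) t ≡ t
        idem (tape _ blank _) _ = refl
        same : ts [ r ]≔ act (blank , (if nonBlank (lookup (Vec.map Tape.head ts) r) then right else stay)) (lookup ts r) ≡ ts
        same rewrite lookup-heads ts r | idem (lookup ts r) top′ = Vecₚ.[]≔-lookup ts r
      pop-nothing eq .grows = ℕₚ.m≤n+m _ _

      push-run : ∀ {σ r x} → Run b (push r x) σ 2 tt (σ [ r ]≔ (x ∷ lookup σ r))
      push-run {σ} {r} {x} .reach {ts} h = 2 , _ , next refl (done refl) , ℕₚ.m≤m*n 2 (suc b) ,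
          subst (λ ts → Holds ts _) (sym two) (holds-at r h (push-onto x (Pointwise.lookup h r)))
        where
        one : ts [ r ]≔ _ ≡ _
        one = sym (trans (perform-at ts r (lookup (Vec.map Tape.head ts) r , left))
                         (cong (λ c → ts [ r ]≔ act (c , left) (lookup ts r)) (lookup-heads ts r)))
        two : perform (idle (Vec.map Tape.head (perform _ ts)) [ r ]≔ (cell x , stay)) (perform _ ts) ≡ _
        two = trans (perform-at (perform _ ts) r _) (trans (cong (λ us → us [ r ]≔ act (cell x , stay) (lookup us r)) (sym one))
                (trans (Vecₚ.[]≔-idempotent ts r) (cong (λ t → ts [ r ]≔ act (cell x , stay) t) (Vecₚ.lookup∘updateAt r ts))))
      push-run {σ} {r} {x} .grows = begin
        volume (σ [ r ]≔ (x ∷ lookup σ r))  ≡⟨ ℕₚ.+-cancelˡ-≡ (length (lookup σ r)) _ _ (trans (volume-at σ r _) (sym (ℕₚ.+-suc _ _))) ⟩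
        1 + volume σ                        ≤⟨ ℕₚ.+-mono-≤ (s≤s z≤n) ℕₚ.≤-refl ⟩
        2 * suc b + volume σ                ∎
        where open ℕₚ.≤-Reasoning

      infixr 1 _⨾_

      _⨾_ : {{l : Listed E}} {P : Prog E} {f : E → Prog F} → ∀ {σ c e σ′ c′ e′ σ″} →
            Run b P σ c e σ′ → Run b (f e) σ′ c′ e′ σ″ → Run b (P >>= f) σ (c + c′) e′ σ″
      _⨾_ {c = c} {c′ = c′} r r′ .reach h with reach r h
      ... | s , _ , p , s≤ , h′ with reach r′ h′
      ... | s′ , _ , p′ , s′≤ , h″ = s + s′ , _ , bind-reach p p′ ,
            subst (s + s′ ≤_) (sym (ℕₚ.*-distribʳ-+ (suc b) c c′)) (ℕₚ.+-mono-≤ s≤ s′≤) , h″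
      _⨾_ {σ = σ} {c = c} {σ′ = σ′} {c′ = c′} {σ″ = σ″} r r′ .grows = begin
        volume σ″                               ≤⟨ grows r′ ⟩
        c′ * suc b + volume σ′                  ≤⟨ ℕₚ.+-mono-≤ (ℕₚ.≤-refl {c′ * suc b}) (grows r) ⟩
        c′ * suc b + (c * suc b + volume σ)     ≡⟨ shuffle c c′ (suc b) (volume σ) ⟩
        (c + c′) * suc b + volume σ             ∎
        where
        open ℕₚ.≤-Reasoning
        shuffle : ∀ c c′ b v → c′ * b + (c * b + v) ≡ (c + c′) * b + v
        shuffle = solve-∀

      again : {{l : Listed A}} {body : A → Prog (A ⊎ E)} → ∀ {a σ c a′ σ′ c′ e σ″} →
              Run b (body a) σ c (inj₁ a′) σ′ → Run b (loop body a′) σ′ c′ e σ″ → Run b (loop body a) σ (c + c′) e σ″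
      again {c = c} {c′ = c′} r r′ .reach h with reach r h
      ... | s , _ , p , s≤ , h′ with reach r′ h′
      ... | s′ , _ , p′ , s′≤ , h″ = s + s′ , _ , reach-start (loop-again p p′) ,
            subst (s + s′ ≤_) (sym (ℕₚ.*-distribʳ-+ (suc b) c c′)) (ℕₚ.+-mono-≤ s≤ s′≤) , h″
      again {σ = σ} {c = c} {σ′ = σ′} {c′ = c′} {σ″ = σ″} r r′ .grows = begin
        volume σ″                               ≤⟨ grows r′ ⟩
        c′ * suc b + volume σ′                  ≤⟨ ℕₚ.+-mono-≤ (ℕₚ.≤-refl {c′ * suc b}) (grows r) ⟩
        c′ * suc b + (c * suc b + volume σ)     ≡⟨ shuffle c c′ (suc b) (volume σ) ⟩
        (c + c′) * suc b + volume σ             ∎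
        where
        open ℕₚ.≤-Reasoning
        shuffle : ∀ c c′ b v → c′ * b + (c * b + v) ≡ (c + c′) * b + v
        shuffle = solve-∀

      exit : {{l : Listed A}} {body : A → Prog (A ⊎ E)} → ∀ {a σ c e σ′} →
             Run b (body a) σ c (inj₂ e) σ′ → Run b (loop body a) σ c e σ′
      exit r .reach h with reach r h
      ... | s , _ , p , s≤ , h′ = s , _ , loop-exit p , s≤ , h′
      exit r .grows = grows r

    -- Routines that traverse a stack are timed in single steps and then charged as a constant
    -- number of units, once the unit exceeds the height of the stack.
    rescale : ∀ {b b′ c c′} {P : Prog E} {σ e σ′} → c * suc b ≤ c′ * suc b′ → Run b P σ c e σ′ → Run b′ P σ c′ e σ′
    rescale c≤ r .reach h with reach r h
    ... | s , _ , p , s≤ , h′ = s , _ , p , ℕₚ.≤-trans s≤ c≤ , h′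
    rescale c≤ r .grows = ℕₚ.≤-trans (grows r) (ℕₚ.+-mono-≤ c≤ ℕₚ.≤-refl)

    weaken : ∀ {b c c′} {P : Prog E} {σ e σ′} → c ≤ c′ → Run b P σ c e σ′ → Run b P σ c′ e σ′
    weaken c≤ = rescale (ℕₚ.*-monoˡ-≤ _ c≤)

    same-program : ∀ {b c} {P P′ : Prog E} {σ e σ′} → P ≡ P′ → Run b P′ σ c e σ′ → Run b P σ c e σ′
    same-program refl r = r

    infixr 5 _▷_

    -- The content of a log t after w has been written on it. It lies there in reverse, and moving
    -- it to the output stack reverses it back (`▷-ʳ++`).
    _▷_ : List O → List Γ → List Γ
    []      ▷ t = t
    (c ∷ w) ▷ t = w ▷ (out c ∷ t)

    ▷-++ : ∀ w {w′ t} → (w ++ w′) ▷ t ≡ w′ ▷ w ▷ t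
    ▷-++ []      = refl
    ▷-++ (c ∷ w) = ▷-++ w

    ▷-ʳ++ : ∀ w {t o} → (w ▷ t) ʳ++ o ≡ t ʳ++ (map out w ++ o)
    ▷-ʳ++ []          = refl
    ▷-ʳ++ (c ∷ w) {t} = ▷-ʳ++ w

  module Compilation {I O W : Set} {{listedW : Listed W}} {extra : ℕ} where

    open Programs I O W extra
    open Run

    machine : Prog ⊤ → Machine I O
    machine P = record
      { State = Q P ⊎ ⊤ ; Work = W
      ; stateFinite = finite (listed-⊎ {{Qlisted P}}) ; workFinite = finite listedW
      ; extraTapes = extra ; start = inj₁ (q₀ P)
      ; δ = λ { (inj₁ q) hs → just (δ P q hs) ; (inj₂ _) hs → nothing } }

    module _ (P : Prog ⊤) where

      open Machine (machine P) using (_⇓[_]_; halt; next; initial; result)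

      halts : ∀ {q ts n e ts′} → Reach P q ts n e ts′ → (inj₁ q , ts) ⇓[ n ] (inj₂ tt , ts′)
      halts (done eq)   = next (cong (λ r → just (map₂ (λ as → perform as _) r)) eq) (halt refl)
      halts (next eq r) = next (cong (λ r → just (map₂ (λ as → perform as _) r)) eq) (halts r)

      Input : List I → Stacks
      Input w = map inp w ∷ Vec.replicate _ []

      holds-initial : ∀ w → Holds (proj₂ (initial w)) (Input w)
      holds-initial w = input-stack w ∷ blanks _
        where
        input-stack : ∀ w → Stack (load (map input w)) (map inp w)
        input-stack []      = stack [] (refl ∷ []) refl
        input-stack (i ∷ w) = stack [] [] (cong (input i ∷_) (trans (Listₚ.map-∘ w) (sym (Listₚ.++-identityʳ _))))
        blanks : ∀ n → Holds (Vec.replicate n (load [])) (Vec.replicate n [])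
        blanks zero    = []
        blanks (suc n) = stack [] (refl ∷ []) refl ∷ blanks n

      result-correct : ∀ {q ts σ} w → Holds ts σ → lookup σ (suc zero) ≡ map out w → result (q , ts) ≡ map output w
      result-correct w (_ ∷ stack {bs} _ blanks eq ∷ _) refl = trans (cong (takeWhileᵇ nonBlank) eq) (written w blanks)
        where
        written : ∀ w {cs : List (Cell I O W)} → Blanks cs → takeWhileᵇ nonBlank (map cell (map out w) ++ cs) ≡ map output w
        written [] []           = refl
        written [] (refl ∷ _)   = refl
        written (x ∷ w) b       = cong (output x ∷_) (written w b)

    -- At `b` = 0 the unit of time is one step, so the cost of the run is a bound on the steps of
    -- the machine.
    polyTime : (P : Prog ⊤) (encA : A → List I) (encB : B → List O) (f : A → B) (c d : ℕ) →
               (∀ x → ∃[ n ] ∃[ σ ] Run 0 P (Input P (encA x)) n tt σ ×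
                      lookup σ (suc zero) ≡ map out (encB (f x)) × n ≤ c * suc (length (encA x)) ^ d) →
               PolyTime encA encB f
    polyTime P encA encB f c d runs = machine P , c , d , λ x →
      let n , σ , r , eq , n≤ = runs x
          s , ts , p , s≤ , h = reach r (holds-initial P (encA x))
      in s , _ , halts P p , ℕₚ.≤-trans s≤ (subst (_≤ _) (sym (ℕₚ.*-identityʳ n)) n≤) , result-correct P (encB (f x)) h eq

open StackMachines

-- Equivalences, and LTL at positions of the original traces

module _ where
  open Equivalence public using (to; from)

private
  variable
    ℓ₁ ℓ₂ ℓ₃ ℓ₄ : Level

⇔-refl : {A : Set ℓ₁} → A ⇔ A
⇔-refl = mk⇔ id id

⇔-sym : {A : Set ℓ₁} {B : Set ℓ₂} → A ⇔ B → B ⇔ A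
⇔-sym e = mk⇔ (from e) (to e)

infixr 2 _⟫_

_⟫_ : {A : Set ℓ₁} {B : Set ℓ₂} {C : Set ℓ₃} → A ⇔ B → B ⇔ C → A ⇔ C
e ⟫ e′ = mk⇔ (to e′ ∘ to e) (from e ∘ from e′)

×-cong : {A : Set ℓ₁} {B : Set ℓ₂} {C : Set ℓ₃} {D : Set ℓ₄} → A ⇔ B → C ⇔ D → (A × C) ⇔ (B × D)
×-cong e e′ = mk⇔ (λ (x , y) → to e x , to e′ y) (λ (x , y) → from e x , from e′ y)

⊎-cong : {A : Set ℓ₁} {B : Set ℓ₂} {C : Set ℓ₃} {D : Set ℓ₄} → A ⇔ B → C ⇔ D → (A ⊎ C) ⇔ (B ⊎ D)
⊎-cong e e′ = mk⇔ (Sum.map (to e) (to e′)) (Sum.map (from e) (from e′))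

¬-cong : {A : Set ℓ₁} {B : Set ℓ₂} → A ⇔ B → (¬ A) ⇔ (¬ B)
¬-cong e = mk⇔ (λ ¬a b → ¬a (from e b)) (λ ¬b a → ¬b (to e a))

→-cong : {A : Set ℓ₁} {B : Set ℓ₂} {C : Set ℓ₃} {D : Set ℓ₄} → A ⇔ B → C ⇔ D → (A → C) ⇔ (B → D)
→-cong e e′ = mk⇔ (λ f → to e′ ∘ f ∘ from e) (λ f → from e′ ∘ f ∘ to e)

Π-cong : {A : Set ℓ₁} {B : A → Set ℓ₂} {C : A → Set ℓ₃} → (∀ x → B x ⇔ C x) → (∀ x → B x) ⇔ (∀ x → C x)
Π-cong e = mk⇔ (λ f x → to (e x) (f x)) (λ f x → from (e x) (f x))

Σ-cong : {A : Set ℓ₁} {B : A → Set ℓ₂} {C : A → Set ℓ₃} → (∀ x → B x ⇔ C x) → Σ A B ⇔ Σ A C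
Σ-cong e = mk⇔ (λ (x , y) → x , to (e x) y) (λ (x , y) → x , from (e x) y)

Lift-⇔ : {A : Set ℓ₁} → Lift ℓ₂ A ⇔ A
Lift-⇔ = mk⇔ lower lift

≡⇒⇔ : {A B : Set ℓ₁} → A ≡ B → A ⇔ B
≡⇒⇔ refl = ⇔-refl

∈⇔lookup : ∀ {n} {p : Fin n} {s} → (p Subset.∈ s) ⇔ T (lookup s p)
∈⇔lookup = mk⇔ (λ p∈ → from Boolₚ.T-≡ (Vecₚ.[]=⇒lookup p∈)) (λ t → Vecₚ.lookup⇒[]= _ _ (to Boolₚ.T-≡ t))

∈-tabulate : ∀ {n} {p : Fin n} {f} → (p Subset.∈ Vec.tabulate f) ⇔ T (f p)
∈-tabulate {p = p} {f} = ∈⇔lookup ⟫ ≡⇒⇔ (cong T (Vecₚ.lookup∘tabulate f p))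

T-injective : ∀ {b c} → T b ⇔ T c → b ≡ c
T-injective {true}  {true}  _ = refl
T-injective {false} {false} _ = refl
T-injective {true}  {false} e = ⊥-elim (to e tt)
T-injective {false} {true}  e = ⊥-elim (from e tt)

module _ {a : ℕ} where
  open Hyper²LTL a

  -- Satisfaction at a position of the original traces, so that no suffixes are taken.
  sat : (TraceVar → Maybe Trace) → ℕ → LTL → Set
  sat V i (⟨ p ⟩ π)  = MAny.Any (λ t → p Subset.∈ t i) (V π)
  sat V i (not ψ)    = ¬ sat V i ψ
  sat V i (ψ₁ or ψ₂) = sat V i ψ₁ ⊎ sat V i ψ₂
  sat V i (ψ₁ U ψ₂)  = ∃[ j ] sat V (i + j) ψ₂ × (∀ j′ → j′ < j → sat V (i + j′) ψ₁)
  sat V i (X ψ)      = sat V (suc i) ψ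

  -- The invariant while LTL evaluation moves along the traces: the current traces agree pointwise
  -- with suffixes of the original ones, and the domain stays the same.
  data Shifted (i : ℕ) : Maybe Trace → Maybe Trace → Set where
    nothing : Shifted i nothing nothing
    just    : ∀ {t t′} → (∀ j → t′ j ≡ t (i + j)) → Shifted i (just t) (just t′)

  shifted-suffix : ∀ {i x y} j → Shifted i x y → Shifted (i + j) x (Maybe.map (suffix j) y)
  shifted-suffix j nothing = nothing
  shifted-suffix {i} j (just {t} eq) = just λ l → trans (eq (j + l)) (cong t (sym (ℕₚ.+-assoc i j l)))

  shifted-suc : ∀ {i x y} → Shifted i x y → Shifted (suc i) x (Maybe.map (suffix 1) y)
  shifted-suc nothing = nothing
  shifted-suc {i} (just {t} eq) = just λ l → trans (eq (suc l)) (cong t (ℕₚ.+-suc i l))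

  sat-shifted : ∀ {V Π i} → (∀ π → Shifted i (V π) (Assignment.traceOf Π π)) → ∀ ψ → (Π ⊨ˡ ψ) ⇔ sat V i ψ
  sat-shifted {V} {Π} {i} sh (⟨ p ⟩ π) with V π | Assignment.traceOf Π π | sh π
  ... | _ | _ | nothing = mk⇔ (λ ()) (λ ())
  ... | just t | just t′ | just eq = mk⇔ (λ { (MAny.just x) → MAny.just (subst (p Subset.∈_) at x) })
                                         (λ { (MAny.just x) → MAny.just (subst (p Subset.∈_) (sym at) x) })
    where
    at : t′ 0 ≡ t i
    at = trans (eq 0) (cong t (ℕₚ.+-identityʳ i))
  sat-shifted sh (not ψ)    = ¬-cong (sat-shifted sh ψ)
  sat-shifted sh (ψ₁ or ψ₂) = ⊎-cong (sat-shifted sh ψ₁) (sat-shifted sh ψ₂)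
  sat-shifted sh (X ψ)      = sat-shifted (λ π → shifted-suc (sh π)) ψ
  sat-shifted sh (ψ₁ U ψ₂) = Σ-cong λ j → ×-cong (sat-shifted (λ π → shifted-suffix j (sh π)) ψ₂)
    (Π-cong λ j′ → Π-cong λ _ → sat-shifted (λ π → shifted-suffix j′ (sh π)) ψ₁)

  ⊨ˡ⇔sat : ∀ Π ψ → (Π ⊨ˡ ψ) ⇔ sat (Assignment.traceOf Π) 0 ψ
  ⊨ˡ⇔sat Π = sat-shifted λ π → unshifted (Assignment.traceOf Π π)
    where
    unshifted : ∀ x → Shifted 0 x x
    unshifted nothing  = nothing
    unshifted (just _) = just λ _ → refl

  update-same : ∀ {ℓ} {A : Set ℓ} (f : ℕ → A) v d → update ℕₚ._≟_ f v d v ≡ d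
  update-same f v d with v ℕₚ.≟ v
  ... | yes _ = refl
  ... | no v≢v = ⊥-elim (v≢v refl)

-- The function u m + v pairs an arbitrary u with a number v < m.
module _ (m′ : ℕ) where
  private
    m : ℕ
    m = suc m′

  pair-/ : ∀ u {v} → v < m → (u * m + v) / m ≡ u
  pair-/ u {v} v<m = begin
    (u * m + v) / m      ≡⟨ DivMod.+-distrib-/-∣ˡ v (n∣m*n u) ⟩
    u * m / m + v / m    ≡⟨ cong₂ _+_ (DivMod.m*n/n≡m u m) (DivMod.m<n⇒m/n≡0 v<m) ⟩
    u + 0                ≡⟨ ℕₚ.+-identityʳ u ⟩
    u                    ∎
    where
    open ≡-Reasoning
    open import Data.Nat.Divisibility using (n∣m*n)

  pair-% : ∀ u {v} → v < m → (u * m + v) % m ≡ v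
  pair-% u {v} v<m = trans (cong (_% m) (ℕₚ.+-comm (u * m) v))
                           (trans (DivMod.[m+kn]%n≡m%n v u m) (DivMod.m<n⇒m%n≡m v<m))

  pair-mod : ∀ u (v : Fin m) → (u * m + toℕ v) mod m ≡ v
  pair-mod u v = Finₚ.toℕ-injective (trans (Finₚ.toℕ-fromℕ< _) (pair-% u (Finₚ.toℕ<n v)))

-- Reading off the meaning of arithmetic formulas

module A = Arithmetic

module _ where
  open A hiding (and; or; eq; lt)

  infix 4 _≡ˢ_

  _≡ˢ_ : Sort → Sort → Bool
  num    ≡ˢ num    = true
  set    ≡ˢ set    = true
  family ≡ˢ family = true
  _      ≡ˢ _      = false

  ≡ˢ-sound : ∀ s r → T (s ≡ˢ r) → s ≡ r
  ≡ˢ-sound num    num    _ = refl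
  ≡ˢ-sound set    set    _ = refl
  ≡ˢ-sound family family _ = refl

  infixr 8 _∧̇_
  infixr 7 _⇒̇_
  infix  6 _⇔̇_

  _∧̇_ _⇒̇_ _⇔̇_ : Formula → Formula → Formula
  φ ∧̇ χ = φ and χ
  φ ⇒̇ χ = not φ or χ
  φ ⇔̇ χ = (φ ⇒̇ χ) and (χ ⇒̇ φ)

  -- A record rather than a bare equivalence, so that e and φ can be inferred from its type.
  record Reflects {ℓ} (e : Env) (φ : Formula) (P : Set ℓ) : Set (lsuc 0ℓ ⊔ ℓ) where
    constructor reflects
    field meaning : (e ⊨ φ) ⇔ P

  open Reflects public

  module _ {e : Env} where

    reflect-atom : ∀ {α} → Reflects e (atom α) (e ⊨ᵃ α)
    reflect-atom = reflects Lift-⇔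

    convert : ∀ {ℓ ℓ′ φ} {P : Set ℓ} {Q : Set ℓ′} → P ⇔ Q → Reflects e φ P → Reflects e φ Q
    convert h r = reflects (meaning r ⟫ h)

    reflect-∧ : ∀ {ℓ ℓ′ φ χ} {P : Set ℓ} {Q : Set ℓ′} → Reflects e φ P → Reflects e χ Q → Reflects e (φ ∧̇ χ) (P × Q)
    reflect-∧ r r′ = reflects (×-cong (meaning r) (meaning r′))

    reflect-all-num : ∀ {ℓ x φ} {P : ℕ → Set ℓ} → (∀ d → Reflects (assign num e x (lift d)) φ (P d)) →
                      Reflects e (all num x φ) (∀ d → P d)
    reflect-all-num h = reflects (mk⇔ (λ f d → to (meaning (h d)) (f (lift d)))
                                      (λ f d → from (meaning (h (lower d))) (f (lower d))))

    reflect-ex-num : ∀ {ℓ x φ} {P : ℕ → Set ℓ} → (∀ d → Reflects (assign num e x (lift d)) φ (P d)) →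
                     Reflects e (ex num x φ) (∃ P)
    reflect-ex-num h = reflects (mk⇔ (λ (lift d , p) → d , to (meaning (h d)) p)
                                     (λ (d , p) → lift d , from (meaning (h d)) p))

    reflect-all-set : ∀ {ℓ x φ} {P : (ℕ → Bool) → Set ℓ} → (∀ d → Reflects (assign set e x (lift d)) φ (P d)) →
                      Reflects e (all set x φ) (∀ d → P d)
    reflect-all-set h = reflects (mk⇔ (λ f d → to (meaning (h d)) (f (lift d)))
                                      (λ f d → from (meaning (h (lower d))) (f (lower d))))

    reflect-ex-set : ∀ {ℓ x φ} {P : (ℕ → Bool) → Set ℓ} → (∀ d → Reflects (assign set e x (lift d)) φ (P d)) →
                     Reflects e (ex set x φ) (∃ P)
    reflect-ex-set h = reflects (mk⇔ (λ (lift d , p) → d , to (meaning (h d)) p)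
                                     (λ (d , p) → lift d , from (meaning (h d)) p))

    reflect-ex-family : ∀ {ℓ x φ} {P : Pred (ℕ → Bool) 0ℓ → Set ℓ} → (∀ d → Reflects (assign family e x d) φ (P d)) →
                        Reflects e (ex family x φ) (∃ P)
    reflect-ex-family h = reflects (Σ-cong λ d → meaning (h d))

    module _ (em : ExcludedMiddle (lsuc 0ℓ)) where

      reflect-⇒ : ∀ {ℓ ℓ′ φ χ} {P : Set ℓ} {Q : Set ℓ′} → Reflects e φ P → Reflects e χ Q →
                  Reflects e (φ ⇒̇ χ) (P → Q)
      reflect-⇒ {φ = φ} {χ} r r′ = reflects (mk⇔ classical (λ f → decide f em))
        where
        classical : (e ⊨ φ ⇒̇ χ) → _
        classical (inj₁ ¬φ) p = ⊥-elim (¬φ (from (meaning r) p))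
        classical (inj₂ x)  _ = to (meaning r′) x
        decide : _ → Dec (e ⊨ φ) → (e ⊨ φ ⇒̇ χ)
        decide f (yes p) = inj₂ (from (meaning r′) (f (to (meaning r) p)))
        decide f (no ¬p) = inj₁ ¬p

      reflect-⇔ : ∀ {ℓ ℓ′ φ χ} {P : Set ℓ} {Q : Set ℓ′} → Reflects e φ P → Reflects e χ Q →
                  Reflects e (φ ⇔̇ χ) (P ⇔ Q)
      reflect-⇔ r r′ = convert (mk⇔ (λ (f , g) → mk⇔ f g) (λ h → to h , from h))
                               (reflect-∧ (reflect-⇒ r r′) (reflect-⇒ r′ r))

-- Translation of Hyper²LTL into arithmetic

-- Number variable 0 is the current position, 1 and 2 are scratch, and 3, 4, 5 hold the constants 0, 1 and |AP|.
module UpperTranslation (n : ℕ) where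

  module H = Hyper²LTL (suc n)
  open A hiding (and; or; eq; lt)

  v : ℕ → Term
  v = var

  numeral : ℕ → Term
  numeral zero    = v 3
  numeral (suc i) = numeral i ⊕ v 4

  cellOf : H.AP → Term
  cellOf p = (v 0 ⊗ v 5) ⊕ numeral (toℕ p)

  -- The next position passes through variable 1, because rebinding variable 0 hides the old
  -- position. The hole is at the end of the prefix notation, as the transducer requires.
  tomorrow : Formula → Formula
  tomorrow φ = ex num 1 (atom (v 1 ≐ (v 0 ⊕ v 4)) ∧̇ ex num 0 (atom (v 0 ≐ v 1) ∧̇ φ))

  -- φ U χ holds at x iff for some y ≥ x, every z in [x, y] satisfies χ, or satisfies φ and is not y: the least z
  -- satisfying χ is then a witness.  In this form φ and χ are adjacent in prefix notation.
  until : Formula → Formula → Formula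
  until φ χ = ex num 1 (not (atom (v 1 ≺ v 0)) ∧̇ ex num 2 (atom (v 2 ≐ v 0) ∧̇ all num 0
                ((atom (v 0 ≺ v 2) or atom (v 1 ≺ v 0)) or ((atom (v 0 ≺ v 1) ∧̇ φ) or χ))))

  ⌜_⌝ : H.SetVar → ℕ
  ⌜ H.Xa ⌝    = 0
  ⌜ H.Xd ⌝    = 1
  ⌜ H.var i ⌝ = 2 + i

  ⟪_⟫ : H.LTL → Formula
  ⟪ H.⟨ p ⟩ π ⟫  = atom (cellOf p ∈ˢ π)
  ⟪ H.not ψ ⟫    = not ⟪ ψ ⟫
  ⟪ H._or_ ψ₁ ψ₂ ⟫ = ⟪ ψ₁ ⟫ or ⟪ ψ₂ ⟫
  ⟪ H._U_ ψ₁ ψ₂ ⟫  = until ⟪ ψ₁ ⟫ ⟪ ψ₂ ⟫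
  ⟪ H.X ψ ⟫      = tomorrow ⟪ ψ ⟫

  translate : H.Formula → Formula
  translate (H.∃ˢ Y φ)   = ex family ⌜ Y ⌝ (translate φ)
  translate (H.∀ˢ Y φ)   = all family ⌜ Y ⌝ (translate φ)
  translate (H.∃ᵗ π Y φ) = ex set π (atom (π ∈ᶠ ⌜ Y ⌝) ∧̇ translate φ)
  translate (H.∀ᵗ π Y φ) = all set π (atom (π ∈ᶠ ⌜ Y ⌝) ⇒̇ translate φ)
  translate (H.ltl ψ)    = ⟪ ψ ⟫

  pairT : ℕ → ℕ → ℕ → Term
  pairT u m w = (v u ⊗ v m) ⊕ v w

  -- Set variables 0, 1, 2 hold the initial vertices, the edges and the labels of a transition system on the vertices
  -- below number variable 6; set variable 3 holds the graph of a path whose trace is set variable 4.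
  isRun : Formula
  isRun = all num 8 (atom (v 8 ≺ v 6) ⇒̇ atom (v 8 ∈ˢ 3) ⇒̇ atom (v 8 ∈ˢ 0))
       ∧̇ all num 9 (ex num 8 (atom (v 8 ≺ v 6) ∧̇ atom (pairT 9 6 8 ∈ˢ 3)))
       ∧̇ all num 9 (all num 7 (all num 8 (atom (v 7 ≺ v 6) ⇒̇ atom (v 8 ≺ v 6) ⇒̇ atom (pairT 9 6 7 ∈ˢ 3) ⇒̇
            atom ((((v 9 ⊕ v 4) ⊗ v 6) ⊕ v 8) ∈ˢ 3) ⇒̇ atom (pairT 7 6 8 ∈ˢ 1))))
       ∧̇ all num 9 (all num 8 (all num 10 (atom (v 8 ≺ v 6) ⇒̇ atom (v 10 ≺ v 5) ⇒̇ atom (pairT 9 6 8 ∈ˢ 3) ⇒̇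
            (atom (pairT 9 5 10 ∈ˢ 4) ⇔̇ atom (pairT 8 5 10 ∈ˢ 2)))))

  isTraceSet : Formula
  isTraceSet = ex num 6 (atom (v 3 ≺ v 6) ∧̇ ex set 0 (ex set 1 (ex set 2 (
      all num 7 (atom (v 7 ≺ v 6) ⇒̇ ex num 8 (atom (v 8 ≺ v 6) ∧̇ atom (pairT 7 6 8 ∈ˢ 1)))
    ∧̇ all set 4 (atom (4 ∈ᶠ 1) ⇔̇ ex set 3 isRun)))))

  -- Arithmetic has no constants: 0 is pinned down by x + x = x, and 1 by x > 0 and x x = x. Family
  -- 0 takes the place of X_a and family 1 that of X_d, in accordance with `⌜_⌝`.
  wrap : Formula → Formula
  wrap φ =
    ex num 3 (atom ((v 3 ⊕ v 3) ≐ v 3) ∧̇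
    ex num 4 (atom (v 3 ≺ v 4) ∧̇ atom ((v 4 ⊗ v 4) ≐ v 4) ∧̇
    ex num 5 (atom (v 5 ≐ numeral (suc n)) ∧̇
    ex family 0 (all set 0 (atom (0 ∈ᶠ 0)) ∧̇
    ex family 1 (isTraceSet ∧̇
    ex num 0 (atom (v 0 ≐ v 3) ∧̇ φ))))))

-- Correctness of the translation of formulas

module UpperCorrectness (em : ExcludedMiddle (lsuc 0ℓ)) (ext : Extensionality (lsuc 0ℓ) (lsuc 0ℓ)) (n : ℕ) where

  open UpperTranslation n
  open A hiding (and; or; eq; lt)
  open H using (Trace; TraceSet; Assignment; TransitionSystem)
  open Assignment

  funext : {B : Set} {f g : ℕ → B} → (∀ i → f i ≡ g i) → f ≡ g
  funext = lower-extensionality (lsuc 0ℓ) (lsuc 0ℓ) ext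

  a : ℕ
  a = suc n

  decode : (ℕ → Bool) → Trace
  decode s j = Vec.tabulate (λ p → s (j * a + toℕ p))

  encode : Trace → (ℕ → Bool)
  encode t i = lookup (t (i / a)) (i mod a)

  decode-encode : ∀ t → decode (encode t) ≡ t
  decode-encode t = funext λ j → trans
    (Vecₚ.tabulate-cong λ p → cong₂ (λ i p → lookup (t i) p) (pair-/ n j (Finₚ.toℕ<n p)) (pair-mod n j p))
    (Vecₚ.tabulate∘lookup (t j))

  -- Undefined variables are coded by the empty set and the empty family. This fits both the
  -- convention that their atoms are false and the values found in `default`.
  TraceCode : Maybe Trace → (ℕ → Bool) → Set
  TraceCode nothing  s = ∀ i → ¬ T (s i)
  TraceCode (just t) s = t ≡ decode s

  SetCode : Maybe TraceSet → Pred (ℕ → Bool) 0ℓ → Set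
  SetCode nothing  F = ∀ s → ¬ F s
  SetCode (just S) F = ∀ s → F s ⇔ S (decode s)

  record Constants (e : Env) : Set where
    field
      is-zero : Env.nums e 3 ≡ 0
      is-one  : Env.nums e 4 ≡ 1
      is-size : Env.nums e 5 ≡ a

  open Constants

  numeral-value : ∀ {e} → Constants e → ∀ i → ⟦ numeral i ⟧ e ≡ i
  numeral-value c zero    = is-zero c
  numeral-value c (suc i) = trans (cong₂ _+_ (numeral-value c i) (is-one c)) (ℕₚ.+-comm i 1)

  -- Search upwards from 0 until Q holds. The search succeeds by d at the latest, because the
  -- alternative to Q at position j includes j < d.
  earliest : ∀ {P Q : ℕ → Set} d → (∀ j → j ≤ d → (j < d × P j) ⊎ Q j) → ∃[ j ] Q j × (∀ j′ → j′ < j → P j′)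
  earliest {P} {Q} d h with h 0 z≤n
  ... | inj₂ q = 0 , q , λ _ ()
  earliest {P} {Q} (suc d) h | inj₁ (_ , p) with earliest {P ∘ suc} {Q ∘ suc} d
        (λ j j≤d → Sum.map₁ (map₁ ℕₚ.≤-pred) (h (suc j) (s≤s j≤d)))
  ... | j , q , ps = suc j , q , λ { zero _ → p ; (suc j′) (s≤s lt) → ps j′ lt }

  module _ (V : ℕ → Maybe Trace) where

    ltl-correct : ∀ {e} → Constants e → (∀ π → TraceCode (V π) (Env.sets e π)) →
                  ∀ ψ → (e ⊨ ⟪ ψ ⟫) ⇔ sat V (Env.nums e 0) ψ
    ltl-correct {e} c code (H.⟨ p ⟩ π) = Lift-⇔ ⟫ ≡⇒⇔ (cong (T ∘ Env.sets e π) index) ⟫ membership (V π) (code π)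
      where
      index : ⟦ cellOf p ⟧ e ≡ Env.nums e 0 * a + toℕ p
      index = cong₂ (λ i j → Env.nums e 0 * i + j) (is-size c) (numeral-value c (toℕ p))
      membership : ∀ x → TraceCode x (Env.sets e π) →
                   T (Env.sets e π (Env.nums e 0 * a + toℕ p)) ⇔ MAny.Any (λ t → p Subset.∈ t (Env.nums e 0)) x
      membership nothing  none = mk⇔ (⊥-elim ∘ none _) (λ ())
      membership (just t) refl =
        ⇔-sym (∈-tabulate {f = λ p → Env.sets e π (Env.nums e 0 * a + toℕ p)}) ⟫ mk⇔ MAny.just (λ { (MAny.just x) → x })
    ltl-correct c code (H.not ψ)    = ¬-cong (ltl-correct c code ψ)
    ltl-correct c code (H._or_ ψ₁ ψ₂) = ⊎-cong (ltl-correct c code ψ₁) (ltl-correct c code ψ₂)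
    ltl-correct {e} c code (H.X ψ) = mk⇔
      (λ { (lift y , lift y≡ , lift x , lift x≡ , m) →
           subst (λ i → sat V i ψ) (trans x≡ (trans y≡ next≡)) (to (ih y x) m) })
      (λ m → lift (suc (Env.nums e 0)) , lift (sym next≡) , lift _ , lift refl , from (ih _ _) m)
      where
      next≡ : Env.nums e 0 + Env.nums e 4 ≡ suc (Env.nums e 0)
      next≡ = trans (cong (Env.nums e 0 +_) (is-one c)) (ℕₚ.+-comm _ 1)
      ih : ∀ y x → (assign num (assign num e 1 (lift y)) 0 (lift x) ⊨ ⟪ ψ ⟫) ⇔ sat V x ψ
      ih y x = ltl-correct (record { is-zero = is-zero c ; is-one = is-one c ; is-size = is-size c }) code ψ
    ltl-correct {e} c code (H._U_ ψ₁ ψ₂) = mk⇔ forth back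
      where
      x₀ : ℕ
      x₀ = Env.nums e 0
      inner : ℕ → ℕ → ℕ → Env
      inner y w z = assign num (assign num (assign num e 1 (lift y)) 2 (lift w)) 0 (lift z)
      ih : ∀ ψ y w z → (inner y w z ⊨ ⟪ ψ ⟫) ⇔ sat V z ψ
      ih ψ y w z = ltl-correct (record { is-zero = is-zero c ; is-one = is-one c ; is-size = is-size c }) code ψ
      forth : (e ⊨ ⟪ H._U_ ψ₁ ψ₂ ⟫) → sat V x₀ (H._U_ ψ₁ ψ₂)
      forth (lift y , ¬y<x , lift w , lift refl , h) with ℕₚ.m≤n⇒∃[o]m+o≡n (ℕₚ.≮⇒≥ (¬y<x ∘ lift))
      ... | (d , refl) = earliest d λ j j≤d → cases j j≤d (h (lift (x₀ + j)))
        where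
        cases : ∀ j → j ≤ d → _ → (j < d × sat V (x₀ + j) ψ₁) ⊎ sat V (x₀ + j) ψ₂
        cases j _ (inj₁ (inj₁ (lift lt))) = ⊥-elim (ℕₚ.m+n≮m x₀ j lt)
        cases j j≤d (inj₁ (inj₂ (lift gt))) = ⊥-elim (ℕₚ.<⇒≱ (ℕₚ.+-cancelˡ-< x₀ d j gt) j≤d)
        cases j _ (inj₂ (inj₁ (lift lt , m))) = inj₁ (ℕₚ.+-cancelˡ-< x₀ j d lt , to (ih ψ₁ (x₀ + d) x₀ (x₀ + j)) m)
        cases j _ (inj₂ (inj₂ m)) = inj₂ (to (ih ψ₂ (x₀ + d) x₀ (x₀ + j)) m)
      back : sat V x₀ (H._U_ ψ₁ ψ₂) → (e ⊨ ⟪ H._U_ ψ₁ ψ₂ ⟫)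
      back (d , m₂ , m₁) = lift (x₀ + d) , (λ (lift lt) → ℕₚ.m+n≮m x₀ d lt) , lift x₀ , lift refl , λ (lift z) → cases z
        where
        cases : ∀ z → inner (x₀ + d) x₀ z ⊨
                  ((atom (v 0 ≺ v 2) or atom (v 1 ≺ v 0)) or ((atom (v 0 ≺ v 1) ∧̇ ⟪ ψ₁ ⟫) or ⟪ ψ₂ ⟫))
        cases z with ℕₚ.<-≤-connex z x₀
        ... | inj₁ z<x = inj₁ (inj₁ (lift z<x))
        ... | inj₂ x≤z with ℕₚ.m≤n⇒∃[o]m+o≡n x≤z
        ... | (j , refl) with ℕₚ.<-cmp j d
        ... | tri< j<d _ _ = inj₂ (inj₁ (lift (ℕₚ.+-monoʳ-< x₀ j<d) , from (ih ψ₁ (x₀ + d) x₀ (x₀ + j)) (m₁ j j<d)))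
        ... | tri≈ _ refl _ = inj₂ (inj₂ (from (ih ψ₂ (x₀ + d) x₀ (x₀ + d)) m₂))
        ... | tri> _ _ d<j = inj₁ (inj₂ (lift (ℕₚ.+-monoʳ-< x₀ d<j)))

  ⌜⌝-injective : ∀ {Y Z} → ⌜ Y ⌝ ≡ ⌜ Z ⌝ → Y ≡ Z
  ⌜⌝-injective {H.Xa}    {H.Xa}    _    = refl
  ⌜⌝-injective {H.Xd}    {H.Xd}    _    = refl
  ⌜⌝-injective {H.var _} {H.var _} refl = refl

  Codes : H.Assignment → Env → Set
  Codes Π e = (∀ π → TraceCode (traceOf Π π) (Env.sets e π)) × (∀ Y → SetCode (setOf Π Y) (Env.families e ⌜ Y ⌝))

  codes-trace : ∀ {Π e} π s → Codes Π e → Codes (Π H.[ π ↦ᵗ decode s ]) (assign set e π (lift s))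
  codes-trace {Π} {e} π s (codeT , codeS) = updated , codeS
    where
    updated : ∀ ρ → TraceCode (update ℕₚ._≟_ (traceOf Π) π (just (decode s)) ρ) (update ℕₚ._≟_ (Env.sets e) π s ρ)
    updated ρ with π ℕₚ.≟ ρ
    ... | yes _ = refl
    ... | no _  = codeT ρ

  codes-set : ∀ {Π e} Y S F → SetCode (just S) F → Codes Π e → Codes (Π H.[ Y ↦ˢ S ]) (assign family e ⌜ Y ⌝ F)
  codes-set {Π} {e} Y S F code (codeT , codeS) = codeT , updated
    where
    updated : ∀ Z → SetCode (update H._≟ˢ_ (setOf Π) Y (just S) Z) (update ℕₚ._≟_ (Env.families e) ⌜ Y ⌝ F ⌜ Z ⌝)
    updated Z with Y H.≟ˢ Z | ⌜ Y ⌝ ℕₚ.≟ ⌜ Z ⌝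
    ... | yes _    | yes _   = code
    ... | yes refl | no ≢    = ⊥-elim (≢ refl)
    ... | no ≢     | yes eq  = ⊥-elim (≢ (⌜⌝-injective eq))
    ... | no _     | no _    = codeS Z

  family-of : (S : TraceSet) → SetCode (just S) (S ∘ decode)
  family-of S s = ⇔-refl

  -- F must not distinguish s from `encode (decode s)`; extensionality makes the two equal.
  set-of : ∀ F → SetCode (just (F ∘ encode)) F
  set-of F s = ≡⇒⇔ (cong F (sym (funext same)))
    where
    same : ∀ i → encode (decode s) i ≡ s i
    same i = trans (Vecₚ.lookup∘tabulate (λ p → s (i / a * a + toℕ p)) (i mod a)) (cong s (trans (ℕₚ.+-comm (i / a * a) _)
      (trans (cong (_+ i / a * a) (Finₚ.toℕ-fromℕ< (DivMod.m%n<n i a))) (sym (DivMod.m≡m%n+[m/n]*n i a)))))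

  bound-member : ∀ e π y s → (assign set e π (lift s) ⊨ atom (π ∈ᶠ y)) ⇔ Env.families e y s
  bound-member e π y s = Lift-⇔ ⟫ ≡⇒⇔ (cong (Env.families e y) (update-same {n} (Env.sets e) π s))

  -- `decode` and `encode` are mutually inverse, and composing with them matches families with trace
  -- sets, so corresponding quantifiers have matching domains. Position variable 0 has to be 0
  -- because the LTL part is evaluated from the first position.
  translate-correct : ∀ {e Π} → Constants e → Env.nums e 0 ≡ 0 → Codes Π e → ∀ φ → (e ⊨ translate φ) ⇔ (Π H.⊨ φ)
  translate-correct {e} {Π} c z codes (H.∃ˢ Y φ) = mk⇔
    (λ (F , m) → F ∘ encode , to (ih (F ∘ encode) F (set-of F)) m)
    (λ (S , m) → S ∘ decode , from (ih S _ (family-of S)) m)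
    where
    ih : ∀ S F → SetCode (just S) F → (assign family e ⌜ Y ⌝ F ⊨ translate φ) ⇔ (Π H.[ Y ↦ˢ S ] H.⊨ φ)
    ih S F code = translate-correct (record { Constants c }) z (codes-set {Π} {e} Y S F code codes) φ
  translate-correct {e} {Π} c z codes (H.∀ˢ Y φ) = mk⇔
    (λ f S → to (ih S _ (family-of S)) (f _))
    (λ f F → from (ih (F ∘ encode) F (set-of F)) (f _))
    where
    ih : ∀ S F → SetCode (just S) F → (assign family e ⌜ Y ⌝ F ⊨ translate φ) ⇔ (Π H.[ Y ↦ˢ S ] H.⊨ φ)
    ih S F code = translate-correct (record { Constants c }) z (codes-set {Π} {e} Y S F code codes) φ
  translate-correct {e} {Π} c z codes (H.∃ᵗ π Y φ) with setOf Π Y | proj₂ codes Y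
  ... | nothing | none = mk⇔ (λ (lift s , f , _) → ⊥-elim (none s (to (bound-member e π _ s) f))) (λ ())
  ... | just S  | code = mk⇔
    (λ { (lift s , f , m) → MAny.just (decode s , to (code s) (to (bound-member e π _ s) f) , to (ih s) m) })
    (λ { (MAny.just (t , x , m)) → lift (encode t) ,
         from (bound-member e π _ (encode t)) (from (code _) (subst S (sym (decode-encode t)) x)) ,
         from (ih (encode t)) (subst (λ t → Π H.[ π ↦ᵗ t ] H.⊨ φ) (sym (decode-encode t)) m) })
    where
    ih : ∀ s → (assign set e π (lift s) ⊨ translate φ) ⇔ (Π H.[ π ↦ᵗ decode s ] H.⊨ φ)
    ih s = translate-correct (record { Constants c }) z (codes-trace {Π} {e} π s codes) φ
  translate-correct {e} {Π} c z codes (H.∀ᵗ π Y φ) with setOf Π Y | proj₂ codes Y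
  ... | nothing | none = mk⇔ (λ _ → MAll.nothing) (λ _ (lift s) → inj₁ λ f → none s (to (bound-member e π _ s) f))
  ... | just S  | code = mk⇔
    (λ f → MAll.just λ t x → subst (λ t → Π H.[ π ↦ᵗ t ] H.⊨ φ) (decode-encode t)
       (to (guarded (encode t)) (f (lift (encode t))) (from (code _) (subst S (sym (decode-encode t)) x))))
    (λ { (MAll.just f) (lift s) → from (guarded s) λ m → f (decode s) (to (code s) m) })
    where
    guarded : ∀ s → (assign set e π (lift s) ⊨ atom (π ∈ᶠ ⌜ Y ⌝) ⇒̇ translate φ) ⇔
                    (Env.families e ⌜ Y ⌝ s → Π H.[ π ↦ᵗ decode s ] H.⊨ φ)
    guarded s = meaning (reflect-⇒ {assign set e π (lift s)} em {φ = atom (π ∈ᶠ ⌜ Y ⌝)} (reflects (bound-member e π _ s))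
                  (reflects (translate-correct (record { Constants c }) z (codes-trace {Π} {e} π s codes) φ)))
  translate-correct {e} {Π} c z (codeT , _) (H.ltl ψ) =
    ltl-correct (traceOf Π) c codeT ψ ⟫ ≡⇒⇔ (cong (λ i → sat (traceOf Π) i ψ) z) ⟫ ⇔-sym (⊨ˡ⇔sat Π ψ) ⟫ ⇔-sym Lift-⇔

-- Transition systems in arithmetic, and the translated sentence

module UpperSentence (em : ExcludedMiddle (lsuc 0ℓ)) (ext : Extensionality (lsuc 0ℓ) (lsuc 0ℓ)) (n : ℕ) where

  open UpperTranslation n
  open UpperCorrectness em ext n
  open A hiding (and; or; eq; lt)
  open H using (Trace; TraceSet; Assignment; TransitionSystem)
  open Constants

  Total : ℕ → (ℕ → Bool) → Set
  Total m E = ∀ u → u < m → ∃[ w ] w < m × T (E (u * m + w))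

  -- R may relate several vertices to one position. All of them satisfy the conditions on edges and
  -- labels, so choosing one per position always yields a path with trace s; conversely, the graph
  -- of a path satisfies all four conditions.
  Run : (m : ℕ) (I E L R s : ℕ → Bool) → Set
  Run m I E L R s =
      (∀ w → w < m → T (R w) → T (I w))
    × (∀ i → ∃[ w ] w < m × T (R (i * m + w)))
    × (∀ i u w → u < m → w < m → T (R (i * m + u)) → T (R (suc i * m + w)) → T (E (u * m + w)))
    × (∀ i w p → w < m → p < a → T (R (i * m + w)) → T (s (i * a + p)) ⇔ T (L (w * a + p)))

  IsTraceSet : Pred (ℕ → Bool) 0ℓ → Set
  IsTraceSet F = ∃[ m ] 0 < m × ∃[ I ] ∃[ E ] ∃[ L ] Total m E × (∀ s → F s ⇔ (∃[ R ] Run m I E L R s))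

  reflect-isTraceSet : ∀ {e} → Constants e → Reflects e isTraceSet (IsTraceSet (Env.families e 1))
  reflect-isTraceSet {e} c =
    reflect-ex-num λ m → reflect-∧ (convert (≡⇒⇔ (cong (_< m) (is-zero c))) reflect-atom)
      (reflect-ex-set λ I → reflect-ex-set λ E → reflect-ex-set λ L → reflect-∧
        (reflect-all-num λ u → reflect-⇒ em reflect-atom (reflect-ex-num λ w → reflect-∧ reflect-atom reflect-atom))
        (reflect-all-set λ s → reflect-⇔ em reflect-atom (reflect-ex-set λ R → reflect-∧
          (reflect-all-num λ w → reflect-⇒ em reflect-atom (reflect-⇒ em reflect-atom reflect-atom)) (reflect-∧
          (reflect-all-num λ i → reflect-ex-num λ w → reflect-∧ reflect-atom reflect-atom) (reflect-∧
          (reflect-all-num λ i → reflect-all-num λ u → reflect-all-num λ w →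
            reflect-⇒ em reflect-atom (reflect-⇒ em reflect-atom (reflect-⇒ em reflect-atom (reflect-⇒ em
              (convert (≡⇒⇔ (cong (λ j → T (R (j * m + w))) (trans (cong (i +_) (is-one c)) (ℕₚ.+-comm i 1)))) reflect-atom)
              reflect-atom))))
          (reflect-all-num λ i → reflect-all-num λ w → reflect-all-num λ p →
            reflect-⇒ em reflect-atom (reflect-⇒ em (convert (≡⇒⇔ (cong (p <_) (is-size c))) reflect-atom)
              (reflect-⇒ em reflect-atom (reflect-⇔ em
                (convert (≡⇒⇔ (cong (λ a → T (s (i * a + p))) (is-size c))) reflect-atom)
                (convert (≡⇒⇔ (cong (λ a → T (L (w * a + p))) (is-size c))) reflect-atom))))))))))

  Traces : Pred (ℕ → Bool) 0ℓ → Set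
  Traces F = Σ[ 𝔗 ∈ TransitionSystem ] (∀ s → F s ⇔ TransitionSystem.Tr 𝔗 (decode s))

  module _ (m′ : ℕ) (I E L : ℕ → Bool) where
    private
      m : ℕ
      m = suc m′

    system : Total m E → TransitionSystem
    system total = record
      { pred-size  = m′
      ; successors = λ u → Vec.tabulate λ w → E (toℕ u * m + toℕ w)
      ; total      = λ u → let w , w<m , uw = total (toℕ u) (Finₚ.toℕ<n u) in
                     fromℕ< w<m , from (∈-tabulate {f = λ w → E (toℕ u * m + toℕ w)}) (subst (λ w → T (E (toℕ u * m + w))) (sym (Finₚ.toℕ-fromℕ< w<m)) uw)
      ; initials   = Vec.tabulate (I ∘ toℕ)
      ; label      = λ u → Vec.tabulate λ p → L (toℕ u * a + toℕ p) }

    graph : (ℕ → Fin m) → ℕ → Bool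
    graph ρ i = ⌊ ρ (i / m) Finₚ.≟ i mod m ⌋

    graph-at : ∀ ρ i w → T (graph ρ (i * m + toℕ w)) ⇔ (ρ i ≡ w)
    graph-at ρ i w = ≡⇒⇔ (cong₂ (λ j w → T ⌊ ρ j Finₚ.≟ w ⌋) (pair-/ m′ i (Finₚ.toℕ<n w)) (pair-mod m′ i w)) ⟫
                     mk⇔ toWitness fromWitness

    graph-below : ∀ ρ i {w} → w < m → T (graph ρ (i * m + w)) → toℕ (ρ i) ≡ w
    graph-below ρ i {w} w<m t = trans (cong toℕ (to (graph-at ρ i (fromℕ< w<m))
      (subst (λ w → T (graph ρ (i * m + w))) (sym (Finₚ.toℕ-fromℕ< w<m)) t))) (Finₚ.toℕ-fromℕ< w<m)

    system-run : ∀ total s → (∃[ R ] Run m I E L R s) ⇔ TransitionSystem.Tr (system total) (decode s)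
    system-run total s = mk⇔
      (λ (R , init , visits , edges , labels) →
        let w  = λ i → proj₁ (visits i)
            w< = λ i → proj₁ (proj₂ (visits i))
            w∈ = λ i → proj₂ (proj₂ (visits i))
            ρ  = λ i → fromℕ< (w< i)
            at = λ i → Finₚ.toℕ-fromℕ< (w< i)
        in ρ , ( from (∈-tabulate {f = I ∘ toℕ}) (subst (T ∘ I) (sym (at 0)) (init (w 0) (w< 0) (w∈ 0)))
               , λ i → from (∈-tabulate {f = λ w → E (toℕ (ρ i) * m + toℕ w)}) (subst₂ (λ u w → T (E (u * m + w))) (sym (at i)) (sym (at (suc i)))
                         (edges i (w i) (w (suc i)) (w< i) (w< (suc i)) (w∈ i) (w∈ (suc i))))) ,
           λ i → Vecₚ.tabulate-cong λ p → T-injective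
             (labels i (w i) (toℕ p) (w< i) (Finₚ.toℕ<n p) (w∈ i) ⟫ ≡⇒⇔ (cong (λ w → T (L (w * a + toℕ p))) (sym (at i)))))
      (λ (ρ , (init , edges) , labels) → graph ρ
        , (λ w w<m t → subst (T ∘ I) (graph-below ρ 0 w<m t) (to (∈-tabulate {f = I ∘ toℕ}) init))
        , (λ i → toℕ (ρ i) , Finₚ.toℕ<n (ρ i) , from (graph-at ρ i (ρ i)) refl)
        , (λ i u w u<m w<m tu tw → subst₂ (λ u w → T (E (u * m + w))) (graph-below ρ i u<m tu) (graph-below ρ (suc i) w<m tw)
             (to (∈-tabulate {f = λ w → E (toℕ (ρ i) * m + toℕ w)}) (edges i)))
        , (λ i w p w<m p<a t → subst₂ (λ w p → T (s (i * a + p)) ⇔ T (L (w * a + p)))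
             (graph-below ρ i w<m t) (Finₚ.toℕ-fromℕ< p<a) (labelled ρ i (fromℕ< p<a) (labels i))))
      where
      labelled : ∀ ρ i p → decode s i ≡ TransitionSystem.label (system total) (ρ i) →
                 T (s (i * a + toℕ p)) ⇔ T (L (toℕ (ρ i) * a + toℕ p))
      labelled ρ i p eq = ⇔-sym (∈-tabulate {f = λ p → s (i * a + toℕ p)}) ⟫ ≡⇒⇔ (cong (p Subset.∈_) eq) ⟫
                          ∈-tabulate {f = λ p → L (toℕ (ρ i) * a + toℕ p)}

  system⇔ : ∀ {F} → IsTraceSet F ⇔ Traces F
  system⇔ {F} = mk⇔
    (λ { (suc m′ , _ , I , E , L , total , runs) → system m′ I E L total , λ s → runs s ⟫ system-run m′ I E L total s })
    (λ (𝔗 , traces) → suc (TransitionSystem.pred-size 𝔗) , s≤s z≤n , I′ 𝔗 , E′ 𝔗 , L′ 𝔗 , all-total 𝔗 ,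
      λ s → traces s ⟫ same 𝔗 s ⟫ ⇔-sym (system-run _ (I′ 𝔗) (E′ 𝔗) (L′ 𝔗) (all-total 𝔗) s))
    where
    -- Codes of a given system. Reducing indices modulo m and a makes them total; values outside the
    -- coded range are immaterial to `Run`.
    I′ : TransitionSystem → ℕ → Bool
    I′ 𝔗 i = lookup (TransitionSystem.initials 𝔗) (i mod suc (TransitionSystem.pred-size 𝔗))
    E′ : TransitionSystem → ℕ → Bool
    E′ 𝔗 i = let open TransitionSystem 𝔗; m = suc pred-size in lookup (successors ((i / m) mod m)) (i mod m)
    L′ : TransitionSystem → ℕ → Bool
    L′ 𝔗 i = let open TransitionSystem 𝔗; m = suc pred-size in lookup (label ((i / a) mod m)) (i mod a)
    toℕ-mod : ∀ {m′} (u : Fin (suc m′)) → toℕ u mod suc m′ ≡ u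
    toℕ-mod {m′} u = pair-mod m′ 0 u
    edge : ∀ 𝔗 u w → lookup (TransitionSystem.successors 𝔗 u) w ≡ E′ 𝔗 (toℕ u * suc (TransitionSystem.pred-size 𝔗) + toℕ w)
    edge 𝔗 u w = cong₂ (λ u w → lookup (TransitionSystem.successors 𝔗 u) w)
      (sym (trans (cong (_mod _) (pair-/ _ (toℕ u) (Finₚ.toℕ<n w))) (toℕ-mod u))) (sym (pair-mod _ (toℕ u) w))
    all-total : ∀ 𝔗 → Total (suc (TransitionSystem.pred-size 𝔗)) (E′ 𝔗)
    all-total 𝔗 u u<m = let open TransitionSystem 𝔗; w , uw = total (fromℕ< u<m) in
      toℕ w , Finₚ.toℕ<n w , subst (λ u → T (E′ 𝔗 (u * suc pred-size + toℕ w))) (Finₚ.toℕ-fromℕ< u<m)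
        (subst T (edge 𝔗 (fromℕ< u<m) w) (to ∈⇔lookup uw))
    same : ∀ 𝔗 s → TransitionSystem.Tr 𝔗 (decode s) ⇔
                   TransitionSystem.Tr (system (TransitionSystem.pred-size 𝔗) (I′ 𝔗) (E′ 𝔗) (L′ 𝔗) (all-total 𝔗)) (decode s)
    same 𝔗 s = Σ-cong λ ρ → ×-cong
      (×-cong (∈⇔lookup ⟫ ≡⇒⇔ (cong (T ∘ lookup initials) (sym (toℕ-mod (ρ 0)))) ⟫ ⇔-sym (∈-tabulate {f = I′ 𝔗 ∘ toℕ}))
              (Π-cong λ i → ∈⇔lookup ⟫ ≡⇒⇔ (cong T (edge 𝔗 (ρ i) (ρ (suc i)))) ⟫
                 ⇔-sym (∈-tabulate {f = λ w → E′ 𝔗 (toℕ (ρ i) * suc pred-size + toℕ w)})))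
      (Π-cong λ i → ≡⇒⇔ (cong (decode s i ≡_) (trans (sym (Vecₚ.tabulate∘lookup (label (ρ i)))) (Vecₚ.tabulate-cong (labelled (ρ i))))))
      where
      open TransitionSystem 𝔗
      labelled : ∀ u p → lookup (label u) p ≡ L′ 𝔗 (toℕ u * a + toℕ p)
      labelled u p = cong₂ (λ u p → lookup (label u) p)
        (sym (trans (cong (_mod _) (pair-/ n (toℕ u) (Finₚ.toℕ<n p))) (toℕ-mod u))) (sym (pair-mod n (toℕ u) p))

  wrap-correct : ∀ φ → (default ⊨ wrap (translate φ)) ⇔
                 (Σ[ 𝔗 ∈ TransitionSystem ] ((H.emptyAssignment H.[ H.Xa ↦ˢ (λ _ → ⊤) ]) H.[ H.Xd ↦ˢ TransitionSystem.Tr 𝔗 ] H.⊨ φ))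
  wrap-correct φ = mk⇔ forth back
    where
    Inner : ℕ → ℕ → ℕ → Pred (ℕ → Bool) 0ℓ → Pred (ℕ → Bool) 0ℓ → Env
    Inner z o s F G = assign family (assign family (assign num (assign num (assign num default
      3 (lift z)) 4 (lift o)) 5 (lift s)) 0 F) 1 G
    start : TransitionSystem → Assignment
    start 𝔗 = (H.emptyAssignment H.[ H.Xa ↦ˢ (λ _ → ⊤) ]) H.[ H.Xd ↦ˢ TransitionSystem.Tr 𝔗 ]
    codes : ∀ 𝔗 F G → (∀ s → F s) → (∀ s → G s ⇔ TransitionSystem.Tr 𝔗 (decode s)) →
            Codes (start 𝔗) (assign num (Inner 0 1 a F G) 0 (lift 0))
    codes 𝔗 F G full traces = (λ π i ()) ,
      λ { H.Xa s → mk⇔ (λ _ → tt) (λ _ → full s) ; H.Xd s → traces s ; (H.var _) s () }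
    constants : ∀ {F G x} → Constants (assign num (Inner 0 1 a F G) 0 (lift x))
    constants = record { is-zero = refl ; is-one = refl ; is-size = refl }
    constants′ : ∀ {F G} → Constants (Inner 0 1 a F G)
    constants′ = record { is-zero = refl ; is-one = refl ; is-size = refl }
    double : ∀ x → x + x ≡ x → x ≡ 0
    double x eq = ℕₚ.+-cancelˡ-≡ x x 0 (trans eq (sym (ℕₚ.+-identityʳ x)))
    idempotent : ∀ x → 0 < x → x * x ≡ x → x ≡ 1
    idempotent (suc x) _ eq = ℕₚ.*-cancelˡ-≡ (suc x) 1 (suc x) (trans eq (sym (ℕₚ.*-identityʳ (suc x))))
    size : ⟦ numeral a ⟧ (assign num (assign num (assign num default 3 (lift 0)) 4 (lift 1)) 5 (lift a)) ≡ a
    size = numeral-value (record { is-zero = refl ; is-one = refl ; is-size = refl }) a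
    forth : _
    forth (lift z , lift z≡ , lift o , lift o> , lift o≡ , lift s , lift s≡ , F , full , G , traces , lift x , lift x≡ , m)
      with double z z≡
    ... | refl with idempotent o o> o≡
    -- The numeral is built from variables 3 and 4, so its value is |AP| whatever s is bound to
    -- variable 5.
    ... | refl with trans s≡ (trans (value s) (refl {x = a}))
      where
      value : ∀ s → ⟦ numeral a ⟧ (assign num (assign num (assign num default 3 (lift 0)) 4 (lift 1)) 5 (lift s)) ≡ a
      value s = go a
        where
        go : ∀ i → ⟦ numeral i ⟧ (assign num (assign num (assign num default 3 (lift 0)) 4 (lift 1)) 5 (lift s)) ≡ i
        go zero    = refl
        go (suc i) = trans (cong (_+ 1) (go i)) (ℕₚ.+-comm i 1)
    ... | refl with x≡
    ... | refl = let 𝔗 , tr = to system⇔ (to (meaning (reflect-isTraceSet (constants′ {F} {G}))) traces) in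
      𝔗 , to (translate-correct constants refl (codes 𝔗 F G (λ s → lower (full (lift s))) tr) φ) m
    back : _
    back (𝔗 , m) = lift 0 , lift refl , lift 1 , lift (s≤s z≤n) , lift refl , lift a , lift (sym size) ,
      (λ _ → ⊤) , (λ _ → lift tt) , (TransitionSystem.Tr 𝔗 ∘ decode) ,
      from (meaning (reflect-isTraceSet (constants′ {λ _ → ⊤} {TransitionSystem.Tr 𝔗 ∘ decode}))) (from system⇔ (𝔗 , λ s → ⇔-refl)) , lift 0 , lift refl ,
      from (translate-correct constants refl (codes 𝔗 _ _ (λ _ → tt) (λ _ → ⇔-refl)) φ) m

-- Closedness of the translated sentence

module UpperSyntax (n : ℕ) where

  open UpperTranslation n
  open A hiding (and; or; eq; lt)

  BoundedTerm : (Sort → ℕ → Set) → Term → Set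
  BoundedTerm P (var x)   = P num x
  BoundedTerm P (t₁ ⊕ t₂) = BoundedTerm P t₁ × BoundedTerm P t₂
  BoundedTerm P (t₁ ⊗ t₂) = BoundedTerm P t₁ × BoundedTerm P t₂

  BoundedAtom : (Sort → ℕ → Set) → Atom → Set
  BoundedAtom P (t₁ ≐ t₂) = BoundedTerm P t₁ × BoundedTerm P t₂
  BoundedAtom P (t₁ ≺ t₂) = BoundedTerm P t₁ × BoundedTerm P t₂
  BoundedAtom P (t ∈ˢ x)  = BoundedTerm P t × P set x
  BoundedAtom P (x ∈ᶠ y)  = P set x × P family y

  extend : (Sort → ℕ → Set) → Sort → ℕ → Sort → ℕ → Set
  extend P s x r y = (r , y) ≡ (s , x) ⊎ P r y

  -- A positive form of "all free variables are in P", which passes under binders by extending P;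
  -- for empty P it gives closedness.
  Bounded : (Sort → ℕ → Set) → Formula → Set
  Bounded P (atom α)    = BoundedAtom P α
  Bounded P (not φ)     = Bounded P φ
  Bounded P (φ and χ)   = Bounded P φ × Bounded P χ
  Bounded P (φ or χ)    = Bounded P φ × Bounded P χ
  Bounded P (all s x φ) = Bounded (extend P s x) φ
  Bounded P (ex s x φ)  = Bounded (extend P s x) φ

  occurs-term : ∀ {P x} t → BoundedTerm P t → OccursTerm x t → P num x
  occurs-term (var y)   p        refl     = p
  occurs-term (t₁ ⊕ t₂) (p₁ , _) (inj₁ o) = occurs-term t₁ p₁ o
  occurs-term (t₁ ⊕ t₂) (_ , p₂) (inj₂ o) = occurs-term t₂ p₂ o
  occurs-term (t₁ ⊗ t₂) (p₁ , _) (inj₁ o) = occurs-term t₁ p₁ o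
  occurs-term (t₁ ⊗ t₂) (_ , p₂) (inj₂ o) = occurs-term t₂ p₂ o

  occurs-atom : ∀ {P} s {x} α → BoundedAtom P α → OccursAtom s x α → P s x
  occurs-atom num    (t₁ ≐ t₂) (p₁ , _) (inj₁ o) = occurs-term t₁ p₁ o
  occurs-atom num    (t₁ ≐ t₂) (_ , p₂) (inj₂ o) = occurs-term t₂ p₂ o
  occurs-atom num    (t₁ ≺ t₂) (p₁ , _) (inj₁ o) = occurs-term t₁ p₁ o
  occurs-atom num    (t₁ ≺ t₂) (_ , p₂) (inj₂ o) = occurs-term t₂ p₂ o
  occurs-atom num    (t ∈ˢ _)  (p , _)  o        = occurs-term t p o
  occurs-atom set    (_ ∈ˢ _)  (_ , p)  refl     = p
  occurs-atom set    (_ ∈ᶠ _)  (p , _)  refl     = p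
  occurs-atom family (_ ∈ᶠ _)  (_ , p)  refl     = p

  free⇒bounded : ∀ {P s x} φ → Bounded P φ → Free s x φ → P s x
  free⇒bounded (atom α)    b       f        = occurs-atom _ α b f
  free⇒bounded (not φ)     b       f        = free⇒bounded φ b f
  free⇒bounded (φ and χ)   (b , _) (inj₁ f) = free⇒bounded φ b f
  free⇒bounded (φ and χ)   (_ , b) (inj₂ f) = free⇒bounded χ b f
  free⇒bounded (φ or χ)    (b , _) (inj₁ f) = free⇒bounded φ b f
  free⇒bounded (φ or χ)    (_ , b) (inj₂ f) = free⇒bounded χ b f
  free⇒bounded (all s x φ) b (≢ , f) = [ (λ eq → ⊥-elim (≢ eq)) , id ]′ (free⇒bounded φ b f)
  free⇒bounded (ex s x φ)  b (≢ , f) = [ (λ eq → ⊥-elim (≢ eq)) , id ]′ (free⇒bounded φ b f)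

  Scope : Set
  Scope = List (Sort × ℕ)

  member : Scope → Sort → ℕ → Bool
  member []            s x = false
  member ((r , y) ∷ Γ) s x = ((s ≡ˢ r) ∧ (x ℕ.≡ᵇ y)) ∨ member Γ s x

  boundedTerm : Scope → Term → Bool
  boundedTerm Γ (var x)   = member Γ num x
  boundedTerm Γ (t₁ ⊕ t₂) = boundedTerm Γ t₁ ∧ boundedTerm Γ t₂
  boundedTerm Γ (t₁ ⊗ t₂) = boundedTerm Γ t₁ ∧ boundedTerm Γ t₂

  boundedAtom : Scope → Atom → Bool
  boundedAtom Γ (t₁ ≐ t₂) = boundedTerm Γ t₁ ∧ boundedTerm Γ t₂
  boundedAtom Γ (t₁ ≺ t₂) = boundedTerm Γ t₁ ∧ boundedTerm Γ t₂
  boundedAtom Γ (t ∈ˢ x)  = boundedTerm Γ t ∧ member Γ set x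
  boundedAtom Γ (x ∈ᶠ y)  = member Γ set x ∧ member Γ family y

  -- Lets the concrete formula `isTraceSet` be checked by evaluation instead of by a derivation of
  -- `Bounded`.
  bounded : Scope → Formula → Bool
  bounded Γ (atom α)    = boundedAtom Γ α
  bounded Γ (not φ)     = bounded Γ φ
  bounded Γ (φ and χ)   = bounded Γ φ ∧ bounded Γ χ
  bounded Γ (φ or χ)    = bounded Γ φ ∧ bounded Γ χ
  bounded Γ (all s x φ) = bounded ((s , x) ∷ Γ) φ
  bounded Γ (ex s x φ)  = bounded ((s , x) ∷ Γ) φ

  module _ where
    private
      variable
        P : Sort → ℕ → Set
        Γ : Scope

    Covers : (Sort → ℕ → Set) → Scope → Set
    Covers P Γ = ∀ s x → T (member Γ s x) → P s x

    covers-extend : ∀ {P} Γ {s x} → Covers P Γ → Covers (extend P s x) ((s , x) ∷ Γ)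
    covers-extend Γ {s} {x} c r y m with to Boolₚ.T-∨ m
    ... | inj₂ m′ = inj₂ (c r y m′)
    ... | inj₁ m′ = let m₁ , m₂ = to Boolₚ.T-∧ m′ in inj₁ (cong₂ _,_ (≡ˢ-sound r s m₁) (ℕₚ.≡ᵇ⇒≡ y x m₂))

    boundedTerm-sound : Covers P Γ → ∀ t → T (boundedTerm Γ t) → BoundedTerm P t
    boundedTerm-sound c (var x)   b = c num x b
    boundedTerm-sound c (t₁ ⊕ t₂) b = let b₁ , b₂ = to Boolₚ.T-∧ b in boundedTerm-sound c t₁ b₁ , boundedTerm-sound c t₂ b₂
    boundedTerm-sound c (t₁ ⊗ t₂) b = let b₁ , b₂ = to Boolₚ.T-∧ b in boundedTerm-sound c t₁ b₁ , boundedTerm-sound c t₂ b₂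

    bounded-sound : Covers P Γ → ∀ φ → T (bounded Γ φ) → Bounded P φ
    bounded-sound c (atom (t₁ ≐ t₂)) b = let b₁ , b₂ = to Boolₚ.T-∧ b in boundedTerm-sound c t₁ b₁ , boundedTerm-sound c t₂ b₂
    bounded-sound c (atom (t₁ ≺ t₂)) b = let b₁ , b₂ = to Boolₚ.T-∧ b in boundedTerm-sound c t₁ b₁ , boundedTerm-sound c t₂ b₂
    bounded-sound c (atom (t ∈ˢ x))  b = let b₁ , b₂ = to Boolₚ.T-∧ b in boundedTerm-sound c t b₁ , c set x b₂
    bounded-sound c (atom (x ∈ᶠ y))  b = let b₁ , b₂ = to Boolₚ.T-∧ b in c set x b₁ , c family y b₂
    bounded-sound c (not φ)     b = bounded-sound c φ b
    bounded-sound c (φ and χ)   b = let b₁ , b₂ = to Boolₚ.T-∧ b in bounded-sound c φ b₁ , bounded-sound c χ b₂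
    bounded-sound c (φ or χ)    b = let b₁ , b₂ = to Boolₚ.T-∧ b in bounded-sound c φ b₁ , bounded-sound c χ b₂
    bounded-sound {Γ = Γ} c (all s x φ) b = bounded-sound (covers-extend Γ c) φ b
    bounded-sound {Γ = Γ} c (ex s x φ)  b = bounded-sound (covers-extend Γ c) φ b

  record Globals (P : Sort → ℕ → Set) : Set where
    field
      position : P num 0
      zero′    : P num 3
      one      : P num 4
      size     : P num 5

  numeral-bounded : ∀ {P} → P num 3 → P num 4 → ∀ i → BoundedTerm P (numeral i)
  numeral-bounded p₃ p₄ zero    = p₃
  numeral-bounded p₃ p₄ (suc i) = numeral-bounded p₃ p₄ i , p₄

  ltl-bounded : ∀ {P} → Globals P → ∀ ψ → (∀ π → H.OccursLTL π ψ → P set π) → Bounded P ⟪ ψ ⟫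
  ltl-bounded g (H.⟨ p ⟩ π)     o = ((position , size) , numeral-bounded zero′ one (toℕ p)) , o π refl
    where open Globals g
  ltl-bounded g (H.not ψ)       o = ltl-bounded g ψ o
  ltl-bounded g (H._or_ ψ₁ ψ₂)  o = ltl-bounded g ψ₁ (λ π → o π ∘ inj₁) , ltl-bounded g ψ₂ (λ π → o π ∘ inj₂)
  ltl-bounded g (H.X ψ)         o = (inj₁ refl , inj₂ position , inj₂ one) , (inj₁ refl , inj₂ (inj₁ refl)) ,
    ltl-bounded (record { position = inj₁ refl ; zero′ = inj₂ (inj₂ zero′) ; one = inj₂ (inj₂ one) ; size = inj₂ (inj₂ size) })
      ψ (λ π → inj₂ ∘ inj₂ ∘ o π)
    where open Globals g
  ltl-bounded {P} g (H._U_ ψ₁ ψ₂) o = (inj₁ refl , inj₂ position) , (inj₁ refl , inj₂ (inj₂ position)) ,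
    ((inj₁ refl , inj₂ (inj₁ refl)) , (inj₂ (inj₂ (inj₁ refl)) , inj₁ refl)) ,
    ((inj₁ refl , inj₂ (inj₂ (inj₁ refl))) , ltl-bounded inner ψ₁ (λ π → inj₂ ∘ inj₂ ∘ inj₂ ∘ o π ∘ inj₁)) ,
    ltl-bounded inner ψ₂ (λ π → inj₂ ∘ inj₂ ∘ inj₂ ∘ o π ∘ inj₂)
    where
    open Globals g
    inner : Globals (extend (extend (extend P num 1) num 2) num 0)
    inner = record { position = inj₁ refl ; zero′ = inj₂ (inj₂ (inj₂ zero′)) ; one = inj₂ (inj₂ (inj₂ one))
                   ; size = inj₂ (inj₂ (inj₂ size)) }

  globals-extend : ∀ {P s x} → Globals P → Globals (extend P s x)
  globals-extend g = record { position = inj₂ position ; zero′ = inj₂ zero′ ; one = inj₂ one ; size = inj₂ size }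
    where open Globals g

  translate-bounded : ∀ {P} → Globals P → ∀ φ → (∀ π → H.FreeTrace π φ → P set π) →
                      (∀ Y → H.FreeSet Y φ → P family ⌜ Y ⌝) → Bounded P (translate φ)
  translate-bounded {P} g (H.∃ˢ Y φ) ft fs = translate-bounded (globals-extend g) φ (λ π → inj₂ ∘ ft π) shadow
    where
    shadow : ∀ Z → H.FreeSet Z φ → extend P family ⌜ Y ⌝ family ⌜ Z ⌝
    shadow Z f with Z H.≟ˢ Y
    ... | yes refl = inj₁ refl
    ... | no ≢     = inj₂ (fs Z (≢ , f))
  translate-bounded {P} g (H.∀ˢ Y φ) ft fs = translate-bounded (globals-extend g) φ (λ π → inj₂ ∘ ft π) shadow
    where
    shadow : ∀ Z → H.FreeSet Z φ → extend P family ⌜ Y ⌝ family ⌜ Z ⌝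
    shadow Z f with Z H.≟ˢ Y
    ... | yes refl = inj₁ refl
    ... | no ≢     = inj₂ (fs Z (≢ , f))
  translate-bounded {P} g (H.∃ᵗ π Y φ) ft fs =
    (inj₁ refl , inj₂ (fs Y (inj₁ refl))) , translate-bounded (globals-extend g) φ shadow (λ Z → inj₂ ∘ fs Z ∘ inj₂)
    where
    shadow : ∀ ρ → H.FreeTrace ρ φ → extend P set π set ρ
    shadow ρ f with ρ ℕₚ.≟ π
    ... | yes refl = inj₁ refl
    ... | no ≢     = inj₂ (ft ρ (≢ , f))
  translate-bounded {P} g (H.∀ᵗ π Y φ) ft fs =
    (inj₁ refl , inj₂ (fs Y (inj₁ refl))) , translate-bounded (globals-extend g) φ shadow (λ Z → inj₂ ∘ fs Z ∘ inj₂)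
    where
    shadow : ∀ ρ → H.FreeTrace ρ φ → extend P set π set ρ
    shadow ρ f with ρ ℕₚ.≟ π
    ... | yes refl = inj₁ refl
    ... | no ≢     = inj₂ (ft ρ (≢ , f))
  translate-bounded g (H.ltl ψ) ft fs = ltl-bounded g ψ ft

  wrap-bounded : ∀ φ → H.IsSentence φ → Bounded (λ _ _ → ⊥) (wrap (translate φ))
  wrap-bounded φ (ft , fs) =
    ((inj₁ refl , inj₁ refl) , inj₁ refl) ,
    (inj₂ (inj₁ refl) , inj₁ refl) , ((inj₁ refl , inj₁ refl) , inj₁ refl) ,
    (inj₁ refl , numeral-bounded (inj₂ (inj₂ (inj₁ refl))) (inj₂ (inj₁ refl)) (suc n)) ,
    (inj₁ refl , inj₂ (inj₁ refl)) ,
    bounded-sound {Γ = Γ} covers isTraceSet tt ,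
    (inj₁ refl , inj₂ (inj₂ (inj₂ (inj₂ (inj₂ (inj₁ refl)))))) ,
    translate-bounded (record { position = inj₁ refl ; zero′ = inj₂ (inj₂ (inj₂ (inj₂ (inj₂ (inj₁ refl)))))
                              ; one = inj₂ (inj₂ (inj₂ (inj₂ (inj₁ refl)))) ; size = inj₂ (inj₂ (inj₂ (inj₁ refl))) })
      φ (λ π f → ⊥-elim (ft π f)) free-sets
    where
    P : Sort → ℕ → Set
    P = extend (extend (extend (extend (extend (λ _ _ → ⊥) num 3) num 4) num 5) family 0) family 1
    Γ : Scope
    Γ = (family , 1) ∷ (family , 0) ∷ (num , 5) ∷ (num , 4) ∷ (num , 3) ∷ []
    covers : Covers P Γ
    covers = covers-extend ((family , 0) ∷ (num , 5) ∷ (num , 4) ∷ (num , 3) ∷ [])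
            (covers-extend ((num , 5) ∷ (num , 4) ∷ (num , 3) ∷ []) (covers-extend ((num , 4) ∷ (num , 3) ∷ [])
            (covers-extend ((num , 3) ∷ []) (covers-extend [] (λ _ _ ())))))
    free-sets : ∀ Y → H.FreeSet Y φ → extend P num 0 family ⌜ Y ⌝
    free-sets Y f with fs Y f
    ... | inj₁ refl = inj₂ (inj₂ (inj₁ refl))
    ... | inj₂ refl = inj₂ (inj₁ refl)

  sentence : H.Sentence → Sentence
  sentence (φ , closed) = wrap (translate φ) , λ s x f → free⇒bounded {λ _ _ → ⊥} (wrap (translate φ)) (wrap-bounded φ closed) f

-- A linear-time transducer for the upper bound

module UpperProgram (n : ℕ) where

  open UpperTranslation n
  open UpperSyntax n using (sentence)
  open Programs H.Sym A.Sym ⊤ 2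

  instance
    listed-HSym : Listed H.Sym
    listed-HSym .Listed.finite = H.symFinite

    listed-ASym : Listed A.Sym
    listed-ASym .Listed.finite = A.symFinite

  pattern In  = zero
  pattern Out = suc zero
  pattern Log = suc (suc zero)
  pattern Idx = suc (suc (suc zero))

  outer : A.Term → A.Formula → A.Formula
  outer t φ = A.ex A.num 3 (A.atom ((v 3 A.⊕ v 3) A.≐ v 3) ∧̇
    A.ex A.num 4 (A.atom (v 3 A.≺ v 4) ∧̇ A.atom ((v 4 A.⊗ v 4) A.≐ v 4) ∧̇
    A.ex A.num 5 (A.atom (v 5 A.≐ t) ∧̇ φ)))

  inner : A.Formula → A.Formula
  inner φ = A.ex A.family 0 (A.all A.set 0 (A.atom (0 A.∈ᶠ 0)) ∧̇ A.ex A.family 1 (isTraceSet ∧̇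
    A.ex A.num 0 (A.atom (v 0 A.≐ v 3) ∧̇ φ)))

  -- The constant texts are cut off from instances whose holes are filled with the formula φ₀ of length 3.
  φ₀ : A.Formula
  φ₀ = A.atom (0 A.∈ᶠ 0)

  textBefore : ℕ → A.Formula → List A.Sym
  textBefore m φ = take (length (A.encodeFormula φ) ℕ.∸ m) (A.encodeFormula φ)

  outerText innerText nextText untilText sizeText : List A.Sym
  outerText = textBefore 4 (outer (v 0) φ₀)
  innerText = textBefore 3 (inner φ₀)
  nextText  = textBefore 3 (tomorrow φ₀)
  untilText = textBefore 6 (until φ₀ φ₀)
  sizeText  = A.encodeTerm (numeral (suc n))

  cellText : H.AP → List A.Sym
  cellText p = A.inˢ ∷ A.encodeTerm (cellOf p)

  emit : List A.Sym → Prog ⊤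
  emit []      = skip tt
  emit (c ∷ w) = push Log (out c) >> emit w

  copyIndex : Prog ⊤
  copyIndex = loop (λ _ → pop In >>= λ
    { (just (inp H.stroke)) → push Log (out A.stroke) >> skip (inj₁ tt)
    ; _                     → push Log (out A.end) >> skip (inj₂ tt) }) tt

  saveIndex : Prog ⊤
  saveIndex = loop (λ _ → pop In >>= λ
    { (just (inp H.stroke)) → push Log (out A.stroke) >> (push Idx (wrk tt) >> skip (inj₁ tt))
    ; _                     → push Log (out A.end) >> skip (inj₂ tt) }) tt

  replayIndex : Prog ⊤
  replayIndex = loop (λ _ → pop Idx >>= λ
    { (just _) → push Log (out A.stroke) >> skip (inj₁ tt)
    ; nothing  → push Log (out A.end) >> skip (inj₂ tt) }) tt

  setVariable : Prog ⊤
  setVariable = pop In >>= λ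
    { (just (inp H.xa))     → emit (A.encodeIndex 0)
    ; (just (inp H.xd))     → emit (A.encodeIndex 1)
    -- Two of the strokes are the offset of `⌜_⌝`, the third is the one just read.
    ; (just (inp H.stroke)) → emit (A.stroke ∷ A.stroke ∷ A.stroke ∷ []) >> copyIndex
    ; _                     → emit (A.encodeIndex 2) }

  -- Each connective is replaced by the text of its translation up to the holes, which come last and
  -- are filled by what the main loop writes next. A trace quantifier reads ahead: its variable
  -- occurs twice in the translation, so its index is saved and replayed.
  symbol : H.Sym → Prog ⊤
  symbol H.∃ˢ       = emit (A.ex A.family ∷ []) >> setVariable
  symbol H.∀ˢ       = emit (A.all A.family ∷ []) >> setVariable
  symbol H.∃ᵗ       = emit (A.ex A.set ∷ []) >> (saveIndex >> (emit (A.and ∷ A.inᶠ ∷ []) >> (replayIndex >> setVariable)))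
  symbol H.∀ᵗ       = emit (A.all A.set ∷ []) >> (saveIndex >> (emit (A.or ∷ A.not ∷ A.inᶠ ∷ []) >> (replayIndex >> setVariable)))
  symbol H.not      = emit (A.not ∷ [])
  symbol H.or       = emit (A.or ∷ [])
  symbol H.U        = emit untilText
  symbol H.X        = emit nextText
  symbol (H.prop p) = emit (cellText p) >> copyIndex
  symbol _          = skip tt

  main : Prog ⊤
  main = loop (λ _ → pop In >>= λ
    { (just (inp c)) → symbol c >> skip (inj₁ tt)
    ; _              → skip (inj₂ tt) }) tt

  unload : Prog ⊤
  unload = loop (λ _ → pop Log >>= λ
    { (just c) → push Out c >> skip (inj₁ tt)
    ; nothing  → skip (inj₂ tt) }) tt

  front : List A.Sym → Prog ⊤
  front w = emit w >> main

  program : List A.Sym → Prog ⊤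
  program w = front w >> unload

  ⟨_,_,_⟩ : List H.Sym → List Γ → ℕ → Stacks
  ⟨ w , t , x ⟩ = map inp w ∷ [] ∷ t ∷ replicate x (wrk tt) ∷ []

  emit-run : ∀ w {u t x} → Run 0 (emit w) ⟨ u , t , x ⟩ (2 * length w + 1) tt ⟨ u , w ▷ t , x ⟩
  emit-run []      = skip-run
  emit-run (c ∷ w) = weaken (ℕₚ.≤-reflexive (cost (length w))) (push-run ⨾ emit-run w)
    where
    cost : ∀ l → 2 + (2 * l + 1) ≡ 2 * suc l + 1
    cost = solve-∀

  copyIndex-run : ∀ i {u t x} → Run 0 copyIndex ⟨ H.encodeIndex i ++ u , t , x ⟩ (6 * suc i) tt ⟨ u , A.encodeIndex i ▷ t , x ⟩
  copyIndex-run zero    = exit (weaken (s≤s (s≤s (s≤s (s≤s z≤n)))) (pop-just refl ⨾ push-run ⨾ skip-run))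
  copyIndex-run (suc i) = weaken (ℕₚ.≤-trans (ℕₚ.m≤n+m _ 2) (ℕₚ.≤-reflexive (sym (ℕₚ.*-suc 6 (suc i)))))
    (again (pop-just refl ⨾ push-run ⨾ skip-run) (copyIndex-run i))

  saveIndex-run : ∀ i {u t x} → Run 0 saveIndex ⟨ H.encodeIndex i ++ u , t , x ⟩ (6 * suc i) tt ⟨ u , A.encodeIndex i ▷ t , i + x ⟩
  saveIndex-run zero    = exit (weaken (s≤s (s≤s (s≤s (s≤s z≤n)))) (pop-just refl ⨾ push-run ⨾ skip-run))
  saveIndex-run (suc i) {u} {t} {x} = weaken (ℕₚ.≤-reflexive (sym (ℕₚ.*-suc 6 (suc i))))
    (again (pop-just refl ⨾ push-run ⨾ push-run ⨾ skip-run)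
      (subst (λ y → Run 0 saveIndex ⟨ H.encodeIndex i ++ u , out A.stroke ∷ t , suc x ⟩ (6 * suc i) tt ⟨ u , A.encodeIndex i ▷ out A.stroke ∷ t , y ⟩)
        (ℕₚ.+-suc i x) (saveIndex-run i {u} {out A.stroke ∷ t} {suc x})))

  indexSaved-run : ∀ i {u t} → Run 0 saveIndex ⟨ H.encodeIndex i ++ u , t , 0 ⟩ (6 * suc i) tt ⟨ u , A.encodeIndex i ▷ t , i ⟩
  indexSaved-run i {u} {t} = subst (λ x → Run 0 saveIndex ⟨ H.encodeIndex i ++ u , t , 0 ⟩ (6 * suc i) tt ⟨ u , A.encodeIndex i ▷ t , x ⟩)
    (ℕₚ.+-identityʳ i) (saveIndex-run i {u} {t})

  replayIndex-run : ∀ i {u t} → Run 0 replayIndex ⟨ u , t , i ⟩ (4 * suc i) tt ⟨ u , A.encodeIndex i ▷ t , 0 ⟩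
  replayIndex-run zero    = exit (pop-nothing refl ⨾ push-run ⨾ skip-run)
  replayIndex-run (suc i) = weaken (ℕₚ.≤-reflexive (sym (ℕₚ.*-suc 4 (suc i))))
    (again (pop-just refl ⨾ push-run ⨾ skip-run) (replayIndex-run i))

  setVariable-run : ∀ Y {u t} → Run 0 setVariable ⟨ H.encodeSetVar Y ++ u , t , 0 ⟩ (14 * length (H.encodeSetVar Y)) tt
                                                  ⟨ u , A.encodeIndex ⌜ Y ⌝ ▷ t , 0 ⟩
  setVariable-run H.Xa            = weaken (toWitness {a? = 4 ℕₚ.≤? 14} tt) (pop-just refl ⨾ emit-run (A.encodeIndex 0))
  setVariable-run H.Xd            = weaken (toWitness {a? = 6 ℕₚ.≤? 14} tt) (pop-just refl ⨾ emit-run (A.encodeIndex 1))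
  setVariable-run (H.var zero)    = weaken (toWitness {a? = 8 ℕₚ.≤? 14} tt) (pop-just refl ⨾ emit-run (A.encodeIndex 2))
  setVariable-run (H.var (suc i)) = weaken bound
    (pop-just refl ⨾ emit-run (A.stroke ∷ A.stroke ∷ A.stroke ∷ []) ⨾ copyIndex-run i)
    where
    bound : 8 + 6 * suc i ≤ 14 * suc (length (H.encodeIndex i))
    bound = subst (8 + 6 * suc i ≤_) (sym (trans (cong (λ l → 14 * suc l) (index-length i)) (ℕₚ.*-suc 14 (suc i))))
      (ℕₚ.+-mono-≤ (toWitness {a? = 8 ℕₚ.≤? 14} tt) (ℕₚ.*-monoˡ-≤ (suc i) (toWitness {a? = 6 ℕₚ.≤? 14} tt)))
      where
      index-length : ∀ i → length (H.encodeIndex i) ≡ suc i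
      index-length zero    = refl
      index-length (suc i) = cong suc (index-length i)

  main-step : ∀ {c u t u′ t′ m m′ σ} → Run 0 (symbol c) ⟨ u , t , 0 ⟩ m tt ⟨ u′ , t′ , 0 ⟩ → Run 0 main ⟨ u′ , t′ , 0 ⟩ m′ tt σ →
              Run 0 main ⟨ c ∷ u , t , 0 ⟩ (2 + m + m′) tt σ
  main-step {m = m} {m′} r r′ = weaken (ℕₚ.≤-reflexive (cost m m′)) (again (pop-just refl ⨾ r ⨾ skip-run) r′)
    where
    cost : ∀ m m′ → 1 + (m + 1) + m′ ≡ 2 + m + m′
    cost = solve-∀

  -- The summand with n pays for the numeral of a proposition, whose length is linear in the
  -- proposition. Opaque so that the constant is not unfolded in unary.
  opaque
    D : ℕ
    D = 200 + 2 * (6 * n)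

    D-bounds : ∀ {i} → i ≤ n → 200 + 2 * (6 * i) ≤ D
    D-bounds i≤ = ℕₚ.+-monoʳ-≤ 200 (ℕₚ.*-monoʳ-≤ 2 (ℕₚ.*-monoʳ-≤ 6 i≤))

  200≤D : 200 ≤ D
  200≤D = D-bounds z≤n

  -- Each input symbol pays for at most D steps.
  budget : ∀ {m} l {m′} → m ≤ D → m + (D * l + m′) ≤ D * suc l + m′
  budget {m} l {m′} m≤ = ℕₚ.≤-trans (ℕₚ.+-monoˡ-≤ (D * l + m′) m≤) (ℕₚ.≤-reflexive (cost D l m′))
    where
    cost : ∀ D l m′ → D + (D * l + m′) ≡ D * suc l + m′
    cost = solve-∀

  literal : ∀ m {h : True (m ℕₚ.≤? 200)} → m ≤ D
  literal m {h} = ℕₚ.≤-trans (toWitness h) 200≤D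

  index-length : ∀ i → length (H.encodeIndex i) ≡ suc i
  index-length zero    = refl
  index-length (suc i) = cong suc (index-length i)

  cell-cost : ∀ p → 2 + (2 * length (cellText p) + 1) ≤ D
  cell-cost p = begin
      2 + (2 * length (cellText p) + 1)  ≡⟨ cong (λ l → 2 + (2 * l + 1)) (cong (10 +_) (numeral-length (toℕ p))) ⟩
      2 + (2 * (14 + 6 * toℕ p) + 1)     ≡⟨ arrange (toℕ p) ⟩
      31 + 2 * (6 * toℕ p)               ≤⟨ ℕₚ.+-monoˡ-≤ (2 * (6 * toℕ p)) (toWitness {a? = 31 ℕₚ.≤? 200} tt) ⟩
      200 + 2 * (6 * toℕ p)              ≤⟨ D-bounds (ℕₚ.≤-pred (Finₚ.toℕ<n p)) ⟩
      D ∎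
    where
    open ℕₚ.≤-Reasoning
    arrange : ∀ i → 2 + (2 * (14 + 6 * i) + 1) ≡ 31 + 2 * (6 * i)
    arrange = solve-∀
    numeral-length : ∀ i → length (A.encodeTerm (numeral i)) ≡ 4 + 6 * i
    numeral-length zero    = refl
    numeral-length (suc i) = trans (cong suc (Listₚ.length-++ (A.encodeTerm (numeral i))))
      (trans (cong (λ l → suc (l + 5)) (numeral-length i)) (step i))
      where
      step : ∀ i → suc (4 + 6 * i + 5) ≡ 4 + 6 * suc i
      step = solve-∀

  quantifier-cost : ∀ m j l k {m′} → m ≤ 200 → m + 10 * j + 14 * k + (D * l + m′) ≤ D * suc (j + (k + l)) + m′
  quantifier-cost m j l k {m′} m≤ = ℕₚ.≤-trans
    (ℕₚ.+-monoˡ-≤ (D * l + m′) (ℕₚ.+-mono-≤ (ℕₚ.+-mono-≤ (ℕₚ.≤-trans m≤ 200≤D)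
      (ℕₚ.*-monoˡ-≤ j (literal 10))) (ℕₚ.*-monoˡ-≤ k (literal 14))))
    (ℕₚ.≤-reflexive (cost D j l k m′))
    where
    cost : ∀ D j l k m′ → D + D * j + D * k + (D * l + m′) ≡ D * suc (j + (k + l)) + m′
    cost = solve-∀

  -- The run on the rest u of the input is a hypothesis. In this continuation form a binary
  -- connective is handled by composing the two induction hypotheses, with no need to split the
  -- input.
  main-ltl : ∀ ψ {u t m σ} → Run 0 main ⟨ u , A.encodeFormula ⟪ ψ ⟫ ▷ t , 0 ⟩ m tt σ →
             Run 0 main ⟨ H.encodeLTL ψ ++ u , t , 0 ⟩ (D * length (H.encodeLTL ψ) + m) tt σ
  main-ltl (H.⟨ p ⟩ π) {t = t} {m} r rewrite index-length π = weaken bound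
    (main-step (emit-run (cellText p) ⨾ copyIndex-run π) (subst (λ t → Run 0 main ⟨ _ , t , 0 ⟩ m tt _) (▷-++ (cellText p)) r))
    where
    bound : 2 + (2 * length (cellText p) + 1 + 6 * suc π) + m ≤ D * suc (suc π) + m
    bound = ℕₚ.≤-trans (ℕₚ.≤-reflexive (cost (length (cellText p)) π m))
      (ℕₚ.≤-trans (ℕₚ.+-monoʳ-≤ (2 + (2 * length (cellText p) + 1)) (ℕₚ.+-monoˡ-≤ m (ℕₚ.*-monoˡ-≤ (suc π) (literal 6))))
        (budget (suc π) (cell-cost p)))
      where
      cost : ∀ l π m → 2 + (2 * l + 1 + 6 * suc π) + m ≡ 2 + (2 * l + 1) + (6 * suc π + m)
      cost = solve-∀
  main-ltl (H.not ψ) r = weaken (budget (length (H.encodeLTL ψ)) (literal 5)) (main-step (emit-run (A.not ∷ [])) (main-ltl ψ r))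
  main-ltl (H.X ψ) r = weaken (budget (length (H.encodeLTL ψ)) (literal (2 + (2 * length nextText + 1))))
    (main-step (emit-run nextText) (main-ltl ψ (subst (λ t → Run 0 main ⟨ _ , t , 0 ⟩ _ tt _) (▷-++ nextText {A.encodeFormula ⟪ ψ ⟫}) r)))
  main-ltl (H._or_ ψ₁ ψ₂) {u} {t} {m} r
    rewrite Listₚ.length-++ (H.encodeLTL ψ₁) {H.encodeLTL ψ₂} | Listₚ.++-assoc (H.encodeLTL ψ₁) (H.encodeLTL ψ₂) u =
    weaken (binary (literal 5)) (main-step (emit-run (A.or ∷ [])) (main-ltl ψ₁ (main-ltl ψ₂
      (subst (λ t → Run 0 main ⟨ _ , t , 0 ⟩ _ tt _) (▷-++ (A.encodeFormula ⟪ ψ₁ ⟫)) r))))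
    where
    binary : ∀ {k} → k ≤ D → k + (D * length (H.encodeLTL ψ₁) + (D * length (H.encodeLTL ψ₂) + m)) ≤
             D * suc (length (H.encodeLTL ψ₁) + length (H.encodeLTL ψ₂)) + m
    binary {k} k≤ = ℕₚ.≤-trans (ℕₚ.≤-reflexive (cong (k +_) (cost D (length (H.encodeLTL ψ₁)) (length (H.encodeLTL ψ₂)) m))) (budget _ k≤)
      where
      cost : ∀ D a b m → D * a + (D * b + m) ≡ D * (a + b) + m
      cost = solve-∀
  main-ltl (H._U_ ψ₁ ψ₂) {u} {t} {m} r
    rewrite Listₚ.length-++ (H.encodeLTL ψ₁) {H.encodeLTL ψ₂} | Listₚ.++-assoc (H.encodeLTL ψ₁) (H.encodeLTL ψ₂) u =
    weaken (binary (literal (2 + (2 * length untilText + 1)))) (main-step (emit-run untilText) (main-ltl ψ₁ (main-ltl ψ₂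
      (subst (λ t → Run 0 main ⟨ _ , t , 0 ⟩ _ tt _)
        (trans (▷-++ untilText {A.encodeFormula ⟪ ψ₁ ⟫ ++ A.encodeFormula ⟪ ψ₂ ⟫}) (▷-++ (A.encodeFormula ⟪ ψ₁ ⟫))) r))))
    where
    binary : ∀ {k} → k ≤ D → k + (D * length (H.encodeLTL ψ₁) + (D * length (H.encodeLTL ψ₂) + m)) ≤
             D * suc (length (H.encodeLTL ψ₁) + length (H.encodeLTL ψ₂)) + m
    binary {k} k≤ = ℕₚ.≤-trans (ℕₚ.≤-reflexive (cong (k +_) (cost D (length (H.encodeLTL ψ₁)) (length (H.encodeLTL ψ₂)) m))) (budget _ k≤)
      where
      cost : ∀ D a b m → D * a + (D * b + m) ≡ D * (a + b) + m
      cost = solve-∀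

  Formula-run : H.Formula → Set
  Formula-run φ = ∀ {u t m σ} → Run 0 main ⟨ u , A.encodeFormula (translate φ) ▷ t , 0 ⟩ m tt σ →
                  Run 0 main ⟨ H.encodeFormula φ ++ u , t , 0 ⟩ (D * length (H.encodeFormula φ) + m) tt σ

  main-∀∃ˢ : ∀ (q : H.Sym) c Y φ {u t m σ} → symbol q ≡ (emit (c ∷ []) >> setVariable) → Formula-run φ →
             Run 0 main ⟨ u , (c ∷ A.encodeIndex ⌜ Y ⌝ ++ A.encodeFormula (translate φ)) ▷ t , 0 ⟩ m tt σ →
             Run 0 main ⟨ (q ∷ H.encodeSetVar Y ++ H.encodeFormula φ) ++ u , t , 0 ⟩
               (D * length (q ∷ H.encodeSetVar Y ++ H.encodeFormula φ) + m) tt σ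
  main-∀∃ˢ q c Y φ {u} {t} {m} eq ih r
    rewrite Listₚ.length-++ (H.encodeSetVar Y) {H.encodeFormula φ} | Listₚ.++-assoc (H.encodeSetVar Y) (H.encodeFormula φ) u =
    weaken (quantifier-cost 5 0 _ (length (H.encodeSetVar Y)) {m} (toWitness {a? = 5 ℕₚ.≤? 200} tt))
      (main-step (same-program eq (emit-run (c ∷ []) ⨾ setVariable-run Y))
        (ih (subst (λ t → Run 0 main ⟨ _ , t , 0 ⟩ m tt _) (▷-++ (A.encodeIndex ⌜ Y ⌝)) r)))

  main-∀∃ᵗ : ∀ (q : H.Sym) c w π Y φ {u t m σ} → length w ≤ 5 →
             symbol q ≡ (emit (c ∷ []) >> (saveIndex >> (emit w >> (replayIndex >> setVariable)))) → Formula-run φ →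
             Run 0 main ⟨ u , (A.encodeFormula (translate φ)) ▷ A.encodeIndex ⌜ Y ⌝ ▷ A.encodeIndex π ▷ w ▷ A.encodeIndex π ▷ out c ∷ t , 0 ⟩ m tt σ →
             Run 0 main ⟨ (q ∷ H.encodeIndex π ++ H.encodeSetVar Y ++ H.encodeFormula φ) ++ u , t , 0 ⟩
               (D * length (q ∷ H.encodeIndex π ++ H.encodeSetVar Y ++ H.encodeFormula φ) + m) tt σ
  main-∀∃ᵗ q c w π Y φ {u} {t} {m} w≤ eq ih r
    rewrite Listₚ.length-++ (H.encodeIndex π) {H.encodeSetVar Y ++ H.encodeFormula φ} | index-length π
          | Listₚ.length-++ (H.encodeSetVar Y) {H.encodeFormula φ}
          | Listₚ.++-assoc (H.encodeIndex π) (H.encodeSetVar Y ++ H.encodeFormula φ) u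
          | Listₚ.++-assoc (H.encodeSetVar Y) (H.encodeFormula φ) u =
    weaken (ℕₚ.≤-trans (ℕₚ.≤-reflexive (arrange (length w) (suc π) (length (H.encodeSetVar Y)) _))
             (quantifier-cost (6 + 2 * length w) (suc π) _ (length (H.encodeSetVar Y)) {m}
               (ℕₚ.≤-trans (ℕₚ.+-monoʳ-≤ 6 (ℕₚ.*-monoʳ-≤ 2 w≤)) (toWitness {a? = 16 ℕₚ.≤? 200} tt))))
      (main-step (same-program eq
          (emit-run (c ∷ []) ⨾ indexSaved-run π {H.encodeSetVar Y ++ H.encodeFormula φ ++ u} {out c ∷ t}
            ⨾ emit-run w ⨾ replayIndex-run π ⨾ setVariable-run Y))
        (ih r))
    where
    arrange : ∀ w j k m → 2 + (3 + (6 * j + (2 * w + 1 + (4 * j + 14 * k)))) + m ≡ 6 + 2 * w + 10 * j + 14 * k + m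
    arrange = solve-∀

  main-formula : ∀ φ → Formula-run φ
  main-formula (H.∃ˢ Y φ) r = main-∀∃ˢ H.∃ˢ (A.ex A.family) Y φ refl (main-formula φ) r
  main-formula (H.∀ˢ Y φ) r = main-∀∃ˢ H.∀ˢ (A.all A.family) Y φ refl (main-formula φ) r
  main-formula (H.∃ᵗ π Y φ) r =
    main-∀∃ᵗ H.∃ᵗ (A.ex A.set) (A.and ∷ A.inᶠ ∷ []) π Y φ (toWitness {a? = 2 ℕₚ.≤? 5} tt) refl (main-formula φ)
      (subst (λ t → Run 0 main ⟨ _ , t , 0 ⟩ _ tt _)
        (trans (▷-++ (A.encodeIndex π)) (trans (▷-++ (A.encodeIndex π ++ A.encodeIndex ⌜ Y ⌝))
          (cong (A.encodeFormula (translate φ) ▷_) (▷-++ (A.encodeIndex π))))) r)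
  main-formula (H.∀ᵗ π Y φ) r =
    main-∀∃ᵗ H.∀ᵗ (A.all A.set) (A.or ∷ A.not ∷ A.inᶠ ∷ []) π Y φ (toWitness {a? = 3 ℕₚ.≤? 5} tt) refl (main-formula φ)
      (subst (λ t → Run 0 main ⟨ _ , t , 0 ⟩ _ tt _)
        (trans (▷-++ (A.encodeIndex π)) (trans (▷-++ (A.encodeIndex π ++ A.encodeIndex ⌜ Y ⌝))
          (cong (A.encodeFormula (translate φ) ▷_) (▷-++ (A.encodeIndex π))))) r)
  main-formula (H.ltl ψ) r = main-ltl ψ r

  unload-run : ∀ t {o} → Run 0 unload ([] ∷ o ∷ t ∷ [] ∷ []) (4 * length t + 2) tt ([] ∷ (t ʳ++ o) ∷ [] ∷ [] ∷ [])
  unload-run []      = exit (pop-nothing refl ⨾ skip-run)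
  unload-run (c ∷ t) = weaken (ℕₚ.≤-reflexive (cost (length t))) (again (pop-just refl ⨾ push-run ⨾ skip-run) (unload-run t))
    where
    cost : ∀ l → 4 + (4 * l + 2) ≡ 4 * suc l + 2
    cost = solve-∀

  setup : List A.Sym → ℕ
  setup w = 2 * length w + 1

  factor : ℕ → ℕ → ℕ
  factor s d = 5 * (s + 2 + d) + 6

  total-cost : ∀ s d l → let t = s + (d * l + 2) in t + (4 * (t * 1 + (l + 0)) + 2) ≤ factor s d * suc l ^ 1
  -- The second argument of `m≤m+n` is the exact difference of the two polynomials, which leaves an
  -- identity for the ring solver.
  total-cost s d l = ℕₚ.≤-trans (ℕₚ.m≤m+n (s + (d * l + 2) + (4 * ((s + (d * l + 2)) * 1 + (l + 0)) + 2)) (5 * (s * l + 2 * l + d) + 2 * l + 4))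
    (ℕₚ.≤-reflexive (arrange s d l))
    where
    arrange : ∀ s d l → s + (d * l + 2) + (4 * ((s + (d * l + 2)) * 1 + (l + 0)) + 2) + (5 * (s * l + 2 * l + d) + 2 * l + 4)
              ≡ (5 * (s + 2 + d) + 6) * (suc l * 1)
    arrange = solve-∀

  module Reduction (before : List A.Sym) (φ : H.Formula) where
    private
      ℓ t : ℕ
      ℓ = length (H.encodeFormula φ)
      t = setup before + (D * ℓ + 2)

      w : List A.Sym
      w = before ++ A.encodeFormula (translate φ)

    front-run : Run 0 (front before) ⟨ H.encodeFormula φ , [] , 0 ⟩ t tt ⟨ [] , w ▷ [] , 0 ⟩
    front-run = emit-run before ⨾
      subst (λ i → Run 0 main ⟨ i , before ▷ [] , 0 ⟩ (D * ℓ + 2) tt ⟨ [] , w ▷ [] , 0 ⟩) (Listₚ.++-identityʳ (H.encodeFormula φ))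
        (main-formula φ (subst (λ l → Run 0 main ⟨ [] , l , 0 ⟩ 2 tt ⟨ [] , w ▷ [] , 0 ⟩) (▷-++ before) (exit (pop-nothing refl ⨾ skip-run))))

    -- The log was empty at the start, so its length is bounded by the time spent on writing plus
    -- the volume of the input.
    log-length : length (w ▷ []) ≤ t * 1 + (ℓ + 0)
    log-length = ℕₚ.≤-trans (ℕₚ.≤-trans (ℕₚ.m≤m+n _ 0) (Run.grows front-run))
      (ℕₚ.≤-reflexive (cong (λ l → t * 1 + (l + 0)) (Listₚ.length-map inp (H.encodeFormula φ))))

    program-run : ∀ {v} → v ≡ w → ∃[ m ] ∃[ σ ] Run 0 (program before) ⟨ H.encodeFormula φ , [] , 0 ⟩ m tt σ ×
                    lookup σ Out ≡ map out v × m ≤ factor (setup before) D * suc ℓ ^ 1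
    program-run refl = t + (4 * (t * 1 + (ℓ + 0)) + 2) , _ ,
      (front-run ⨾ weaken (ℕₚ.+-monoˡ-≤ 2 (ℕₚ.*-monoʳ-≤ 4 log-length)) (unload-run (w ▷ []))) ,
      trans (▷-ʳ++ w) (Listₚ.++-identityʳ (map out w)) , total-cost (setup before) D ℓ

  wrap-text : ∀ φ → A.encodeFormula (wrap φ) ≡ (outerText ++ sizeText ++ innerText) ++ A.encodeFormula φ
  wrap-text φ = sym (trans (Listₚ.++-assoc outerText (sizeText ++ innerText) (A.encodeFormula φ))
    (cong (outerText ++_) (Listₚ.++-assoc sizeText innerText (A.encodeFormula φ))))

  open Compilation {H.Sym} {A.Sym} {⊤} {2} using (polyTime)

  upper-polyTime : PolyTime {A = H.Sentence} (H.encodeFormula ∘ proj₁) (A.encodeFormula ∘ proj₁) sentence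
  upper-polyTime = polyTime (program before) (H.encodeFormula ∘ proj₁) (A.encodeFormula ∘ proj₁) sentence (factor (setup before) D) 1
    λ (φ , _) → Reduction.program-run before φ (wrap-text (translate φ))
    where
    before : List A.Sym
    before = outerText ++ sizeText ++ innerText

module Upper (em : ExcludedMiddle (lsuc 0ℓ)) (ext : Extensionality (lsuc 0ℓ) (lsuc 0ℓ)) (n : ℕ) where

  upper-bound : FiniteStateSatisfiability (suc n) ≤ₚ ThirdOrderArithmeticTruth
  upper-bound = sentence , upper-polyTime , λ φ → ⇔-sym (wrap-correct (proj₁ φ))
    where
    open UpperSyntax n using (sentence)
    open UpperProgram n using (upper-polyTime)
    open UpperSentence em ext n using (wrap-correct)

module _ {ℓ : Level} {V : Set} {D : Set ℓ} {_≟_ : DecidableEquality V} where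

  update-hit : ∀ {f : V → D} {v d w} → v ≡ w → update _≟_ f v d w ≡ d
  update-hit {v = v} {w = w} eq with v ≟ w
  ... | yes _ = refl
  ... | no ≠  = ⊥-elim (≠ eq)

  update-miss : ∀ {f : V → D} {v d w} → v ≢ w → update _≟_ f v d w ≡ f w
  update-miss {v = v} {w = w} ≠ with v ≟ w
  ... | yes eq = ⊥-elim (≠ eq)
  ... | no _   = refl

-- Trees of trace quantifiers and their prenex form

module Prenexing (n : ℕ) where

  module H = Hyper²LTL (suc n)
  open H using (Assignment; Trace; TraceSet; LTL; Formula; SetVar; var; _⊨ˡ_; _⊨_; _[_↦ᵗ_]; _[_↦ˢ_])
  open Assignment

  -- any i quantifies an arbitrary trace i as an element of an arbitrary set i, and inside i y an element i of the set y.
  data Block : Set where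
    any    : ℕ → Block
    inside : ℕ → ℕ → Block

  -- Formulas with quantifiers below connectives, which the syntax of Hyper²LTL excludes.
  data Tree : Set where
    ltl       : LTL → Tree
    neg       : Tree → Tree
    conj disj : Tree → Tree → Tree
    all ex    : Block → Tree → Tree

  -- An `any` block ranges over all traces because the set can be chosen freely; this is how X_a is
  -- avoided. It also leaves behind a set known to be nonempty, which later `inside` blocks may
  -- refer to.
  Dom : Block → Assignment → Set₁
  Dom (any i)    Π = Σ[ S ∈ TraceSet ] Σ[ t ∈ Trace ] S t
  Dom (inside i y) Π = Σ[ S ∈ TraceSet ] setOf Π (var y) ≡ just S × (Σ[ t ∈ Trace ] S t)

  put : ∀ q Π → Dom q Π → Assignment
  put (any i)    Π (S , t , _)     = Π [ var i ↦ˢ S ] [ i ↦ᵗ t ]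
  put (inside i y) Π (S , _ , t , _) = Π [ i ↦ᵗ t ]

  ⟦_⟧ : Tree → Assignment → Set₁
  ⟦ ltl ψ ⟧    Π = Lift (lsuc 0ℓ) (Π ⊨ˡ ψ)
  ⟦ neg A ⟧    Π = ¬ ⟦ A ⟧ Π
  ⟦ conj A B ⟧ Π = ⟦ A ⟧ Π × ⟦ B ⟧ Π
  ⟦ disj A B ⟧ Π = ⟦ A ⟧ Π ⊎ ⟦ B ⟧ Π
  ⟦ all q A ⟧  Π = (d : Dom q Π) → ⟦ A ⟧ (put q Π d)
  ⟦ ex q A ⟧   Π = Σ[ d ∈ Dom q Π ] ⟦ A ⟧ (put q Π d)

  infixr 6 _andL_

  _andL_ : LTL → LTL → LTL
  ψ andL χ = H.not (H._or_ (H.not ψ) (H.not χ))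

  matrix : Tree → LTL
  matrix (ltl ψ)    = ψ
  matrix (neg A)    = H.not (matrix A)
  matrix (conj A B) = matrix A andL matrix B
  matrix (disj A B) = H._or_ (matrix A) (matrix B)
  matrix (all _ A)  = matrix A
  matrix (ex _ A)   = matrix A

  closeBlock : Bool → Block → Formula → Formula
  closeBlock true  (any i)    φ = H.∃ˢ (var i) (H.∃ᵗ i (var i) φ)
  closeBlock true  (inside i y) φ = H.∃ᵗ i (var y) φ
  closeBlock false (any i)    φ = H.∀ˢ (var i) (H.∀ᵗ i (var i) φ)
  closeBlock false (inside i y) φ = H.∀ᵗ i (var y) φ

  -- The quantifiers of A in the order of their occurrence; the polarity b is true when A occurs positively.
  close : Bool → Tree → Formula → Formula
  close b (ltl _)    φ = φ
  close b (neg A)    φ = close (¬ᵇ b) A φ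
  close b (conj A B) φ = close b A (close b B φ)
  close b (disj A B) φ = close b A (close b B φ)
  close b (all q A)  φ = closeBlock (¬ᵇ b) q (close b A φ)
  close b (ex q A)   φ = closeBlock b q (close b A φ)

  Quant : Bool → (D : Set₁) → (D → Set₁) → Set₁
  Quant true  D F = Σ D F
  Quant false D F = ∀ d → F d

  Quant-cong : ∀ b {D F G} → (∀ d → F d ⇔ G d) → Quant b D F ⇔ Quant b D G
  Quant-cong true  = Σ-cong
  Quant-cong false = Π-cong

  -- close on the level of predicates.
  wp : Bool → Tree → (Assignment → Set₁) → Assignment → Set₁
  wp b (ltl _)    K Π = K Π
  wp b (neg A)    K   = wp (¬ᵇ b) A K
  wp b (conj A B) K   = wp b A (wp b B K)
  wp b (disj A B) K   = wp b A (wp b B K)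
  wp b (all q A)  K Π = Quant (¬ᵇ b) (Dom q Π) λ d → wp b A K (put q Π d)
  wp b (ex q A)   K Π = Quant b (Dom q Π) λ d → wp b A K (put q Π d)

  record Agree (P N : ℕ → Set) (Π Π′ : Assignment) : Set₁ where
    constructor agree
    field
      traces : ∀ v → P v → traceOf Π v ≡ traceOf Π′ v
      sets   : ∀ y → N y → setOf Π (var y) ≡ setOf Π′ (var y)

  agree-sym : ∀ {P N Π Π′} → Agree P N Π Π′ → Agree P N Π′ Π
  agree-sym (agree a a′) = agree (λ v p → sym (a v p)) (λ y p → sym (a′ y p))

  agree-trans : ∀ {P N Π Π′ Π″} → Agree P N Π Π′ → Agree P N Π′ Π″ → Agree P N Π Π″
  agree-trans (agree a a′) (agree b b′) = agree (λ v p → trans (a v p) (b v p)) (λ y p → trans (a′ y p) (b′ y p))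

  agree-⊆ : ∀ {P N P′ N′ : ℕ → Set} {Π Π′} → (∀ v → P′ v → P v) → (∀ v → N′ v → N v) → Agree P N Π Π′ → Agree P′ N′ Π Π′
  agree-⊆ P⊆ N⊆ (agree a a′) = agree (λ v → a v ∘ P⊆ v) (λ y → a′ y ∘ N⊆ y)

  target : Block → ℕ
  target (any i)    = i
  target (inside i _) = i

  infixl 6 _∪_

  _∪_ : (ℕ → Set) → ℕ → ℕ → Set
  (P ∪ i) v = v ≡ i ⊎ P v

  RefersTo : (ℕ → Set) → Block → Set
  RefersTo N (any _)    = ⊤
  RefersTo N (inside _ y) = N y

  grow : (ℕ → Set) → Block → ℕ → Set
  grow N (any i)    = N ∪ i
  grow N (inside _ _) = N

  -- The bound variables of A lie in the interval [lo, hi), those of sibling subtrees in disjoint intervals; its free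
  -- variables are in P, and the sets it quantifies over are in N (the sets known to be nonempty) or bound.
  Scoped : (P N : ℕ → Set) (lo hi : ℕ) → Tree → Set
  Scoped P N lo hi (ltl ψ)    = ∀ v → H.OccursLTL v ψ → P v
  Scoped P N lo hi (neg A)    = Scoped P N lo hi A
  Scoped P N lo hi (conj A B) = ∃[ mid ] lo ≤ mid × mid ≤ hi × Scoped P N mid hi A × Scoped P N lo mid B
  Scoped P N lo hi (disj A B) = ∃[ mid ] lo ≤ mid × mid ≤ hi × Scoped P N mid hi A × Scoped P N lo mid B
  Scoped P N lo hi (all q A)  = (lo ≤ target q × target q < hi) × RefersTo N q × Scoped (P ∪ target q) (grow N q) lo (target q) A
  Scoped P N lo hi (ex q A)   = (lo ≤ target q × target q < hi) × RefersTo N q × Scoped (P ∪ target q) (grow N q) lo (target q) A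

  Bound : ℕ → Tree → Set
  Bound v (ltl _)    = ⊥
  Bound v (neg A)    = Bound v A
  Bound v (conj A B) = Bound v A ⊎ Bound v B
  Bound v (disj A B) = Bound v A ⊎ Bound v B
  Bound v (all q A)  = v ≡ target q ⊎ Bound v A
  Bound v (ex q A)   = v ≡ target q ⊎ Bound v A

  Outside : ℕ → ℕ → ℕ → Set
  Outside lo hi v = v < lo ⊎ hi ≤ v

  bound-interval : ∀ {P N lo hi v} A → Scoped P N lo hi A → Bound v A → lo ≤ v × v < hi
  bound-interval (neg A) s b = bound-interval A s b
  bound-interval (conj A B) (_ , l , h , s , _) (inj₁ b) = map₁ (ℕₚ.≤-trans l) (bound-interval A s b)
  bound-interval (conj A B) (_ , l , h , _ , s) (inj₂ b) = map₂ (λ lt → ℕₚ.≤-trans lt h) (bound-interval B s b)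
  bound-interval (disj A B) (_ , l , h , s , _) (inj₁ b) = map₁ (ℕₚ.≤-trans l) (bound-interval A s b)
  bound-interval (disj A B) (_ , l , h , _ , s) (inj₂ b) = map₂ (λ lt → ℕₚ.≤-trans lt h) (bound-interval B s b)
  bound-interval (all q A) (i , _ , _) (inj₁ refl) = i
  bound-interval (all q A) ((_ , h) , _ , s) (inj₂ b) = map₂ (λ lt → ℕₚ.<-trans lt h) (bound-interval A s b)
  bound-interval (ex q A) (i , _ , _) (inj₁ refl) = i
  bound-interval (ex q A) ((_ , h) , _ , s) (inj₂ b) = map₂ (λ lt → ℕₚ.<-trans lt h) (bound-interval A s b)

  matrix-occurs : ∀ {P N lo hi v} A → Scoped P N lo hi A → H.OccursLTL v (matrix A) → P v ⊎ Bound v A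
  matrix-occurs (ltl ψ) s o = inj₁ (s _ o)
  matrix-occurs (neg A) s o = matrix-occurs A s o
  matrix-occurs (conj A B) (_ , _ , _ , s , _) (inj₁ o) = Sum.map₂ inj₁ (matrix-occurs A s o)
  matrix-occurs (conj A B) (_ , _ , _ , _ , s) (inj₂ o) = Sum.map₂ inj₂ (matrix-occurs B s o)
  matrix-occurs (disj A B) (_ , _ , _ , s , _) (inj₁ o) = Sum.map₂ inj₁ (matrix-occurs A s o)
  matrix-occurs (disj A B) (_ , _ , _ , _ , s) (inj₂ o) = Sum.map₂ inj₂ (matrix-occurs B s o)
  matrix-occurs (all q A) (_ , _ , s) o with matrix-occurs A s o
  ... | inj₁ (inj₁ eq) = inj₂ (inj₁ eq)
  ... | inj₁ (inj₂ p)  = inj₁ p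
  ... | inj₂ b         = inj₂ (inj₂ b)
  matrix-occurs (ex q A) (_ , _ , s) o with matrix-occurs A s o
  ... | inj₁ (inj₁ eq) = inj₂ (inj₁ eq)
  ... | inj₁ (inj₂ p)  = inj₁ p
  ... | inj₂ b         = inj₂ (inj₂ b)

  sat-agree : ∀ ψ {V W : ℕ → Maybe Trace} {i} → (∀ v → H.OccursLTL v ψ → V v ≡ W v) → sat V i ψ ⇔ sat W i ψ
  sat-agree (H.⟨ p ⟩ π) {i = i} a = ≡⇒⇔ (cong (MAny.Any (λ t → p Subset.∈ t i)) (a π refl))
  sat-agree (H.not ψ) a = ¬-cong (sat-agree ψ a)
  sat-agree (H._or_ ψ χ) a = ⊎-cong (sat-agree ψ (λ v → a v ∘ inj₁)) (sat-agree χ (λ v → a v ∘ inj₂))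
  sat-agree (H._U_ ψ χ) a = Σ-cong λ j → ×-cong (sat-agree χ (λ v → a v ∘ inj₂))
    (Π-cong λ j′ → Π-cong λ _ → sat-agree ψ (λ v → a v ∘ inj₁))
  sat-agree (H.X ψ) a = sat-agree ψ a

  ltl-agree : ∀ {P N Π Π′} ψ → (∀ v → H.OccursLTL v ψ → P v) → Agree P N Π Π′ → (Π ⊨ˡ ψ) ⇔ (Π′ ⊨ˡ ψ)
  ltl-agree {Π = Π} {Π′} ψ o (agree a _) = ⊨ˡ⇔sat Π ψ ⟫ sat-agree ψ (λ v → a v ∘ o v) ⟫ ⇔-sym (⊨ˡ⇔sat Π′ ψ)

  var-≠ : ∀ {i v} → i ≢ v → var i ≢ var v
  var-≠ ≠ refl = ≠ refl

  put-agree : ∀ q {Π} d {P N} → (∀ v → P v → target q ≢ v) → (∀ v → N v → target q ≢ v) → Agree P N Π (put q Π d)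
  put-agree (any i) d ≠ ≠′ =
    agree (λ v p → sym (update-miss {_≟_ = ℕₚ._≟_} (≠ v p))) (λ y p → sym (update-miss {_≟_ = H._≟ˢ_} (var-≠ (≠′ y p))))
  put-agree (inside i y) d ≠ ≠′ = agree (λ v p → sym (update-miss {_≟_ = ℕₚ._≟_} (≠ v p))) λ _ _ → refl

  update-agree : ∀ {ℓ} {V : Set} {D : Set ℓ} (_≟_ : DecidableEquality V) {f g : V → D} {i d w} →
                 (w ≡ i ⊎ f w ≡ g w) → update _≟_ f i d w ≡ update _≟_ g i d w
  update-agree _≟_ {i = i} {w = w} h with i ≟ w
  ... | yes _ = refl
  update-agree _≟_ (inj₁ eq) | no ≠ = ⊥-elim (≠ (sym eq))
  update-agree _≟_ (inj₂ eq) | no ≠ = eq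

  transport : ∀ q {P N : ℕ → Set} {Π Π′} → RefersTo N q → Agree P N Π Π′ → (d : Dom q Π) →
              Σ[ d′ ∈ Dom q Π′ ] Agree (P ∪ target q) (grow N q) (put q Π d) (put q Π′ d′)
  transport (any i) r (agree a a′) (S , t , x) = (S , t , x) ,
    agree (λ v p → update-agree ℕₚ._≟_ (Sum.map₂ (a v) p))
    (λ y p → update-agree H._≟ˢ_ (Sum.map (cong var) (a′ y) p))
  transport (inside i y) r (agree a a′) (S , eq , t , x) = (S , trans (sym (a′ y r)) eq , t , x) ,
    agree (λ v p → update-agree ℕₚ._≟_ (Sum.map₂ (a v) p)) a′

  ⟦⟧-agree : ∀ {P N lo hi Π Π′} A → Scoped P N lo hi A → Agree P N Π Π′ → ⟦ A ⟧ Π ⇔ ⟦ A ⟧ Π′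
  ⟦⟧-agree (ltl ψ) s a = Lift-⇔ ⟫ ltl-agree ψ s a ⟫ ⇔-sym Lift-⇔
  ⟦⟧-agree (neg A) s a = ¬-cong (⟦⟧-agree A s a)
  ⟦⟧-agree (conj A B) (_ , _ , _ , s , s′) a = ×-cong (⟦⟧-agree A s a) (⟦⟧-agree B s′ a)
  ⟦⟧-agree (disj A B) (_ , _ , _ , s , s′) a = ⊎-cong (⟦⟧-agree A s a) (⟦⟧-agree B s′ a)
  ⟦⟧-agree (all q A) (_ , r , s) a = mk⇔
    (λ f d′ → let d , a′ = transport q r (agree-sym a) d′ in to (⟦⟧-agree A s (agree-sym a′)) (f d))
    (λ f d → let d′ , a′ = transport q r a d in from (⟦⟧-agree A s a′) (f d′))
  ⟦⟧-agree (ex q A) (_ , r , s) a = mk⇔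
    (λ (d , x) → let d′ , a′ = transport q r a d in d′ , to (⟦⟧-agree A s a′) x)
    (λ (d′ , x) → let d , a′ = transport q r (agree-sym a) d′ in d , from (⟦⟧-agree A s (agree-sym a′)) x)

  -- The assignments reachable by quantifying names from [lo, hi): nothing outside the interval
  -- changes.
  Off : ℕ → ℕ → Assignment → Assignment → Set₁
  Off lo hi = Agree (Outside lo hi) (Outside lo hi)

  off-⊆ : ∀ {lo hi lo′ hi′ Π Π′} → lo ≤ lo′ → hi′ ≤ hi → Off lo′ hi′ Π Π′ → Off lo hi Π Π′
  off-⊆ {lo} {hi} {lo′} {hi′} l h = agree-⊆ ⊆ ⊆
    where
    ⊆ : ∀ v → Outside lo hi v → Outside lo′ hi′ v
    ⊆ v = Sum.map (λ lt → ℕₚ.≤-trans lt l) (ℕₚ.≤-trans h)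

  off-put : ∀ q {lo hi Π} d → lo ≤ target q → target q < hi → Off lo hi Π (put q Π d)
  off-put q {lo} {hi} d l h = put-agree q d ≠ ≠
    where
    ≠ : ∀ v → Outside lo hi v → target q ≢ v
    ≠ v (inj₁ lt) refl = ℕₚ.<⇒≱ lt l
    ≠ v (inj₂ ge) refl = ℕₚ.<⇒≱ h ge

  -- Continuations need to be compared only where the quantifiers of A can lead, that is, at
  -- assignments that differ from Π inside the interval of A.
  wp-cong : ∀ b {P N lo hi Π} A → Scoped P N lo hi A → {K K′ : Assignment → Set₁} →
            (∀ Π′ → Off lo hi Π Π′ → K Π′ ⇔ K′ Π′) → wp b A K Π ⇔ wp b A K′ Π
  wp-cong b (ltl _) s h = h _ (agree (λ _ _ → refl) (λ _ _ → refl))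
  wp-cong b (neg A) s h = wp-cong (¬ᵇ b) A s h
  wp-cong b (conj A B) (_ , l , h , s , s′) e = wp-cong b A s λ Π′ o → wp-cong b B s′ λ Π″ o′ →
    e Π″ (agree-trans (off-⊆ l ℕₚ.≤-refl o) (off-⊆ ℕₚ.≤-refl h o′))
  wp-cong b (disj A B) (_ , l , h , s , s′) e = wp-cong b A s λ Π′ o → wp-cong b B s′ λ Π″ o′ →
    e Π″ (agree-trans (off-⊆ l ℕₚ.≤-refl o) (off-⊆ ℕₚ.≤-refl h o′))
  wp-cong b (all q A) ((l , h) , _ , s) e = Quant-cong (¬ᵇ b) λ d → wp-cong b A s λ Π′ o →
    e Π′ (agree-trans (off-put q d l h) (off-⊆ ℕₚ.≤-refl (ℕₚ.<⇒≤ h) o))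
  wp-cong b (ex q A) ((l , h) , _ , s) e = Quant-cong b λ d → wp-cong b A s λ Π′ o →
    e Π′ (agree-trans (off-put q d l h) (off-⊆ ℕₚ.≤-refl (ℕₚ.<⇒≤ h) o))

  wp-cong′ : ∀ b {Π} A {K K′ : Assignment → Set₁} → (∀ Π′ → K Π′ ⇔ K′ Π′) → wp b A K Π ⇔ wp b A K′ Π
  wp-cong′ b (ltl _)    e = e _
  wp-cong′ b (neg A)    e = wp-cong′ (¬ᵇ b) A e
  wp-cong′ b (conj A B) e = wp-cong′ b A λ _ → wp-cong′ b B e
  wp-cong′ b (disj A B) e = wp-cong′ b A λ _ → wp-cong′ b B e
  wp-cong′ b (all q A)  e = Quant-cong (¬ᵇ b) λ _ → wp-cong′ b A e
  wp-cong′ b (ex q A)   e = Quant-cong b λ _ → wp-cong′ b A e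

  closeBlock-sem : ∀ b q {Π φ} → (Π ⊨ closeBlock b q φ) ⇔ Quant b (Dom q Π) (λ d → put q Π d ⊨ φ)
  closeBlock-sem true (any i) {Π} =
    Σ-cong (λ S → at (update-hit {_≟_ = H._≟ˢ_} {f = setOf Π} {v = var i} refl)) ⟫
    mk⇔ (λ (S , t , x , m) → (S , t , x) , m) (λ ((S , t , x) , m) → S , t , x , m)
    where
    at : ∀ {x S} {F : TraceSet → Set₁} → x ≡ just S → MAny.Any F x ⇔ F S
    at refl = mk⇔ (λ { (MAny.just f) → f }) MAny.just
  closeBlock-sem false (any i) {Π} =
    Π-cong (λ S → at (update-hit {_≟_ = H._≟ˢ_} {f = setOf Π} {v = var i} refl)) ⟫
    mk⇔ (λ f (S , t , x) → f S t x) (λ f S t x → f (S , t , x))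
    where
    at : ∀ {x S} {F : TraceSet → Set₁} → x ≡ just S → MAll.All F x ⇔ F S
    at refl = mk⇔ (λ { (MAll.just f) → f }) MAll.just
  closeBlock-sem true (inside i y) {Π} with setOf Π (var y)
  ... | nothing = mk⇔ (λ ()) (λ ())
  ... | just S  = mk⇔ (λ { (MAny.just (t , x , m)) → (S , refl , t , x) , m }) (λ { ((_ , refl , t , x) , m) → MAny.just (t , x , m) })
  closeBlock-sem false (inside i y) {Π} with setOf Π (var y)
  ... | nothing = mk⇔ (λ _ ()) (λ _ → MAll.nothing)
  ... | just S  = mk⇔ (λ { (MAll.just f) (_ , refl , t , x) → f t x }) (λ f → MAll.just λ t x → f (S , refl , t , x))

  close-sem : ∀ b A {Π φ} → (Π ⊨ close b A φ) ⇔ wp b A (_⊨ φ) Π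
  close-sem b (ltl _)    = ⇔-refl
  close-sem b (neg A)    = close-sem (¬ᵇ b) A
  close-sem b (conj A B) = close-sem b A ⟫ wp-cong′ b A (λ _ → close-sem b B)
  close-sem b (disj A B) = close-sem b A ⟫ wp-cong′ b A (λ _ → close-sem b B)
  close-sem b (all q A)  = closeBlock-sem (¬ᵇ b) q ⟫ Quant-cong (¬ᵇ b) (λ _ → close-sem b A)
  close-sem b (ex q A)   = closeBlock-sem b q ⟫ Quant-cong b (λ _ → close-sem b A)

  -- A formula with a hole for the truth value of the subtree whose quantifiers are being pulled
  -- out. The polarity says whether the context is monotone or antitone in the hole.
  Context : Set₂
  Context = Set₁ → Assignment → Set₁

  Monotone : Bool → Context → Set₂
  Monotone true  G = ∀ {Π X Y} → (X → Y) → G X Π → G Y Π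
  Monotone false G = ∀ {Π X Y} → (Y → X) → G X Π → G Y Π

  context-cong : ∀ b {G} → Monotone b G → ∀ {Π X Y} → X ⇔ Y → G X Π ⇔ G Y Π
  context-cong true  m e = mk⇔ (m (to e)) (m (from e))
  context-cong false m e = mk⇔ (m (from e)) (m (to e))

  Stable : ℕ → ℕ → Context → Set₂
  Stable lo hi G = ∀ {Π Π′ X} → Off lo hi Π Π′ → G X Π → G X Π′

  stable⇔ : ∀ {lo hi G} → Stable lo hi G → ∀ {Π Π′ X} → Off lo hi Π Π′ → G X Π ⇔ G X Π′
  stable⇔ st o = mk⇔ (st o) (st (agree-sym o))

  -- Quantifiers over an empty set do not commute with connectives, so prenexing is possible only if
  -- the sets quantified over are nonempty.
  Inhabited : (ℕ → Set) → Assignment → Set₁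
  Inhabited N Π = ∀ y → N y → Σ[ S ∈ TraceSet ] setOf Π (var y) ≡ just S × (Σ[ t ∈ Trace ] S t)

  inhabited-agree : ∀ {P N Π Π′} → Agree P N Π Π′ → Inhabited N Π → Inhabited N Π′
  inhabited-agree (agree _ a) h y ny = let S , eq , x = h y ny in S , trans (sym (a y ny)) eq , x

  module Classical (em : ExcludedMiddle (lsuc 0ℓ)) where

    andL-sem : ∀ {Π ψ χ} → (Π ⊨ˡ ψ andL χ) ⇔ (Π ⊨ˡ ψ × Π ⊨ˡ χ)
    andL-sem {Π} {ψ} {χ} = mk⇔ (λ ¬¬ → stable (¬¬ ∘ inj₁) , stable (¬¬ ∘ inj₂)) (λ (x , y) → [ _$ x , _$ y ]′)
      where
      stable : ∀ {A : Set} → ¬ ¬ A → A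
      stable {A} ¬¬a with em {Lift (lsuc 0ℓ) A}
      ... | yes (lift a) = a
      ... | no ¬a        = ⊥-elim (¬¬a (¬a ∘ lift))

    -- Decide whether some d satisfies F. If so, that d makes `F d` equivalent to `Σ D F`; if not,
    -- both are false for every d, and d₀ serves where a value is demanded. In an antitone context
    -- the quantifier turns universal.
    ex-out : ∀ b {G Π} {D : Set₁} {F : D → Set₁} → Monotone b G → D → Quant b D (λ d → G (F d) Π) ⇔ G (Σ D F) Π
    ex-out true {G} {Π} {D} {F} m d₀ = mk⇔ (λ (d , g) → m (d ,_) g) (λ g → decide g em)
      where
      decide : G (Σ D F) Π → Dec (Σ D F) → Σ[ d ∈ D ] G (F d) Π
      decide g (yes (d , x)) = d , m (λ _ → x) g
      decide g (no ¬x)       = d₀ , m (λ x → ⊥-elim (¬x x)) g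
    ex-out false {G} {Π} {D} {F} m d₀ = mk⇔ (λ f → decide f em) (λ g d → m (d ,_) g)
      where
      decide : (∀ d → G (F d) Π) → Dec (Σ D F) → G (Σ D F) Π
      decide f (yes (d , x)) = m (λ _ → x) (f d)
      decide f (no ¬x)       = m (λ x → ⊥-elim (¬x x)) (f d₀)

    -- Dual to `ex-out`: the case distinction is whether all d satisfy F, and otherwise a
    -- counterexample takes the role of the witness.
    all-out : ∀ b {G Π} {D : Set₁} {F : D → Set₁} → Monotone b G → D → Quant (¬ᵇ b) D (λ d → G (F d) Π) ⇔ G (∀ d → F d) Π
    all-out b {G} {Π} {D} {F} m d₀ = variant b m em
      where
      counterexample : ¬ (∀ d → F d) → Σ[ d ∈ D ] ¬ F d
      counterexample ¬f with em {Σ[ d ∈ D ] ¬ F d}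
      ... | yes x = x
      ... | no ¬x = ⊥-elim (¬f λ d → decide d em)
        where
        decide : ∀ d → Dec (F d) → F d
        decide d (yes x) = x
        decide d (no ¬y) = ⊥-elim (¬x (d , ¬y))
      variant : ∀ b → Monotone b G → Dec (∀ d → F d) → Quant (¬ᵇ b) D (λ d → G (F d) Π) ⇔ G (∀ d → F d) Π
      variant true  m (yes f) = mk⇔ (λ g → m (λ _ → f) (g d₀)) (λ g d → m (λ f → f d) g)
      variant true  m (no ¬f) = mk⇔ (λ g → let d , ¬x = counterexample ¬f in m (λ x → ⊥-elim (¬x x)) (g d)) (λ g d → m (λ f → f d) g)
      variant false m (yes f) = mk⇔ (λ (d , g) → m (λ f → f d) g) (λ g → d₀ , m (λ _ → f) g)
      variant false m (no ¬f) = mk⇔ (λ (d , g) → m (λ f → f d) g) (λ g → let d , ¬x = counterexample ¬f in d , m (λ x → ⊥-elim (¬x x)) g)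

    Fresh : (ℕ → Set) → ℕ → ℕ → Set
    Fresh P lo hi = ∀ v → P v → Outside lo hi v

    mono-¬ : ∀ b {G : Context} → Monotone b G → Monotone (¬ᵇ b) (λ X → G (¬ X))
    mono-¬ true  m f = m (λ ¬x → ¬x ∘ f)
    mono-¬ false m f = m (λ ¬y → ¬y ∘ f)

    mono-map : ∀ b {G : Context} (f : Set₁ → Assignment → Set₁) → (∀ {Π X Y} → (X → Y) → f X Π → f Y Π) → Monotone b G →
               Monotone b (λ X Π → G (f X Π) Π)
    mono-map true  f f-mono m h = m (f-mono h)
    mono-map false f f-mono m h = m (f-mono h)

    inhabitant : ∀ q {N Π} → RefersTo N q → Inhabited N Π → Dom q Π
    inhabitant (any i)      r h = (λ _ → ⊤) , (λ _ → Vec.replicate _ true) , tt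
    inhabitant (inside i y) r h = h y r

    inhabited-grow : ∀ q {N : ℕ → Set} {Π} → (∀ v → N v → target q ≢ v) → Inhabited N Π → ∀ d → Inhabited (grow N q) (put q Π d)
    inhabited-grow (any i) ≠ h (S , t , x) y (inj₁ refl) = S , update-hit {_≟_ = H._≟ˢ_} {v = var i} refl , t , x
    inhabited-grow (any i) ≠ h d y (inj₂ ny) =
      let S , eq , x = h y ny in S , trans (update-miss {_≟_ = H._≟ˢ_} (var-≠ (≠ y ny))) eq , x
    inhabited-grow (inside i _) ≠ h d = h

    -- Induction on A for all contexts at once: negation is absorbed into the context and flips its
    -- polarity, a quantifier leaves the context by `ex-out` or `all-out`. Stability of the context
    -- under the names bound in A is what prevents capture.
    prenex : ∀ b A {P N lo hi Π} {G : Context} → Scoped P N lo hi A → Fresh P lo hi → (∀ v → N v → P v) → Inhabited N Π →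
             Monotone b G → Stable lo hi G →
             wp b A (λ Π′ → G (Lift (lsuc 0ℓ) (Π′ ⊨ˡ matrix A)) Π′) Π ⇔ G (⟦ A ⟧ Π) Π
    -- Under the quantifiers of A, those of B are pulled out first, with the matrix of A as part of
    -- the context; then those of A, with the meaning of B as part of it. Disjoint intervals of
    -- names make both contexts stable.
    prenex-binary : ∀ b A B (_⊙_ : Set₁ → Set₁ → Set₁) → (∀ {X X′ Y Y′} → (X → X′) → (Y → Y′) → X ⊙ Y → X′ ⊙ Y′) →
             ∀ {P N lo mid hi Π} {G : Context} → lo ≤ mid → mid ≤ hi → Scoped P N mid hi A → Scoped P N lo mid B →
             Fresh P lo hi → (∀ v → N v → P v) → Inhabited N Π → Monotone b G → Stable lo hi G →
             wp b A (wp b B (λ Π′ → G (Lift (lsuc 0ℓ) (Π′ ⊨ˡ matrix A) ⊙ Lift (lsuc 0ℓ) (Π′ ⊨ˡ matrix B)) Π′)) Π ⇔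
             G (⟦ A ⟧ Π ⊙ ⟦ B ⟧ Π) Π
    prenex-block : ∀ b q A {P N lo hi Π} {G : Context} → lo ≤ target q → target q < hi →
             Scoped (P ∪ target q) (grow N q) lo (target q) A → Fresh P lo hi → (∀ v → N v → P v) → Inhabited N Π →
             Monotone b G → Stable lo hi G → (d : Dom q Π) →
             wp b A (λ Π′ → G (Lift (lsuc 0ℓ) (Π′ ⊨ˡ matrix A)) Π′) (put q Π d) ⇔ G (⟦ A ⟧ (put q Π d)) Π
    prenex b (ltl ψ) s fresh N⊆P inh m st = ⇔-refl
    prenex b (neg A) {G = G} s fresh N⊆P inh m st =
      wp-cong′ (¬ᵇ b) A (λ Π′ → context-cong b m (Lift-⇔ ⟫ ¬-cong (⇔-sym Lift-⇔))) ⟫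
      prenex (¬ᵇ b) A s fresh N⊆P inh (mono-¬ b m) st
    prenex b (conj A B) (_ , l , h , s , s′) fresh N⊆P inh m st =
      wp-cong′ b A (λ _ → wp-cong′ b B λ Π′ → context-cong b m
        (Lift-⇔ ⟫ andL-sem {Π′} {matrix A} {matrix B} ⟫ ×-cong (⇔-sym Lift-⇔) (⇔-sym Lift-⇔))) ⟫
      prenex-binary b A B _×_ (λ f g (x , y) → f x , g y) l h s s′ fresh N⊆P inh m st
    prenex b (disj A B) (_ , l , h , s , s′) fresh N⊆P inh m st =
      wp-cong′ b A (λ _ → wp-cong′ b B λ Π′ → context-cong b m (Lift-⇔ ⟫ ⊎-cong (⇔-sym Lift-⇔) (⇔-sym Lift-⇔))) ⟫
      prenex-binary b A B _⊎_ Sum.map l h s s′ fresh N⊆P inh m st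
    prenex b (all q A) ((l , h) , r , s) fresh N⊆P inh m st =
      Quant-cong (¬ᵇ b) (prenex-block b q A l h s fresh N⊆P inh m st) ⟫ all-out b m (inhabitant q r inh)
    prenex b (ex q A) ((l , h) , r , s) fresh N⊆P inh m st =
      Quant-cong b (prenex-block b q A l h s fresh N⊆P inh m st) ⟫ ex-out b m (inhabitant q r inh)

    prenex-block b q A {P} {N} {lo} {hi} {Π} {G} l h s fresh N⊆P inh m st d =
      prenex b A s fresh′ (N⊆P′ q) (inhabited-grow q ≠ inh d) m (st ∘ off-⊆ ℕₚ.≤-refl (ℕₚ.<⇒≤ h)) ⟫
      ⇔-sym (stable⇔ {G = G} st (off-put q d l h))
      where
      fresh′ : Fresh (P ∪ target q) lo (target q)
      fresh′ v (inj₁ refl) = inj₂ ℕₚ.≤-refl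
      fresh′ v (inj₂ p) = Sum.map₂ (ℕₚ.≤-trans (ℕₚ.<⇒≤ h)) (fresh v p)
      N⊆P′ : ∀ q v → grow N q v → (P ∪ target q) v
      N⊆P′ (any i)      v (inj₁ eq) = inj₁ eq
      N⊆P′ (any i)      v (inj₂ nv) = inj₂ (N⊆P v nv)
      N⊆P′ (inside i y) v nv        = inj₂ (N⊆P v nv)
      ≠ : ∀ v → N v → target q ≢ v
      ≠ v nv refl with fresh v (N⊆P v nv)
      ... | inj₁ lt = ℕₚ.<⇒≱ lt l
      ... | inj₂ ge = ℕₚ.<⇒≱ h ge

    prenex-binary b A B _⊙_ ⊙-mono {P} {N} {lo} {mid} {hi} {Π} {G} l h s s′ fresh N⊆P inh m st =
      wp-cong b A s (λ Π′ o → prenex b B s′ freshB N⊆P (inhabited-agree (off-agree A-off o) inh) monoB stableB) ⟫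
      prenex b A s freshA N⊆P inh monoA stableA
      where
      freshA : Fresh P mid hi
      freshA v p = Sum.map₁ (λ lt → ℕₚ.≤-trans lt l) (fresh v p)
      freshB : Fresh P lo mid
      freshB v p = Sum.map₂ (ℕₚ.≤-trans h) (fresh v p)
      A-off : ∀ v → P v → Outside mid hi v
      A-off = freshA
      off-agree : ∀ {lo hi Π Π′} → (∀ v → P v → Outside lo hi v) → Off lo hi Π Π′ → Agree P N Π Π′
      off-agree f = agree-⊆ f (λ v → f v ∘ N⊆P v)
      GB GA : Context
      GB X Π′ = G (Lift (lsuc 0ℓ) (Π′ ⊨ˡ matrix A) ⊙ X) Π′
      GA X Π′ = G (X ⊙ ⟦ B ⟧ Π′) Π′
      monoB : Monotone b GB
      monoB = mono-map b {G} (λ X Π′ → Lift (lsuc 0ℓ) (Π′ ⊨ˡ matrix A) ⊙ X) (⊙-mono id) m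
      monoA : Monotone b GA
      monoA = mono-map b {G} (λ X Π′ → X ⊙ ⟦ B ⟧ Π′) (λ f → ⊙-mono f id) m
      A-vars : ∀ v → H.OccursLTL v (matrix A) → Outside lo mid v
      A-vars v o with matrix-occurs A s o
      ... | inj₁ p = freshB v p
      ... | inj₂ bd = inj₂ (proj₁ (bound-interval A s bd))
      stableB : Stable lo mid GB
      stableB {Π₁} {Π₂} o g = to (context-cong b m (mk⇔ (⊙-mono (to e) id) (⊙-mono (from e) id))) (st (off-⊆ ℕₚ.≤-refl h o) g)
        where
        e : Lift (lsuc 0ℓ) (Π₁ ⊨ˡ matrix A) ⇔ Lift (lsuc 0ℓ) (Π₂ ⊨ˡ matrix A)
        e = Lift-⇔ ⟫ ltl-agree (matrix A) A-vars o ⟫ ⇔-sym Lift-⇔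
      stableA : Stable mid hi GA
      stableA {Π₁} {Π₂} o g = to (context-cong b m (mk⇔ (⊙-mono id (to e)) (⊙-mono id (from e)))) (st (off-⊆ l ℕₚ.≤-refl o) g)
        where
        e : ⟦ B ⟧ Π₁ ⇔ ⟦ B ⟧ Π₂
        e = ⟦⟧-agree B s′ (off-agree freshA o)

-- Three sets of numbers on a trace, and LTL formulas about them

module TrackFormulas (n : ℕ) where

  open Prenexing n using (_andL_; module H)
  open H using (LTL; X; ⟨_⟩_)

  Xs : ℕ → LTL → LTL
  Xs zero    ψ = ψ
  Xs (suc j) ψ = X (Xs j ψ)

  -- At the start 3 r of row r, this reads row r of track j for j < 3, and with 3 + j in place of j
  -- the next row of the same track.
  at : ℕ → ℕ → LTL
  at j v = Xs j (⟨ zero ⟩ v)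

  iffL : LTL → LTL → LTL
  iffL ψ χ = H._or_ (ψ andL χ) (H.not ψ andL H.not χ)

  -- The left operand of `U` is a tautology. The last two look only at positions marked by the
  -- clock, trace variable 0, which are the starts of rows.
  eventually always somewhere everywhere : LTL → LTL
  eventually ψ = H._U_ (H._or_ (at 0 0) (H.not (at 0 0))) ψ
  always ψ     = H.not (eventually (H.not ψ))
  somewhere ψ  = eventually (at 0 0 andL ψ)
  everywhere ψ = H.not (somewhere (H.not ψ))

  -- The pattern is fixed on its first three positions and propagated with period 3. The
  -- unrestricted `always` is used because the clock cannot be relied on yet.
  isClock : LTL
  isClock = at 0 0 andL H.not (at 1 0) andL H.not (at 2 0) andL always (iffL (at 0 0) (at 3 0))

  -- For singletons {k} and {m}, `successorT` expresses k = m + 1: row 0 is empty and every later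
  -- row is the preceding row of the other track.
  equalT successorT : ℕ × ℕ → ℕ × ℕ → LTL
  equalT (v , i) (w , j)     = everywhere (iffL (at i v) (at j w))
  successorT (v , i) (w , j) = H.not (at i v) andL everywhere (iffL (at (3 + i) v) (at j w))

  zeroT : ℕ × ℕ → LTL
  zeroT (v , i) = at i v andL everywhere (H.not (at (3 + i) v))

  -- Moving on by one row, three positions, makes the inequality strict.
  lessT : ℕ → LTL
  lessT v = somewhere (at 0 v andL Xs 3 (somewhere (at 1 v)))

  meetT : ℕ → ℕ → LTL
  meetT v w = somewhere (at 0 v andL at 0 w)

-- Each trace carries three sets of numbers, its tracks: j-th track of t is the set of r with p ∈ t (3 r + j), for the
-- proposition p = 0.
module Tracks (em : ExcludedMiddle (lsuc 0ℓ)) (n : ℕ) where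

  open Prenexing n
  open Classical em
  open TrackFormulas n public
  open H using (Trace; LTL; X; ⟨_⟩_)

  stable : ∀ {A : Set} → ¬ ¬ A → A
  stable {A} ¬¬a with em {Lift (lsuc 0ℓ) A}
  ... | yes (lift a) = a
  ... | no ¬a        = ⊥-elim (¬¬a (¬a ∘ lift))

  mark : Trace → ℕ → Bool
  mark t i = lookup (t i) zero

  track : Trace → ℕ → ℕ → Bool
  track t j r = mark t (j + r * 3)

  record SameTrack (x y : Trace × ℕ) : Set where
    constructor same
    field rows : ∀ r → track (proj₁ x) (proj₂ x) r ≡ track (proj₁ y) (proj₂ y) r

  record SuccTrack (x y : Trace × ℕ) : Set where
    constructor successor
    field
      first : ¬ T (track (proj₁ x) (proj₂ x) 0)
      rows  : ∀ r → track (proj₁ x) (proj₂ x) (suc r) ≡ track (proj₁ y) (proj₂ y) r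

  record ZeroTrack (x : Trace × ℕ) : Set where
    constructor zeroed
    field
      first : T (track (proj₁ x) (proj₂ x) 0)
      rows  : ∀ r → ¬ T (track (proj₁ x) (proj₂ x) (suc r))

  Clock : Trace → Set
  Clock κ = ∀ i → T (mark κ i) ⇔ (∃[ r ] i ≡ r * 3)

  Valuation : Set
  Valuation = ℕ → Maybe Trace

  record Means (V : Valuation) (i : ℕ) (ψ : LTL) (P : Set) : Set where
    constructor means
    field meaning : sat V i ψ ⇔ P

  open Means

  means-⇔ : ∀ {V i ψ P Q} → P ⇔ Q → Means V i ψ P → Means V i ψ Q
  means-⇔ e p = means (meaning p ⟫ e)

  means-self : ∀ {V i} ψ → Means V i ψ (sat V i ψ)
  means-self ψ = means ⇔-refl

  reading : ∀ Π ψ {P} → Means (H.Assignment.traceOf Π) 0 ψ P → (Π H.⊨ˡ ψ) ⇔ P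
  reading Π ψ m = ⊨ˡ⇔sat Π ψ ⟫ meaning m

  module _ {V : Valuation} where

    means-and : ∀ {i ψ χ P Q} → Means V i ψ P → Means V i χ Q → Means V i (ψ andL χ) (P × Q)
    means-and p q = means (mk⇔ (λ ¬¬ → stable (λ ¬p → ¬¬ (inj₁ (¬p ∘ to (meaning p)))) , stable (λ ¬q → ¬¬ (inj₂ (¬q ∘ to (meaning q)))))
                               (λ (x , y) → [ _$ from (meaning p) x , _$ from (meaning q) y ]′))

    -- The second conjunct is interpreted only where the first holds; thus the table axioms can be
    -- read under the assumption that the clock is correct.
    means-and-then : ∀ {i ψ χ P Q} → Means V i ψ P → (P → Means V i χ Q) → Means V i (ψ andL χ) (P × Q)
    means-and-then {ψ = ψ} {χ} p q = means (meaning (means-and (means-self ψ) (means-self χ)) ⟫ mk⇔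
      (λ (x , y) → let x′ = to (meaning p) x in x′ , to (meaning (q x′)) y)
      (λ (x , y) → from (meaning p) x , from (meaning (q x)) y))

    means-or : ∀ {i ψ χ P Q} → Means V i ψ P → Means V i χ Q → Means V i (H._or_ ψ χ) (P ⊎ Q)
    means-or p q = means (⊎-cong (meaning p) (meaning q))

    means-not : ∀ {i ψ P} → Means V i ψ P → Means V i (H.not ψ) (¬ P)
    means-not p = means (¬-cong (meaning p))

    means-iff : ∀ {i ψ χ P Q} → Means V i ψ P → Means V i χ Q → Means V i (iffL ψ χ) (P ⇔ Q)
    means-iff {P = P} p q = means (meaning (means-or (means-and p q) (means-and (means-not p) (means-not q))) ⟫ mk⇔
      (λ { (inj₁ (x , y)) → mk⇔ (λ _ → y) (λ _ → x) ; (inj₂ (¬x , ¬y)) → mk⇔ (⊥-elim ∘ ¬x) (⊥-elim ∘ ¬y) })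
      (λ e → stable λ ¬c → ¬c (inj₂ ((λ x → ¬c (inj₁ (x , to e x))) , λ y → ¬c (inj₁ (from e y , y))))))

    means-Xs : ∀ j {i ψ P} → Means V (j + i) ψ P → Means V i (Xs j ψ) P
    means-Xs zero    p = p
    means-Xs (suc j) {i} {ψ} {P} p = means (meaning (means-Xs j (subst (λ i → Means V i ψ P) (sym (ℕₚ.+-suc j i)) p)))

    means-mark : ∀ {v t i} → V v ≡ just t → Means V i (⟨ zero ⟩ v) (T (mark t i))
    means-mark {t = t} {i} eq = means (known eq)
      where
      known : ∀ {x} → x ≡ just t → MAny.Any (λ t → zero Subset.∈ t i) x ⇔ T (mark t i)
      known refl = mk⇔ (λ { (MAny.just x) → to ∈⇔lookup x }) (λ x → MAny.just (from (∈⇔lookup {s = t i}) x))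

    means-at : ∀ {v t i} j → V v ≡ just t → Means V i (at j v) (T (mark t (j + i)))
    means-at j eq = means-Xs j (means-mark eq)

    means-eventually : ∀ {i ψ} {P : ℕ → Set} → (∀ j → Means V (i + j) ψ (P (i + j))) → Means V i (eventually ψ) (∃[ j ] P (i + j))
    means-eventually h = means (mk⇔ (λ (j , x , _) → j , to (meaning (h j)) x)
      (λ (j , x) → j , from (meaning (h j)) x , λ _ _ → stable λ ¬c → ¬c (inj₂ (¬c ∘ inj₁))))

    means-always : ∀ {ψ} {P : ℕ → Set} → (∀ i → Means V i ψ (P i)) → Means V 0 (always ψ) (∀ i → P i)
    means-always {P = P} h = means-⇔ (mk⇔ (λ ¬∃ i → stable λ ¬p → ¬∃ (i , ¬p)) (λ f (i , ¬p) → ¬p (f i)))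
      (means-not (means-eventually {0} {P = λ i → ¬ P i} λ i → means-not (h i)))

    module Clocked {κ : Trace} (clock : Clock κ) (V₀ : V 0 ≡ just κ) where

      means-somewhere : ∀ {r ψ} {P : ℕ → Set} → (∀ s → Means V (s * 3) ψ (P s)) → Means V (r * 3) (somewhere ψ) (∃[ s ] r ≤ s × P s)
      means-somewhere {r} {ψ} {P} h = means (mk⇔
        (λ (j , x , _) → let c , y = to (meaning (means-and (means-at {i = r * 3 + j} 0 V₀) (means-self ψ))) x
                             s , eq = to (clock _) c
                         in s , ℕₚ.*-cancelʳ-≤ r s 3 (subst (r * 3 ≤_) eq (ℕₚ.m≤m+n (r * 3) j)) ,
                            to (meaning (h s)) (subst (λ i → sat V i ψ) eq y))
        (λ (s , r≤s , x) → let d , eq = ℕₚ.m≤n⇒∃[o]m+o≡n r≤s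
                               pos = trans (sym (ℕₚ.*-distribʳ-+ 3 r d)) (cong (_* 3) eq)
                           in d * 3 , from (meaning (means-and (means-at {i = r * 3 + d * 3} 0 V₀) (means-self ψ)))
                                (from (clock _) (s , pos) , subst (λ i → sat V i ψ) (sym pos) (from (meaning (h s)) x)) ,
                              λ _ _ → stable λ ¬c → ¬c (inj₂ (¬c ∘ inj₁))))

      means-everywhere : ∀ {ψ} {P : ℕ → Set} → (∀ r → Means V (r * 3) ψ (P r)) → Means V 0 (everywhere ψ) (∀ r → P r)
      means-everywhere {P = P} h = means (meaning (means-not (means-somewhere {0} {P = λ s → ¬ P s} (λ s → means-not (h s)))) ⟫
        mk⇔ (λ ¬∃ r → stable λ ¬p → ¬∃ (r , z≤n , ¬p)) (λ f (r , _ , ¬p) → ¬p (f r)))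

      means-equal : ∀ {v w t u} i j → V v ≡ just t → V w ≡ just u → Means V 0 (equalT (v , i) (w , j)) (SameTrack (t , i) (u , j))
      means-equal i j eq eq′ = means (meaning (means-everywhere λ r → means-iff (means-at i eq) (means-at j eq′)) ⟫
        mk⇔ (λ f → same λ r → T-injective (f r)) (λ (same f) r → ≡⇒⇔ (cong T (f r))))

      next-row : ∀ t i r → mark t (3 + i + r * 3) ≡ track t i (suc r)
      next-row t i r = cong (mark t) (trans (cong (_+ r * 3) (ℕₚ.+-comm 3 i)) (ℕₚ.+-assoc i 3 (r * 3)))

      means-successor : ∀ {v w t u} i j → V v ≡ just t → V w ≡ just u →
                        Means V 0 (successorT (v , i) (w , j)) (SuccTrack (t , i) (u , j))
      means-successor {t = t} i j eq eq′ = means (meaning (means-and (means-not (means-at i eq))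
          (means-everywhere λ r → means-iff (means-at (3 + i) eq) (means-at j eq′))) ⟫
        mk⇔ (λ (¬0 , f) → successor ¬0 λ r → trans (sym (next-row t i r)) (T-injective (f r)))
            (λ (successor ¬0 f) → ¬0 , λ r → ≡⇒⇔ (cong T (trans (next-row t i r) (f r)))))

      means-zero : ∀ {v t} i → V v ≡ just t → Means V 0 (zeroT (v , i)) (ZeroTrack (t , i))
      means-zero {t = t} i eq = means (meaning (means-and (means-at i eq) (means-everywhere λ r → means-not (means-at (3 + i) eq))) ⟫
        mk⇔ (λ (z , f) → zeroed z λ r x → f r (subst T (sym (next-row t i r)) x))
            (λ (zeroed z f) → z , λ r x → f r (subst T (next-row t i r) x)))

      means-less : ∀ {v t} → V v ≡ just t → Means V 0 (lessT v) (∃[ r ] ∃[ s ] r < s × T (track t 0 r) × T (track t 1 s))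
      means-less eq = means (meaning (means-somewhere {0} λ r → means-and (means-at 0 eq) (means-Xs 3 (means-somewhere {suc r} λ s → means-at 1 eq))) ⟫
        mk⇔ (λ (r , _ , x , s , lt , y) → r , s , lt , x , y) (λ (r , s , lt , x , y) → r , z≤n , x , s , lt , y))

      means-meet : ∀ {v w t u} → V v ≡ just t → V w ≡ just u → Means V 0 (meetT v w) (∃[ r ] T (track t 0 r) × T (track u 0 r))
      means-meet eq eq′ = means (meaning (means-somewhere {0} λ r → means-and (means-at 0 eq) (means-at 0 eq′)) ⟫
        mk⇔ (λ (r , _ , x) → r , x) (λ (r , x) → r , z≤n , x))

    -- Both directions go by steps of three from the initial pattern: marks propagate forwards from
    -- 0, and a mark at i can be traced back to a position below 3.
    means-isClock : ∀ {κ} → V 0 ≡ just κ → Means V 0 isClock (Clock κ)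
    means-isClock {κ} eq = means (meaning (means-and (means-at 0 eq) (means-and (means-not (means-at 1 eq)) (means-and (means-not (means-at 2 eq))
        (means-always {P = λ i → T (mark κ i) ⇔ T (mark κ (3 + i))} λ i → means-iff (means-at 0 eq) (means-at 3 eq))))) ⟫
      mk⇔ (λ (m₀ , ¬m₁ , ¬m₂ , p) i → mk⇔ (forth m₀ ¬m₁ ¬m₂ p i) (λ { (r , refl) → back m₀ p r })) λ c →
        from (c 0) (0 , refl) , (λ m → small 1 (λ ()) (s≤s (s≤s z≤n)) (to (c 1) m)) , (λ m → small 2 (λ ()) (s≤s (s≤s (s≤s z≤n))) (to (c 2) m)) ,
        λ i → c i ⟫ mk⇔ (λ (r , e) → suc r , cong (3 +_) e) (λ { (suc r , e) → r , ℕₚ.+-cancelˡ-≡ 3 i (r * 3) e }) ⟫ ⇔-sym (c (3 + i)))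
      where
      forth : T (mark κ 0) → ¬ T (mark κ 1) → ¬ T (mark κ 2) → (∀ i → T (mark κ i) ⇔ T (mark κ (3 + i))) →
              ∀ i → T (mark κ i) → ∃[ r ] i ≡ r * 3
      forth m₀ ¬m₁ ¬m₂ p 0 m = 0 , refl
      forth m₀ ¬m₁ ¬m₂ p 1 m = ⊥-elim (¬m₁ m)
      forth m₀ ¬m₁ ¬m₂ p 2 m = ⊥-elim (¬m₂ m)
      forth m₀ ¬m₁ ¬m₂ p (suc (suc (suc i))) m = let r , e = forth m₀ ¬m₁ ¬m₂ p i (from (p i) m) in suc r , cong (3 +_) e
      back : T (mark κ 0) → (∀ i → T (mark κ i) ⇔ T (mark κ (3 + i))) → ∀ r → T (mark κ (r * 3))
      back m₀ p zero    = m₀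
      back m₀ p (suc r) = to (p (r * 3)) (back m₀ p r)
      small : ∀ i → i ≢ 0 → i < 3 → ¬ (∃[ r ] i ≡ r * 3)
      small i i≢0 i<3 (zero , e)  = i≢0 e
      small i i≢0 i<3 (suc r , e) = ℕₚ.m+n≮m 3 (r * 3) (subst (_< 3) e i<3)

  -- A trace with prescribed tracks 0, 1 and 2; every other proposition copies proposition 0.
  weave : (ℕ → ℕ → Bool) → Trace
  weave f i = Vec.replicate (suc n) (f (i % 3) (i / 3))

  track-weave : ∀ f j r → j < 3 → track (weave f) j r ≡ f j r
  track-weave f j r j<3 = cong₂ f (trans (cong (_% 3) (ℕₚ.+-comm j (r * 3))) (pair-% 2 r j<3))
                                  (trans (cong (_/ 3) (ℕₚ.+-comm j (r * 3))) (pair-/ 2 r j<3))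

  clockTrace : Trace
  clockTrace i = Vec.replicate (suc n) (i % 3 ℕ.≡ᵇ 0)

  clockTrace-clock : Clock clockTrace
  clockTrace-clock i = mk⇔ (λ m → i / 3 , trans (DivMod.m≡m%n+[m/n]*n i 3) (cong (_+ i / 3 * 3) (ℕₚ.≡ᵇ⇒≡ (i % 3) 0 m)))
                           (λ { (r , refl) → ℕₚ.≡⇒≡ᵇ (r * 3 % 3) 0 (DivMod.m*n%n≡0 r 3) })

-- Defining addition and multiplication by sets of traces

module Tables (em : ExcludedMiddle (lsuc 0ℓ)) (n₀ : ℕ) where

  open Prenexing n₀
  open Classical em
  open Tracks em n₀
  open H using (Trace; TraceSet; LTL)
  open Means

  record Is (t : Trace) (j m : ℕ) : Set where
    constructor is
    field rows : ∀ r → track t j r ≡ (r ℕ.≡ᵇ m)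

  is-member : ∀ {t j m} → Is t j m → T (track t j m)
  is-member {m = m} (is h) = subst T (sym (h m)) (ℕₚ.≡⇒≡ᵇ m m refl)

  is-at : ∀ {t j m r} → Is t j m → T (track t j r) → r ≡ m
  is-at {m = m} {r} (is h) x = ℕₚ.≡ᵇ⇒≡ r m (subst T (h r) x)

  is-unique : ∀ {t j m m′} → Is t j m → Is t j m′ → m ≡ m′
  is-unique h h′ = is-at h′ (is-member h)

  is-cong : ∀ {t j m m′} → m ≡ m′ → Is t j m → Is t j m′
  is-cong refl h = h

  is-same : ∀ {t i u j m} → SameTrack (t , i) (u , j) → Is u j m → Is t i m
  is-same (same s) (is h) = is λ r → trans (s r) (h r)

  same-is : ∀ {t i u j m} → Is t i m → Is u j m → SameTrack (t , i) (u , j)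
  same-is (is h) (is h′) = same λ r → trans (h r) (sym (h′ r))

  same-sym : ∀ {t i u j} → SameTrack (t , i) (u , j) → SameTrack (u , j) (t , i)
  same-sym (same s) = same λ r → sym (s r)

  false-≡ : ∀ {b} → ¬ T b → b ≡ false
  false-≡ {true}  ¬t = ⊥-elim (¬t tt)
  false-≡ {false} _  = refl

  is-succ : ∀ {t i u j m} → SuccTrack (t , i) (u , j) → Is u j m → Is t i (suc m)
  is-succ (successor ¬0 s) (is h) = is λ { zero → false-≡ ¬0 ; (suc r) → trans (s r) (h r) }

  is-pred : ∀ {t i u j m} → SuccTrack (t , i) (u , j) → Is t i (suc m) → Is u j m
  is-pred (successor _ s) (is h) = is λ r → trans (sym (s r)) (h (suc r))

  succ-is : ∀ {t i u j m} → Is t i (suc m) → Is u j m → SuccTrack (t , i) (u , j)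
  succ-is (is h) (is h′) = successor (λ x → subst T (h 0) x) λ r → trans (h (suc r)) (sym (h′ r))

  is-zero : ∀ {t i} → ZeroTrack (t , i) ⇔ Is t i 0
  is-zero = mk⇔ (λ (zeroed z ¬s) → is λ { zero → to Boolₚ.T-≡ z ; (suc r) → false-≡ (¬s r) })
                (λ h → zeroed (is-member h) λ r x → case is-at {r = suc r} h x of λ ())

  Triple : Trace → ℕ → ℕ → ℕ → Set
  Triple t n m k = Is t 0 n × Is t 1 m × Is t 2 k

  rowsOf : ℕ → ℕ → ℕ → ℕ → ℕ → Bool
  rowsOf n m k 0 r = r ℕ.≡ᵇ n
  rowsOf n m k 1 r = r ℕ.≡ᵇ m
  rowsOf n m k _ r = r ℕ.≡ᵇ k

  triple : ℕ → ℕ → ℕ → Trace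
  triple n m k = weave (rowsOf n m k)

  triple-is : ∀ n m k → Triple (triple n m k) n m k
  triple-is n m k = is (λ r → track-weave (rowsOf n m k) 0 r (s≤s z≤n)) , is (λ r → track-weave (rowsOf n m k) 1 r (s≤s (s≤s z≤n))) ,
                    is (λ r → track-weave (rowsOf n m k) 2 r (s≤s (s≤s (s≤s z≤n))))

  Table : (ℕ → ℕ → ℕ) → TraceSet → Set
  Table _⊙_ S = (∀ t → S t → ∃[ n ] ∃[ m ] Triple t n m (n ⊙ m)) × (∀ n m → ∃[ t ] S t × Triple t n m (n ⊙ m))

  table : (ℕ → ℕ → ℕ) → TraceSet
  table _⊙_ t = ∃[ n ] ∃[ m ] Triple t n m (n ⊙ m)

  table-correct : ∀ _⊙_ → Table _⊙_ (table _⊙_)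
  table-correct _⊙_ = (λ _ → id) , λ n m → triple n m (n ⊙ m) , (n , m , triple-is n m (n ⊙ m)) , triple-is n m (n ⊙ m)

  AllZero : Trace → Set
  AllZero t = ZeroTrack (t , 0) × ZeroTrack (t , 1) × ZeroTrack (t , 2)

  LeftStep RightStep : Trace → Trace → Set
  LeftStep t u  = SuccTrack (t , 0) (u , 0) × SameTrack (t , 1) (u , 1) × SuccTrack (t , 2) (u , 2)
  RightStep t u = SameTrack (t , 0) (u , 0) × SuccTrack (t , 1) (u , 1) × SuccTrack (t , 2) (u , 2)

  -- The table of addition is generated from (0, 0, 0) by increasing either summand.  Every entry is generated because
  -- the sum decreases along predecessors; this needs a nonempty third track.
  PlusStep : Trace → Trace → Trace → Trace → Set
  PlusStep t a b c = LeftStep a t × RightStep b t × (∃[ r ] T (track t 2 r)) × (AllZero t ⊎ LeftStep t c ⊎ RightStep t c)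

  zero-triple : ∀ {t} → AllZero t ⇔ Triple t 0 0 0
  zero-triple = ×-cong is-zero (×-cong is-zero is-zero)

  left-triple : ∀ {t u n m k} → LeftStep t u → Triple u n m k → Triple t (suc n) m (suc k)
  left-triple {t} {u} (s , s′ , s″) (h , h′ , h″) = is-succ s h , is-same s′ h′ , is-succ s″ h″

  right-triple : ∀ {t u n m k} → RightStep t u → Triple u n m k → Triple t n (suc m) (suc k)
  right-triple {t} {u} (s , s′ , s″) (h , h′ , h″) = is-same s h , is-succ s′ h′ , is-succ s″ h″

  triple-left : ∀ {t u n m k} → Triple t (suc n) m (suc k) → Triple u n m k → LeftStep t u
  triple-left {t} {u} (g , g′ , g″) (h , h′ , h″) = succ-is g h , same-is g′ h′ , succ-is g″ h″

  triple-right : ∀ {t u n m k} → Triple t n (suc m) (suc k) → Triple u n m k → RightStep t u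
  triple-right {t} {u} (g , g′ , g″) (h , h′ , h″) = same-is g h , succ-is g′ h′ , succ-is g″ h″

  triple-cong : ∀ {t n m k k′} → k ≡ k′ → Triple t n m k → Triple t n m k′
  triple-cong refl h = h

  -- Soundness is an induction on some element r of the third track, since nothing says beforehand
  -- that the tracks are singletons: passing to the predecessor lowers r, and an entry with r = 0
  -- can only be the origin. Completeness follows from closure under both steps.
  plus-table : (S : TraceSet) → (∃[ t ] S t × AllZero t) →
               (∀ t → S t → ∃[ a ] S a × ∃[ b ] S b × ∃[ c ] S c × PlusStep t a b c) → Table _+_ S
  plus-table S (t₀ , s₀ , z₀) steps = sound , complete
    where
    generated : ∀ r t → S t → T (track t 2 r) → ∃[ n ] ∃[ m ] Triple t n m (n + m)
    generated r t s x with steps t s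
    ... | _ , _ , _ , _ , c , sc , _ , _ , _ , inj₁ z = 0 , 0 , to zero-triple z
    generated zero t s x | _ , _ , _ , _ , c , sc , _ , _ , _ , inj₂ (inj₁ (_ , _ , successor ¬0 _)) = ⊥-elim (¬0 x)
    generated zero t s x | _ , _ , _ , _ , c , sc , _ , _ , _ , inj₂ (inj₂ (_ , _ , successor ¬0 _)) = ⊥-elim (¬0 x)
    generated (suc r) t s x | _ , _ , _ , _ , c , sc , _ , _ , _ , inj₂ (inj₁ l@(_ , _ , successor _ e)) =
      let n , m , h = generated r c sc (subst T (e r) x) in suc n , m , left-triple l h
    generated (suc r) t s x | _ , _ , _ , _ , c , sc , _ , _ , _ , inj₂ (inj₂ l@(_ , _ , successor _ e)) =
      let n , m , h = generated r c sc (subst T (e r) x) in n , suc m , triple-cong (sym (ℕₚ.+-suc n m)) (right-triple l h)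
    sound : ∀ t → S t → ∃[ n ] ∃[ m ] Triple t n m (n + m)
    sound t s = let _ , _ , _ , _ , _ , _ , _ , _ , (r , x) , _ = steps t s in generated r t s x
    complete : ∀ n m → ∃[ t ] S t × Triple t n m (n + m)
    complete zero    zero    = t₀ , s₀ , to zero-triple z₀
    complete zero    (suc m) = let t , s , h = complete zero m ; _ , _ , b , sb , _ , _ , _ , st , _ = steps t s in b , sb , right-triple st h
    complete (suc n) m       = let t , s , h = complete n m ; a , sa , _ , _ , _ , _ , st , _ = steps t s in a , sa , left-triple st h

  plus-steps : ∀ t → table _+_ t → ∃[ a ] table _+_ a × ∃[ b ] table _+_ b × ∃[ c ] table _+_ c × PlusStep t a b c
  plus-steps t (n , m , h) =
    triple (suc n) m (suc n + m) , proj₁ (proj₂ (proj₂ (table-correct _+_) (suc n) m)) ,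
    triple n (suc m) (n + suc m) , proj₁ (proj₂ (proj₂ (table-correct _+_) n (suc m))) ,
    predecessor n m h
    where
    predecessor : ∀ n m → Triple t n m (n + m) → ∃[ c ] table _+_ c × PlusStep t (triple (suc n) m (suc n + m)) (triple n (suc m) (n + suc m)) c
    predecessor n m h = proj₁ (before n m h) , proj₁ (proj₂ (before n m h)) ,
        triple-left (triple-is (suc n) m (suc n + m)) h ,
        triple-right (triple-cong {triple n (suc m) (n + suc m)} (ℕₚ.+-suc n m) (triple-is n (suc m) (n + suc m))) h ,
        (n + m , is-member (proj₂ (proj₂ h))) , proj₂ (proj₂ (before n m h))
      where
      before : ∀ n m → Triple t n m (n + m) → ∃[ c ] table _+_ c × (AllZero t ⊎ LeftStep t c ⊎ RightStep t c)
      -- Any entry may serve as c here, since the first alternative holds.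
      before zero    zero    h = t , (0 , 0 , h) , inj₁ (from zero-triple h)
      before zero    (suc m) h = triple 0 m m , (0 , m , triple-is 0 m m) , inj₂ (inj₂ (triple-right h (triple-is 0 m m)))
      before (suc n) m       h = triple n m (n + m) , (n , m , triple-is n m (n + m)) , inj₂ (inj₁ (triple-left h (triple-is n m (n + m))))

  RowStep : Trace → Trace → Trace → Set
  RowStep t u d = SameTrack (t , 0) (u , 0) × SuccTrack (t , 1) (u , 1) ×
                  SameTrack (d , 0) (u , 2) × SameTrack (d , 1) (u , 0) × SameTrack (t , 2) (d , 2)

  NextRow : Trace → Trace → Set
  NextRow t u = SuccTrack (t , 0) (u , 0) × ZeroTrack (t , 1) × ZeroTrack (t , 2)

  -- The table of multiplication is generated from (0, 0, 0) by (n, m, k) ↦ (n, m + 1, k + n) and (n, m, k) ↦ (n + 1, 0, 0);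
  -- d, d′ and e are entries of the table of addition, and e makes sure that the factors are numbers.
  TimesStep : (t a b c d d′ e : Trace) → Set
  TimesStep t a b c d d′ e = RowStep a t d × NextRow b t × (SameTrack (t , 0) (e , 0) × SameTrack (t , 1) (e , 1)) ×
                             ((ZeroTrack (t , 1) × ZeroTrack (t , 2)) ⊎ RowStep t c d′)

  TimesSteps : TraceSet → TraceSet → Trace → Set
  TimesSteps P S t = ∃[ a ] S a × ∃[ b ] S b × ∃[ c ] S c × ∃[ d ] P d × ∃[ d′ ] P d′ × ∃[ e ] P e × TimesStep t a b c d d′ e

  -- Equality with tracks of e makes the factors numbers. The product is then determined by
  -- induction on the second factor: at 0 the successor alternative is impossible, at a successor
  -- the table of addition gives the third track. Completeness fills the rows (n, 0, 0) by the
  -- second step and each row by the first.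
  times-table : ∀ P (S : TraceSet) → Table _+_ P → (∃[ t ] S t × AllZero t) → (∀ t → S t → TimesSteps P S t) → Table _*_ S
  times-table P S (plus , _) (t₀ , s₀ , z₀) steps = sound , complete
    where
    row : ∀ {t u d n m k} → P d → RowStep t u d → Is u 0 n → Is u 1 m → Is u 2 k → Is t 0 n × Is t 1 (suc m) × Is t 2 (k + n)
    row {t} {u} {d} {n} {m} {k} pd (s , s′ , e , e′ , e″) h h′ h″ with plus d pd
    ... | x , y , g , g′ , g″ = is-same s h , is-succ s′ h′ ,
          is-cong (cong₂ _+_ (is-unique g (is-same e h″)) (is-unique g′ (is-same e′ h)))
            (is-same e″ g″)
    generated : ∀ m {n} t → S t → Is t 0 n → Is t 1 m → Is t 2 (n * m)
    generated m t s h h′ with steps t s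
    generated zero {n} t s h h′ | _ , _ , _ , _ , c , sc , _ , _ , d , pd , _ , _ , _ , _ , _ , inj₁ (_ , z) =
      is-cong (sym (ℕₚ.*-zeroʳ n)) (to is-zero z)
    generated zero {n} t s h h′ | _ , _ , _ , _ , c , sc , _ , _ , d , pd , _ , _ , _ , _ , _ , inj₂ (_ , successor ¬0 _ , _) =
      ⊥-elim (¬0 (is-member h′))
    generated (suc m) t s h h′ | _ , _ , _ , _ , c , sc , _ , _ , d , pd , _ , _ , _ , _ , _ , inj₁ (zeroed _ ¬s , _) =
      ⊥-elim (¬s m (is-member h′))
    generated (suc m) {n} t s h h′ | _ , _ , _ , _ , c , sc , _ , _ , d , pd , _ , _ , _ , _ , _ , inj₂ r@(e , e′ , _) =
      let hc  = is-same (same-sym e) h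
          hc′ = is-pred e′ h′
      in is-cong (trans (ℕₚ.+-comm (n * m) n) (sym (ℕₚ.*-suc n m))) (proj₂ (proj₂ (row pd r hc hc′ (generated m c sc hc hc′))))
    sound : ∀ t → S t → ∃[ n ] ∃[ m ] Triple t n m (n * m)
    sound t s with steps t s
    ... | _ , _ , _ , _ , _ , _ , _ , _ , _ , _ , e , pe , _ , _ , (q , q′) , _ with plus e pe
    ... | n , m , g , g′ , _ = n , m , h , h′ , generated m t s h h′
      where
      h : Is t 0 n
      h = is-same q g
      h′ : Is t 1 m
      h′ = is-same q′ g′
    complete : ∀ n m → ∃[ t ] S t × Triple t n m (n * m)
    complete zero    zero    = t₀ , s₀ , to zero-triple z₀
    complete (suc n) zero    with complete n zero
    ... | t , s , h , _ with steps t s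
    ... | _ , _ , b , sb , _ , _ , _ , _ , _ , _ , _ , _ , _ , (q , q′ , q″) , _ =
      b , sb , is-succ q h , to is-zero q′ , is-cong (sym (ℕₚ.*-zeroʳ n)) (to is-zero q″)
    complete n (suc m) with complete n m
    ... | t , s , h , h′ , h″ with steps t s
    ... | a , sa , _ , _ , _ , _ , d , pd , _ , _ , _ , _ , r , _ =
      let g , g′ , g″ = row pd r h h′ h″ in a , sa , g , g′ , is-cong (trans (ℕₚ.+-comm (n * m) n) (sym (ℕₚ.*-suc n m))) g″

  times-steps : ∀ t → table _*_ t → TimesSteps (table _+_) (table _*_) t
  times-steps t (n , m , h , h′ , h″) =
    product n (suc m) , entry _*_ n (suc m) , product (suc n) 0 , entry _*_ (suc n) 0 , proj₁ (before m h′ h″) , proj₁ (proj₂ (before m h′ h″)) ,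
    sum (n * m) n , entry _+_ (n * m) n , proj₁ (proj₂ (proj₂ (before m h′ h″))) , proj₁ (proj₂ (proj₂ (proj₂ (before m h′ h″)))) ,
    sum n m , entry _+_ n m ,
    (row (triple-is n (suc m) (n * suc m)) h h′ h″) ,
    (succ-is (proj₁ (triple-is (suc n) 0 (suc n * 0))) h ,
       from is-zero (proj₁ (proj₂ (triple-is (suc n) 0 (suc n * 0)))) ,
       from is-zero (is-cong (ℕₚ.*-zeroʳ (suc n)) (proj₂ (proj₂ (triple-is (suc n) 0 (suc n * 0)))))) ,
    (same-is h (proj₁ (triple-is n m (n + m))) , same-is h′ (proj₁ (proj₂ (triple-is n m (n + m))))) ,
    proj₂ (proj₂ (proj₂ (proj₂ (before m h′ h″))))
    where
    product sum : ℕ → ℕ → Trace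
    product n m = triple n m (n * m)
    sum n m = triple n m (n + m)
    entry : ∀ _⊙_ n m → table _⊙_ (triple n m (n ⊙ m))
    entry _⊙_ n m = n , m , triple-is n m (n ⊙ m)
    row : ∀ {t u n m} → Triple t n (suc m) (n * suc m) → Is u 0 n → Is u 1 m → Is u 2 (n * m) → RowStep t u (sum (n * m) n)
    row {t} {u} {n} {m} (g , g′ , g″) h h′ h″ = let e , e′ , e″ = triple-is (n * m) n (n * m + n) ; d = sum (n * m) n in
      same-is g h , succ-is g′ h′ , same-is e h″ , same-is e′ h ,
      same-is (is-cong (trans (ℕₚ.*-suc n m) (ℕₚ.+-comm n (n * m))) g″) e″
    before : ∀ m → Is t 1 m → Is t 2 (n * m) → ∃[ c ] table _*_ c × ∃[ d′ ] table _+_ d′ × ((ZeroTrack (t , 1) × ZeroTrack (t , 2)) ⊎ RowStep t c d′)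
    -- The entries for c and d′ are arbitrary, since the alternative for second factor 0 holds.
    before zero h′ h″ = product n 0 , entry _*_ n 0 , sum 0 0 , entry _+_ 0 0 , inj₁ (from is-zero h′ , from is-zero (is-cong (ℕₚ.*-zeroʳ n) h″))
    before (suc m) h′ h″ = product n m , entry _*_ n m , sum (n * m) n , entry _+_ (n * m) n ,
      let g , g′ , g″ = triple-is n m (n * m) in inj₂ (row (h , h′ , h″) g g′ g″)

-- Translation of arithmetic into trees

module LowerTranslation (n : ℕ) where

  open Prenexing n
  open TrackFormulas n
  open A using (Sort; num; set; family; Term; _⊕_; _⊗_; Atom; _≐_; _≺_; _∈ˢ_; _∈ᶠ_; atom)

  -- A bound variable of arithmetic together with the index of the trace, or for families the set, that represents it.
  Binding : Set
  Binding = Sort × ℕ × ℕ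

  _≟ᵛ_ : (s s′ : Sort × ℕ) → Dec (s ≡ s′)
  (s , x) ≟ᵛ (s′ , x′) with s ≟ˢ s′ | x ℕₚ.≟ x′
    where
    _≟ˢ_ : (s s′ : Sort) → Dec (s ≡ s′)
    num    ≟ˢ num    = yes refl
    num    ≟ˢ set    = no λ ()
    num    ≟ˢ family = no λ ()
    set    ≟ˢ num    = no λ ()
    set    ≟ˢ set    = yes refl
    set    ≟ˢ family = no λ ()
    family ≟ˢ num    = no λ ()
    family ≟ˢ set    = no λ ()
    family ≟ˢ family = yes refl
  ... | yes refl | yes refl = yes refl
  ... | no s≢    | _        = no λ { refl → s≢ refl }
  ... | yes _    | no x≢    = no λ { refl → x≢ refl }

  find : List Binding → Sort → ℕ → ℕ
  find [] s x = 0
  find ((s′ , x′ , i) ∷ ρ) s x with (s , x) ≟ᵛ (s′ , x′)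
  ... | yes _ = i
  ... | no _  = find ρ s x

  -- This and the following sizes are the lengths of the encodings (`term-length`,
  -- `formula-length`), so that the program can obtain fresh names by counting its input.
  sizeT : Term → ℕ
  sizeT (A.var x) = suc x
  sizeT (t ⊕ u)   = suc (sizeT t + sizeT u)
  sizeT (t ⊗ u)   = suc (sizeT t + sizeT u)

  sizeA : Atom → ℕ
  sizeA (t ≐ u)  = suc (sizeT t + sizeT u)
  sizeA (t ≺ u)  = suc (sizeT t + sizeT u)
  sizeA (t ∈ˢ x) = suc (sizeT t + suc x)
  sizeA (x ∈ᶠ y) = suc (suc x + suc y)

  size : A.Formula → ℕ
  size (atom α)    = sizeA α
  size (A.not φ)   = suc (size φ)
  size (φ A.and χ) = suc (size φ + size χ)
  size (φ A.or χ)  = suc (size φ + size χ)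
  size (A.all s x φ) = suc (suc x + size φ)
  size (A.ex s x φ)  = suc (suc x + size φ)

  -- Indices below 14 are used by the tables of addition and multiplication.  The index bound at a node is determined by
  -- the length of the part of the input that follows its first symbol, hence larger than all indices bound later.
  fresh : ℕ → ℕ → ℕ
  fresh m r = 14 + (m + r)

  plusTable timesTable : ℕ
  plusTable  = 1
  timesTable = 6

  -- The j-th track of trace v is the value of the term.
  termTree : List Binding → (v j r : ℕ) → Term → Tree
  termTree ρ v j r (A.var x) = ltl (equalT (v , j) (find ρ num x , 0))
  termTree ρ v j r (t ⊕ u)   = let i = fresh (sizeT t + sizeT u) r in
    ex (inside i plusTable) (conj (ltl (equalT (v , j) (i , 2))) (conj (termTree ρ i 0 (sizeT u + r) t) (termTree ρ i 1 r u)))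
  termTree ρ v j r (t ⊗ u)   = let i = fresh (sizeT t + sizeT u) r in
    ex (inside i timesTable) (conj (ltl (equalT (v , j) (i , 2))) (conj (termTree ρ i 0 (sizeT u + r) t) (termTree ρ i 1 r u)))

  -- Values of terms are guessed as tracks of a new trace i: one shared track for an equation, two
  -- for an inequality, one that meets the given set for membership. Membership in a family asks for
  -- an element of its set that is tagged in row 0 of track 1 and carries the given set on track 0.
  atomTree : List Binding → ℕ → Atom → Tree
  atomTree ρ r (t ≐ u)  = let i = fresh (sizeT t + sizeT u) r in
    ex (any i) (conj (termTree ρ i 0 (sizeT u + r) t) (termTree ρ i 0 r u))
  atomTree ρ r (t ≺ u)  = let i = fresh (sizeT t + sizeT u) r in
    ex (any i) (conj (ltl (lessT i)) (conj (termTree ρ i 0 (sizeT u + r) t) (termTree ρ i 1 r u)))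
  atomTree ρ r (t ∈ˢ x) = let i = fresh (sizeT t + suc x) r in
    ex (any i) (conj (termTree ρ i 0 (suc x + r) t) (ltl (meetT i (find ρ set x))))
  atomTree ρ r (x ∈ᶠ y) = let i = fresh (suc x + suc y) r in
    ex (inside i (find ρ family y)) (ltl (at 1 i andL equalT (i , 0) (find ρ set x , 0)))

  -- A number is the first summand of an entry of the table of addition. Every number occurs there
  -- and nothing else does, so number quantifiers need no relativising condition.
  blockOf : Sort → ℕ → Block
  blockOf num i    = inside i plusTable
  blockOf set i    = any i
  blockOf family i = any i

  tree : List Binding → ℕ → A.Formula → Tree
  tree ρ r (atom α)      = atomTree ρ r α
  tree ρ r (A.not φ)     = neg (tree ρ r φ)
  tree ρ r (φ A.and χ)   = conj (tree ρ (size χ + r) φ) (tree ρ r χ)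
  tree ρ r (φ A.or χ)    = disj (tree ρ (size χ + r) φ) (tree ρ r χ)
  tree ρ r (A.all s x φ) = let i = fresh (suc x + size φ) r in all (blockOf s i) (tree ((s , x , i) ∷ ρ) r φ)
  tree ρ r (A.ex s x φ)  = let i = fresh (suc x + size φ) r in ex (blockOf s i) (tree ((s , x , i) ∷ ρ) r φ)

  Over : (ℕ → Set) → H.LTL → Set
  Over P ψ = ∀ v → H.OccursLTL v ψ → P v

  module _ {P : ℕ → Set} where

    over-or : ∀ ψ χ → Over P ψ → Over P χ → Over P (H._or_ ψ χ)
    over-or ψ χ p q v = [ p v , q v ]′

    over-at : ∀ j v → P v → Over P (at j v)
    over-at zero    v p w refl = p
    over-at (suc j) v p        = over-at j v p

    module _ (P₀ : P 0) where

      over-somewhere : ∀ ψ → Over P ψ → Over P (somewhere ψ)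
      over-somewhere ψ p = over-or (H._or_ (at 0 0) (H.not (at 0 0))) (at 0 0 andL ψ) (over-or (at 0 0) (at 0 0) κ κ) (over-or (at 0 0) ψ κ p)
        where
        κ : Over P (at 0 0)
        κ = over-at 0 0 P₀

      over-equal : ∀ v i w j → P v → P w → Over P (equalT (v , i) (w , j))
      over-equal v i w j p q = over-somewhere (iffL (at i v) (at j w)) (over-or (at i v andL at j w) (at i v andL at j w) both both)
        where
        both : Over P (at i v andL at j w)
        both = over-or (at i v) (at j w) (over-at i v p) (over-at j w q)

      over-less : ∀ v → P v → Over P (lessT v)
      over-less v p = over-somewhere (at 0 v andL Xs 3 (somewhere (at 1 v)))
        (over-or (at 0 v) (somewhere (at 1 v)) (over-at 0 v p) (over-somewhere (at 1 v) (over-at 1 v p)))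

      over-meet : ∀ v w → P v → P w → Over P (meetT v w)
      over-meet v w p q = over-somewhere (at 0 v andL at 0 w) (over-or (at 0 v) (at 0 w) (over-at 0 v p) (over-at 0 w q))

  scoped-weaken : ∀ {P N lo hi lo′ hi′} A → lo′ ≤ lo → hi ≤ hi′ → Scoped P N lo hi A → Scoped P N lo′ hi′ A
  scoped-weaken (ltl ψ) l h s = s
  scoped-weaken (neg A) l h s = scoped-weaken A l h s
  scoped-weaken (conj A B) l h (m , lm , mh , s , s′) =
    m , ℕₚ.≤-trans l lm , ℕₚ.≤-trans mh h , scoped-weaken A ℕₚ.≤-refl h s , scoped-weaken B l ℕₚ.≤-refl s′
  scoped-weaken (disj A B) l h (m , lm , mh , s , s′) =
    m , ℕₚ.≤-trans l lm , ℕₚ.≤-trans mh h , scoped-weaken A ℕₚ.≤-refl h s , scoped-weaken B l ℕₚ.≤-refl s′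
  scoped-weaken (all q A) l h ((li , ih) , r , s) = (ℕₚ.≤-trans l li , ℕₚ.≤-trans ih h) , r , scoped-weaken A l ℕₚ.≤-refl s
  scoped-weaken (ex q A) l h ((li , ih) , r , s) = (ℕₚ.≤-trans l li , ℕₚ.≤-trans ih h) , r , scoped-weaken A l ℕₚ.≤-refl s

  visible : List Binding → ℕ → Set
  visible []                = _< 14
  visible ((_ , _ , i) ∷ ρ) = visible ρ ∪ i

  -- Set 0, which contains the clock, is included because `find` returns 0 for an unbound family.
  nonempty : List Binding → ℕ → Set
  nonempty []                = λ y → y ≡ 0 ⊎ y ≡ plusTable ⊎ y ≡ timesTable
  nonempty ((s , _ , i) ∷ ρ) = grow (nonempty ρ) (blockOf s i)

  visible-global : ∀ ρ {v} → v < 14 → visible ρ v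
  visible-global []      lt = lt
  visible-global (_ ∷ ρ) lt = inj₂ (visible-global ρ lt)

  nonempty-old : ∀ b ρ {y} → nonempty ρ y → nonempty (b ∷ ρ) y
  nonempty-old (num , _ , _)    ρ p = p
  nonempty-old (set , _ , _)    ρ p = inj₂ p
  nonempty-old (family , _ , _) ρ p = inj₂ p

  nonempty-plus : ∀ ρ → nonempty ρ plusTable
  nonempty-plus []      = inj₂ (inj₁ refl)
  nonempty-plus (b ∷ ρ) = nonempty-old b ρ (nonempty-plus ρ)

  nonempty-times : ∀ ρ → nonempty ρ timesTable
  nonempty-times []      = inj₂ (inj₂ refl)
  nonempty-times (b ∷ ρ) = nonempty-old b ρ (nonempty-times ρ)

  find-visible : ∀ ρ s x → visible ρ (find ρ s x)
  find-visible [] s x = s≤s z≤n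
  find-visible ((s′ , x′ , i) ∷ ρ) s x with (s , x) ≟ᵛ (s′ , x′)
  ... | yes _ = inj₁ refl
  ... | no _  = inj₂ (find-visible ρ s x)

  find-nonempty : ∀ ρ x → nonempty ρ (find ρ family x)
  find-nonempty [] x = inj₁ refl
  find-nonempty ((s′ , x′ , i) ∷ ρ) x with (family , x) ≟ᵛ (s′ , x′)
  ... | yes refl = inj₁ refl
  ... | no _     = nonempty-old (s′ , x′ , i) ρ (find-nonempty ρ x)

  scoped-ltl-conj : ∀ {P N lo hi} ψ A → lo ≤ hi → Over P ψ → Scoped P N lo hi A → Scoped P N lo hi (conj (ltl ψ) A)
  scoped-ltl-conj {hi = hi} ψ A l p s = hi , l , ℕₚ.≤-refl , p , s

  fresh-lower : ∀ m r → 14 + r ≤ fresh m r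
  fresh-lower m r = ℕₚ.+-monoʳ-≤ 14 (ℕₚ.m≤n+m r m)

  termTree-scoped : ∀ {P N ρ} → P 0 → (∀ x → P (find ρ num x)) → N plusTable → N timesTable →
                    ∀ t {v} {j} {r} → P v → Scoped P N (14 + r) (fresh (sizeT t) r) (termTree ρ v j r t)
  termTree-scoped p₀ p nP nT (A.var x) {v} {j} pv = over-equal p₀ v j _ 0 pv (p x)
  termTree-scoped p₀ p nP nT (t ⊕ u) {v} {j} {r} pv =
    (fresh-lower (sizeT t + sizeT u) r , ℕₚ.≤-refl) , nP ,
    scoped-ltl-conj (equalT (v , j) (fresh (sizeT t + sizeT u) r , 2)) (conj (termTree _ _ 0 (sizeT u + r) t) (termTree _ _ 1 r u)) (fresh-lower (sizeT t + sizeT u) r)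
      (over-equal (inj₂ p₀) v j _ 2 (inj₂ pv) (inj₁ refl))
      (fresh (sizeT u) r , fresh-lower (sizeT u) r , ℕₚ.+-monoʳ-≤ 14 (ℕₚ.+-monoˡ-≤ r (ℕₚ.m≤n+m (sizeT u) (sizeT t))) ,
       scoped-weaken (termTree _ _ 0 (sizeT u + r) t) ℕₚ.≤-refl (ℕₚ.≤-reflexive (cong (14 +_) (sym (ℕₚ.+-assoc (sizeT t) (sizeT u) r))))
         (termTree-scoped (inj₂ p₀) (inj₂ ∘ p) nP nT t (inj₁ refl)) ,
       termTree-scoped (inj₂ p₀) (inj₂ ∘ p) nP nT u (inj₁ refl))
  termTree-scoped p₀ p nP nT (t ⊗ u) {v} {j} {r} pv =
    (fresh-lower (sizeT t + sizeT u) r , ℕₚ.≤-refl) , nT ,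
    scoped-ltl-conj (equalT (v , j) (fresh (sizeT t + sizeT u) r , 2)) (conj (termTree _ _ 0 (sizeT u + r) t) (termTree _ _ 1 r u)) (fresh-lower (sizeT t + sizeT u) r)
      (over-equal (inj₂ p₀) v j _ 2 (inj₂ pv) (inj₁ refl))
      (fresh (sizeT u) r , fresh-lower (sizeT u) r , ℕₚ.+-monoʳ-≤ 14 (ℕₚ.+-monoˡ-≤ r (ℕₚ.m≤n+m (sizeT u) (sizeT t))) ,
       scoped-weaken (termTree _ _ 0 (sizeT u + r) t) ℕₚ.≤-refl (ℕₚ.≤-reflexive (cong (14 +_) (sym (ℕₚ.+-assoc (sizeT t) (sizeT u) r))))
         (termTree-scoped (inj₂ p₀) (inj₂ ∘ p) nP nT t (inj₁ refl)) ,
       termTree-scoped (inj₂ p₀) (inj₂ ∘ p) nP nT u (inj₁ refl))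

  -- More input remains while the left subtree is processed, so all its names lie above those of the
  -- right one; `fresh b r` separates them.
  pair-scoped : ∀ {P N lo} A B a b r → lo ≡ 14 + r → Scoped P N (fresh b r) (fresh a (b + r)) A → Scoped P N lo (fresh b r) B →
                Scoped P N lo (fresh (a + b) r) (conj A B)
  pair-scoped A B a b r refl s s′ = fresh b r , fresh-lower b r , ℕₚ.+-monoʳ-≤ 14 (ℕₚ.+-monoˡ-≤ r (ℕₚ.m≤n+m b a)) ,
    scoped-weaken A ℕₚ.≤-refl (ℕₚ.≤-reflexive (cong (14 +_) (sym (ℕₚ.+-assoc a b r)))) s , s′

  atomTree-scoped : ∀ ρ r α → Scoped (visible ρ) (nonempty ρ) (14 + r) (fresh (sizeA α) r) (atomTree ρ r α)
  atomTree-scoped ρ r (t ≐ u) = (fresh-lower _ r , ℕₚ.≤-refl) , tt ,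
    pair-scoped (termTree ρ _ 0 (sizeT u + r) t) (termTree ρ _ 0 r u) (sizeT t) (sizeT u) r refl
      (termTree-scoped (inj₂ (visible-global ρ (s≤s z≤n))) (inj₂ ∘ find-visible ρ num) (inj₂ (nonempty-plus ρ)) (inj₂ (nonempty-times ρ)) t (inj₁ refl))
      (termTree-scoped (inj₂ (visible-global ρ (s≤s z≤n))) (inj₂ ∘ find-visible ρ num) (inj₂ (nonempty-plus ρ)) (inj₂ (nonempty-times ρ)) u (inj₁ refl))
  atomTree-scoped ρ r (t ≺ u) = (fresh-lower _ r , ℕₚ.≤-refl) , tt ,
    scoped-ltl-conj (lessT (fresh (sizeT t + sizeT u) r)) (conj (termTree ρ _ 0 (sizeT u + r) t) (termTree ρ _ 1 r u)) (fresh-lower _ r)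
      (over-less (inj₂ (visible-global ρ (s≤s z≤n))) _ (inj₁ refl))
    (pair-scoped (termTree ρ _ 0 (sizeT u + r) t) (termTree ρ _ 1 r u) (sizeT t) (sizeT u) r refl
      (termTree-scoped (inj₂ (visible-global ρ (s≤s z≤n))) (inj₂ ∘ find-visible ρ num) (inj₂ (nonempty-plus ρ)) (inj₂ (nonempty-times ρ)) t (inj₁ refl))
      (termTree-scoped (inj₂ (visible-global ρ (s≤s z≤n))) (inj₂ ∘ find-visible ρ num) (inj₂ (nonempty-plus ρ)) (inj₂ (nonempty-times ρ)) u (inj₁ refl)))
  atomTree-scoped ρ r (t ∈ˢ x) = (fresh-lower _ r , ℕₚ.≤-refl) , tt ,
    pair-scoped (termTree ρ _ 0 (suc x + r) t) (ltl (meetT _ (find ρ set x))) (sizeT t) (suc x) r refl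
      (termTree-scoped (inj₂ (visible-global ρ (s≤s z≤n))) (inj₂ ∘ find-visible ρ num) (inj₂ (nonempty-plus ρ)) (inj₂ (nonempty-times ρ)) t (inj₁ refl))
      (over-meet (inj₂ (visible-global ρ (s≤s z≤n))) (fresh (sizeT t + suc x) r) (find ρ set x) (inj₁ refl) (inj₂ (find-visible ρ set x)))
  atomTree-scoped ρ r (x ∈ᶠ y) = (fresh-lower _ r , ℕₚ.≤-refl) , find-nonempty ρ y ,
    over-or (at 1 (fresh (suc x + suc y) r)) (equalT (fresh (suc x + suc y) r , 0) (find ρ set x , 0)) (over-at 1 _ (inj₁ refl))
      (over-equal (inj₂ (visible-global ρ (s≤s z≤n))) _ 0 (find ρ set x) 0 (inj₁ refl) (inj₂ (find-visible ρ set x)))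

  target-blockOf : ∀ s i → target (blockOf s i) ≡ i
  target-blockOf num    i = refl
  target-blockOf set    i = refl
  target-blockOf family i = refl

  refers-blockOf : ∀ s ρ i → RefersTo (nonempty ρ) (blockOf s i)
  refers-blockOf num    ρ i = nonempty-plus ρ
  refers-blockOf set    ρ i = tt
  refers-blockOf family ρ i = tt

  tree-scoped : ∀ ρ r φ → Scoped (visible ρ) (nonempty ρ) (14 + r) (fresh (size φ) r) (tree ρ r φ)
  quantifier-scoped : ∀ ρ r s x φ → let i = fresh (suc x + size φ) r ; q = blockOf s i in
    (14 + r ≤ target q × target q < fresh (suc (suc x + size φ)) r) × RefersTo (nonempty ρ) q ×
    Scoped (visible ρ ∪ target q) (grow (nonempty ρ) q) (14 + r) (target q) (tree ((s , x , i) ∷ ρ) r φ)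
  tree-scoped ρ r (atom α)      = atomTree-scoped ρ r α
  tree-scoped ρ r (A.not φ)     = scoped-weaken (tree ρ r φ) ℕₚ.≤-refl (ℕₚ.n≤1+n _) (tree-scoped ρ r φ)
  tree-scoped ρ r (φ A.and χ)   = scoped-weaken (conj (tree ρ (size χ + r) φ) (tree ρ r χ)) ℕₚ.≤-refl (ℕₚ.n≤1+n _)
    (pair-scoped (tree ρ (size χ + r) φ) (tree ρ r χ) (size φ) (size χ) r refl (tree-scoped ρ (size χ + r) φ) (tree-scoped ρ r χ))
  tree-scoped ρ r (φ A.or χ)    = scoped-weaken (disj (tree ρ (size χ + r) φ) (tree ρ r χ)) ℕₚ.≤-refl (ℕₚ.n≤1+n _)
    (pair-scoped (tree ρ (size χ + r) φ) (tree ρ r χ) (size φ) (size χ) r refl (tree-scoped ρ (size χ + r) φ) (tree-scoped ρ r χ))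
  tree-scoped ρ r (A.all s x φ) = quantifier-scoped ρ r s x φ
  tree-scoped ρ r (A.ex s x φ)  = quantifier-scoped ρ r s x φ
  quantifier-scoped ρ r s x φ rewrite target-blockOf s (fresh (suc x + size φ) r) =
    (fresh-lower _ r , ℕₚ.≤-refl) , refers-blockOf s ρ _ ,
    scoped-weaken (tree ((s , x , fresh (suc x + size φ) r) ∷ ρ) r φ) ℕₚ.≤-refl (ℕₚ.+-monoʳ-≤ 14 (ℕₚ.+-monoˡ-≤ r (ℕₚ.m≤n+m (size φ) (suc x))))
      (tree-scoped ((s , x , fresh (suc x + size φ) r) ∷ ρ) r φ)

-- Correctness of the translation into trees

module LowerCorrectness (em : ExcludedMiddle (lsuc 0ℓ)) (ext : Extensionality (lsuc 0ℓ) (lsuc 0ℓ)) (n₀ : ℕ) where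

  open Prenexing n₀
  open Classical em
  open Tracks em n₀
  open Tables em n₀
  open LowerTranslation n₀
  open H using (Trace; TraceSet; Assignment; var)
  open Assignment
  open A using (Sort; num; set; family; Term; _⊕_; _⊗_; Atom; _≐_; _≺_; _∈ˢ_; _∈ᶠ_; atom; Env; Domain; assign)

  record Standard (Π : Assignment) : Set₁ where
    field
      κ           : Trace
      clock       : Clock κ
      hasClock    : traceOf Π 0 ≡ just κ
      Plus Times  : TraceSet
      plus-sums   : Table _+_ Plus
      times-prods : Table _*_ Times
      hasPlus     : setOf Π (var plusTable) ≡ just Plus
      hasTimes    : setOf Π (var timesTable) ≡ just Times

  standard-put : ∀ q {Π} d → 14 ≤ target q → Standard Π → Standard (put q Π d)
  standard-put q {Π} d h st = record
    { κ = κ ; clock = clock ; hasClock = trans (sym (Agree.traces unchanged 0 (small (s≤s z≤n)))) hasClock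
    ; Plus = Plus ; Times = Times ; plus-sums = plus-sums ; times-prods = times-prods
    ; hasPlus  = trans (sym (Agree.sets unchanged plusTable (small (s≤s (s≤s z≤n))))) hasPlus
    ; hasTimes = trans (sym (Agree.sets unchanged timesTable (small (s≤s (s≤s (s≤s (s≤s (s≤s (s≤s (s≤s z≤n)))))))))) hasTimes }
    where
    open Standard st
    unchanged : Agree (Outside 14 (suc (target q))) (Outside 14 (suc (target q))) Π (put q Π d)
    unchanged = off-put q d h ℕₚ.≤-refl
    small : ∀ {v} → v < 14 → Outside 14 (suc (target q)) v
    small = inj₁

  value : ∀ s → Env → ℕ → Domain s
  value num    e x = lift (Env.nums e x)
  value set    e x = lift (Env.sets e x)
  value family e x = Env.families e x

  value-same : ∀ s {e} x d → value s (assign s e x d) x ≡ d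
  value-same num    {e} x (lift d) = cong lift (update-hit {_≟_ = ℕₚ._≟_} {f = Env.nums e} {v = x} {d} refl)
  value-same set    {e} x (lift d) = cong lift (update-hit {_≟_ = ℕₚ._≟_} {f = Env.sets e} {v = x} {d} refl)
  value-same family {e} x d        = update-hit {_≟_ = ℕₚ._≟_} {f = Env.families e} {v = x} {d} refl

  value-other : ∀ s s′ {e} x x′ d → (s′ , x′) ≢ (s , x) → value s′ (assign s e x d) x′ ≡ value s′ e x′
  value-other num    num    {e} x x′ (lift d) ≠ = cong lift (update-miss {_≟_ = ℕₚ._≟_} {f = Env.nums e} {v = x} {d} {x′} λ { refl → ≠ refl })
  value-other num    set    x x′ d ≠ = refl
  value-other num    family x x′ d ≠ = refl
  value-other set    num    x x′ d ≠ = refl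
  value-other set    set    {e} x x′ (lift d) ≠ = cong lift (update-miss {_≟_ = ℕₚ._≟_} {f = Env.sets e} {v = x} {d} {x′} λ { refl → ≠ refl })
  value-other set    family x x′ d ≠ = refl
  value-other family num    x x′ d ≠ = refl
  value-other family set    x x′ d ≠ = refl
  value-other family family {e} x x′ d ≠ = update-miss {_≟_ = ℕₚ._≟_} {f = Env.families e} {v = x} {d} {x′} λ { refl → ≠ refl }

  -- Only elements tagged on track 1 count as members. Untagged ones keep the set nonempty even when
  -- the family is empty, as prenexing demands.
  Codes : TraceSet → Pred (ℕ → Bool) 0ℓ → Set
  Codes S F = ∀ s → F s ⇔ (∃[ t ] S t × T (track t 1 0) × (∀ r → track t 0 r ≡ s r))

  Represents : ∀ s → Assignment → ℕ → Domain s → Set₁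
  Represents num    Π i (lift m) = Lift (lsuc 0ℓ) (∃[ t ] traceOf Π i ≡ just t × Is t 0 m)
  Represents set    Π i (lift s) = Lift (lsuc 0ℓ) (∃[ t ] traceOf Π i ≡ just t × (∀ r → track t 0 r ≡ s r))
  Represents family Π i F        = Σ[ S ∈ TraceSet ] setOf Π (var i) ≡ just S × Codes S F

  represents-agree : ∀ s {P N Π Π′ i d} → Agree P N Π Π′ → P i → N i → Represents s Π i d → Represents s Π′ i d
  represents-agree num    (agree a _) p q (lift (t , eq , h)) = lift (t , trans (sym (a _ p)) eq , h)
  represents-agree set    (agree a _) p q (lift (t , eq , h)) = lift (t , trans (sym (a _ p)) eq , h)
  represents-agree family (agree _ a) p q (S , eq , h)        = S , trans (sym (a _ q)) eq , h

  -- All names in use are at least hi. Blocks bound later use names below hi and hence cannot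
  -- overwrite them.
  Related : Assignment → Env → List Binding → ℕ → (Sort → ℕ → Set) → Set₁
  Related Π e ρ hi occurs = ∀ s x → occurs s x → Lift (lsuc 0ℓ) (hi ≤ find ρ s x) × Represents s Π (find ρ s x) (value s e x)

  related-weaken : ∀ {Π e ρ hi hi′} {O O′ : Sort → ℕ → Set} → hi′ ≤ hi → (∀ s x → O′ s x → O s x) → Related Π e ρ hi O → Related Π e ρ hi′ O′
  related-weaken h ⊆ rel s x o = let lift l , m = rel s x (⊆ s x o) in lift (ℕₚ.≤-trans h l) , m

  related-put : ∀ q {Π e ρ hi O} d → target q < hi → Related Π e ρ hi O → Related (put q Π d) e ρ (target q) O
  related-put q {Π} {ρ = ρ} d h rel s x o = let lift l , m = rel s x o in
    lift (ℕₚ.≤-trans (ℕₚ.<⇒≤ h) l) , represents-agree s (off-put q d ℕₚ.≤-refl ℕₚ.≤-refl) (inj₂ (ℕₚ.≤-trans h l)) (inj₂ (ℕₚ.≤-trans h l)) m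

  related-bind : ∀ q {Π e ρ hi O} s x {a} d → target q < hi → Related Π e ρ hi (λ s′ x′ → (s′ , x′) ≢ (s , x) × O s′ x′) →
                 Represents s (put q Π d) (target q) a → Related (put q Π d) (assign s e x a) ((s , x , target q) ∷ ρ) (target q) O
  related-bind q {Π} {e} {ρ} s x {a} d h rel m s′ x′ o with (s′ , x′) ≟ᵛ (s , x)
  ... | yes refl = lift ℕₚ.≤-refl , subst (Represents s _ _) (sym (value-same s x a)) m
  ... | no ≠ = map₂ (subst (Represents s′ _ _) (sym (value-other s s′ x x′ a ≠))) (related-put q {ρ = ρ} d h rel s′ x′ (≠ , o))

  ltl-means : ∀ {Π ψ P} → Means (traceOf Π) 0 ψ P → ⟦ ltl ψ ⟧ Π ⇔ P
  ltl-means {Π} {ψ} m = Lift-⇔ ⟫ reading Π ψ m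

  witness : ∀ q {Π} → Dom q Π → Trace
  witness (any _)      (_ , t , _)     = t
  witness (inside _ _) (_ , _ , t , _) = t

  put-trace : ∀ q {Π} d → traceOf (put q Π d) (target q) ≡ just (witness q d)
  put-trace (any i)      d = update-hit {_≟_ = ℕₚ._≟_} {v = i} refl
  put-trace (inside i _) d = update-hit {_≟_ = ℕₚ._≟_} {v = i} refl

  put-other : ∀ q {Π} d {v} → target q ≢ v → traceOf (put q Π d) v ≡ traceOf Π v
  put-other (any i)      d ≠ = update-miss {_≟_ = ℕₚ._≟_} ≠
  put-other (inside i _) d ≠ = update-miss {_≟_ = ℕₚ._≟_} ≠

  module _ {Π : H.Assignment} (st : Standard Π) where
    open Standard st

    equal-means : ∀ v w {t u} i j → traceOf Π v ≡ just t → traceOf Π w ≡ just u →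
                  ⟦ ltl (equalT (v , i) (w , j)) ⟧ Π ⇔ SameTrack (t , i) (u , j)
    equal-means v w i j eq eq′ = ltl-means {Π} {equalT (v , i) (w , j)} (Clocked.means-equal clock hasClock {v} {w} i j eq eq′)

  Numbers : Term → Sort → ℕ → Set
  Numbers t num x = A.OccursTerm x t
  Numbers t _   x = ⊥

  fresh-mono : ∀ {a b} r → a ≤ b → fresh a r ≤ fresh b r
  fresh-mono r l = ℕₚ.+-monoʳ-≤ 14 (ℕₚ.+-monoˡ-≤ r l)

  fresh-left : ∀ a b r → fresh a (b + r) ≤ fresh (a + b) r
  fresh-left a b r = ℕₚ.≤-reflexive (cong (14 +_) (sym (ℕₚ.+-assoc a b r)))

  fresh-right : ∀ a b r → fresh b r ≤ fresh (a + b) r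
  fresh-right a b r = fresh-mono r (ℕₚ.m≤n+m b a)

  term-correct : ∀ t {Π e ρ v j r w} → Standard Π → Related Π e ρ (fresh (sizeT t) r) (Numbers t) → fresh (sizeT t) r ≤ v →
                 traceOf Π v ≡ just w → ⟦ termTree ρ v j r t ⟧ Π ⇔ Is w j (A.⟦ t ⟧ e)
  -- By soundness of the table, the first two tracks of an entry determine the third; by
  -- completeness there is an entry for the values of t and u.
  operation-correct : ∀ t u {Π e ρ v j r w} y _⊙_ S → Standard Π → setOf Π (var y) ≡ just S → Table _⊙_ S →
                      Related Π e ρ (fresh (suc (sizeT t + sizeT u)) r) (λ s x → Numbers t s x ⊎ Numbers u s x) →
                      fresh (suc (sizeT t + sizeT u)) r ≤ v → traceOf Π v ≡ just w → let i = fresh (sizeT t + sizeT u) r in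
                      ⟦ ex (inside i y) (conj (ltl (equalT (v , j) (i , 2))) (conj (termTree ρ i 0 (sizeT u + r) t) (termTree ρ i 1 r u))) ⟧ Π
                      ⇔ Is w j (A.⟦ t ⟧ e ⊙ A.⟦ u ⟧ e)
  term-correct (A.var x) {Π} {e} {ρ} {v} {j} {w = w} st rel v≥ eq with rel num x refl
  ... | _ , lift (u , eq′ , h) = equal-means {Π} st v (find ρ num x) j 0 eq eq′ ⟫ mk⇔ (λ s → is-same s h) (λ h′ → same-is h′ h)
  term-correct (t ⊕ u) {ρ = ρ} st rel v≥ eq = operation-correct t u plusTable _+_ (Standard.Plus st) st (Standard.hasPlus st) (Standard.plus-sums st)
    (related-weaken {ρ = ρ} ℕₚ.≤-refl (λ { num x o → o ; set x (inj₁ ()) ; set x (inj₂ ()) ; family x (inj₁ ()) ; family x (inj₂ ()) }) rel) v≥ eq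
  term-correct (t ⊗ u) {ρ = ρ} st rel v≥ eq = operation-correct t u timesTable _*_ (Standard.Times st) st (Standard.hasTimes st) (Standard.times-prods st)
    (related-weaken {ρ = ρ} ℕₚ.≤-refl (λ { num x o → o ; set x (inj₁ ()) ; set x (inj₂ ()) ; family x (inj₁ ()) ; family x (inj₂ ()) }) rel) v≥ eq
  operation-correct t u {Π} {e} {ρ} {v} {j} {r} {w} y _⊙_ S st hasS (sound , complete) rel v≥ eq = mk⇔
    (λ ((S′ , eq′ , z , sz) , q , m , m′) → forth S′ eq′ z sz q m m′)
    (λ h → let z , sz , g , g′ , g″ = complete (A.⟦ t ⟧ e) (A.⟦ u ⟧ e) ; d = S , hasS , z , sz in
      d , from (same? d) (same-is h g″) , from (left? d) g , from (right? d) g′)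
    where
    i : ℕ
    i = fresh (sizeT t + sizeT u) r
    q₁ : Block
    q₁ = inside i y
    st′ : ∀ d → Standard (put q₁ Π d)
    st′ d = standard-put q₁ d (ℕₚ.m≤m+n 14 _) st
    rel′ : ∀ d → Related (put q₁ Π d) e ρ i (λ s x → Numbers t s x ⊎ Numbers u s x)
    rel′ d = related-put q₁ {ρ = ρ} d ℕₚ.≤-refl rel
    same? : ∀ (d : Dom q₁ Π) → ⟦ ltl (equalT (v , j) (i , 2)) ⟧ (put q₁ Π d) ⇔ SameTrack (w , j) (witness q₁ {Π} d , 2)
    same? d = equal-means {put q₁ Π d} (st′ d) v i j 2 (trans (put-other q₁ {Π} d (ℕₚ.<⇒≢ v≥)) eq) (put-trace q₁ {Π} d)
    left? : ∀ (d : Dom q₁ Π) → ⟦ termTree ρ i 0 (sizeT u + r) t ⟧ (put q₁ Π d) ⇔ Is (witness q₁ {Π} d) 0 (A.⟦ t ⟧ e)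
    left? d = term-correct t (st′ d) (related-weaken {ρ = ρ} (fresh-left (sizeT t) (sizeT u) r) (λ _ _ → inj₁) (rel′ d))
                (fresh-left (sizeT t) (sizeT u) r) (put-trace q₁ {Π} d)
    right? : ∀ (d : Dom q₁ Π) → ⟦ termTree ρ i 1 r u ⟧ (put q₁ Π d) ⇔ Is (witness q₁ {Π} d) 1 (A.⟦ u ⟧ e)
    right? d = term-correct u (st′ d) (related-weaken {ρ = ρ} (fresh-right (sizeT t) (sizeT u) r) (λ _ _ → inj₂) (rel′ d))
                (fresh-right (sizeT t) (sizeT u) r) (put-trace q₁ {Π} d)
    forth : ∀ S′ eq′ z sz → let d = S′ , eq′ , z , sz in ⟦ ltl (equalT (v , j) (i , 2)) ⟧ (put q₁ Π d) →
            ⟦ termTree ρ i 0 (sizeT u + r) t ⟧ (put q₁ Π d) → ⟦ termTree ρ i 1 r u ⟧ (put q₁ Π d) → Is w j (A.⟦ t ⟧ e ⊙ A.⟦ u ⟧ e)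
    forth S′ eq′ z sz q m m′ with trans (sym hasS) eq′
    ... | refl with sound z sz
    ... | _ , _ , g , g′ , g″ = is-cong (cong₂ _⊙_ (is-unique g (to (left? (S′ , eq′ , z , sz)) m)) (is-unique g′ (to (right? (S′ , eq′ , z , sz)) m′)))
                                  (is-same (to (same? (S′ , eq′ , z , sz)) q) g″)

  anyTrace : ∀ i {Π} → Trace → Dom (any i) Π
  anyTrace i t = (λ _ → ⊤) , t , tt

  atom-correct : ∀ α {Π e ρ r} → Standard Π → Related Π e ρ (fresh (sizeA α) r) (λ s x → A.OccursAtom s x α) →
                 ⟦ atomTree ρ r α ⟧ Π ⇔ (e A.⊨ atom α)
  atom-correct (t ≐ u) {Π} {e} {ρ} {r} st rel = mk⇔
    (λ (d , m , m′) → lift (is-unique (to (left? d) m) (to (right? d) m′)))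
    (λ (lift eq) → let g , _ = triple-is (A.⟦ t ⟧ e) 0 0 ; d = anyTrace i {Π} (triple (A.⟦ t ⟧ e) 0 0) in
      d , from (left? d) g , from (right? d) (is-cong eq g))
    where
    i : ℕ
    i = fresh (sizeT t + sizeT u) r
    st′ : ∀ d → Standard (put (any i) Π d)
    st′ d = standard-put (any i) d (ℕₚ.m≤m+n 14 _) st
    rel′ : ∀ d → Related (put (any i) Π d) e ρ i (λ s x → A.OccursAtom s x (t ≐ u))
    rel′ d = related-put (any i) {ρ = ρ} d ℕₚ.≤-refl rel
    left? : ∀ (d : Dom (any i) Π) → ⟦ termTree ρ i 0 (sizeT u + r) t ⟧ (put (any i) Π d) ⇔ Is (witness (any i) {Π} d) 0 (A.⟦ t ⟧ e)
    left? d = term-correct t (st′ d) (related-weaken {ρ = ρ} (fresh-left (sizeT t) (sizeT u) r) (λ { num _ o → inj₁ o ; set _ () ; family _ () }) (rel′ d))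
                (fresh-left (sizeT t) (sizeT u) r) (put-trace (any i) {Π} d)
    right? : ∀ (d : Dom (any i) Π) → ⟦ termTree ρ i 0 r u ⟧ (put (any i) Π d) ⇔ Is (witness (any i) {Π} d) 0 (A.⟦ u ⟧ e)
    right? d = term-correct u (st′ d) (related-weaken {ρ = ρ} (fresh-right (sizeT t) (sizeT u) r) (λ { num _ o → inj₂ o ; set _ () ; family _ () }) (rel′ d))
                (fresh-right (sizeT t) (sizeT u) r) (put-trace (any i) {Π} d)
  atom-correct (t ≺ u) {Π} {e} {ρ} {r} st rel = mk⇔
    (λ (d , m , m′ , m″) → let a , b , lt , x , y = to (less? d) m in
      lift (subst₂ _<_ (is-at (to (left? d) m′) x) (is-at (to (right? d) m″) y) lt))
    (λ (lift lt) → let g , g′ , _ = triple-is (A.⟦ t ⟧ e) (A.⟦ u ⟧ e) 0 ; d = anyTrace i {Π} (triple (A.⟦ t ⟧ e) (A.⟦ u ⟧ e) 0) in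
      d , from (less? d) (A.⟦ t ⟧ e , A.⟦ u ⟧ e , lt , is-member g , is-member g′) , from (left? d) g , from (right? d) g′)
    where
    i : ℕ
    i = fresh (sizeT t + sizeT u) r
    st′ : ∀ d → Standard (put (any i) Π d)
    st′ d = standard-put (any i) d (ℕₚ.m≤m+n 14 _) st
    rel′ : ∀ d → Related (put (any i) Π d) e ρ i (λ s x → A.OccursAtom s x (t ≺ u))
    rel′ d = related-put (any i) {ρ = ρ} d ℕₚ.≤-refl rel
    less? : ∀ (d : Dom (any i) Π) → let w = witness (any i) {Π} d in
            ⟦ ltl (lessT i) ⟧ (put (any i) Π d) ⇔ (∃[ a ] ∃[ b ] a < b × T (track w 0 a) × T (track w 1 b))
    less? d = ltl-means {put (any i) Π d} {lessT i} (Clocked.means-less (Standard.clock (st′ d)) (Standard.hasClock (st′ d)) (put-trace (any i) {Π} d))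
    left? : ∀ (d : Dom (any i) Π) → ⟦ termTree ρ i 0 (sizeT u + r) t ⟧ (put (any i) Π d) ⇔ Is (witness (any i) {Π} d) 0 (A.⟦ t ⟧ e)
    left? d = term-correct t (st′ d) (related-weaken {ρ = ρ} (fresh-left (sizeT t) (sizeT u) r) (λ { num _ o → inj₁ o ; set _ () ; family _ () }) (rel′ d))
                (fresh-left (sizeT t) (sizeT u) r) (put-trace (any i) {Π} d)
    right? : ∀ (d : Dom (any i) Π) → ⟦ termTree ρ i 1 r u ⟧ (put (any i) Π d) ⇔ Is (witness (any i) {Π} d) 1 (A.⟦ u ⟧ e)
    right? d = term-correct u (st′ d) (related-weaken {ρ = ρ} (fresh-right (sizeT t) (sizeT u) r) (λ { num _ o → inj₂ o ; set _ () ; family _ () }) (rel′ d))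
                (fresh-right (sizeT t) (sizeT u) r) (put-trace (any i) {Π} d)
  atom-correct (t ∈ˢ x) {Π} {e} {ρ} {r} st rel = mk⇔
    (λ (d , m , m′) → let a , y , z = to (meet? d) m′ in
      lift (subst (T ∘ Env.sets e x) (is-at (to (left? d) m) y) (subst T (same-set a) z)))
    (λ (lift x∈) → let g , _ = triple-is (A.⟦ t ⟧ e) 0 0 ; d = anyTrace i {Π} (triple (A.⟦ t ⟧ e) 0 0) in
      d , from (left? d) g , from (meet? d) (A.⟦ t ⟧ e , is-member g , subst T (sym (same-set (A.⟦ t ⟧ e))) x∈))
    where
    i : ℕ
    i = fresh (sizeT t + suc x) r
    st′ : ∀ d → Standard (put (any i) Π d)
    st′ d = standard-put (any i) d (ℕₚ.m≤m+n 14 _) st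
    rel′ : ∀ d → Related (put (any i) Π d) e ρ i (λ s y → A.OccursAtom s y (t ∈ˢ x))
    rel′ d = related-put (any i) {ρ = ρ} d ℕₚ.≤-refl rel
    u : Trace
    u = proj₁ (lower (proj₂ (rel set x refl)))
    same-set : ∀ a → track u 0 a ≡ Env.sets e x a
    same-set = proj₂ (proj₂ (lower (proj₂ (rel set x refl))))
    meet? : ∀ (d : Dom (any i) Π) → let w = witness (any i) {Π} d in
            ⟦ ltl (meetT i (find ρ set x)) ⟧ (put (any i) Π d) ⇔ (∃[ a ] T (track w 0 a) × T (track u 0 a))
    meet? d = ltl-means {put (any i) Π d} {meetT i (find ρ set x)} (Clocked.means-meet (Standard.clock (st′ d)) (Standard.hasClock (st′ d)) {v = i} {w = find ρ set x} (put-trace (any i) {Π} d)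
                (trans (put-other (any i) {Π} d (ℕₚ.<⇒≢ (lower (proj₁ (rel set x refl))))) (proj₁ (proj₂ (lower (proj₂ (rel set x refl)))))))
    left? : ∀ (d : Dom (any i) Π) → ⟦ termTree ρ i 0 (suc x + r) t ⟧ (put (any i) Π d) ⇔ Is (witness (any i) {Π} d) 0 (A.⟦ t ⟧ e)
    left? d = term-correct t (st′ d) (related-weaken {ρ = ρ} (fresh-left (sizeT t) (suc x) r) (λ { num _ o → o ; set _ () ; family _ () }) (rel′ d))
                (fresh-left (sizeT t) (suc x) r) (put-trace (any i) {Π} d)
  atom-correct (x ∈ᶠ y) {Π} {e} {ρ} {r} st rel with rel set x refl | rel family y refl
  ... | lift l , lift (u , equ , same-set) | _ , S , eqS , codes = mk⇔
    (λ ((S′ , eq′ , w , sw) , m) → forth S′ eq′ w sw m)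
    (λ (lift m) → let w , sw , tag , eq = to (codes (Env.sets e x)) m in back w sw tag eq)
    where
    i : ℕ
    i = fresh (suc x + suc y) r
    q : Block
    q = inside i (find ρ family y)
    st′ : ∀ d → Standard (put q Π d)
    st′ d = standard-put q d (ℕₚ.m≤m+n 14 _) st
    member? : ∀ (d : Dom q Π) → let w = witness q {Π} d in
              ⟦ ltl (at 1 i andL equalT (i , 0) (find ρ set x , 0)) ⟧ (put q Π d) ⇔ (T (track w 1 0) × SameTrack (w , 0) (u , 0))
    member? d = ltl-means {put q Π d} {at 1 i andL equalT (i , 0) (find ρ set x , 0)} (means-and (means-at {v = i} {i = 0} 1 (put-trace q {Π} d))
      (Clocked.means-equal (Standard.clock (st′ d)) (Standard.hasClock (st′ d)) {v = i} {w = find ρ set x} 0 0 (put-trace q {Π} d)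
        (trans (put-other q {Π} d (ℕₚ.<⇒≢ l)) equ)))
    back : ∀ w → S w → T (track w 1 0) → (∀ a → track w 0 a ≡ Env.sets e x a) → ⟦ atomTree ρ r (x ∈ᶠ y) ⟧ Π
    back w sw tag eq = (S , eqS , w , sw) , from (member? (S , eqS , w , sw)) (tag , same λ a → trans (eq a) (sym (same-set a)))
    forth : ∀ S′ eq′ w sw → ⟦ ltl (at 1 i andL equalT (i , 0) (find ρ set x , 0)) ⟧ (put q Π (S′ , eq′ , w , sw)) → e A.⊨ atom (x ∈ᶠ y)
    forth S′ eq′ w sw m with trans (sym eqS) eq′
    ... | refl = let tag , same eq = to (member? (S′ , eq′ , w , sw)) m in
      lift (from (codes (Env.sets e x)) (w , sw , tag , λ a → trans (eq a) (same-set a)))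

  tagged : (ℕ → Bool) → Bool → ℕ → ℕ → Bool
  tagged s b 0 r = s r
  tagged s b _ r = b

  setTrace : (ℕ → Bool) → Bool → Trace
  setTrace s b = weave (tagged s b)

  -- With `represent` this is the back-and-forth between a block and a sort: every element of the
  -- block denotes a value, and every value is denoted. Hence the quantifiers agree in
  -- `tree-correct`.
  represented : ∀ s i {Π} → Standard Π → (d : Dom (blockOf s i) Π) → Σ[ a ∈ Domain s ] Represents s (put (blockOf s i) Π d) (target (blockOf s i)) a
  represented num i {Π} st d@(S , eq , t , x) with trans (sym (Standard.hasPlus st)) eq
  ... | refl = let m , _ , h , _ = proj₁ (Standard.plus-sums st) t x in lift m , lift (t , put-trace (inside i plusTable) {Π} d , h)
  represented set i {Π} st d@(S , t , x) = lift (track t 0) , lift (t , put-trace (any i) {Π} d , λ _ → refl)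
  represented family i st (S , t , x) =
    (λ s → ∃[ t ] S t × T (track t 1 0) × (∀ r → track t 0 r ≡ s r)) , S , update-hit {_≟_ = H._≟ˢ_} {v = var i} refl , λ s → ⇔-refl

  represent : ∀ s i {Π} → Standard Π → (a : Domain s) → Σ[ d ∈ Dom (blockOf s i) Π ] Represents s (put (blockOf s i) Π d) (target (blockOf s i)) a
  represent num i {Π} st (lift m) = let t , x , h , _ = proj₂ (Standard.plus-sums st) m 0 ; d = Standard.Plus st , Standard.hasPlus st , t , x in
    d , lift (t , put-trace (inside i plusTable) {Π} d , h)
  represent set i {Π} st (lift s) = d , lift (setTrace s true , put-trace (any i) {Π} d , λ r → track-weave (tagged s true) 0 r (s≤s z≤n))
    where
    d : Dom (any i) Π
    d = anyTrace i {Π} (setTrace s true)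
  -- The element quantified along with the set is an untagged trace, so it exists for every F, also
  -- for the empty family.
  represent family i st F = (S , setTrace (λ _ → true) false , inj₁ (subst (¬_ ∘ T) (sym (track-weave (tagged (λ _ → true) false) 1 0 (s≤s (s≤s z≤n)))) id)) ,
    S , update-hit {_≟_ = H._≟ˢ_} {v = var i} refl , codes
    where
    S : TraceSet
    S t = ¬ T (track t 1 0) ⊎ F (track t 0)
    codes : Codes S F
    codes s = mk⇔
      (λ f → setTrace s true , inj₂ (subst F (sym (lower-extensionality (lsuc 0ℓ) (lsuc 0ℓ) ext λ r → track-weave (tagged s true) 0 r (s≤s z≤n))) f) ,
             subst T (sym (track-weave (tagged s true) 1 0 (s≤s (s≤s z≤n)))) tt , λ r → track-weave (tagged s true) 0 r (s≤s z≤n))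
      (λ { (t , inj₁ ¬tag , tag , _) → ⊥-elim (¬tag tag)
         ; (t , inj₂ f , _ , eq) → subst F (lower-extensionality (lsuc 0ℓ) (lsuc 0ℓ) ext eq) f })

  tree-correct : ∀ φ {Π e ρ r} → Standard Π → Related Π e ρ (fresh (size φ) r) (λ s x → A.Free s x φ) → ⟦ tree ρ r φ ⟧ Π ⇔ (e A.⊨ φ)
  instance-correct : ∀ s x φ {Π e ρ r} → let i = fresh (suc x + size φ) r ; q = blockOf s i in Standard Π →
                     Related Π e ρ (fresh (suc (suc x + size φ)) r) (λ s′ x′ → (s′ , x′) ≢ (s , x) × A.Free s′ x′ φ) →
                     ∀ d {a} → Represents s (put q Π d) (target q) a → ⟦ tree ((s , x , i) ∷ ρ) r φ ⟧ (put q Π d) ⇔ (assign s e x a A.⊨ φ)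
  tree-correct (atom α) st rel = atom-correct α st rel
  tree-correct (A.not φ) {ρ = ρ} {r} st rel = ¬-cong (tree-correct φ st (related-weaken {ρ = ρ} (fresh-mono r (ℕₚ.n≤1+n (size φ))) (λ _ _ → id) rel))
  tree-correct (φ A.and χ) {ρ = ρ} {r} st rel = ×-cong
    (tree-correct φ st (related-weaken {ρ = ρ} (ℕₚ.≤-trans (fresh-left (size φ) (size χ) r) (ℕₚ.n≤1+n _)) (λ _ _ → inj₁) rel))
    (tree-correct χ st (related-weaken {ρ = ρ} (ℕₚ.≤-trans (fresh-right (size φ) (size χ) r) (ℕₚ.n≤1+n _)) (λ _ _ → inj₂) rel))
  tree-correct (φ A.or χ) {ρ = ρ} {r} st rel = ⊎-cong
    (tree-correct φ st (related-weaken {ρ = ρ} (ℕₚ.≤-trans (fresh-left (size φ) (size χ) r) (ℕₚ.n≤1+n _)) (λ _ _ → inj₁) rel))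
    (tree-correct χ st (related-weaken {ρ = ρ} (ℕₚ.≤-trans (fresh-right (size φ) (size χ) r) (ℕₚ.n≤1+n _)) (λ _ _ → inj₂) rel))
  tree-correct (A.all s x φ) {ρ = ρ} st rel = mk⇔
    (λ f a → let d , m = represent s _ st a in to (instance-correct s x φ {ρ = ρ} st rel d m) (f d))
    (λ f d → let a , m = represented s _ st d in from (instance-correct s x φ {ρ = ρ} st rel d m) (f a))
  tree-correct (A.ex s x φ) {ρ = ρ} st rel = mk⇔
    (λ (d , y) → let a , m = represented s _ st d in a , to (instance-correct s x φ {ρ = ρ} st rel d m) y)
    (λ (a , y) → let d , m = represent s _ st a in d , from (instance-correct s x φ {ρ = ρ} st rel d m) y)
  instance-correct s x φ {Π} {e} {ρ} {r} st rel d {a} m =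
    tree-correct φ (standard-put q d (subst (14 ≤_) (sym q≡) (ℕₚ.m≤m+n 14 _)) st)
      (subst (λ j → Related (put q Π d) (assign s e x a) ((s , x , j) ∷ ρ) (fresh (size φ) r) (λ s x → A.Free s x φ)) q≡
        (related-weaken {ρ = (s , x , target q) ∷ ρ} (subst (fresh (size φ) r ≤_) (sym q≡) (fresh-mono r (ℕₚ.m≤n+m (size φ) (suc x)))) (λ _ _ → id)
          (related-bind q {ρ = ρ} s x d (subst (_< fresh (suc (suc x + size φ)) r) (sym q≡) ℕₚ.≤-refl) rel m)))
    where
    q : Block
    q = blockOf s (fresh (suc x + size φ) r)
    q≡ : target q ≡ fresh (suc x + size φ) r
    q≡ = target-blockOf s _

-- The sentence for the lower bound and its syntax

module LowerSentence (n : ℕ) where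

  open Prenexing n
  open TrackFormulas n
  open LowerTranslation n
  open H using (LTL; Formula; SetVar; var)

  allZeroL : ℕ → LTL
  allZeroL v = zeroT (v , 0) andL zeroT (v , 1) andL zeroT (v , 2)

  leftStepL rightStepL nextRowL : ℕ → ℕ → LTL
  leftStepL v w  = successorT (v , 0) (w , 0) andL equalT (v , 1) (w , 1) andL successorT (v , 2) (w , 2)
  rightStepL v w = equalT (v , 0) (w , 0) andL successorT (v , 1) (w , 1) andL successorT (v , 2) (w , 2)
  nextRowL v w   = successorT (v , 0) (w , 0) andL zeroT (v , 1) andL zeroT (v , 2)

  rowStepL : ℕ → ℕ → ℕ → LTL
  rowStepL v w d = equalT (v , 0) (w , 0) andL successorT (v , 1) (w , 1) andL
                   equalT (d , 0) (w , 2) andL equalT (d , 1) (w , 0) andL equalT (v , 2) (d , 2)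

  -- Trace 0 is the clock; 1 and 6 are the origins of the two tables, 2 and 7 their arbitrary entries, and the others
  -- the entries required by PlusStep (3 to 5) and TimesStep (8 to 13).
  tableAxioms axioms : LTL
  tableAxioms = allZeroL 1
    andL (leftStepL 3 2 andL rightStepL 4 2 andL somewhere (at 2 2) andL H._or_ (allZeroL 2) (H._or_ (leftStepL 2 5) (rightStepL 2 5)))
    andL allZeroL 6
    andL (rowStepL 8 7 11 andL nextRowL 9 7 andL (equalT (7 , 0) (13 , 0) andL equalT (7 , 1) (13 , 1)) andL
          H._or_ (zeroT (7 , 1) andL zeroT (7 , 2)) (rowStepL 7 10 12))
  axioms = isClock andL tableAxioms

  -- `true` marks an existential block. The first three blocks choose the clock and the two tables
  -- with their origins; then follow an arbitrary entry of each table and the entries demanded for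
  -- it.
  tables : List (Bool × Block)
  tables = (true , any 0) ∷ (true , any plusTable) ∷ (true , any timesTable) ∷
    (false , inside 2 plusTable) ∷ (true , inside 3 plusTable) ∷ (true , inside 4 plusTable) ∷ (true , inside 5 plusTable) ∷
    (false , inside 7 timesTable) ∷ (true , inside 8 timesTable) ∷ (true , inside 9 timesTable) ∷ (true , inside 10 timesTable) ∷
    (true , inside 11 plusTable) ∷ (true , inside 12 plusTable) ∷ (true , inside 13 plusTable) ∷ []

  closeAll : List (Bool × Block) → Formula → Formula
  closeAll []             φ = φ
  closeAll ((b , q) ∷ qs) φ = closeBlock b q (closeAll qs φ)

  body : A.Formula → Formula
  body φ = close true (tree [] 0 φ) (H.ltl (axioms andL matrix (tree [] 0 φ)))

  -- The translated formula stands in the scope of the universally quantified table entries. Its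
  -- truth does not depend on them, and the whole sentence stays prenex with a single conjunction as
  -- its matrix.
  lowerFormula : A.Formula → Formula
  lowerFormula φ = closeAll tables (body φ)

  -- Decides by evaluation that the axioms use only the reserved names.
  below : LTL → Bool
  below (H.⟨ _ ⟩ v)  = v ℕ.<ᵇ 14
  below (H.not ψ)    = below ψ
  below (H._or_ ψ χ) = below ψ ∧ below χ
  below (H._U_ ψ χ)  = below ψ ∧ below χ
  below (H.X ψ)      = below ψ

  below-sound : ∀ ψ → T (below ψ) → Over (_< 14) ψ
  below-sound (H.⟨ _ ⟩ v)  b w refl = ℕₚ.<ᵇ⇒< v 14 b
  below-sound (H.not ψ)    b w o = below-sound ψ b w o
  below-sound (H._or_ ψ χ) b w o = let b₁ , b₂ = to Boolₚ.T-∧ b in [ below-sound ψ b₁ w , below-sound χ b₂ w ]′ o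
  below-sound (H._U_ ψ χ)  b w o = let b₁ , b₂ = to Boolₚ.T-∧ b in [ below-sound ψ b₁ w , below-sound χ b₂ w ]′ o
  below-sound (H.X ψ)      b w o = below-sound ψ b w o

  axioms-below : Over (_< 14) axioms
  axioms-below = below-sound axioms tt

  block-free-trace : ∀ b q {φ v} → H.FreeTrace v (closeBlock b q φ) → v ≢ target q × H.FreeTrace v φ
  block-free-trace true  (any i)      f = f
  block-free-trace true  (inside i y) f = f
  block-free-trace false (any i)      f = f
  block-free-trace false (inside i y) f = f

  close-free-trace : ∀ b A {φ v} → H.FreeTrace v (close b A φ) → ¬ Bound v A × H.FreeTrace v φ
  close-free-trace b (ltl ψ)    f = (λ ()) , f
  close-free-trace b (neg A)    f = close-free-trace (¬ᵇ b) A f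
  close-free-trace b (conj A B) f = let ¬a , g = close-free-trace b A f ; ¬b , h = close-free-trace b B g in [ ¬a , ¬b ]′ , h
  close-free-trace b (disj A B) f = let ¬a , g = close-free-trace b A f ; ¬b , h = close-free-trace b B g in [ ¬a , ¬b ]′ , h
  close-free-trace b (all q A)  f = let ≢q , g = block-free-trace (¬ᵇ b) q f ; ¬a , h = close-free-trace b A g in [ ≢q , ¬a ]′ , h
  close-free-trace b (ex q A)   f = let ≢q , g = block-free-trace b q f ; ¬a , h = close-free-trace b A g in [ ≢q , ¬a ]′ , h

  block-free-set : ∀ b q {φ Y} {N : ℕ → Set} → RefersTo N q → H.FreeSet Y (closeBlock b q φ) →
                   (∃[ y ] Y ≡ var y × N y) ⊎ (H.FreeSet Y φ × (∀ y → Y ≡ var y → grow N q y → N y))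
  block-free-set true  (any i)      r (≢i , inj₁ eq) = ⊥-elim (≢i eq)
  block-free-set true  (any i)      r (≢i , inj₂ f)  = inj₂ (f , λ { y refl (inj₁ refl) → ⊥-elim (≢i refl) ; y eq (inj₂ p) → p })
  block-free-set false (any i)      r (≢i , inj₁ eq) = ⊥-elim (≢i eq)
  block-free-set false (any i)      r (≢i , inj₂ f)  = inj₂ (f , λ { y refl (inj₁ refl) → ⊥-elim (≢i refl) ; y eq (inj₂ p) → p })
  block-free-set true  (inside i y) r (inj₁ eq)      = inj₁ (y , eq , r)
  block-free-set true  (inside i y) r (inj₂ f)       = inj₂ (f , λ _ _ → id)
  block-free-set false (inside i y) r (inj₁ eq)      = inj₁ (y , eq , r)
  block-free-set false (inside i y) r (inj₂ f)       = inj₂ (f , λ _ _ → id)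

  close-free-set : ∀ b A {φ Y P N lo hi} → Scoped P N lo hi A → H.FreeSet Y (close b A φ) → (∃[ y ] Y ≡ var y × N y) ⊎ H.FreeSet Y φ
  close-free-set b (ltl ψ) s f = inj₂ f
  close-free-set b (neg A) s f = close-free-set (¬ᵇ b) A s f
  close-free-set b (conj A B) (_ , _ , _ , s , s′) f = [ inj₁ , close-free-set b B s′ ]′ (close-free-set b A s f)
  close-free-set b (disj A B) (_ , _ , _ , s , s′) f = [ inj₁ , close-free-set b B s′ ]′ (close-free-set b A s f)
  close-free-set b (all q A) (_ , r , s) f with block-free-set (¬ᵇ b) q r f
  ... | inj₁ x = inj₁ x
  ... | inj₂ (g , shrink) = Sum.map₁ (λ (y , eq , p) → y , eq , shrink y eq p) (close-free-set b A s g)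
  close-free-set b (ex q A) (_ , r , s) f with block-free-set b q r f
  ... | inj₁ x = inj₁ x
  ... | inj₂ (g , shrink) = Sum.map₁ (λ (y , eq , p) → y , eq , shrink y eq p) (close-free-set b A s g)

  tables-free-trace : ∀ {φ v} → H.FreeTrace v (closeAll tables φ) → ¬ v < 14 × H.FreeTrace v φ
  tables-free-trace {φ} {v} f = (λ lt → bound v lt f) , inner f
    where
    inner : H.FreeTrace v (closeAll tables φ) → H.FreeTrace v φ
    inner (_ , _ , _ , _ , _ , _ , _ , _ , _ , _ , _ , _ , _ , _ , f) = f
    bound : ∀ v → v < 14 → ¬ H.FreeTrace v (closeAll tables φ)
    bound 0  _ (≠ , _) = ≠ refl
    bound 1  _ (_ , ≠ , _) = ≠ refl
    bound 6  _ (_ , _ , ≠ , _) = ≠ refl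
    bound 2  _ (_ , _ , _ , ≠ , _) = ≠ refl
    bound 3  _ (_ , _ , _ , _ , ≠ , _) = ≠ refl
    bound 4  _ (_ , _ , _ , _ , _ , ≠ , _) = ≠ refl
    bound 5  _ (_ , _ , _ , _ , _ , _ , ≠ , _) = ≠ refl
    bound 7  _ (_ , _ , _ , _ , _ , _ , _ , ≠ , _) = ≠ refl
    bound 8  _ (_ , _ , _ , _ , _ , _ , _ , _ , ≠ , _) = ≠ refl
    bound 9  _ (_ , _ , _ , _ , _ , _ , _ , _ , _ , ≠ , _) = ≠ refl
    bound 10 _ (_ , _ , _ , _ , _ , _ , _ , _ , _ , _ , ≠ , _) = ≠ refl
    bound 11 _ (_ , _ , _ , _ , _ , _ , _ , _ , _ , _ , _ , ≠ , _) = ≠ refl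
    bound 12 _ (_ , _ , _ , _ , _ , _ , _ , _ , _ , _ , _ , _ , ≠ , _) = ≠ refl
    bound 13 _ (_ , _ , _ , _ , _ , _ , _ , _ , _ , _ , _ , _ , _ , ≠ , _) = ≠ refl
    bound (suc (suc (suc (suc (suc (suc (suc (suc (suc (suc (suc (suc (suc (suc v)))))))))))))) lt _ = ℕₚ.m+n≮m 14 v lt

  Origin : ℕ → Set
  Origin y = y ≡ 0 ⊎ y ≡ plusTable ⊎ y ≡ timesTable

  tables-free-set : ∀ {φ Y} → H.FreeSet Y (closeAll tables φ) → H.FreeSet Y φ × (∀ y → Y ≡ var y → ¬ Origin y)
  tables-free-set (n₀ , inj₁ eq) = ⊥-elim (n₀ eq)
  tables-free-set (n₀ , inj₂ (n₁ , inj₁ eq)) = ⊥-elim (n₁ eq)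
  tables-free-set (n₀ , inj₂ (n₁ , inj₂ (n₆ , inj₁ eq))) = ⊥-elim (n₆ eq)
  tables-free-set {φ} {Y} (n₀ , inj₂ (n₁ , inj₂ (n₆ , inj₂ f))) =
      -- One step per `inside` block of `tables`, the outermost block being treated first.
      p (p (p (t (t (t (t (p (p (p (p f)))))))))) ,
      λ { y eq (inj₁ refl) → n₀ eq ; y eq (inj₂ (inj₁ refl)) → n₁ eq ; y eq (inj₂ (inj₂ refl)) → n₆ eq }
    where
    p : ∀ {X : Set} → Y ≡ var plusTable ⊎ X → X
    p = [ (λ eq → ⊥-elim (n₁ eq)) , id ]′
    t : ∀ {X : Set} → Y ≡ var timesTable ⊎ X → X
    t = [ (λ eq → ⊥-elim (n₆ eq)) , id ]′

  block-Xa : ∀ b q {φ} → H.OccursSet H.Xa (closeBlock b q φ) → H.OccursSet H.Xa φ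
  block-Xa true  (any i)      (inj₂ (inj₂ o)) = o
  block-Xa true  (inside i y) (inj₂ o)        = o
  block-Xa false (any i)      (inj₂ (inj₂ o)) = o
  block-Xa false (inside i y) (inj₂ o)        = o

  closeAll-Xa : ∀ qs {φ} → H.OccursSet H.Xa (closeAll qs φ) → H.OccursSet H.Xa φ
  closeAll-Xa []             o = o
  closeAll-Xa ((b , q) ∷ qs) o = closeAll-Xa qs (block-Xa b q o)

  close-Xa : ∀ b A {φ} → H.OccursSet H.Xa (close b A φ) → H.OccursSet H.Xa φ
  close-Xa b (ltl ψ)    o = o
  close-Xa b (neg A)    o = close-Xa (¬ᵇ b) A o
  close-Xa b (conj A B) o = close-Xa b B (close-Xa b A o)
  close-Xa b (disj A B) o = close-Xa b B (close-Xa b A o)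
  close-Xa b (all q A)  o = close-Xa b A (block-Xa (¬ᵇ b) q o)
  close-Xa b (ex q A)   o = close-Xa b A (block-Xa b q o)

  lowerSentence : A.Formula → Σ H.Sentence H.XaFree
  lowerSentence φ = (lowerFormula φ , closed-traces , closed-sets) , λ o → close-Xa true (tree [] 0 φ) (closeAll-Xa tables o)
    where
    scoped : Scoped (_< 14) Origin 14 (fresh (size φ) 0) (tree [] 0 φ)
    scoped = tree-scoped [] 0 φ
    closed-traces : ∀ v → ¬ H.FreeTrace v (lowerFormula φ)
    closed-traces v f with tables-free-trace {body φ} f
    ... | ≮14 , g with close-free-trace true (tree [] 0 φ) g
    ... | ¬bound , inj₁ o = ≮14 (axioms-below v o)
    ... | ¬bound , inj₂ o = [ ≮14 , ¬bound ]′ (matrix-occurs (tree [] 0 φ) scoped o)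
    closed-sets : ∀ Y → H.FreeSet Y (lowerFormula φ) → Y ≡ H.Xa ⊎ Y ≡ H.Xd
    closed-sets Y f with tables-free-set {body φ} f
    ... | g , ¬origin with close-free-set true (tree [] 0 φ) scoped g
    ... | inj₁ (y , eq , o) = ⊥-elim (¬origin y eq o)

-- Correctness of the sentence

module LowerSentenceCorrectness (em : ExcludedMiddle (lsuc 0ℓ)) (ext : Extensionality (lsuc 0ℓ) (lsuc 0ℓ)) (n₀ : ℕ) where

  open Prenexing n₀
  open Classical em
  open Tracks em n₀
  open Tables em n₀
  open LowerTranslation n₀
  open LowerSentence n₀
  open LowerCorrectness em ext n₀ using (Standard; Related; tree-correct)
  open H using (Trace; TraceSet; Assignment; TransitionSystem; var; _⊨_)
  open Assignment

  wpAll : List (Bool × Block) → (Assignment → Set₁) → Assignment → Set₁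
  wpAll []             K Π = K Π
  wpAll ((b , q) ∷ qs) K Π = Quant b (Dom q Π) λ d → wpAll qs K (put q Π d)

  closeAll-sem : ∀ qs {Π φ} → (Π ⊨ closeAll qs φ) ⇔ wpAll qs (_⊨ φ) Π
  closeAll-sem []             = ⇔-refl
  closeAll-sem ((b , q) ∷ qs) = closeBlock-sem b q ⟫ Quant-cong b (λ _ → closeAll-sem qs)

  -- `prenex` in the positive context that conjoins the axioms. The context is stable because the
  -- axioms mention names below 14 and the tree binds names from 14 on.
  body-sem : ∀ φ {Π} → Inhabited Origin Π → (Π ⊨ body φ) ⇔ (Lift (lsuc 0ℓ) (Π H.⊨ˡ axioms) × ⟦ tree [] 0 φ ⟧ Π)
  body-sem φ {Π} inh = close-sem true t ⟫
    wp-cong′ true t (λ Π′ → Lift-⇔ ⟫ andL-sem {Π′} {axioms} {matrix t} ⟫ ×-cong (⇔-sym Lift-⇔) (⇔-sym Lift-⇔)) ⟫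
    prenex true t {G = λ X Π → Lift (lsuc 0ℓ) (Π H.⊨ˡ axioms) × X} (tree-scoped [] 0 φ) (λ _ → inj₁)
      (λ { y (inj₁ refl) → s≤s z≤n ; y (inj₂ (inj₁ refl)) → s≤s (s≤s z≤n)
         ; y (inj₂ (inj₂ refl)) → s≤s (s≤s (s≤s (s≤s (s≤s (s≤s (s≤s z≤n)))))) })
      inh (λ f → map₂ (λ x → f x)) (λ o → map₁ (λ (lift m) → lift (to (ltl-agree axioms (λ v → inj₁ ∘ axioms-below v) o) m)))
    where
    t : Tree
    t = tree [] 0 φ

  record Entries : Set where
    field
      κ                  : Trace
      origin⁺ t a b c    : Trace
      origin* s a′ b′ c′ : Trace
      d d′ e             : Trace

  module _ (Π₀ : Assignment) (C P S : TraceSet) (E : Entries) where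
    open Entries E

    final : Assignment
    final = Π₁₂ H.[ 13 ↦ᵗ e ]
      where
      Π₁ Π₂ Π₃ Π₄ Π₅ Π₆ Π₇ Π₈ Π₉ Π₁₀ Π₁₁ Π₁₂ : Assignment
      Π₁ = Π₀ H.[ var 0 ↦ˢ C ] H.[ 0 ↦ᵗ κ ]
      Π₂ = Π₁ H.[ var 1 ↦ˢ P ] H.[ 1 ↦ᵗ origin⁺ ]
      Π₃ = Π₂ H.[ var 6 ↦ˢ S ] H.[ 6 ↦ᵗ origin* ]
      Π₄ = Π₃ H.[ 2 ↦ᵗ t ]
      Π₅ = Π₄ H.[ 3 ↦ᵗ a ]
      Π₆ = Π₅ H.[ 4 ↦ᵗ b ]
      Π₇ = Π₆ H.[ 5 ↦ᵗ c ]
      Π₈ = Π₇ H.[ 7 ↦ᵗ s ]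
      Π₉ = Π₈ H.[ 8 ↦ᵗ a′ ]
      Π₁₀ = Π₉ H.[ 9 ↦ᵗ b′ ] H.[ 10 ↦ᵗ c′ ]
      Π₁₁ = Π₁₀ H.[ 11 ↦ᵗ d ]
      Π₁₂ = Π₁₁ H.[ 12 ↦ᵗ d′ ]

    Axioms : Set
    Axioms = AllZero origin⁺ × PlusStep t a b c × AllZero origin* × TimesStep s a′ b′ c′ d d′ e

    private
      V : ℕ → Maybe Trace
      V = traceOf final

    module _ (clock : Clock κ) where
      open Clocked {V} clock refl

      means-allZero : ∀ v {t} → V v ≡ just t → Means V 0 (allZeroL v) (AllZero t)
      means-allZero v eq = means-and (means-zero {v} 0 eq) (means-and (means-zero {v} 1 eq) (means-zero {v} 2 eq))

      means-left : ∀ v w {t u} → V v ≡ just t → V w ≡ just u → Means V 0 (leftStepL v w) (LeftStep t u)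
      means-left v w eq eq′ = means-and (means-successor {v} {w} 0 0 eq eq′)
        (means-and (means-equal {v} {w} 1 1 eq eq′) (means-successor {v} {w} 2 2 eq eq′))

      means-right : ∀ v w {t u} → V v ≡ just t → V w ≡ just u → Means V 0 (rightStepL v w) (RightStep t u)
      means-right v w eq eq′ = means-and (means-equal {v} {w} 0 0 eq eq′)
        (means-and (means-successor {v} {w} 1 1 eq eq′) (means-successor {v} {w} 2 2 eq eq′))

      means-row : ∀ v w x {t u d} → V v ≡ just t → V w ≡ just u → V x ≡ just d → Means V 0 (rowStepL v w x) (RowStep t u d)
      means-row v w x eq eq′ eq″ = means-and (means-equal {v} {w} 0 0 eq eq′) (means-and (means-successor {v} {w} 1 1 eq eq′)
        (means-and (means-equal {x} {w} 0 2 eq″ eq′) (means-and (means-equal {x} {w} 1 0 eq″ eq′) (means-equal {v} {x} 2 2 eq eq″))))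

      means-next : ∀ v w {t u} → V v ≡ just t → V w ≡ just u → Means V 0 (nextRowL v w) (NextRow t u)
      means-next v w eq eq′ = means-and (means-successor {v} {w} 0 0 eq eq′) (means-and (means-zero {v} 1 eq) (means-zero {v} 2 eq))

      means-inhabited : Means V 0 (somewhere (at 2 2)) (∃[ r ] T (track t 2 r))
      means-inhabited = means (Means.meaning (means-somewhere {0} {P = λ r → T (track t 2 r)} λ r → means-at {v = 2} 2 refl) ⟫
        mk⇔ (λ (r , _ , x) → r , x) (λ (r , x) → r , z≤n , x))

      means-tables : Means V 0 tableAxioms Axioms
      means-tables = means-and (means-allZero 1 refl) (means-and
        (means-and (means-left 3 2 refl refl) (means-and (means-right 4 2 refl refl) (means-and
          means-inhabited
          (means-or (means-allZero 2 refl) (means-or (means-left 2 5 refl refl) (means-right 2 5 refl refl))))))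
        (means-and (means-allZero 6 refl)
        (means-and (means-row 8 7 11 refl refl refl) (means-and (means-next 9 7 refl refl) (means-and
          (means-and (means-equal {7} {13} 0 0 refl refl) (means-equal {7} {13} 1 1 refl refl))
          (means-or (means-and (means-zero {7} 1 refl) (means-zero {7} 2 refl)) (means-row 7 10 12 refl refl refl)))))))

    means-axioms : (final H.⊨ˡ axioms) ⇔ (Clock κ × Axioms)
    means-axioms = reading final axioms (means-and-then (means-isClock {V} refl) means-tables)

    origins : ∀ {x y z} → C x → P y → S z → Inhabited Origin final
    origins cx py sz _ (inj₁ refl)        = C , refl , _ , cx
    origins cx py sz _ (inj₂ (inj₁ refl)) = P , refl , _ , py
    origins cx py sz _ (inj₂ (inj₂ refl)) = S , refl , _ , sz

    standard : Clock κ → Table _+_ P → Table _*_ S → Standard final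
    standard clock plus times = record
      { κ = κ ; clock = clock ; hasClock = refl ; Plus = P ; Times = S ; plus-sums = plus ; times-prods = times
      ; hasPlus = refl ; hasTimes = refl }

  module _ (Π₀ : Assignment) (φ : A.Formula) (closed : ∀ s x → ¬ A.Free s x φ) where

    unrelated : ∀ {Π hi} → Related Π A.default [] hi (λ s x → A.Free s x φ)
    unrelated s x f = ⊥-elim (closed s x f)

    -- Each pair of entries t and s yields the axioms for both tables at once. Varying one of them
    -- while the other is fixed to an origin shows that P and S are the true tables; the translated
    -- formula is then read off at the two origins.
    satisfied⇒true : (Π₀ ⊨ lowerFormula φ) → A.default A.⊨ φ
    satisfied⇒true m = holds (to (closeAll-sem tables) m)
     where
     holds : wpAll tables (_⊨ body φ) Π₀ → A.default A.⊨ φ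
     holds ((C , κ , cκ) , (P , o⁺ , po) , (S , o* , so) , choose) =
      to (tree-correct φ (standard Π₀ C P S _ clock plus times) (unrelated {hi = fresh (size φ) 0})) (proj₂ (Given.facts first))
      where
      record Given (t s : Trace) : Set₁ where
        field
          a b c a′ b′ c′ d d′ e : Trace
        E : Entries
        E = record { κ = κ ; origin⁺ = o⁺ ; t = t ; a = a ; b = b ; c = c ; origin* = o* ; s = s ; a′ = a′ ; b′ = b′ ; c′ = c′
                   ; d = d ; d′ = d′ ; e = e }
        field
          ∈plus  : P a × P b × P c × P d × P d′ × P e
          ∈times : S a′ × S b′ × S c′
          facts  : (Clock κ × Axioms Π₀ C P S E) × ⟦ tree [] 0 φ ⟧ (final Π₀ C P S E)
      given : ∀ t → P t → ∀ s → S s → Given t s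
      given t pt s ss =
        case choose (P , refl , t , pt) of λ { ((_ , refl , a , pa) , (_ , refl , b , pb) , (_ , refl , c , pc) , choose′) →
        case choose′ (S , refl , s , ss) of λ { ((_ , refl , a′ , sa) , (_ , refl , b′ , sb) , (_ , refl , c′ , sc) ,
            (_ , refl , d , pd) , (_ , refl , d′ , pd′) , (_ , refl , e , pe) , m′) →
          let E = record { κ = κ ; origin⁺ = o⁺ ; t = t ; a = a ; b = b ; c = c ; origin* = o* ; s = s ; a′ = a′ ; b′ = b′ ; c′ = c′
                         ; d = d ; d′ = d′ ; e = e } in
          record { ∈plus = pa , pb , pc , pd , pd′ , pe ; ∈times = sa , sb , sc
                 ; facts = map₁ (to (means-axioms Π₀ C P S E) ∘ lower) (to (body-sem φ (origins Π₀ C P S E cκ po so)) m′) } } }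
      first : Given o⁺ o*
      first = given o⁺ po o* so
      clock : Clock κ
      clock = proj₁ (proj₁ (Given.facts first))
      plus : Table _+_ P
      plus = plus-table P (o⁺ , po , proj₁ (proj₂ (proj₁ (Given.facts first)))) λ t pt →
        -- Only the conditions on addition are extracted, so the other entry may be the origin.
        let open Given (given t pt o* so) ; pa , pb , pc , _ = ∈plus in
        a , pa , b , pb , c , pc , proj₁ (proj₂ (proj₂ (proj₁ facts)))
      times : Table _*_ S
      times = times-table P S plus (o* , so , proj₁ (proj₂ (proj₂ (proj₂ (proj₁ (Given.facts first)))))) λ s ss →
        let open Given (given o⁺ po s ss) ; _ , _ , _ , pd , pd′ , pe = ∈plus ; sa , sb , sc = ∈times in
        a′ , sa , b′ , sb , c′ , sc , d , pd , d′ , pd′ , e , pe , proj₂ (proj₂ (proj₂ (proj₂ (proj₁ facts))))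

    true⇒satisfied : A.default A.⊨ φ → Π₀ ⊨ lowerFormula φ
    true⇒satisfied truth = from (closeAll-sem tables) (
      (C , clockTrace , tt) , (P , triple 0 0 0 , po) , (S , triple 0 0 0 , so) ,
      λ { (_ , refl , t , pt) → let a , pa , b , pb , c , pc , plus = plus-steps t pt in
        (_ , refl , a , pa) , (_ , refl , b , pb) , (_ , refl , c , pc) ,
      λ { (_ , refl , s , ss) → let a′ , sa , b′ , sb , c′ , sc , d , pd , d′ , pd′ , e , pe , times = times-steps s ss
                                    E = record { κ = clockTrace ; origin⁺ = triple 0 0 0 ; t = t ; a = a ; b = b ; c = c
                                               ; origin* = triple 0 0 0 ; s = s ; a′ = a′ ; b′ = b′ ; c′ = c′ ; d = d ; d′ = d′ ; e = e } in
        (_ , refl , a′ , sa) , (_ , refl , b′ , sb) , (_ , refl , c′ , sc) , (_ , refl , d , pd) , (_ , refl , d′ , pd′) , (_ , refl , e , pe) ,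
        from (body-sem φ (origins Π₀ C P S E {clockTrace} tt po so))
          (lift (from (means-axioms Π₀ C P S E) (clockTrace-clock , zeros , plus , zeros , times)) ,
           from (tree-correct φ (standard Π₀ C P S E clockTrace-clock (table-correct _+_) (table-correct _*_)) (unrelated {hi = fresh (size φ) 0})) truth) } })
      where
      C P S : TraceSet
      C _ = ⊤
      P = table _+_
      S = table _*_
      po : P (triple 0 0 0)
      po = 0 , 0 , triple-is 0 0 0
      so : S (triple 0 0 0)
      so = 0 , 0 , triple-is 0 0 0
      zeros : AllZero (triple 0 0 0)
      zeros = from (zero-triple {triple 0 0 0}) (triple-is 0 0 0)

  -- Both implications above hold for every initial assignment, so any transition system can serve
  -- as the witness.
  trivialSystem : TransitionSystem
  trivialSystem = record
    { pred-size = 0 ; successors = λ _ → true ∷ [] ; total = λ _ → zero , Vecₚ.lookup⇒[]= zero (true ∷ []) refl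
    ; initials = true ∷ [] ; label = λ _ → Vec.replicate _ true }

  lower-correct : ∀ (φ : A.Sentence) → (A.default A.⊨ proj₁ φ) ⇔
                  (Σ[ 𝔗 ∈ TransitionSystem ] (TransitionSystem.Tr 𝔗 H.⊨ˢ proj₁ (lowerSentence (proj₁ φ))))
  lower-correct (φ , closed) = mk⇔ (λ truth → trivialSystem , true⇒satisfied _ φ closed truth) (λ (𝔗 , m) → satisfied⇒true _ φ closed m)

-- The program for the lower bound

module LowerProgram (n : ℕ) where

  open Prenexing n
  open TrackFormulas n
  open LowerTranslation n
  open LowerSentence n
  open A using (Sort; num; set; family; Term; _⊕_; _⊗_; Atom; _≐_; _≺_; _∈ˢ_; _∈ᶠ_; atom)

  -- The alphabet of the goal stack, with names in unary. The first flag of a goal is the polarity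
  -- of the subformula; the second flag of `term` tells whether its value goes to track 0 or 1.
  data Mark : Set where
    stroke end neg mem : Mark
    form               : Bool → Mark
    term               : Bool → Bool → Mark
    bind               : Sort → Mark

  open Programs A.Sym H.Sym Mark 8

  instance
    listed-ASym : Listed A.Sym
    listed-ASym .Listed.finite = A.symFinite

    listed-HSym : Listed H.Sym
    listed-HSym .Listed.finite = H.symFinite

    listed-Mark : Listed Mark
    listed-Mark .Listed.finite =
      stroke ∷ end ∷ neg ∷ mem ∷ form false ∷ form true ∷ term false false ∷ term false true ∷ term true false ∷ term true true ∷
      bind num ∷ bind set ∷ bind family ∷ [] ,
      λ { stroke → here refl ; end → there (here refl) ; neg → there (there (here refl)) ; mem → there (there (there (here refl)))
        ; (form false) → there (there (there (there (here refl)))) ; (form true) → there (there (there (there (there (here refl)))))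
        ; (term false false) → there (there (there (there (there (there (here refl))))))
        ; (term false true) → there (there (there (there (there (there (there (here refl)))))))
        ; (term true false) → there (there (there (there (there (there (there (there (here refl))))))))
        ; (term true true) → there (there (there (there (there (there (there (there (there (here refl)))))))))
        ; (bind num) → there (there (there (there (there (there (there (there (there (there (here refl))))))))))
        ; (bind set) → there (there (there (there (there (there (there (there (there (there (there (here refl)))))))))))
        ; (bind family) → there (there (there (there (there (there (there (there (there (there (there (there (here refl)))))))))))) }

  pattern In  = zero
  pattern Out = suc zero
  pattern Gls = suc (suc zero)
  pattern Tmp = suc (suc (suc zero))
  pattern Pfx = suc (suc (suc (suc zero)))
  pattern Mtx = suc (suc (suc (suc (suc zero))))
  pattern X   = suc (suc (suc (suc (suc (suc zero)))))
  pattern Y   = suc (suc (suc (suc (suc (suc (suc zero))))))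
  pattern R   = suc (suc (suc (suc (suc (suc (suc (suc zero)))))))
  pattern R′  = suc (suc (suc (suc (suc (suc (suc (suc (suc zero))))))))

  move : Fin k → Fin k → Prog ⊤
  move r r′ = loop (λ _ → pop r >>= λ
    { (just c) → push r′ c >> skip (inj₁ tt)
    ; nothing  → skip (inj₂ tt) }) tt

  clear : Fin k → Prog ⊤
  clear r = loop (λ _ → pop r >>= λ
    { (just c) → skip (inj₁ tt)
    ; nothing  → skip (inj₂ tt) }) tt

  -- The finitely many ways in which a name is copied from a register to another stack.
  data Port : Set where
    X→Pfx Y→Pfx X→Mtx Y→Mtx Y→Gls : Port

  source sink : Port → Fin k
  source X→Pfx = X
  source Y→Pfx = Y
  source X→Mtx = X
  source Y→Mtx = Y
  source Y→Gls = Y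
  sink X→Pfx = Pfx
  sink Y→Pfx = Pfx
  sink X→Mtx = Mtx
  sink Y→Mtx = Mtx
  sink Y→Gls = Gls

  ink : Port → Γ
  ink Y→Gls = wrk stroke
  ink _     = out H.stroke

  copyOut : Port → Prog ⊤
  copyOut c = loop (λ _ → pop (source c) >>= λ
    { (just _) → push Tmp (wrk stroke) >> (push (sink c) (ink c) >> skip (inj₁ tt))
    ; nothing  → skip (inj₂ tt) }) tt

  copy : Port → Prog ⊤
  copy c = copyOut c >> move Tmp (source c)

  data Item : Set where
    lit         : H.Sym → Item
    nameX nameY : Item

  data Log : Set where
    pfx mtx : Log

  logReg : Log → Fin k
  logReg pfx = Pfx
  logReg mtx = Mtx

  portX portY : Log → Port
  portX pfx = X→Pfx
  portX mtx = X→Mtx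
  portY pfx = Y→Pfx
  portY mtx = Y→Mtx

  text : Log → List Item → Prog ⊤
  text l []            = skip tt
  text l (lit c ∷ w)   = push (logReg l) (out c) >> text l w
  text l (nameX ∷ w)   = copy (portX l) >> (push (logReg l) (out H.end) >> text l w)
  text l (nameY ∷ w)   = copy (portY l) >> (push (logReg l) (out H.end) >> text l w)

  pushName : Prog ⊤
  pushName = push Gls (wrk end) >> copy Y→Gls

  data NameReg : Set where
    toX toY : NameReg

  nameReg : NameReg → Fin k
  nameReg toX = X
  nameReg toY = Y

  strokesTo : Fin k → ℕ → Prog ⊤
  strokesTo r zero    = skip tt
  strokesTo r (suc i) = push r (wrk stroke) >> strokesTo r i

  countInput : NameReg → Prog ⊤
  countInput a = loop (λ _ → pop In >>= λ
    { (just c) → push Tmp c >> (push (nameReg a) (wrk stroke) >> skip (inj₁ tt))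
    ; nothing  → skip (inj₂ tt) }) tt

  -- Computes `fresh` as 14 plus the length of the remaining input, which is moved to `Tmp` and back
  -- while being counted.
  freshName : NameReg → Prog ⊤
  freshName a = countInput a >> (move Tmp In >> strokesTo (nameReg a) 14)

  readName : Prog ⊤
  readName = loop (λ _ → pop Gls >>= λ
    { (just (wrk stroke)) → push X (wrk stroke) >> skip (inj₁ tt)
    ; _                   → skip (inj₂ tt) }) tt

  dropName : Prog ⊤
  dropName = loop (λ _ → pop Gls >>= λ
    { (just (wrk stroke)) → skip (inj₁ tt)
    ; _                   → skip (inj₂ tt) }) tt

  readIndex : Prog ⊤
  readIndex = loop (λ _ → pop In >>= λ
    { (just (inp A.stroke)) → push R (wrk stroke) >> skip (inj₁ tt)
    ; _                     → skip (inj₂ tt) }) tt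

  -- Compares the index on top of the goals with R, whose strokes are moved to R′ as far as they are matched.
  compareStep : Bool → Prog (Bool ⊎ Bool)
  compareStep ok = pop Gls >>= λ
    { (just (wrk stroke)) → push Tmp (wrk stroke) >> (pop R >>= λ
        { (just c) → push R′ c >> skip (inj₁ ok)
        ; nothing  → skip (inj₁ false) })
    ; _ → push Tmp (wrk end) >> (pop R >>= λ
        { (just c) → push R c >> skip (inj₂ false)
        ; nothing  → skip (inj₂ ok) }) }

  compare : Prog Bool
  compare = loop compareStep true

  takeName : Prog ⊤
  takeName = loop (λ _ → pop Gls >>= λ
    { (just (wrk stroke)) → push Tmp (wrk stroke) >> (push Y (wrk stroke) >> skip (inj₁ tt))
    ; _                   → push Tmp (wrk end) >> skip (inj₂ tt) }) tt

  examine : Bool → Prog (⊤ ⊎ ⊤)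
  examine true  = compare >>= λ
    { true  → takeName >> skip (inj₂ tt)
    ; false → move R′ R >> skip (inj₁ tt) }
  examine false = skip (inj₁ tt)

  -- The search goes down from the top of the goal stack and stops at the first match, which is the
  -- innermost binding; this respects shadowing.
  scan : Sort → Prog ⊤
  scan s = loop (λ _ → pop Gls >>= λ
    { (just (wrk (bind s′))) → push Tmp (wrk (bind s′)) >> examine (s ≡ˢ s′)
    ; (just c)               → push Tmp c >> skip (inj₁ tt)
    ; nothing                → skip (inj₂ tt) }) tt

  findName : Sort → Prog ⊤
  findName s = scan s >> (move Tmp Gls >> (clear R >> clear R′))

  reference : Sort → Prog ⊤
  reference s = readIndex >> findName s

  -- Templates are written as formulas whose trace variables 1 and 2 stand for the names in X and Y.
  items : H.LTL → List Item
  items (H.⟨ p ⟩ 0) = lit (H.prop p) ∷ lit H.end ∷ []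
  items (H.⟨ p ⟩ 1) = lit (H.prop p) ∷ nameX ∷ []
  items (H.⟨ p ⟩ _) = lit (H.prop p) ∷ nameY ∷ []
  items (H.not ψ)    = lit H.not ∷ items ψ
  items (H._or_ ψ χ) = lit H.or ∷ items ψ ++ items χ
  items (H._U_ ψ χ)  = lit H.U ∷ items ψ ++ items χ
  items (H.X ψ)      = lit H.X ∷ items ψ

  literally : List H.Sym → List Item
  literally = map lit

  quantˢ quantᵗ : Bool → H.Sym
  quantˢ true  = H.∃ˢ
  quantˢ false = H.∀ˢ
  quantᵗ true  = H.∃ᵗ
  quantᵗ false = H.∀ᵗ

  anyItems : Bool → List Item
  anyItems b = lit (quantˢ b) ∷ nameY ∷ lit (quantᵗ b) ∷ nameY ∷ nameY ∷ []

  tableItems : Bool → ℕ → List Item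
  tableItems b y = lit (quantᵗ b) ∷ nameY ∷ literally (H.encodeIndex y)

  blockItems : Bool → Sort → List Item
  blockItems b num    = tableItems b plusTable
  blockItems b set    = anyItems b
  blockItems b family = anyItems b

  -- The connective `andL` is a negated disjunction of negations. This text precedes the first
  -- conjunct, and a goal `neg` waiting between the conjuncts writes the negation in front of the
  -- second.
  opening : List H.Sym
  opening = H.not ∷ H.or ∷ H.not ∷ []

  conjItems : H.LTL → List Item
  conjItems ψ = literally opening ++ items ψ ++ literally (H.not ∷ opening)

  track#  : Bool → ℕ
  track# false = 0
  track# true  = 1

  pushTerms : Bool → Bool → Prog ⊤
  pushTerms b j = pushName >> (push Gls (wrk (term b j)) >> (push Gls (wrk neg) >> (pushName >> push Gls (wrk (term b false)))))

  -- The binding is pushed below the goal for the body. While the body is processed it acts as an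
  -- entry of the environment; when it comes to the top, its scope has ended and it is dropped.
  quantifier : Bool → Sort → Bool → Prog ⊤
  quantifier c s b = freshName toY >> (text pfx (blockItems c s) >> (pushName >> (readIndex >> (push Gls (wrk end) >> (move R Gls >>
    (push Gls (wrk (bind s)) >> (push Gls (wrk (form b)) >> clear Y)))))))

  formulaNode : Bool → A.Sym → Prog ⊤
  formulaNode b A.not     = text mtx (literally (H.not ∷ [])) >> push Gls (wrk (form (¬ᵇ b)))
  formulaNode b A.and     = text mtx (literally opening) >> (push Gls (wrk (form b)) >> (push Gls (wrk neg) >> push Gls (wrk (form b))))
  formulaNode b A.or      = text mtx (literally (H.or ∷ [])) >> (push Gls (wrk (form b)) >> push Gls (wrk (form b)))
  formulaNode b (A.all s) = quantifier (¬ᵇ b) s b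
  formulaNode b (A.ex s)  = quantifier b s b
  formulaNode b A.eq      = freshName toY >> (text pfx (anyItems b) >> (text mtx (literally opening) >> (pushTerms b false >> clear Y)))
  formulaNode b A.lt      = freshName toY >> (text pfx (anyItems b) >> (text mtx (conjItems (lessT 2)) >> (pushTerms b true >> clear Y)))
  formulaNode b A.inˢ     = freshName toY >> (text pfx (anyItems b) >> (text mtx (literally opening) >>
    (pushName >> (push Gls (wrk mem) >> (push Gls (wrk neg) >> (pushName >> (push Gls (wrk (term b false)) >> clear Y)))))))
  formulaNode b A.inᶠ     = freshName toX >> (reference set >> (text mtx (items (at 1 1 andL equalT (1 , 0) (2 , 0))) >> (clear Y >>
    (reference family >> (text pfx (lit (quantᵗ b) ∷ nameX ∷ nameY ∷ []) >> (clear X >> clear Y))))))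
  formulaNode b _         = skip tt

  operation : Bool → Bool → ℕ → Prog ⊤
  operation b j y = freshName toY >> (text pfx (tableItems b y) >> (text mtx (conjItems (equalT (1 , track# j) (2 , 2))) >>
    (pushTerms b true >> (clear X >> clear Y))))

  termNode : Bool → Bool → A.Sym → Prog ⊤
  termNode b j A.plus  = operation b j plusTable
  termNode b j A.times = operation b j timesTable
  -- The term is a variable, and the symbol just popped is the first of its index, so it is put
  -- back.
  termNode b j c       = push In (inp c) >> (reference num >> (text mtx (items (equalT (1 , track# j) (2 , 0))) >> (clear X >> clear Y)))

  goal : Mark → Prog ⊤
  goal (form b)   = pop In >>= λ { (just (inp c)) → formulaNode b c ; _ → skip tt }
  goal neg        = push Mtx (out H.not)
  goal (term b j) = readName >> (pop In >>= λ { (just (inp c)) → termNode b j c ; _ → skip tt })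
  goal mem        = readName >> (reference set >> (text mtx (items (meetT 1 2)) >> (clear X >> clear Y)))
  goal (bind _)   = dropName >> dropName
  goal _          = skip tt

  -- The stack of goals stands in for the recursion of the translation. Prefix and matrix list their
  -- pieces in the order of the input, so each goal only has to append to the two logs.
  main : Prog ⊤
  main = loop (λ _ → pop Gls >>= λ
    { (just (wrk g)) → goal g >> skip (inj₁ tt)
    ; _              → skip (inj₂ tt) }) tt

  blockText : Bool → Block → List H.Sym
  blockText b (any i)      = quantˢ b ∷ H.encodeIndex i ++ quantᵗ b ∷ H.encodeIndex i ++ H.encodeIndex i
  blockText b (inside i y) = quantᵗ b ∷ H.encodeIndex i ++ H.encodeIndex y

  blocksText : List (Bool × Block) → List H.Sym
  blocksText []             = []
  blocksText ((b , q) ∷ qs) = blockText b q ++ blocksText qs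

  axiomsText : List H.Sym
  axiomsText = opening ++ H.encodeLTL axioms ++ H.not ∷ []

  front : List H.Sym → List H.Sym → Prog ⊤
  front u v = text pfx (literally u) >> (text mtx (literally v) >> (push Gls (wrk (form true)) >> main))

  program : List H.Sym → List H.Sym → Prog ⊤
  -- `Out` is a stack too: the matrix comes last in the text and is therefore moved first.
  program u v = front u v >> (move Mtx Out >> move Pfx Out)

-- Runs of the copying and writing routines

module LowerProgramCorrectness (n : ℕ) where

  open Prenexing n
  open TrackFormulas n
  open LowerTranslation n
  open LowerSentence n
  open LowerProgram n
  open A using (Sort; num; set; family; Term; _⊕_; _⊗_; Atom; _≐_; _≺_; _∈ˢ_; _∈ᶠ_; atom)
  open Programs A.Sym H.Sym Mark 8

  strokes : ℕ → List Γ
  strokes i = replicate i (wrk stroke)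

  st : List A.Sym → List Mark → List Γ → List Γ → List Γ → ℕ → ℕ → ℕ → ℕ → Stacks
  st i g t p m x y r r′ = map inp i ∷ [] ∷ map wrk g ∷ t ∷ p ∷ m ∷ strokes x ∷ strokes y ∷ strokes r ∷ strokes r′ ∷ []

  unary : ℕ → List Mark
  unary i = replicate i stroke ++ end ∷ []

  -- Traversing a stack of height at most b costs a constant number of units.
  rescale₀ : ∀ a {b ℓ E} {P : Prog E} {σ e σ′} → ℓ ≤ b → Run 0 P σ (a * suc ℓ) e σ′ → Run b P σ a e σ′
  rescale₀ a {b} {ℓ} h = rescale (subst (_≤ a * suc b) (sym (ℕₚ.*-identityʳ (a * suc ℓ))) (ℕₚ.*-monoʳ-≤ a (s≤s h)))

  loop-cost : ∀ a {d} → d ≤ a → ∀ i → a * i + d ≤ a * suc i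
  loop-cost a {d} d≤ i = subst (a * i + d ≤_) (trans (ℕₚ.+-comm (a * i) a) (sym (ℕₚ.*-suc a i))) (ℕₚ.+-monoʳ-≤ (a * i) d≤)

  once-more : ∀ a b i → a + (a * i + b) ≡ a * suc i + b
  once-more = solve-∀

  by : ∀ {b c c′ E} {P : Prog E} {σ e σ′} → c ≡ c′ → Run b P σ c e σ′ → Run b P σ c′ e σ′
  by eq = weaken (ℕₚ.≤-reflexive eq)

  inks : Port → ℕ → List Γ → List Γ
  inks c zero    w = w
  inks c (suc i) w = inks c i (ink c ∷ w)

  -- The state in which the sink of a port holds w and its source holds i.
  atPort : Port → (i : List A.Sym) (g : List Γ) (t p m : List Γ) (x y : ℕ) → List Γ → ℕ → Stacks
  atPort X→Pfx i g t p m x y w k = map inp i ∷ [] ∷ g ∷ t ∷ w ∷ m ∷ strokes k ∷ strokes y ∷ [] ∷ [] ∷ []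
  atPort Y→Pfx i g t p m x y w k = map inp i ∷ [] ∷ g ∷ t ∷ w ∷ m ∷ strokes x ∷ strokes k ∷ [] ∷ [] ∷ []
  atPort X→Mtx i g t p m x y w k = map inp i ∷ [] ∷ g ∷ t ∷ p ∷ w ∷ strokes k ∷ strokes y ∷ [] ∷ [] ∷ []
  atPort Y→Mtx i g t p m x y w k = map inp i ∷ [] ∷ g ∷ t ∷ p ∷ w ∷ strokes x ∷ strokes k ∷ [] ∷ [] ∷ []
  atPort Y→Gls i g t p m x y w k = map inp i ∷ [] ∷ w ∷ t ∷ p ∷ m ∷ strokes x ∷ strokes k ∷ [] ∷ [] ∷ []

  -- The proof is repeated for each port, because the stacks indexed by `source c` and `sink c`
  -- compute only when c is concrete.
  copyOut-run : ∀ c k j {i g p m x y w} → Run 0 (copyOut c) (atPort c i g (strokes j) p m x y w k) (6 * k + 2) tt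
                                            (atPort c i g (strokes (k + j)) p m x y (inks c k w) 0)
  copyOut-rest : ∀ c k j {i g p m x y w} → Run 0 (copyOut c) (atPort c i g (strokes (suc j)) p m x y (ink c ∷ w) k) (6 * k + 2) tt
                                             (atPort c i g (strokes (suc (k + j))) p m x y (inks c (suc k) w) 0)
  copyOut-run X→Pfx zero j = exit (pop-nothing refl ⨾ skip-run)
  copyOut-run Y→Pfx zero j = exit (pop-nothing refl ⨾ skip-run)
  copyOut-run X→Mtx zero j = exit (pop-nothing refl ⨾ skip-run)
  copyOut-run Y→Mtx zero j = exit (pop-nothing refl ⨾ skip-run)
  copyOut-run Y→Gls zero j = exit (pop-nothing refl ⨾ skip-run)
  copyOut-run X→Pfx (suc k) j {i} {g} {p} {m} {x} {y} {w} =
    by (once-more 6 2 k) (again (pop-just refl ⨾ push-run ⨾ push-run ⨾ skip-run) (copyOut-rest X→Pfx k j {i} {g} {p} {m} {x} {y} {w}))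
  copyOut-run Y→Pfx (suc k) j {i} {g} {p} {m} {x} {y} {w} =
    by (once-more 6 2 k) (again (pop-just refl ⨾ push-run ⨾ push-run ⨾ skip-run) (copyOut-rest Y→Pfx k j {i} {g} {p} {m} {x} {y} {w}))
  copyOut-run X→Mtx (suc k) j {i} {g} {p} {m} {x} {y} {w} =
    by (once-more 6 2 k) (again (pop-just refl ⨾ push-run ⨾ push-run ⨾ skip-run) (copyOut-rest X→Mtx k j {i} {g} {p} {m} {x} {y} {w}))
  copyOut-run Y→Mtx (suc k) j {i} {g} {p} {m} {x} {y} {w} =
    by (once-more 6 2 k) (again (pop-just refl ⨾ push-run ⨾ push-run ⨾ skip-run) (copyOut-rest Y→Mtx k j {i} {g} {p} {m} {x} {y} {w}))
  copyOut-run Y→Gls (suc k) j {i} {g} {p} {m} {x} {y} {w} =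
    by (once-more 6 2 k) (again (pop-just refl ⨾ push-run ⨾ push-run ⨾ skip-run) (copyOut-rest Y→Gls k j {i} {g} {p} {m} {x} {y} {w}))
  copyOut-rest c k j {i} {g} {p} {m} {x} {y} {w} =
    subst (λ l → Run 0 (copyOut c) (atPort c i g (strokes (suc j)) p m x y (ink c ∷ w) k) (6 * k + 2) tt
                                   (atPort c i g (strokes l) p m x y (inks c (suc k) w) 0))
      (ℕₚ.+-suc k j) (copyOut-run c k (suc j) {i} {g} {p} {m} {x} {y} {ink c ∷ w})

  restore-run : ∀ c k j {i g p m x y w} → Run 0 (move Tmp (source c)) (atPort c i g (strokes k) p m x y w j) (4 * k + 2) tt
                                            (atPort c i g [] p m x y w (k + j))
  restore-rest : ∀ c k j {i g p m x y w} → Run 0 (move Tmp (source c)) (atPort c i g (strokes k) p m x y w (suc j)) (4 * k + 2) tt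
                                             (atPort c i g [] p m x y w (suc (k + j)))
  restore-run X→Pfx zero j = exit (pop-nothing refl ⨾ skip-run)
  restore-run Y→Pfx zero j = exit (pop-nothing refl ⨾ skip-run)
  restore-run X→Mtx zero j = exit (pop-nothing refl ⨾ skip-run)
  restore-run Y→Mtx zero j = exit (pop-nothing refl ⨾ skip-run)
  restore-run Y→Gls zero j = exit (pop-nothing refl ⨾ skip-run)
  restore-run X→Pfx (suc k) j {i} {g} {p} {m} {x} {y} {w} =
    by (once-more 4 2 k) (again (pop-just refl ⨾ push-run ⨾ skip-run) (restore-rest X→Pfx k j {i} {g} {p} {m} {x} {y} {w}))
  restore-run Y→Pfx (suc k) j {i} {g} {p} {m} {x} {y} {w} =
    by (once-more 4 2 k) (again (pop-just refl ⨾ push-run ⨾ skip-run) (restore-rest Y→Pfx k j {i} {g} {p} {m} {x} {y} {w}))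
  restore-run X→Mtx (suc k) j {i} {g} {p} {m} {x} {y} {w} =
    by (once-more 4 2 k) (again (pop-just refl ⨾ push-run ⨾ skip-run) (restore-rest X→Mtx k j {i} {g} {p} {m} {x} {y} {w}))
  restore-run Y→Mtx (suc k) j {i} {g} {p} {m} {x} {y} {w} =
    by (once-more 4 2 k) (again (pop-just refl ⨾ push-run ⨾ skip-run) (restore-rest Y→Mtx k j {i} {g} {p} {m} {x} {y} {w}))
  restore-run Y→Gls (suc k) j {i} {g} {p} {m} {x} {y} {w} =
    by (once-more 4 2 k) (again (pop-just refl ⨾ push-run ⨾ skip-run) (restore-rest Y→Gls k j {i} {g} {p} {m} {x} {y} {w}))
  restore-rest c k j {i} {g} {p} {m} {x} {y} {w} =
    subst (λ l → Run 0 (move Tmp (source c)) (atPort c i g (strokes k) p m x y w (suc j)) (4 * k + 2) tt (atPort c i g [] p m x y w l))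
      (ℕₚ.+-suc k j) (restore-run c k (suc j) {i} {g} {p} {m} {x} {y} {w})

  copy-run : ∀ c k {b i g p m x y w} → k ≤ b → Run b (copy c) (atPort c i g [] p m x y w k) 10 tt (atPort c i g [] p m x y (inks c k w) k)
  copy-run c k {i = i} {g} {p} {m} {x} {y} {w} k≤ = rescale₀ 10 k≤
    (weaken (subst (_≤ 10 * suc k) (arrange k) (loop-cost 10 (toWitness {a? = 4 ℕₚ.≤? 10} tt) k))
      (subst (λ l → Run 0 (copy c) (atPort c i g [] p m x y w k) (6 * k + 2 + (4 * l + 2)) tt (atPort c i g [] p m x y (inks c k w) l))
        (ℕₚ.+-identityʳ k) (copyOut-run c k 0 {i} {g} {p} {m} {x} {y} {w} ⨾ restored)))
    where
    arrange : ∀ k → 10 * k + 4 ≡ 6 * k + 2 + (4 * k + 2)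
    arrange = solve-∀
    restored : Run 0 (move Tmp (source c)) (atPort c i g (strokes (k + 0)) p m x y (inks c k w) 0) (4 * (k + 0) + 2) tt
                 (atPort c i g [] p m x y (inks c k w) (k + 0))
    restored = subst (λ l → Run 0 (move Tmp (source c)) (atPort c i g (strokes (k + 0)) p m x y (inks c k w) 0) (4 * (k + 0) + 2) tt
                 (atPort c i g [] p m x y (inks c k w) l)) (ℕₚ.+-identityʳ (k + 0)) (restore-run c (k + 0) 0 {i} {g} {p} {m} {x} {y} {inks c k w})

  ⟨_,_,_,_,_,_⟩ : List A.Sym → List Mark → List Γ → List Γ → ℕ → ℕ → Stacks
  ⟨ i , g , p , m , x , y ⟩ = st i g [] p m x y 0 0

  render : ℕ → ℕ → List Item → List H.Sym
  render x y []          = []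
  render x y (lit c ∷ w) = c ∷ render x y w
  render x y (nameX ∷ w) = H.encodeIndex x ++ render x y w
  render x y (nameY ∷ w) = H.encodeIndex y ++ render x y w

  render-++ : ∀ x y v w → render x y (v ++ w) ≡ render x y v ++ render x y w
  render-++ x y []          w = refl
  render-++ x y (lit c ∷ v) w = cong (c ∷_) (render-++ x y v w)
  render-++ x y (nameX ∷ v) w = trans (cong (H.encodeIndex x ++_) (render-++ x y v w)) (sym (Listₚ.++-assoc (H.encodeIndex x) _ _))
  render-++ x y (nameY ∷ v) w = trans (cong (H.encodeIndex y ++_) (render-++ x y v w)) (sym (Listₚ.++-assoc (H.encodeIndex y) _ _))

  render-literally : ∀ x y w → render x y (literally w) ≡ w
  render-literally x y []      = refl
  render-literally x y (c ∷ w) = cong (c ∷_) (render-literally x y w)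

  logged : Log → (i : List A.Sym) (g : List Mark) (p m : List Γ) (x y : ℕ) → List Γ → Stacks
  logged pfx i g p m x y w = ⟨ i , g , w , m , x , y ⟩
  logged mtx i g p m x y w = ⟨ i , g , p , w , x , y ⟩

  index-▷ : ∀ i w v → (H.encodeIndex i ++ v) ▷ w ≡ v ▷ out H.end ∷ inks X→Pfx i w
  index-▷ zero    w v = refl
  index-▷ (suc i) w v = index-▷ i (out H.stroke ∷ w) v

  text-run : ∀ l w {b i g p m x y v} → x ≤ b → y ≤ b → Run b (text l w) (logged l i g p m x y v) (12 * length w + 1) tt
                                                       (logged l i g p m x y (render x y w ▷ v))
  text-run l [] x≤ y≤ = skip-run
  text-run pfx (lit c ∷ w) {i = i} {g} {p} {m} {x} {y} x≤ y≤ = weaken (longer (length w)) (push-run ⨾ text-run pfx w {i = i} {g} {p} {m} {x} {y} x≤ y≤)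
    where
    longer : ∀ l → 2 + (12 * l + 1) ≤ 12 * suc l + 1
    longer l = subst (2 + (12 * l + 1) ≤_) (once-more 12 1 l) (ℕₚ.+-monoˡ-≤ (12 * l + 1) (toWitness {a? = 2 ℕₚ.≤? 12} tt))
  text-run mtx (lit c ∷ w) {i = i} {g} {p} {m} {x} {y} x≤ y≤ = weaken (longer (length w)) (push-run ⨾ text-run mtx w {i = i} {g} {p} {m} {x} {y} x≤ y≤)
    where
    longer : ∀ l → 2 + (12 * l + 1) ≤ 12 * suc l + 1
    longer l = subst (2 + (12 * l + 1) ≤_) (once-more 12 1 l) (ℕₚ.+-monoˡ-≤ (12 * l + 1) (toWitness {a? = 2 ℕₚ.≤? 12} tt))
  text-run pfx (nameX ∷ w) {i = i} {g} {p} {m} {x} {y} {v} x≤ y≤ = by (once-more 12 1 (length w))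
    (subst (λ u → Run _ (text pfx (nameX ∷ w)) (logged pfx i g p m x y v) _ tt ⟨ i , g , u , m , x , y ⟩) (sym (index-▷ x v (render x y w)))
      (copy-run X→Pfx x {i = i} {map wrk g} {p} {m} {x} {y} {v} x≤ ⨾ push-run ⨾ text-run pfx w {i = i} {g} {p} {m} {x} {y} x≤ y≤))
  text-run mtx (nameX ∷ w) {i = i} {g} {p} {m} {x} {y} {v} x≤ y≤ = by (once-more 12 1 (length w))
    (subst (λ u → Run _ (text mtx (nameX ∷ w)) (logged mtx i g p m x y v) _ tt ⟨ i , g , p , u , x , y ⟩) (sym (trans (index-▷ x v (render x y w)) (cong (λ u → render x y w ▷ out H.end ∷ u) (same x v))))
      (copy-run X→Mtx x {i = i} {map wrk g} {p} {m} {x} {y} {v} x≤ ⨾ push-run ⨾ text-run mtx w {i = i} {g} {p} {m} {x} {y} x≤ y≤))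
    where
    same : ∀ x v → inks X→Pfx x v ≡ inks X→Mtx x v
    same zero    v = refl
    same (suc x) v = same x (out H.stroke ∷ v)
  text-run pfx (nameY ∷ w) {i = i} {g} {p} {m} {x} {y} {v} x≤ y≤ = by (once-more 12 1 (length w))
    (subst (λ u → Run _ (text pfx (nameY ∷ w)) (logged pfx i g p m x y v) _ tt ⟨ i , g , u , m , x , y ⟩) (sym (trans (index-▷ y v (render x y w)) (cong (λ u → render x y w ▷ out H.end ∷ u) (same y v))))
      (copy-run Y→Pfx y {i = i} {map wrk g} {p} {m} {x} {y} {v} y≤ ⨾ push-run ⨾ text-run pfx w {i = i} {g} {p} {m} {x} {y} x≤ y≤))
    where
    same : ∀ x v → inks X→Pfx x v ≡ inks Y→Pfx x v
    same zero    v = refl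
    same (suc x) v = same x (out H.stroke ∷ v)
  text-run mtx (nameY ∷ w) {i = i} {g} {p} {m} {x} {y} {v} x≤ y≤ = by (once-more 12 1 (length w))
    (subst (λ u → Run _ (text mtx (nameY ∷ w)) (logged mtx i g p m x y v) _ tt ⟨ i , g , p , u , x , y ⟩) (sym (trans (index-▷ y v (render x y w)) (cong (λ u → render x y w ▷ out H.end ∷ u) (same y v))))
      (copy-run Y→Mtx y {i = i} {map wrk g} {p} {m} {x} {y} {v} y≤ ⨾ push-run ⨾ text-run mtx w {i = i} {g} {p} {m} {x} {y} x≤ y≤))
    where
    same : ∀ x v → inks X→Pfx x v ≡ inks Y→Mtx x v
    same zero    v = refl
    same (suc x) v = same x (out H.stroke ∷ v)

  pushName-run : ∀ {b i g p m x y} → y ≤ b → Run b pushName ⟨ i , g , p , m , x , y ⟩ 12 tt ⟨ i , unary y ++ g , p , m , x , y ⟩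
  pushName-run {i = i} {g} {p} {m} {x} {y} y≤ = subst (λ w → Run _ pushName ⟨ i , g , p , m , x , y ⟩ 12 tt (map inp i ∷ [] ∷ w ∷ [] ∷ p ∷ m ∷ strokes x ∷ strokes y ∷ [] ∷ [] ∷ []))
      (trans (written y (end ∷ g)) (cong (map wrk) (sym (Listₚ.++-assoc (replicate y stroke) (end ∷ []) g))))
      (push-run ⨾ copy-run Y→Gls y {i = i} {map wrk g} {p} {m} {x} {y} {map wrk (end ∷ g)} y≤)
    where
    written : ∀ y g → inks Y→Gls y (map wrk g) ≡ map wrk (replicate y stroke ++ g)
    written zero    g = refl
    written (suc y) g = trans (written y (stroke ∷ g)) (cong (map wrk) (stroke-front y g))
      where
      stroke-front : ∀ y g → replicate y stroke ++ stroke ∷ g ≡ stroke ∷ replicate y stroke ++ g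
      stroke-front zero    g = refl
      stroke-front (suc y) g = cong (stroke ∷_) (stroke-front y g)

-- Fresh names and lookup in the environment

module LowerProgramLookup (n : ℕ) where

  open Prenexing n using (module H)
  open LowerTranslation n
  open LowerProgram n
  open LowerProgramCorrectness n
  open A using (Sort; num; set; family)
  open Programs A.Sym H.Sym Mark 8

  data Goal : Set where
    neg  : Goal
    form : Bool → Goal
    term : Bool → Bool → ℕ → Goal
    mem  : ℕ → Goal
    bind : Sort → ℕ → ℕ → Goal

  flatGoal : Goal → List Mark
  flatGoal neg          = neg ∷ []
  flatGoal (form b)     = form b ∷ []
  flatGoal (term b j v) = term b j ∷ unary v
  flatGoal (mem v)      = mem ∷ unary v
  flatGoal (bind s x i) = bind s ∷ unary x ++ unary i

  flat : List Goal → List Mark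
  flat []       = []
  flat (g ∷ gs) = flatGoal g ++ flat gs

  -- The bindings left on the goal stack, innermost first, form the environment of the current node.
  scope : List Goal → List Binding
  scope []                = []
  scope (bind s x i ∷ gs) = (s , x , i) ∷ scope gs
  scope (_ ∷ gs)          = scope gs

  private
    variable
      b x y r r′ : ℕ
      i          : List A.Sym
      g          : List Mark
      t p m      : List Γ

  at-suc : ∀ {E} {P : Prog E} {σ c e} (f : ℕ → Stacks) k j → Run b P σ c e (f (k + suc j)) → Run b P σ c e (f (suc (k + j)))
  at-suc {b} {E} {P} {σ} {c} {e} f k j = subst (λ l → Run b P σ c e (f l)) (ℕₚ.+-suc k j)

  at-zero : ∀ {E} {P : Prog E} {σ c e} (f : ℕ → Stacks) k → Run b P σ c e (f (k + 0)) → Run b P σ c e (f k)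
  at-zero {b} {E} {P} {σ} {c} {e} f k = subst (λ l → Run b P σ c e (f l)) (ℕₚ.+-identityʳ k)

  countX-run : ∀ i u x → Run 0 (countInput toX) (st i g (map inp u) p m x y 0 0) (6 * length i + 2) tt
                               (st [] g (map inp (i ʳ++ u)) p m (length i + x) y 0 0)
  countX-run [] u x = exit (pop-nothing refl ⨾ skip-run)
  countX-run {g} {p} {m} {y} (c ∷ i) u x = by (once-more 6 2 (length i)) (again (pop-just refl ⨾ push-run ⨾ push-run ⨾ skip-run)
    (at-suc (λ l → st [] g (map inp (i ʳ++ (c ∷ u))) p m l y 0 0) (length i) x (countX-run {g} {p} {m} {y} i (c ∷ u) (suc x))))

  countY-run : ∀ i u y → Run 0 (countInput toY) (st i g (map inp u) p m x y 0 0) (6 * length i + 2) tt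
                               (st [] g (map inp (i ʳ++ u)) p m x (length i + y) 0 0)
  countY-run [] u y = exit (pop-nothing refl ⨾ skip-run)
  countY-run {g} {p} {m} {x} (c ∷ i) u y = by (once-more 6 2 (length i)) (again (pop-just refl ⨾ push-run ⨾ push-run ⨾ skip-run)
    (at-suc (λ l → st [] g (map inp (i ʳ++ (c ∷ u))) p m x l 0 0) (length i) y (countY-run {g} {p} {m} {x} i (c ∷ u) (suc y))))

  putBack-run : ∀ u w → Run 0 (move Tmp In) (st w g (map inp u) p m x y 0 0) (4 * length u + 2) tt (st (u ʳ++ w) g [] p m x y 0 0)
  putBack-run [] w = exit (pop-nothing refl ⨾ skip-run)
  putBack-run {g} {p} {m} {x} {y} (c ∷ u) w = by (once-more 4 2 (length u)) (again (pop-just refl ⨾ push-run ⨾ skip-run)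
    (putBack-run {g} {p} {m} {x} {y} u (c ∷ w)))

  putBack′-run : ∀ i → Run 0 (move Tmp In) (st [] g (map inp (i ʳ++ [])) p m x y 0 0) (4 * length i + 2) tt ⟨ i , g , p , m , x , y ⟩
  putBack′-run {g} {p} {m} {x} {y} i = by (cong (λ l → 4 * l + 2) (Listₚ.length-reverse i))
    (subst (λ w → Run 0 (move Tmp In) (st [] g (map inp (i ʳ++ [])) p m x y 0 0) (4 * length (i ʳ++ []) + 2) tt ⟨ w , g , p , m , x , y ⟩)
      (Listₚ.reverse-involutive i) (putBack-run {g} {p} {m} {x} {y} (i ʳ++ []) []))

  strokesX-run : ∀ k x → Run b (strokesTo X k) ⟨ i , g , p , m , x , y ⟩ (2 * k + 1) tt ⟨ i , g , p , m , k + x , y ⟩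
  strokesX-run zero x = skip-run
  strokesX-run {b} {i} {g} {p} {m} {y} (suc k) x = by (once-more 2 1 k)
    (push-run ⨾ at-suc (λ l → ⟨ i , g , p , m , l , y ⟩) k x (strokesX-run {b} {i} {g} {p} {m} {y} k (suc x)))

  strokesY-run : ∀ k y → Run b (strokesTo Y k) ⟨ i , g , p , m , x , y ⟩ (2 * k + 1) tt ⟨ i , g , p , m , x , k + y ⟩
  strokesY-run zero y = skip-run
  strokesY-run {b} {i} {g} {p} {m} {x} (suc k) y = by (once-more 2 1 k)
    (push-run ⨾ at-suc (λ l → ⟨ i , g , p , m , x , l ⟩) k y (strokesY-run {b} {i} {g} {p} {m} {x} k (suc y)))

  freshX-run : ∀ i → length i ≤ b → Run b (freshName toX) ⟨ i , g , p , m , 0 , y ⟩ 39 tt ⟨ i , g , p , m , 14 + length i , y ⟩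
  freshX-run {b} {g} {p} {m} {y} i i≤ =
    rescale₀ 6 i≤ (weaken (loop-cost 6 (s≤s (s≤s z≤n)) (length i)) (at-zero (λ l → st [] g (map inp (i ʳ++ [])) p m l y 0 0) (length i)
      (countX-run {g} {p} {m} {y} i [] 0))) ⨾
    rescale₀ 4 i≤ (weaken (loop-cost 4 (s≤s (s≤s z≤n)) (length i)) (putBack′-run {g} {p} {m} {length i} {y} i)) ⨾
    strokesX-run {b} {i} {g} {p} {m} {y} 14 (length i)

  freshY-run : ∀ i → length i ≤ b → Run b (freshName toY) ⟨ i , g , p , m , x , 0 ⟩ 39 tt ⟨ i , g , p , m , x , 14 + length i ⟩
  freshY-run {b} {g} {p} {m} {x} i i≤ =
    rescale₀ 6 i≤ (weaken (loop-cost 6 (s≤s (s≤s z≤n)) (length i)) (at-zero (λ l → st [] g (map inp (i ʳ++ [])) p m x l 0 0) (length i)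
      (countY-run {g} {p} {m} {x} i [] 0))) ⨾
    rescale₀ 4 i≤ (weaken (loop-cost 4 (s≤s (s≤s z≤n)) (length i)) (putBack′-run {g} {p} {m} {x} {length i} i)) ⨾
    strokesY-run {b} {i} {g} {p} {m} {x} 14 (length i)

  readName-loop : ∀ v x → Run 0 readName ⟨ i , unary v ++ g , p , m , x , y ⟩ (4 * v + 2) tt ⟨ i , g , p , m , v + x , y ⟩
  readName-loop zero x = exit (pop-just refl ⨾ skip-run)
  readName-loop {i} {g} {p} {m} {y} (suc v) x = by (once-more 4 2 v) (again (pop-just refl ⨾ push-run ⨾ skip-run)
    (at-suc (λ l → ⟨ i , g , p , m , l , y ⟩) v x (readName-loop {i} {g} {p} {m} {y} v (suc x))))

  readName-run : ∀ v → v ≤ b → Run b readName ⟨ i , unary v ++ g , p , m , 0 , y ⟩ 4 tt ⟨ i , g , p , m , v , y ⟩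
  readName-run {b} {i} {g} {p} {m} {y} v v≤ = rescale₀ 4 v≤ (weaken (loop-cost 4 (s≤s (s≤s z≤n)) v)
    (at-zero (λ l → ⟨ i , g , p , m , l , y ⟩) v (readName-loop {i} {g} {p} {m} {y} v 0)))

  dropName-loop : ∀ v → Run 0 dropName ⟨ i , unary v ++ g , p , m , x , y ⟩ (2 * v + 2) tt ⟨ i , g , p , m , x , y ⟩
  dropName-loop zero = exit (pop-just refl ⨾ skip-run)
  dropName-loop {i} {g} {p} {m} {x} {y} (suc v) = by (once-more 2 2 v) (again (pop-just refl ⨾ skip-run) (dropName-loop {i} {g} {p} {m} {x} {y} v))

  dropName-run : ∀ v → v ≤ b → Run b dropName ⟨ i , unary v ++ g , p , m , x , y ⟩ 2 tt ⟨ i , g , p , m , x , y ⟩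
  dropName-run {b} {i} {g} {p} {m} {x} {y} v v≤ = rescale₀ 2 v≤ (weaken (loop-cost 2 (s≤s (s≤s z≤n)) v) (dropName-loop {i} {g} {p} {m} {x} {y} v))

  readIndex-loop : ∀ v r → Run 0 readIndex (st (A.encodeIndex v ++ i) g [] p m x y r 0) (4 * v + 2) tt (st i g [] p m x y (v + r) 0)
  readIndex-loop zero r = exit (pop-just refl ⨾ skip-run)
  readIndex-loop {i} {g} {p} {m} {x} {y} (suc v) r = by (once-more 4 2 v) (again (pop-just refl ⨾ push-run ⨾ skip-run)
    (at-suc (λ l → st i g [] p m x y l 0) v r (readIndex-loop {i} {g} {p} {m} {x} {y} v (suc r))))

  readIndex-run : ∀ v → v ≤ b → Run b readIndex ⟨ A.encodeIndex v ++ i , g , p , m , x , y ⟩ 4 tt (st i g [] p m x y v 0)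
  readIndex-run {b} {i} {g} {p} {m} {x} {y} v v≤ = rescale₀ 4 v≤ (weaken (loop-cost 4 (s≤s (s≤s z≤n)) v)
    (at-zero (λ l → st i g [] p m x y l 0) v (readIndex-loop {i} {g} {p} {m} {x} {y} v 0)))

  stroke-first : ∀ k (g : List Mark) → replicate k stroke ++ stroke ∷ g ≡ stroke ∷ replicate k stroke ++ g
  stroke-first zero    g = refl
  stroke-first (suc k) g = cong (stroke ∷_) (stroke-first k g)

  storeIndex-loop : ∀ v g → Run 0 (move R Gls) (st i g [] p m x y v 0) (4 * v + 2) tt ⟨ i , replicate v stroke ++ g , p , m , x , y ⟩
  storeIndex-loop zero g = exit (pop-nothing refl ⨾ skip-run)
  storeIndex-loop {i} {p} {m} {x} {y} (suc v) g = by (once-more 4 2 v) (again (pop-just refl ⨾ push-run ⨾ skip-run)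
    (subst (λ h → Run 0 (move R Gls) (st i (stroke ∷ g) [] p m x y v 0) (4 * v + 2) tt ⟨ i , h , p , m , x , y ⟩) (stroke-first v g)
      (storeIndex-loop {i} {p} {m} {x} {y} v (stroke ∷ g))))

  storeIndex-run : ∀ v → v ≤ b → Run b (move R Gls) (st i (end ∷ g) [] p m x y v 0) 4 tt ⟨ i , unary v ++ g , p , m , x , y ⟩
  storeIndex-run {b} {i} {g} {p} {m} {x} {y} v v≤ = rescale₀ 4 v≤ (weaken (loop-cost 4 (s≤s (s≤s z≤n)) v)
    (subst (λ h → Run 0 (move R Gls) (st i (end ∷ g) [] p m x y v 0) (4 * v + 2) tt ⟨ i , h , p , m , x , y ⟩)
      (sym (Listₚ.++-assoc (replicate v stroke) (end ∷ []) g)) (storeIndex-loop {i} {p} {m} {x} {y} v (end ∷ g))))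

  clearX-loop : ∀ x → Run 0 (clear X) ⟨ i , g , p , m , x , y ⟩ (2 * x + 2) tt ⟨ i , g , p , m , 0 , y ⟩
  clearX-loop zero = exit (pop-nothing refl ⨾ skip-run)
  clearX-loop {i} {g} {p} {m} {y} (suc x) = by (once-more 2 2 x) (again (pop-just refl ⨾ skip-run) (clearX-loop {i} {g} {p} {m} {y} x))

  clearY-loop : ∀ y → Run 0 (clear Y) ⟨ i , g , p , m , x , y ⟩ (2 * y + 2) tt ⟨ i , g , p , m , x , 0 ⟩
  clearY-loop zero = exit (pop-nothing refl ⨾ skip-run)
  clearY-loop {i} {g} {p} {m} {x} (suc y) = by (once-more 2 2 y) (again (pop-just refl ⨾ skip-run) (clearY-loop {i} {g} {p} {m} {x} y))

  clearX-run : x ≤ b → Run b (clear X) ⟨ i , g , p , m , x , y ⟩ 2 tt ⟨ i , g , p , m , 0 , y ⟩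
  clearX-run {x} {b} {i} {g} {p} {m} {y} x≤ = rescale₀ 2 x≤ (weaken (loop-cost 2 (s≤s (s≤s z≤n)) x) (clearX-loop {i} {g} {p} {m} {y} x))

  clearY-run : y ≤ b → Run b (clear Y) ⟨ i , g , p , m , x , y ⟩ 2 tt ⟨ i , g , p , m , x , 0 ⟩
  clearY-run {y} {b} {i} {g} {p} {m} {x} y≤ = rescale₀ 2 y≤ (weaken (loop-cost 2 (s≤s (s≤s z≤n)) y) (clearY-loop {i} {g} {p} {m} {x} y))

  clearR-loop : ∀ r → Run 0 (clear R) (st i g t p m x y r r′) (2 * r + 2) tt (st i g t p m x y 0 r′)
  clearR-loop zero = exit (pop-nothing refl ⨾ skip-run)
  clearR-loop {i} {g} {t} {p} {m} {x} {y} {r′} (suc r) = by (once-more 2 2 r) (again (pop-just refl ⨾ skip-run) (clearR-loop {i} {g} {t} {p} {m} {x} {y} {r′} r))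

  clearR′-loop : ∀ r′ → Run 0 (clear R′) (st i g t p m x y r r′) (2 * r′ + 2) tt (st i g t p m x y r 0)
  clearR′-loop zero = exit (pop-nothing refl ⨾ skip-run)
  clearR′-loop {i} {g} {t} {p} {m} {x} {y} {r} (suc r′) = by (once-more 2 2 r′) (again (pop-just refl ⨾ skip-run) (clearR′-loop {i} {g} {t} {p} {m} {x} {y} {r} r′))

  -- The answer of `compare`. Once R runs out, the rest of the index is still moved away with the
  -- answer false, so that the scan is past the index in every case; `moved` counts the strokes that
  -- have gone to R′ by then.
  verdict : Bool → ℕ → ℕ → Bool
  verdict ok zero     zero    = ok
  verdict ok zero     (suc r) = false
  verdict ok (suc x′) zero    = verdict false x′ zero
  verdict ok (suc x′) (suc r) = verdict ok x′ r

  moved : ℕ → ℕ → ℕ → ℕ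
  moved zero     r       r′ = r′
  moved (suc x′) zero    r′ = moved x′ zero r′
  moved (suc x′) (suc r) r′ = moved x′ r (suc r′)

  verdict-false : ∀ x′ r → verdict false x′ r ≡ false
  verdict-false zero     zero    = refl
  verdict-false zero     (suc r) = refl
  verdict-false (suc x′) zero    = verdict-false x′ zero
  verdict-false (suc x′) (suc r) = verdict-false x′ r

  verdict-true : ∀ x′ r → verdict true x′ r ≡ true → r ≡ x′
  verdict-true zero     zero    eq = refl
  verdict-true (suc x′) zero    eq with trans (sym eq) (verdict-false x′ zero)
  ... | ()
  verdict-true (suc x′) (suc r) eq = cong suc (verdict-true x′ r eq)

  verdict-refl : ∀ x′ → verdict true x′ x′ ≡ true
  verdict-refl zero     = refl
  verdict-refl (suc x′) = verdict-refl x′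

  moved-total : ∀ x′ r r′ → moved x′ r r′ + (r ℕ.∸ x′) ≡ r + r′
  moved-total zero     r       r′ = ℕₚ.+-comm r′ r
  moved-total (suc x′) zero    r′ = trans (cong (moved x′ zero r′ +_) (sym (ℕₚ.0∸n≡0 x′))) (moved-total x′ zero r′)
  moved-total (suc x′) (suc r) r′ = trans (moved-total x′ r (suc r′)) (ℕₚ.+-suc r r′)

  moved-bound : ∀ x′ r r′ → moved x′ r r′ ≤ x′ + r′
  moved-bound zero     r       r′ = ℕₚ.≤-refl
  moved-bound (suc x′) zero    r′ = ℕₚ.≤-trans (moved-bound x′ zero r′) (ℕₚ.n≤1+n _)
  moved-bound (suc x′) (suc r) r′ = ℕₚ.≤-trans (moved-bound x′ r (suc r′)) (ℕₚ.≤-reflexive (ℕₚ.+-suc x′ r′))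

  compare-run : ∀ x′ ok r r′ u → Run 0 (loop compareStep ok) (st i (unary x′ ++ g) (map wrk u) p m x y r r′) (7 * suc x′) (verdict ok x′ r)
                                       (st i g (map wrk (unary x′ ʳ++ u)) p m x y (r ℕ.∸ x′) (moved x′ r r′))
  compare-run zero ok zero    r′ u = exit (weaken (toWitness {a? = 5 ℕₚ.≤? 7} tt) (pop-just refl ⨾ push-run ⨾ pop-nothing refl ⨾ skip-run))
  compare-run zero ok (suc r) r′ u = exit (pop-just refl ⨾ push-run ⨾ pop-just refl ⨾ push-run ⨾ skip-run)
  compare-run {i} {g} {p} {m} {x} {y} (suc x′) ok zero r′ u =
    weaken (subst (5 + 7 * suc x′ ≤_) (sym (ℕₚ.*-suc 7 (suc x′))) (ℕₚ.+-monoˡ-≤ (7 * suc x′) (toWitness {a? = 5 ℕₚ.≤? 7} tt)))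
      (again (pop-just refl ⨾ push-run ⨾ pop-nothing refl ⨾ skip-run)
        (subst (λ l → Run 0 (loop compareStep false) (st i (unary x′ ++ g) (map wrk (stroke ∷ u)) p m x y 0 r′) (7 * suc x′) (verdict false x′ 0)
                            (st i g (map wrk (unary x′ ʳ++ (stroke ∷ u))) p m x y l (moved x′ 0 r′)))
          (ℕₚ.0∸n≡0 x′) (compare-run {i} {g} {p} {m} {x} {y} x′ false zero r′ (stroke ∷ u))))
  compare-run {i} {g} {p} {m} {x} {y} (suc x′) ok (suc r) r′ u = by (sym (ℕₚ.*-suc 7 (suc x′)))
    (again (pop-just refl ⨾ push-run ⨾ pop-just refl ⨾ push-run ⨾ skip-run) (compare-run {i} {g} {p} {m} {x} {y} x′ ok r (suc r′) (stroke ∷ u)))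

  takeName-run : ∀ v y u → Run 0 takeName (st i (unary v ++ g) (map wrk u) p m x y r r′) (6 * suc v) tt (st i g (map wrk (unary v ʳ++ u)) p m x (v + y) r r′)
  takeName-run zero y u = exit (weaken (toWitness {a? = 4 ℕₚ.≤? 6} tt) (pop-just refl ⨾ push-run ⨾ skip-run))
  takeName-run {i} {g} {p} {m} {x} {r} {r′} (suc v) y u = by (sym (ℕₚ.*-suc 6 (suc v))) (again (pop-just refl ⨾ push-run ⨾ push-run ⨾ skip-run)
    (at-suc (λ l → st i g (map wrk (unary v ʳ++ (stroke ∷ u))) p m x l r r′) v y (takeName-run {i} {g} {p} {m} {x} {r} {r′} v (suc y) (stroke ∷ u))))

  regain-run : ∀ r′ r → Run 0 (move R′ R) (st i g t p m x y r r′) (4 * r′ + 2) tt (st i g t p m x y (r′ + r) 0)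
  regain-run zero r = exit (pop-nothing refl ⨾ skip-run)
  regain-run {i} {g} {t} {p} {m} {x} {y} (suc r′) r = by (once-more 4 2 r′) (again (pop-just refl ⨾ push-run ⨾ skip-run)
    (at-suc (λ l → st i g t p m x y l 0) r′ r (regain-run {i} {g} {t} {p} {m} {x} {y} r′ (suc r))))

  Plain : Mark → Set
  Plain (bind _) = ⊥
  Plain _        = ⊤

  pass-run : ∀ {s u c σ} a → Plain a → Run 0 (scan s) (st i g (map wrk (a ∷ u)) p m x y r r′) c tt σ →
             Run 0 (scan s) (st i (a ∷ g) (map wrk u) p m x y r r′) (4 + c) tt σ
  pass-run stroke     _ = again (pop-just refl ⨾ push-run ⨾ skip-run)
  pass-run end        _ = again (pop-just refl ⨾ push-run ⨾ skip-run)
  pass-run neg        _ = again (pop-just refl ⨾ push-run ⨾ skip-run)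
  pass-run mem        _ = again (pop-just refl ⨾ push-run ⨾ skip-run)
  pass-run (form _)   _ = again (pop-just refl ⨾ push-run ⨾ skip-run)
  pass-run (term _ _) _ = again (pop-just refl ⨾ push-run ⨾ skip-run)

  pass-unary : ∀ {s c σ} v u → Run 0 (scan s) (st i g (map wrk (unary v ʳ++ u)) p m x y r r′) c tt σ →
               Run 0 (scan s) (st i (unary v ++ g) (map wrk u) p m x y r r′) (4 * suc v + c) tt σ
  pass-unary {i} {g} {p} {m} {x} {y} {r} {r′} zero u go = pass-run {i} {g} {p} {m} {x} {y} {r} {r′} end tt go
  pass-unary {i} {g} {p} {m} {x} {y} {r} {r′} {c = c} (suc v) u go = by (arrange v c)
    (pass-run {i} {unary v ++ g} {p} {m} {x} {y} {r} {r′} stroke tt (pass-unary {i} {g} {p} {m} {x} {y} {r} {r′} v (stroke ∷ u) go))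
    where
    arrange : ∀ v c → 4 + (4 * suc v + c) ≡ 4 * suc (suc v) + c
    arrange = solve-∀

  find-hit : ∀ ρ s x j → find ((s , x , j) ∷ ρ) s x ≡ j
  find-hit ρ s x j with (s , x) ≟ᵛ (s , x)
  ... | yes _ = refl
  ... | no ≠  = ⊥-elim (≠ refl)

  find-miss : ∀ ρ {s x s′ x′} j → (s , x) ≢ (s′ , x′) → find ((s′ , x′ , j) ∷ ρ) s x ≡ find ρ s x
  find-miss ρ {s} {x} {s′} {x′} j ≠ with (s , x) ≟ᵛ (s′ , x′)
  ... | yes eq = ⊥-elim (≠ eq)
  ... | no _   = refl

  ≡ˢ-refl : ∀ s → (s ≡ˢ s) ≡ true
  ≡ˢ-refl num    = refl
  ≡ˢ-refl set    = refl
  ≡ˢ-refl family = refl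

  unary-length : ∀ v → length (unary v) ≡ suc v
  unary-length zero    = refl
  unary-length (suc v) = cong suc (unary-length v)

  -- The goals split into those passed, which lie reversed on `Tmp`, and those ahead. What remains
  -- in R and R′ is bounded by r, so that clearing them is cheap.
  record Scanned (s : Sort) (gs : List Goal) (i : List A.Sym) (seen : List Mark) (p m : List Γ) (x r : ℕ) : Set where
    field
      passed ahead : List Mark
      split       : flat gs ≡ passed ++ ahead
      rest rest′  : ℕ
      rest≤       : rest ≤ r
      rest′≤      : rest′ ≤ r
      scanned     : Run 0 (scan s) (st i (flat gs) (map wrk seen) p m x 0 r 0) (16 * length (flat gs) + 2) tt
                      (st i ahead (map wrk (passed ʳ++ seen)) p m x (find (scope gs) s r) rest rest′)

  bind-flat : ∀ s x j gs → flat (bind s x j ∷ gs) ≡ bind s ∷ unary x ++ unary j ++ flat gs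
  bind-flat s x j gs = cong (bind s ∷_) (Listₚ.++-assoc (unary x) (unary j) (flat gs))

  bind-length : ∀ s x j gs → length (flat (bind s x j ∷ gs)) ≡ suc (suc x + (suc j + length (flat gs)))
  bind-length s x j gs = trans (cong length (bind-flat s x j gs)) (cong suc (trans (Listₚ.length-++ (unary x))
    (cong₂ _+_ (unary-length x) (trans (Listₚ.length-++ (unary j)) (cong (_+ length (flat gs)) (unary-length j))))))

  -- Each mark of the goal stack is charged 16 steps, which covers passing it, comparing it,
  -- restoring R after a mismatch, and copying the name after a match.
  scan-run : ∀ s gs i seen p m x r → Scanned s gs i seen p m x r
  scan-marked : ∀ s a v gs i seen p m x r → Plain a → Scanned s gs i (unary v ʳ++ (a ∷ seen)) p m x r →
                let open Scanned in (sc : Scanned s gs i (unary v ʳ++ (a ∷ seen)) p m x r) →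
                Run 0 (scan s) (st i (a ∷ unary v ++ flat gs) (map wrk seen) p m x 0 r 0) (16 * length (a ∷ unary v ++ flat gs) + 2) tt
                  (st i (ahead sc) (map wrk (passed sc ʳ++ (unary v ʳ++ (a ∷ seen)))) p m x (find (scope gs) s r) (rest sc) (rest′ sc))
  scan-marked s a v gs i seen p m x r plain _ sc = weaken bound
    (pass-run {i} {unary v ++ flat gs} {p} {m} {x} {0} {r} {0} {u = seen} a plain
      (pass-unary {i} {flat gs} {p} {m} {x} {0} {r} {0} v (a ∷ seen) (Scanned.scanned sc)))
    where
    bound : 4 + (4 * suc v + (16 * length (flat gs) + 2)) ≤ 16 * length (a ∷ unary v ++ flat gs) + 2
    bound = ℕₚ.≤-trans (ℕₚ.m≤m+n _ (12 + 12 * suc v)) (ℕₚ.≤-reflexive (trans (arrange (suc v) (length (flat gs)))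
      (cong (λ l → 16 * suc l + 2) (sym (trans (Listₚ.length-++ (unary v)) (cong (_+ length (flat gs)) (unary-length v)))))))
      where
      arrange : ∀ v l → 4 + (4 * v + (16 * l + 2)) + (12 + 12 * v) ≡ 16 * suc (v + l) + 2
      arrange = solve-∀
  scan-run s [] i seen p m x r = record
    { passed = [] ; ahead = [] ; split = refl ; rest = r ; rest′ = 0 ; rest≤ = ℕₚ.≤-refl ; rest′≤ = z≤n
    ; scanned = exit (pop-nothing refl ⨾ skip-run) }
  scan-run s (neg ∷ gs) i seen p m x r = record
    { Scanned sc using (ahead; rest; rest′; rest≤; rest′≤)
    ; passed = neg ∷ Scanned.passed sc ; split = cong (neg ∷_) (Scanned.split sc)
    ; scanned = weaken (bound (length (flat gs))) (pass-run {i} {flat gs} {p} {m} {x} {0} {r} {0} {u = seen} neg tt (Scanned.scanned sc)) }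
    where
    sc : Scanned s gs i (neg ∷ seen) p m x r
    sc = scan-run s gs i (neg ∷ seen) p m x r
    bound : ∀ l → 4 + (16 * l + 2) ≤ 16 * suc l + 2
    bound l = subst (4 + (16 * l + 2) ≤_) (once-more 16 2 l) (ℕₚ.+-monoˡ-≤ (16 * l + 2) (toWitness {a? = 4 ℕₚ.≤? 16} tt))
  scan-run s (form b ∷ gs) i seen p m x r = record
    { Scanned sc using (ahead; rest; rest′; rest≤; rest′≤)
    ; passed = form b ∷ Scanned.passed sc ; split = cong (form b ∷_) (Scanned.split sc)
    ; scanned = weaken (bound (length (flat gs))) (pass-run {i} {flat gs} {p} {m} {x} {0} {r} {0} {u = seen} (form b) tt (Scanned.scanned sc)) }
    where
    sc : Scanned s gs i (form b ∷ seen) p m x r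
    sc = scan-run s gs i (form b ∷ seen) p m x r
    bound : ∀ l → 4 + (16 * l + 2) ≤ 16 * suc l + 2
    bound l = subst (4 + (16 * l + 2) ≤_) (once-more 16 2 l) (ℕₚ.+-monoˡ-≤ (16 * l + 2) (toWitness {a? = 4 ℕₚ.≤? 16} tt))
  scan-run s (term b j v ∷ gs) i seen p m x r = record
    { Scanned sc using (ahead; rest; rest′; rest≤; rest′≤)
    ; passed = term b j ∷ unary v ++ Scanned.passed sc
    ; split = cong (term b j ∷_) (trans (cong (unary v ++_) (Scanned.split sc)) (sym (Listₚ.++-assoc (unary v) _ _)))
    ; scanned = subst (λ t → Run 0 (scan s) _ _ tt (st i (Scanned.ahead sc) (map wrk t) p m x (find (scope gs) s r) (Scanned.rest sc) (Scanned.rest′ sc)))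
        (sym (Listₚ.++-ʳ++ (unary v))) (scan-marked s (term b j) v gs i seen p m x r tt sc sc) }
    where
    sc : Scanned s gs i (unary v ʳ++ (term b j ∷ seen)) p m x r
    sc = scan-run s gs i (unary v ʳ++ (term b j ∷ seen)) p m x r
  scan-run s (mem v ∷ gs) i seen p m x r = record
    { Scanned sc using (ahead; rest; rest′; rest≤; rest′≤)
    ; passed = mem ∷ unary v ++ Scanned.passed sc
    ; split = cong (mem ∷_) (trans (cong (unary v ++_) (Scanned.split sc)) (sym (Listₚ.++-assoc (unary v) _ _)))
    ; scanned = subst (λ t → Run 0 (scan s) _ _ tt (st i (Scanned.ahead sc) (map wrk t) p m x (find (scope gs) s r) (Scanned.rest sc) (Scanned.rest′ sc)))
        (sym (Listₚ.++-ʳ++ (unary v))) (scan-marked s mem v gs i seen p m x r tt sc sc) }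
    where
    sc : Scanned s gs i (unary v ʳ++ (mem ∷ seen)) p m x r
    sc = scan-run s gs i (unary v ʳ++ (mem ∷ seen)) p m x r
  scan-run s (bind s′ x′ j ∷ gs) i seen p m x r = decide (s ≡ˢ s′) refl (verdict true x′ r) refl
    where
    L : ℕ
    L = length (flat gs)
    seen₁ seen₂ : List Mark
    seen₁ = unary x′ ʳ++ (bind s′ ∷ seen)
    seen₂ = unary j ʳ++ seen₁
    sc : Scanned s gs i seen₂ p m x r
    sc = scan-run s gs i seen₂ p m x r
    open Scanned sc
    -- The state after the binding has been passed without a match.
    missed : (s , r) ≢ (s′ , x′) → ∀ {c} →
             c + (4 * suc j + (16 * L + 2)) ≤ 16 * suc (suc x′ + (suc j + L)) + 2 →
             (∀ {c′ τ} → Run 0 (scan s) (st i (unary j ++ flat gs) (map wrk seen₁) p m x 0 r 0) c′ tt τ →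
              Run 0 (scan s) (st i (bind s′ ∷ unary x′ ++ unary j ++ flat gs) (map wrk seen) p m x 0 r 0) (c + c′) tt τ) →
             Scanned s (bind s′ x′ j ∷ gs) i seen p m x r
    missed ≠ {c} bound start = record
      { passed = bind s′ ∷ unary x′ ++ unary j ++ passed ; ahead = ahead ; rest = rest ; rest′ = rest′ ; rest≤ = rest≤ ; rest′≤ = rest′≤
      ; split = trans (bind-flat s′ x′ j gs) (cong (bind s′ ∷_) (trans (cong (λ w → unary x′ ++ unary j ++ w) split)
          (trans (cong (unary x′ ++_) (sym (Listₚ.++-assoc (unary j) passed ahead))) (sym (Listₚ.++-assoc (unary x′) (unary j ++ passed) ahead)))))
      ; scanned = subst₂ (λ g t → Run 0 (scan s) (st i g (map wrk seen) p m x 0 r 0) (16 * length g + 2) tt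
                           (st i ahead (map wrk t) p m x (find (scope (bind s′ x′ j ∷ gs)) s r) rest rest′))
          (sym (bind-flat s′ x′ j gs)) (sym (trans (Listₚ.++-ʳ++ (unary x′)) (Listₚ.++-ʳ++ (unary j))))
          (subst (λ y → Run 0 (scan s) _ _ tt (st i ahead (map wrk (passed ʳ++ seen₂)) p m x y rest rest′)) (sym (find-miss (scope gs) j ≠))
            (weaken (subst (λ l → c + (4 * suc j + (16 * L + 2)) ≤ 16 * l + 2) (sym (trans (cong length (sym (bind-flat s′ x′ j gs))) (bind-length s′ x′ j gs))) bound)
              (start (pass-unary {i} {flat gs} {p} {m} {x} {0} {r} {0} j seen₁ scanned)))) }
    decide : ∀ e → (s ≡ˢ s′) ≡ e → ∀ v → verdict true x′ r ≡ v → Scanned s (bind s′ x′ j ∷ gs) i seen p m x r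
    decide false eq v eqv = missed (λ { refl → case trans (sym eq) (≡ˢ-refl s) of λ () }) bound start
      where
      bound : 4 + 4 * suc x′ + (4 * suc j + (16 * L + 2)) ≤ 16 * suc (suc x′ + (suc j + L)) + 2
      bound = ℕₚ.≤-trans (ℕₚ.m≤m+n _ (12 + 12 * suc x′ + 12 * suc j)) (ℕₚ.≤-reflexive (arrange (suc x′) (suc j) L))
        where
        arrange : ∀ X I L → 4 + 4 * X + (4 * I + (16 * L + 2)) + (12 + 12 * X + 12 * I) ≡ 16 * suc (X + (I + L)) + 2
        arrange = solve-∀
      start : ∀ {c′ τ} → Run 0 (scan s) (st i (unary j ++ flat gs) (map wrk seen₁) p m x 0 r 0) c′ tt τ →
              Run 0 (scan s) (st i (bind s′ ∷ unary x′ ++ unary j ++ flat gs) (map wrk seen) p m x 0 r 0) (4 + 4 * suc x′ + c′) tt τ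
      start {c′} {τ} go = by (sym (ℕₚ.+-assoc 4 (4 * suc x′) c′))
        (again (pop-just refl ⨾ push-run ⨾ subst (λ e → Run 0 (examine e) _ 1 (inj₁ tt) _) (sym eq) skip-run)
          (pass-unary {i} {unary j ++ flat gs} {p} {m} {x} {0} {r} {0} x′ (bind s′ ∷ seen) go))
    decide true eq false eqv = missed (λ { refl → case trans (sym eqv) (verdict-refl x′) of λ () }) bound start
      where
      k₀ : ℕ
      k₀ = moved x′ r 0
      bound : 3 + (7 * suc x′ + (4 * k₀ + 2 + 1)) + (4 * suc j + (16 * L + 2)) ≤ 16 * suc (suc x′ + (suc j + L)) + 2
      bound = ℕₚ.≤-trans (ℕₚ.+-monoˡ-≤ (4 * suc j + (16 * L + 2)) (ℕₚ.+-monoʳ-≤ 3 (ℕₚ.+-monoʳ-≤ (7 * suc x′) (ℕₚ.+-monoˡ-≤ 1 (ℕₚ.+-monoˡ-≤ 2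
          (ℕₚ.*-monoʳ-≤ 4 (ℕₚ.≤-trans (moved-bound x′ r 0) (ℕₚ.≤-trans (ℕₚ.≤-reflexive (ℕₚ.+-identityʳ x′)) (ℕₚ.n≤1+n x′)))))))))
        (ℕₚ.≤-trans (ℕₚ.m≤m+n _ (10 + 5 * suc x′ + 12 * suc j)) (ℕₚ.≤-reflexive (arrange (suc x′) (suc j) L)))
        where
        arrange : ∀ X I L → 3 + (7 * X + (4 * X + 2 + 1)) + (4 * I + (16 * L + 2)) + (10 + 5 * X + 12 * I) ≡ 16 * suc (X + (I + L)) + 2
        arrange = solve-∀
      start : ∀ {c′ τ} → Run 0 (scan s) (st i (unary j ++ flat gs) (map wrk seen₁) p m x 0 r 0) c′ tt τ →
              Run 0 (scan s) (st i (bind s′ ∷ unary x′ ++ unary j ++ flat gs) (map wrk seen) p m x 0 r 0) (3 + (7 * suc x′ + (4 * k₀ + 2 + 1)) + c′) tt τ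
      start go = again (pop-just refl ⨾ push-run ⨾ subst (λ e → Run 0 (examine e) (st i (unary x′ ++ unary j ++ flat gs) (map wrk (bind s′ ∷ seen)) p m x 0 r 0)
            (7 * suc x′ + (4 * k₀ + 2 + 1)) (inj₁ tt) (st i (unary j ++ flat gs) (map wrk seen₁) p m x 0 r 0)) (sym eq) mismatch) go
        where
        mismatch : Run 0 (examine true) (st i (unary x′ ++ unary j ++ flat gs) (map wrk (bind s′ ∷ seen)) p m x 0 r 0)
                     (7 * suc x′ + (4 * k₀ + 2 + 1)) (inj₁ tt) (st i (unary j ++ flat gs) (map wrk seen₁) p m x 0 r 0)
        mismatch = subst (λ v → Run 0 compare (st i (unary x′ ++ unary j ++ flat gs) (map wrk (bind s′ ∷ seen)) p m x 0 r 0) (7 * suc x′) v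
                                  (st i (unary j ++ flat gs) (map wrk seen₁) p m x 0 (r ℕ.∸ x′) k₀)) eqv
                     (compare-run {i} {unary j ++ flat gs} {p} {m} {x} {0} x′ true r 0 (bind s′ ∷ seen)) ⨾
                   subst (λ l → Run 0 (move R′ R) (st i (unary j ++ flat gs) (map wrk seen₁) p m x 0 (r ℕ.∸ x′) k₀) (4 * k₀ + 2) tt
                                  (st i (unary j ++ flat gs) (map wrk seen₁) p m x 0 l 0)) (trans (moved-total x′ r 0) (ℕₚ.+-identityʳ r))
                     (regain-run {i} {unary j ++ flat gs} {map wrk seen₁} {p} {m} {x} {0} k₀ (r ℕ.∸ x′)) ⨾
                   skip-run
    decide true eq true eqv = record
      { passed = bind s′ ∷ unary x′ ++ unary j ; ahead = flat gs ; rest = r ℕ.∸ x′ ; rest′ = moved x′ r 0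
      ; rest≤ = ℕₚ.m∸n≤m r x′
      ; rest′≤ = ℕₚ.≤-trans (ℕₚ.m≤m+n (moved x′ r 0) (r ℕ.∸ x′)) (ℕₚ.≤-reflexive (trans (moved-total x′ r 0) (ℕₚ.+-identityʳ r)))
      ; split = refl
      ; scanned = subst₂ (λ g t → Run 0 (scan s) (st i g (map wrk seen) p m x 0 r 0) (16 * length g + 2) tt
                           (st i (flat gs) (map wrk t) p m x (find (scope (bind s′ x′ j ∷ gs)) s r) (r ℕ.∸ x′) (moved x′ r 0)))
          (sym (bind-flat s′ x′ j gs)) (sym (Listₚ.++-ʳ++ (unary x′)))
          (subst (λ y → Run 0 (scan s) (st i (bind s′ ∷ unary x′ ++ unary j ++ flat gs) (map wrk seen) p m x 0 r 0)
                          (16 * length (bind s′ ∷ unary x′ ++ unary j ++ flat gs) + 2) tt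
                          (st i (flat gs) (map wrk seen₂) p m x y (r ℕ.∸ x′) (moved x′ r 0))) found
            (weaken (subst (λ l → 1 + (2 + (7 * suc x′ + (6 * suc j + 1))) ≤ 16 * l + 2) (sym (trans (cong length (sym (bind-flat s′ x′ j gs))) (bind-length s′ x′ j gs))) bound)
              (exit (pop-just refl ⨾ push-run ⨾ subst (λ e → Run 0 (examine e) (st i (unary x′ ++ unary j ++ flat gs) (map wrk (bind s′ ∷ seen)) p m x 0 r 0)
                 (7 * suc x′ + (6 * suc j + 1)) (inj₂ tt) (st i (flat gs) (map wrk seen₂) p m x (j + 0) (r ℕ.∸ x′) (moved x′ r 0))) (sym eq) match)))) }
      where
      match : Run 0 (examine true) (st i (unary x′ ++ unary j ++ flat gs) (map wrk (bind s′ ∷ seen)) p m x 0 r 0)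
                (7 * suc x′ + (6 * suc j + 1)) (inj₂ tt) (st i (flat gs) (map wrk seen₂) p m x (j + 0) (r ℕ.∸ x′) (moved x′ r 0))
      match = subst (λ v → Run 0 compare (st i (unary x′ ++ unary j ++ flat gs) (map wrk (bind s′ ∷ seen)) p m x 0 r 0) (7 * suc x′) v
                             (st i (unary j ++ flat gs) (map wrk seen₁) p m x 0 (r ℕ.∸ x′) (moved x′ r 0))) eqv
                (compare-run {i} {unary j ++ flat gs} {p} {m} {x} {0} x′ true r 0 (bind s′ ∷ seen)) ⨾
              takeName-run {i} {flat gs} {p} {m} {x} {r ℕ.∸ x′} {moved x′ r 0} j 0 seen₁ ⨾
              skip-run
      found : j + 0 ≡ find (scope (bind s′ x′ j ∷ gs)) s r
      found = trans (ℕₚ.+-identityʳ j) (sym (trans (cong₂ (λ s′ x′ → find ((s′ , x′ , j) ∷ scope gs) s r)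
        (sym (≡ˢ-sound s s′ (from Boolₚ.T-≡ eq))) (sym (verdict-true x′ r eqv))) (find-hit (scope gs) s r j)))
      bound : 1 + (2 + (7 * suc x′ + (6 * suc j + 1))) ≤ 16 * suc (suc x′ + (suc j + L)) + 2
      bound = ℕₚ.≤-trans (ℕₚ.m≤m+n _ (12 + 9 * suc x′ + 10 * suc j + 16 * L + 2)) (ℕₚ.≤-reflexive (arrange (suc x′) (suc j) L))
        where
        arrange : ∀ X I L → 1 + (2 + (7 * X + (6 * I + 1))) + (12 + 9 * X + 10 * I + 16 * L + 2) ≡ 16 * suc (X + (I + L)) + 2
        arrange = solve-∀

  unscan-run : ∀ u w → Run 0 (move Tmp Gls) (st i w (map wrk u) p m x y r r′) (4 * length u + 2) tt (st i (u ʳ++ w) [] p m x y r r′)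
  unscan-run [] w = exit (pop-nothing refl ⨾ skip-run)
  unscan-run {i} {p} {m} {x} {y} {r} {r′} (a ∷ u) w = by (once-more 4 2 (length u)) (again (pop-just refl ⨾ push-run ⨾ skip-run)
    (unscan-run {i} {p} {m} {x} {y} {r} {r′} u (a ∷ w)))

  findName-run : ∀ s gs r → length (flat gs) ≤ b → r ≤ b →
                 Run b (findName s) (st i (flat gs) [] p m x 0 r 0) 24 tt ⟨ i , flat gs , p , m , x , find (scope gs) s r ⟩
  findName-run {b} {i} {p} {m} {x} s gs r gs≤ r≤ =
      rescale₀ 16 gs≤ (weaken (loop-cost 16 (s≤s (s≤s z≤n)) (length (flat gs))) scanned) ⨾
      rescale₀ 4 passed≤ (weaken (loop-cost 4 (s≤s (s≤s z≤n)) (length passed)) restored) ⨾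
      rescale₀ 2 (ℕₚ.≤-trans rest≤ r≤) (weaken (loop-cost 2 (s≤s (s≤s z≤n)) rest) (clearR-loop {i} {flat gs} {[]} {p} {m} {x} {y₀} {rest′} rest)) ⨾
      rescale₀ 2 (ℕₚ.≤-trans rest′≤ r≤) (weaken (loop-cost 2 (s≤s (s≤s z≤n)) rest′) (clearR′-loop {i} {flat gs} {[]} {p} {m} {x} {y₀} {0} rest′))
    where
    open Scanned (scan-run s gs i [] p m x r)
    y₀ : ℕ
    y₀ = find (scope gs) s r
    passed≤ : length passed ≤ b
    passed≤ = ℕₚ.≤-trans (subst (length passed ≤_) (sym (trans (cong length split) (Listₚ.length-++ passed))) (ℕₚ.m≤m+n _ _)) gs≤
    restored : Run 0 (move Tmp Gls) (st i ahead (map wrk (passed ʳ++ [])) p m x y₀ rest rest′) (4 * length passed + 2) tt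
                 (st i (flat gs) [] p m x y₀ rest rest′)
    restored = by (cong (λ l → 4 * l + 2) (Listₚ.length-reverse passed))
      (subst (λ w → Run 0 (move Tmp Gls) (st i ahead (map wrk (passed ʳ++ [])) p m x y₀ rest rest′) (4 * length (passed ʳ++ []) + 2) tt
               (st i w [] p m x y₀ rest rest′)) (trans (Listₚ.ʳ++-ʳ++ passed) (sym split)) (unscan-run {i} {p} {m} {x} {y₀} {rest} {rest′} (passed ʳ++ []) ahead))

  reference-run : ∀ s gs v → length (flat gs) ≤ b → v ≤ b →
                  Run b (reference s) ⟨ A.encodeIndex v ++ i , flat gs , p , m , x , 0 ⟩ 28 tt ⟨ i , flat gs , p , m , x , find (scope gs) s v ⟩
  reference-run {b} {i} {p} {m} {x} s gs v gs≤ v≤ = readIndex-run {b} {i} {flat gs} {p} {m} {x} {0} v v≤ ⨾ findName-run {b} {i} {p} {m} {x} s gs v gs≤ v≤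

-- Running the goals for terms and atomic formulas

module LowerProgramMain (n : ℕ) where

  open Prenexing n
  open TrackFormulas n
  open LowerTranslation n
  open LowerSentence n
  open LowerProgram n
  open LowerProgramCorrectness n
  open LowerProgramLookup n
  open A using (Sort; num; set; family; Term; _⊕_; _⊗_; Atom; _≐_; _≺_; _∈ˢ_; _∈ᶠ_; atom)
  open Programs A.Sym H.Sym Mark 8

  prefixText : Bool → Tree → List H.Sym
  prefixText b (ltl _)    = []
  prefixText b (neg A)    = prefixText (¬ᵇ b) A
  prefixText b (conj A B) = prefixText b A ++ prefixText b B
  prefixText b (disj A B) = prefixText b A ++ prefixText b B
  prefixText b (all q A)  = blockText (¬ᵇ b) q ++ prefixText b A
  prefixText b (ex q A)   = blockText b q ++ prefixText b A

  matrixText : Tree → List H.Sym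
  matrixText A = H.encodeLTL (matrix A)

  closeBlock-text : ∀ b q φ → H.encodeFormula (closeBlock b q φ) ≡ blockText b q ++ H.encodeFormula φ
  closeBlock-text true (any i) φ = cong (H.∃ˢ ∷_) (sym (trans (Listₚ.++-assoc (H.encodeIndex i) _ _)
    (cong (λ w → H.encodeIndex i ++ H.∃ᵗ ∷ w) (Listₚ.++-assoc (H.encodeIndex i) _ _))))
  closeBlock-text false (any i) φ = cong (H.∀ˢ ∷_) (sym (trans (Listₚ.++-assoc (H.encodeIndex i) _ _)
    (cong (λ w → H.encodeIndex i ++ H.∀ᵗ ∷ w) (Listₚ.++-assoc (H.encodeIndex i) _ _))))
  closeBlock-text true  (inside i y) φ = cong (H.∃ᵗ ∷_) (sym (Listₚ.++-assoc (H.encodeIndex i) _ _))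
  closeBlock-text false (inside i y) φ = cong (H.∀ᵗ ∷_) (sym (Listₚ.++-assoc (H.encodeIndex i) _ _))

  closeAll-text : ∀ qs φ → H.encodeFormula (closeAll qs φ) ≡ blocksText qs ++ H.encodeFormula φ
  closeAll-text []             φ = refl
  closeAll-text ((b , q) ∷ qs) φ = trans (closeBlock-text b q _) (trans (cong (blockText b q ++_) (closeAll-text qs φ))
    (sym (Listₚ.++-assoc (blockText b q) _ _)))

  close-text : ∀ b A φ → H.encodeFormula (close b A φ) ≡ prefixText b A ++ H.encodeFormula φ
  close-text b (ltl _)    φ = refl
  close-text b (neg A)    φ = close-text (¬ᵇ b) A φ
  close-text b (conj A B) φ = trans (close-text b A _) (trans (cong (prefixText b A ++_) (close-text b B φ)) (sym (Listₚ.++-assoc (prefixText b A) _ _)))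
  close-text b (disj A B) φ = trans (close-text b A _) (trans (cong (prefixText b A ++_) (close-text b B φ)) (sym (Listₚ.++-assoc (prefixText b A) _ _)))
  close-text b (all q A)  φ = trans (closeBlock-text (¬ᵇ b) q _) (trans (cong (blockText (¬ᵇ b) q ++_) (close-text b A φ))
    (sym (Listₚ.++-assoc (blockText (¬ᵇ b) q) _ _)))
  close-text b (ex q A)   φ = trans (closeBlock-text b q _) (trans (cong (blockText b q ++_) (close-text b A φ))
    (sym (Listₚ.++-assoc (blockText b q) _ _)))

  inst : ℕ → ℕ → H.LTL → H.LTL
  inst x y (H.⟨ q ⟩ 0) = H.⟨ q ⟩ 0
  inst x y (H.⟨ q ⟩ 1) = H.⟨ q ⟩ x
  inst x y (H.⟨ q ⟩ suc (suc _)) = H.⟨ q ⟩ y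
  inst x y (H.not ψ)    = H.not (inst x y ψ)
  inst x y (H._or_ ψ χ) = H._or_ (inst x y ψ) (inst x y χ)
  inst x y (H._U_ ψ χ)  = H._U_ (inst x y ψ) (inst x y χ)
  inst x y (H.X ψ)      = H.X (inst x y ψ)

  render-items : ∀ x y ψ → render x y (items ψ) ≡ H.encodeLTL (inst x y ψ)
  render-items x y (H.⟨ q ⟩ 0) = refl
  render-items x y (H.⟨ q ⟩ 1) = cong (H.prop q ∷_) (Listₚ.++-identityʳ _)
  render-items x y (H.⟨ q ⟩ suc (suc _)) = cong (H.prop q ∷_) (Listₚ.++-identityʳ _)
  render-items x y (H.not ψ)    = cong (H.not ∷_) (render-items x y ψ)
  render-items x y (H._or_ ψ χ) = cong (H.or ∷_) (trans (render-++ x y (items ψ) (items χ)) (cong₂ _++_ (render-items x y ψ) (render-items x y χ)))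
  render-items x y (H._U_ ψ χ)  = cong (H.U ∷_) (trans (render-++ x y (items ψ) (items χ)) (cong₂ _++_ (render-items x y ψ) (render-items x y χ)))
  render-items x y (H.X ψ)      = cong (H.X ∷_) (render-items x y ψ)

  render-conj : ∀ x y ψ → render x y (conjItems ψ) ≡ opening ++ H.encodeLTL (inst x y ψ) ++ H.not ∷ opening
  render-conj x y ψ = cong (opening ++_) (trans (render-++ x y (items ψ) _) (cong₂ _++_ (render-items x y ψ) (render-literally x y (H.not ∷ opening))))

  render-any : ∀ x y b → render x y (anyItems b) ≡ blockText b (any y)
  render-any x y b = cong (λ w → quantˢ b ∷ H.encodeIndex y ++ quantᵗ b ∷ H.encodeIndex y ++ w) (Listₚ.++-identityʳ _)

  render-table : ∀ x y b z → render x y (tableItems b z) ≡ blockText b (inside y z)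
  render-table x y b z = cong (λ w → quantᵗ b ∷ H.encodeIndex y ++ w) (render-literally x y (H.encodeIndex z))

  render-block : ∀ x y b s → render x y (blockItems b s) ≡ blockText b (blockOf s y)
  render-block x y b num    = render-table x y b plusTable
  render-block x y b set    = render-any x y b
  render-block x y b family = render-any x y b

  index-length : ∀ v → length (A.encodeIndex v) ≡ suc v
  index-length zero    = refl
  index-length (suc v) = cong suc (index-length v)

  append-length : ∀ w {k r} (rest : List A.Sym) → length w ≡ k → length rest ≡ r → length (w ++ rest) ≡ k + r
  append-length w rest eq eq′ = trans (Listₚ.length-++ w) (cong₂ _+_ eq eq′)

  term-length : ∀ t → length (A.encodeTerm t) ≡ sizeT t
  term-length (A.var x) = index-length x
  term-length (t ⊕ u)   = cong suc (append-length (A.encodeTerm t) (A.encodeTerm u) (term-length t) (term-length u))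
  term-length (t ⊗ u)   = cong suc (append-length (A.encodeTerm t) (A.encodeTerm u) (term-length t) (term-length u))

  formula-length : ∀ φ → length (A.encodeFormula φ) ≡ size φ
  formula-length (atom (t ≐ u))  = cong suc (append-length (A.encodeTerm t) (A.encodeTerm u) (term-length t) (term-length u))
  formula-length (atom (t ≺ u))  = cong suc (append-length (A.encodeTerm t) (A.encodeTerm u) (term-length t) (term-length u))
  formula-length (atom (t ∈ˢ x)) = cong suc (append-length (A.encodeTerm t) (A.encodeIndex x) (term-length t) (index-length x))
  formula-length (atom (x ∈ᶠ y)) = cong suc (append-length (A.encodeIndex x) (A.encodeIndex y) (index-length x) (index-length y))
  formula-length (A.not φ)       = cong suc (formula-length φ)
  formula-length (φ A.and χ)     = cong suc (append-length (A.encodeFormula φ) (A.encodeFormula χ) (formula-length φ) (formula-length χ))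
  formula-length (φ A.or χ)      = cong suc (append-length (A.encodeFormula φ) (A.encodeFormula χ) (formula-length φ) (formula-length χ))
  formula-length (A.all s x φ)   = cong suc (append-length (A.encodeIndex x) (A.encodeFormula φ) (index-length x) (formula-length φ))
  formula-length (A.ex s x φ)    = cong suc (append-length (A.encodeIndex x) (A.encodeFormula φ) (index-length x) (formula-length φ))

  -- Names are stored in unary on the goal stack, so none exceeds its height; the default of `find`
  -- is 0.
  name-bound : ∀ gs s x → find (scope gs) s x ≤ length (flat gs)
  name-bound [] s x = z≤n
  name-bound (neg ∷ gs) s x = ℕₚ.≤-trans (name-bound gs s x) (ℕₚ.n≤1+n _)
  name-bound (form _ ∷ gs) s x = ℕₚ.≤-trans (name-bound gs s x) (ℕₚ.n≤1+n _)
  name-bound (term b j v ∷ gs) s x = ℕₚ.≤-trans (name-bound gs s x)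
    (ℕₚ.≤-trans (ℕₚ.m≤n+m _ (length (term b j ∷ unary v))) (ℕₚ.≤-reflexive (sym (Listₚ.length-++ (term b j ∷ unary v)))))
  name-bound (mem v ∷ gs) s x = ℕₚ.≤-trans (name-bound gs s x)
    (ℕₚ.≤-trans (ℕₚ.m≤n+m _ (length (mem ∷ unary v))) (ℕₚ.≤-reflexive (sym (Listₚ.length-++ (mem ∷ unary v)))))
  name-bound (bind s′ x′ j ∷ gs) s x with (s , x) ≟ᵛ (s′ , x′)
  ... | yes _ = subst (j ≤_) (sym (bind-length s′ x′ j gs)) (ℕₚ.≤-trans (ℕₚ.≤-trans (ℕₚ.n≤1+n j) (ℕₚ.m≤m+n (suc j) (length (flat gs))))
                  (ℕₚ.≤-trans (ℕₚ.m≤n+m _ (suc x′)) (ℕₚ.n≤1+n _)))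
  ... | no _  = subst (find (scope gs) s x ≤_) (sym (bind-length s′ x′ j gs)) (ℕₚ.≤-trans (name-bound gs s x)
                  (ℕₚ.≤-trans (ℕₚ.m≤n+m _ (suc j)) (ℕₚ.≤-trans (ℕₚ.m≤n+m _ (suc x′)) (ℕₚ.n≤1+n _))))

  -- Opaque, since a unary unfolding of K makes conversion checking infeasible.
  opaque
    K : ℕ
    K = 4000

    within : ∀ c {_ : True (c ℕₚ.≤? 4000)} → c ≤ K
    within c {c≤} = toWitness c≤

  -- b is the unit of time and a bound for all stacks that are traversed; N is a bound for all names.
  module Bounded (b N : ℕ) (N≤b : N ≤ b) where

    -- Bounds what one input symbol can add to the waiting goals: at most two names and a few marks.
    -- The worst case is a binding, with its index and its name.
    G : ℕ
    G = 2 * N + 5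

    -- The potential argument behind the bound on the goal stack: its present height, plus G for
    -- each symbol of the goal still to be expanded, stays below b.
    record Fits (gs : List Goal) (sz r : ℕ) : Set where
      field
        names : 14 + (sz + r) ≤ N
        goals : length (flat gs) + G * sz ≤ b

    open Fits

    child : ∀ {gs gs′ sz sz′ r r′} → Fits gs (suc sz) r → length (flat gs′) ≤ G + length (flat gs) → sz′ ≤ sz → sz′ + r′ ≤ sz + r → Fits gs′ sz′ r′
    child {gs} {gs′} {sz} {sz′} {r} f h l l′ = record
      { names = ℕₚ.≤-trans (ℕₚ.+-monoʳ-≤ 14 (ℕₚ.≤-trans l′ (ℕₚ.n≤1+n _))) (names f)
      ; goals = ℕₚ.≤-trans (ℕₚ.+-mono-≤ h (ℕₚ.*-monoʳ-≤ G l)) (ℕₚ.≤-trans (ℕₚ.≤-reflexive (arrange G (length (flat gs)) sz)) (goals f)) }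
      where
      arrange : ∀ G l s → G + l + G * s ≡ l + G * suc s
      arrange = solve-∀

    stack≤ : ∀ {gs sz r} → Fits gs sz r → length (flat gs) ≤ b
    stack≤ f = ℕₚ.≤-trans (ℕₚ.m≤m+n _ _) (goals f)

    ⟪_,_,_,_⟫ : List A.Sym → List Goal → List Γ → List Γ → Stacks
    ⟪ i , gs , p , m ⟫ = ⟨ i , flat gs , p , m , 0 , 0 ⟩

    Continues : Stacks → ℕ → Stacks → Set
    Continues σ c τ = Run b main σ c tt τ

    module _ {c : ℕ} {τ : Stacks} where

      neg-step : ∀ {i gs p m} → Continues ⟪ i , gs , p , out H.not ∷ m ⟫ c τ → Continues ⟪ i , neg ∷ gs , p , m ⟫ (K + c) τ
      neg-step r = weaken (ℕₚ.+-monoˡ-≤ c (within 4)) (again (pop-just refl ⨾ push-run ⨾ skip-run) r)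

      bind-step : ∀ {i gs p m s x j} → x ≤ b → j ≤ b → Continues ⟪ i , gs , p , m ⟫ c τ → Continues ⟪ i , bind s x j ∷ gs , p , m ⟫ (K + c) τ
      bind-step {i} {gs} {p} {m} {s} {x} {j} x≤ j≤ r = weaken (ℕₚ.+-monoˡ-≤ c (within 6))
        (subst (λ g → Run b main ⟨ i , g , p , m , 0 , 0 ⟩ (6 + c) tt τ) (sym (bind-flat s x j gs))
          (again (pop-just refl ⨾ (dropName-run {b} {i} {unary j ++ flat gs} {p} {m} {0} {0} x x≤ ⨾ dropName-run {b} {i} {flat gs} {p} {m} {0} {0} j j≤) ⨾ skip-run) r))

      form-step : ∀ {a i gs p m β k σ} → Run b (formulaNode β a) ⟪ i , gs , p , m ⟫ k tt σ → 3 + k ≤ K → Continues σ c τ →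
                  Continues ⟪ a ∷ i , form β ∷ gs , p , m ⟫ (K + c) τ
      form-step {k = k} node k≤ r = weaken (ℕₚ.+-monoˡ-≤ c (subst (_≤ K) (arrange k) k≤)) (again (pop-just refl ⨾ (pop-just refl ⨾ node) ⨾ skip-run) r)
        where
        arrange : ∀ k → 3 + k ≡ 1 + (1 + k + 1)
        arrange = solve-∀

      term-step : ∀ {a i gs p m β j v k σ} → v ≤ b → Run b (termNode β j a) ⟨ i , flat gs , p , m , v , 0 ⟩ k tt σ → 7 + k ≤ K → Continues σ c τ →
                  Continues ⟪ a ∷ i , term β j v ∷ gs , p , m ⟫ (K + c) τ
      term-step {a} {i} {gs} {p} {m} {v = v} {k} v≤ node k≤ r = weaken (ℕₚ.+-monoˡ-≤ c (subst (_≤ K) (arrange k) k≤))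
        (again (pop-just refl ⨾ (readName-run {b} {a ∷ i} {flat gs} {p} {m} {0} v v≤ ⨾ pop-just refl ⨾ node) ⨾ skip-run) r)
        where
        arrange : ∀ k → 7 + k ≡ 1 + (4 + (1 + k) + 1)
        arrange = solve-∀

    text-writes : ∀ l w {i g p m x y v u} → x ≤ b → y ≤ b → render x y w ≡ u →
            Run b (text l w) (logged l i g p m x y v) (12 * length w + 1) tt (logged l i g p m x y (u ▷ v))
    text-writes l w {i} {g} {p} {m} {x} {y} {v} x≤ y≤ refl = text-run l w {b} {i} {g} {p} {m} {x} {y} {v} x≤ y≤

    -- A name of the form fresh sz r, bound at a node whose remaining input i has length sz + r.
    module Node {i : List A.Sym} {gs : List Goal} {sz r : ℕ} (i-length : length i ≡ sz + r) (fits : Fits gs (suc sz) r) where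

      I : ℕ
      I = fresh sz r

      I≤N : I ≤ N
      I≤N = ℕₚ.≤-trans (ℕₚ.n≤1+n I) (names fits)

      I≤ : I ≤ b
      I≤ = ℕₚ.≤-trans I≤N N≤b

      i≤ : length i ≤ b
      i≤ = subst (_≤ b) (sym i-length) (ℕₚ.≤-trans (ℕₚ.m≤n+m (sz + r) 14) I≤)

      gs≤ : length (flat gs) ≤ b
      gs≤ = stack≤ fits

      fresh-into-Y : ∀ {g p m x} → Run b (freshName toY) ⟨ i , g , p , m , x , 0 ⟩ 39 tt ⟨ i , g , p , m , x , I ⟩
      fresh-into-Y {g} {p} {m} {x} = subst (λ l → Run b (freshName toY) ⟨ i , g , p , m , x , 0 ⟩ 39 tt ⟨ i , g , p , m , x , 14 + l ⟩) i-length
        (freshY-run {b} {g} {p} {m} {x} i i≤)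

      fresh-into-X : ∀ {g p m y} → Run b (freshName toX) ⟨ i , g , p , m , 0 , y ⟩ 39 tt ⟨ i , g , p , m , I , y ⟩
      fresh-into-X {g} {p} {m} {y} = subst (λ l → Run b (freshName toX) ⟨ i , g , p , m , 0 , y ⟩ 39 tt ⟨ i , g , p , m , 14 + l , y ⟩) i-length
        (freshX-run {b} {g} {p} {m} {y} i i≤)

      push-I : ∀ {g p m x} → Run b pushName ⟨ i , g , p , m , x , I ⟩ 12 tt ⟨ i , unary I ++ g , p , m , x , I ⟩
      push-I {g} {p} {m} {x} = pushName-run {b} {i} {g} {p} {m} {x} {I} I≤

      pushTerms-run : ∀ β j {p m x} → Run b (pushTerms β j) ⟨ i , flat gs , p , m , x , I ⟩ 30 tt
                                          ⟨ i , flat (term β false I ∷ neg ∷ term β j I ∷ gs) , p , m , x , I ⟩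
      pushTerms-run β j {p} {m} {x} = push-I {flat gs} {p} {m} {x} ⨾ push-run ⨾ push-run ⨾
        push-I {flat (neg ∷ term β j I ∷ gs)} {p} {m} {x} ⨾ push-run

      clear-I : ∀ {i g p m x} → Run b (clear Y) ⟨ i , g , p , m , x , I ⟩ 2 tt ⟨ i , g , p , m , x , 0 ⟩
      clear-I {i} {g} {p} {m} {x} = clearY-run {I} {b} {i} {g} {p} {m} {x} I≤

      terms-node : ∀ β j {p m} w u → render 0 I w ≡ u →
        Run b (freshName toY >> (text pfx (anyItems β) >> (text mtx w >> (pushTerms β j >> clear Y)))) ⟪ i , gs , p , m ⟫
          (39 + (12 * length (anyItems β) + 1 + (12 * length w + 1 + 32))) tt
          ⟪ i , term β false I ∷ neg ∷ term β j I ∷ gs , blockText β (any I) ▷ p , u ▷ m ⟫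
      terms-node β j {p} {m} w u eq =
        fresh-into-Y {flat gs} {p} {m} {0} ⨾
        text-writes pfx (anyItems β) {i} {flat gs} {p} {m} {0} {I} {p} z≤n I≤ (render-any 0 I β) ⨾
        text-writes mtx w {i} {flat gs} {blockText β (any I) ▷ p} {m} {0} {I} {m} z≤n I≤ eq ⨾
        pushTerms-run β j {blockText β (any I) ▷ p} {u ▷ m} {0} ⨾
        clear-I {i} {flat (term β false I ∷ neg ∷ term β j I ∷ gs)} {blockText β (any I) ▷ p} {u ▷ m} {0}

      member-node : ∀ β {p m} → Run b (formulaNode β A.inˢ) ⟪ i , gs , p , m ⟫ (39 + (12 * length (anyItems β) + 1 + (37 + 32))) tt
          ⟪ i , term β false I ∷ neg ∷ mem I ∷ gs , blockText β (any I) ▷ p , opening ▷ m ⟫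
      member-node β {p} {m} =
        fresh-into-Y {flat gs} {p} {m} {0} ⨾
        text-writes pfx (anyItems β) {i} {flat gs} {p} {m} {0} {I} {p} z≤n I≤ (render-any 0 I β) ⨾
        text-writes mtx (literally opening) {i} {flat gs} {blockText β (any I) ▷ p} {m} {0} {I} {m} z≤n I≤ (render-literally 0 I opening) ⨾
        push-I {flat gs} {blockText β (any I) ▷ p} {opening ▷ m} {0} ⨾ push-run ⨾ push-run ⨾
        push-I {flat (neg ∷ mem I ∷ gs)} {blockText β (any I) ▷ p} {opening ▷ m} {0} ⨾ push-run ⨾
        clear-I {i} {flat (term β false I ∷ neg ∷ mem I ∷ gs)} {blockText β (any I) ▷ p} {opening ▷ m} {0}

      operation-node : ∀ β j z {p m v} → v ≤ b → Run b (operation β j z) ⟨ i , flat gs , p , m , v , 0 ⟩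
          (39 + (12 * length (tableItems β z) + 1 + (12 * length (conjItems (equalT (1 , track# j) (2 , 2))) + 1 + 34))) tt
          ⟪ i , term β false I ∷ neg ∷ term β true I ∷ gs , blockText β (inside I z) ▷ p ,
            (opening ++ H.encodeLTL (inst v I (equalT (1 , track# j) (2 , 2))) ++ H.not ∷ opening) ▷ m ⟫
      operation-node β j z {p} {m} {v} v≤ =
        fresh-into-Y {flat gs} {p} {m} {v} ⨾
        text-writes pfx (tableItems β z) {i} {flat gs} {p} {m} {v} {I} {p} v≤ I≤ (render-table v I β z) ⨾
        text-writes mtx (conjItems ψ) {i} {flat gs} {p′} {m} {v} {I} {m} v≤ I≤ (render-conj v I ψ) ⨾
        pushTerms-run β true {p′} {m′} {v} ⨾
        clearX-run {v} {b} {i} {flat gs′} {p′} {m′} {I} v≤ ⨾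
        clear-I {i} {flat gs′} {p′} {m′} {0}
        where
        ψ : H.LTL
        ψ = equalT (1 , track# j) (2 , 2)
        p′ m′ : List Γ
        p′ = blockText β (inside I z) ▷ p
        m′ = (opening ++ H.encodeLTL (inst v I ψ) ++ H.not ∷ opening) ▷ m
        gs′ : List Goal
        gs′ = term β false I ∷ neg ∷ term β true I ∷ gs

    quantifier-node : ∀ {x i gs sz r} (i-length : length (A.encodeIndex x ++ i) ≡ sz + r) (fits : Fits gs (suc sz) r) → x ≤ b →
      ∀ γ s β {p m} → let open Node {A.encodeIndex x ++ i} {gs} i-length fits in
      Run b (quantifier γ s β) ⟪ A.encodeIndex x ++ i , gs , p , m ⟫ (39 + (12 * length (blockItems γ s) + 1 + 28)) tt
        ⟪ i , form β ∷ bind s x I ∷ gs , blockText γ (blockOf s I) ▷ p , m ⟫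
    quantifier-node {x} {i} {gs} i-length fits x≤ γ s β {p} {m} =
      fresh-into-Y {flat gs} {p} {m} {0} ⨾
      text-writes pfx (blockItems γ s) {A.encodeIndex x ++ i} {flat gs} {p} {m} {0} {I} {p} z≤n I≤ (render-block 0 I γ s) ⨾
      push-I {flat gs} {p′} {m} {0} ⨾
      readIndex-run {b} {i} {unary I ++ flat gs} {p′} {m} {0} {I} x x≤ ⨾
      push-run ⨾
      storeIndex-run {b} {i} {unary I ++ flat gs} {p′} {m} {0} {I} x x≤ ⨾
      push-run ⨾ push-run ⨾
      subst (λ g → Run b (clear Y) ⟨ i , form β ∷ g , p′ , m , 0 , I ⟩ 2 tt ⟪ i , form β ∷ bind s x I ∷ gs , p′ , m ⟫) (bind-flat s x I gs)
        (clear-I {i} {flat (form β ∷ bind s x I ∷ gs)} {p′} {m} {0})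
      where
      open Node {A.encodeIndex x ++ i} {gs} i-length fits
      p′ : List Γ
      p′ = blockText γ (blockOf s I) ▷ p

    family-node : ∀ {x y i gs sz r} (i-length : length (A.encodeIndex x ++ A.encodeIndex y ++ i) ≡ sz + r) (fits : Fits gs (suc sz) r) → x ≤ b → y ≤ b →
      ∀ β {p m} → let open Node {A.encodeIndex x ++ A.encodeIndex y ++ i} {gs} i-length fits in
      Run b (formulaNode β A.inᶠ) ⟪ A.encodeIndex x ++ A.encodeIndex y ++ i , gs , p , m ⟫
        (39 + (28 + (12 * length (items (at 1 1 andL equalT (1 , 0) (2 , 0))) + 1 + (2 + (28 + (37 + 4)))))) tt
        ⟪ i , gs , blockText β (inside I (find (scope gs) family y)) ▷ p ,
          H.encodeLTL (at 1 I andL equalT (I , 0) (find (scope gs) set x , 0)) ▷ m ⟫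
    family-node {x} {y} {i} {gs} i-length fits x≤ y≤ β {p} {m} =
      fresh-into-X {flat gs} {p} {m} {0} ⨾
      reference-run {b} {A.encodeIndex y ++ i} {p} {m} {I} set gs x gs≤ x≤ ⨾
      text-writes mtx (items ψ) {A.encodeIndex y ++ i} {flat gs} {p} {m} {I} {S} {m} I≤ S≤ (render-items I S ψ) ⨾
      clearY-run {S} {b} {A.encodeIndex y ++ i} {flat gs} {p} {m′} {I} S≤ ⨾
      reference-run {b} {i} {p} {m′} {I} family gs y gs≤ y≤ ⨾
      text-writes pfx (lit (quantᵗ β) ∷ nameX ∷ nameY ∷ []) {i} {flat gs} {p} {m′} {I} {F} {p} I≤ F≤
        (cong (λ w → quantᵗ β ∷ H.encodeIndex I ++ w) (Listₚ.++-identityʳ (H.encodeIndex F))) ⨾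
      clearX-run {I} {b} {i} {flat gs} {p′} {m′} {F} I≤ ⨾
      clearY-run {F} {b} {i} {flat gs} {p′} {m′} {0} F≤
      where
      open Node {A.encodeIndex x ++ A.encodeIndex y ++ i} {gs} i-length fits
      ψ : H.LTL
      ψ = at 1 1 andL equalT (1 , 0) (2 , 0)
      S F : ℕ
      S = find (scope gs) set x
      F = find (scope gs) family y
      S≤ : S ≤ b
      S≤ = ℕₚ.≤-trans (name-bound gs set x) gs≤
      F≤ : F ≤ b
      F≤ = ℕₚ.≤-trans (name-bound gs family y) gs≤
      p′ m′ : List Γ
      p′ = blockText β (inside I F) ▷ p
      m′ = H.encodeLTL (inst I S ψ) ▷ m

    lookup-node : ∀ s ψ x {i gs p m v} → v ≤ b → x ≤ b → length (flat gs) ≤ b →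
      Run b (reference s >> (text mtx (items ψ) >> (clear X >> clear Y))) ⟨ A.encodeIndex x ++ i , flat gs , p , m , v , 0 ⟩
        (28 + (12 * length (items ψ) + 1 + 4)) tt ⟪ i , gs , p , H.encodeLTL (inst v (find (scope gs) s x) ψ) ▷ m ⟫
    lookup-node s ψ x {i} {gs} {p} {m} {v} v≤ x≤ gs≤ =
      reference-run {b} {i} {p} {m} {v} s gs x gs≤ x≤ ⨾
      text-writes mtx (items ψ) {i} {flat gs} {p} {m} {v} {S} {m} v≤ S≤ (render-items v S ψ) ⨾
      clearX-run {v} {b} {i} {flat gs} {p} {m′} {S} v≤ ⨾
      clearY-run {S} {b} {i} {flat gs} {p} {m′} {0} S≤
      where
      S : ℕ
      S = find (scope gs) s x
      S≤ : S ≤ b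
      S≤ = ℕₚ.≤-trans (name-bound gs s x) gs≤
      m′ : List Γ
      m′ = H.encodeLTL (inst v S ψ) ▷ m

    from-eq : ∀ {i i′ gs p p′ m m′ c τ} → i ≡ i′ → p ≡ p′ → m ≡ m′ → Continues ⟪ i , gs , p , m ⟫ c τ → Continues ⟪ i′ , gs , p′ , m′ ⟫ c τ
    from-eq refl refl refl r = r

    -- In continuation form, as for the upper bound. Every symbol is charged two iterations of
    -- `main`, one for its own node and one towards the auxiliary goals that nodes leave behind.
    TermRun : Term → Set
    TermRun t = ∀ {β j v gs r rest p m c τ} → length rest ≡ r → Fits gs (sizeT t) r → v ≤ b →
      let T₁ = termTree (scope gs) v (track# j) r t in Continues ⟪ rest , gs , prefixText β T₁ ▷ p , matrixText T₁ ▷ m ⟫ c τ →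
      Continues ⟪ A.encodeTerm t ++ rest , term β j v ∷ gs , p , m ⟫ (K * (2 * sizeT t) + c) τ

    goal-size : ∀ {gs I β j} → I ≤ N → length (flat (neg ∷ term β j I ∷ gs)) ≤ G + length (flat gs)
    goal-size {gs} {I} {β} {j} I≤ = subst (_≤ G + length (flat gs))
      (cong (λ l → suc (suc l)) (sym (trans (Listₚ.length-++ (unary I)) (cong (_+ length (flat gs)) (unary-length I)))))
      (ℕₚ.+-monoˡ-≤ (length (flat gs)) (ℕₚ.≤-trans (ℕₚ.+-monoʳ-≤ 3 I≤)
        (ℕₚ.≤-trans (ℕₚ.m≤m+n (3 + N) (N + 2)) (ℕₚ.≤-reflexive (arrange N)))))
      where
      arrange : ∀ N → 3 + N + (N + 2) ≡ 2 * N + 5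
      arrange = solve-∀

    ++-size : ∀ w {i k r} → length w ≡ k → length {A = A.Sym} i ≡ r → length (w ++ i) ≡ k + r
    ++-size w eq eq′ = trans (Listₚ.length-++ w) (cong₂ _+_ eq eq′)

    pair-run : ∀ t u → TermRun t → TermRun u → ∀ {β j I gs r rest p m c τ} → length rest ≡ r → Fits gs (suc (sizeT t + sizeT u)) r → I ≤ N →
      let T₁ = termTree (scope gs) I 0 (sizeT u + r) t ; T₂ = termTree (scope gs) I (track# j) r u in
      Continues ⟪ rest , gs , (prefixText β T₁ ++ prefixText β T₂) ▷ p , (matrixText T₁ ++ H.not ∷ matrixText T₂) ▷ m ⟫ c τ →
      Continues ⟪ A.encodeTerm t ++ A.encodeTerm u ++ rest , term β false I ∷ neg ∷ term β j I ∷ gs , p , m ⟫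
        (K * (2 * sizeT t) + (K + (K * (2 * sizeT u) + c))) τ
    pair-run t u run-t run-u {β} {j} {I} {gs} {r} {rest} {p} {m} eq fits I≤ next-run =
      run-t {β} {false} {I} {neg ∷ term β j I ∷ gs} (++-size (A.encodeTerm u) (term-length u) eq)
        (child fits (goal-size {gs} {I} {β} {j} I≤) (ℕₚ.m≤m+n _ _) (ℕₚ.≤-reflexive (sym (ℕₚ.+-assoc (sizeT t) (sizeT u) r)))) (ℕₚ.≤-trans I≤ N≤b)
        (neg-step {gs = term β j I ∷ gs}
          (run-u {β} {j} {I} {gs} eq (child fits (ℕₚ.m≤n+m _ G) (ℕₚ.m≤n+m _ _) (ℕₚ.+-monoˡ-≤ r (ℕₚ.m≤n+m _ (sizeT t)))) (ℕₚ.≤-trans I≤ N≤b)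
            (from-eq {gs = gs} refl (▷-++ (prefixText β T₁)) (▷-++ (matrixText T₁)) next-run)))
      where
      T₁ : Tree
      T₁ = termTree (scope gs) I 0 (sizeT u + r) t

    binary-cost : ∀ a d c → K + (K * (2 * a) + (K + (K * (2 * d) + c))) ≡ K * (2 * suc (a + d)) + c
    binary-cost = arrange K
      where
      arrange : ∀ K a d c → K + (K * (2 * a) + (K + (K * (2 * d) + c))) ≡ K * (2 * suc (a + d)) + c
      arrange = solve-∀

    single-cost : ∀ a c → K + c ≤ K * (2 * suc a) + c
    single-cost a c = ℕₚ.+-monoˡ-≤ c (ℕₚ.≤-trans (ℕₚ.≤-reflexive (sym (ℕₚ.*-identityʳ K))) (ℕₚ.*-monoʳ-≤ K (s≤s z≤n)))

    track-cases : ∀ {P : Bool → Set} → P false → P true → ∀ j → P j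
    track-cases f t false = f
    track-cases f t true  = t

    inst-equal : ∀ v I j z → inst v I (equalT (1 , track# j) (2 , z)) ≡ equalT (v , track# j) (I , z)
    inst-equal v I j z = trans (inst-everywhere (iffL (at (track# j) 1) (at z 2))) (cong everywhere
      (cong₂ iffL (inst-at (track# j) 1) (inst-at z 2)))
      where
      pick : ℕ → ℕ
      pick 0 = 0
      pick 1 = v
      pick _ = I
      inst-at : ∀ i w → inst v I (at i w) ≡ at i (pick w)
      inst-at zero    0             = refl
      inst-at zero    1             = refl
      inst-at zero    (suc (suc _)) = refl
      inst-at (suc i) w             = cong H.X (inst-at i w)
      inst-everywhere : ∀ ψ → inst v I (everywhere ψ) ≡ everywhere (inst v I ψ)
      inst-everywhere ψ = refl

    main-term : ∀ t → TermRun t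
    main-operation : ∀ t u a y (_∙_ : Term → Term → Term) → (∀ β j → termNode β j a ≡ operation β j y) → TermRun t → TermRun u →
      ∀ {β j v gs r rest p m c τ} → length rest ≡ r → Fits gs (suc (sizeT t + sizeT u)) r → v ≤ b →
      let i = fresh (sizeT t + sizeT u) r
          T₁ = ex (inside i y) (conj (ltl (equalT (v , track# j) (i , 2))) (conj (termTree (scope gs) i 0 (sizeT u + r) t) (termTree (scope gs) i 1 r u))) in
      (∀ β j → 7 + (39 + (12 * length (tableItems β y) + 1 + (12 * length (conjItems (equalT (1 , track# j) (2 , 2))) + 1 + 34))) ≤ K) →
      Continues ⟪ rest , gs , prefixText β T₁ ▷ p , matrixText T₁ ▷ m ⟫ c τ →
      Continues ⟪ (a ∷ A.encodeTerm t ++ A.encodeTerm u) ++ rest , term β j v ∷ gs , p , m ⟫ (K * (2 * suc (sizeT t + sizeT u)) + c) τ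
    main-operation t u a y _∙_ node≡ run-t run-u {β} {j} {v} {gs} {r} {rest} {p} {m} {c} {τ} eq fits v≤ cost r′ =
      by (binary-cost (sizeT t) (sizeT u) c)
        (from-eq {gs = term β j v ∷ gs} (cong (a ∷_) (sym (Listₚ.++-assoc (A.encodeTerm t) (A.encodeTerm u) rest))) refl refl
          (term-step {a = a} {i = i} {gs = gs} {p} {m} {β} {j} {v} v≤
            (same-program (node≡ β j) (operation-node β j y {p} {m} {v} v≤)) (cost β j)
            (pair-run t u run-t run-u {β} {true} {I} {gs} eq fits I≤N
              (from-eq {gs = gs} refl (▷-++ (blockText β (inside I y)) {prefixText β T₁ ++ prefixText β T₂}) matrix≡ r′))))
      where
      i : List A.Sym
      i = A.encodeTerm t ++ A.encodeTerm u ++ rest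
      i-length : length i ≡ sizeT t + sizeT u + r
      i-length = trans (++-size (A.encodeTerm t) (term-length t) (++-size (A.encodeTerm u) (term-length u) eq)) (sym (ℕₚ.+-assoc (sizeT t) (sizeT u) r))
      open Node {i} {gs} i-length fits
      T₁ T₂ : Tree
      T₁ = termTree (scope gs) I 0 (sizeT u + r) t
      T₂ = termTree (scope gs) I 1 r u
      ψ : H.LTL
      ψ = equalT (v , track# j) (I , 2)
      texts : H.encodeLTL ψ ++ H.not ∷ opening ++ matrixText T₁ ++ H.not ∷ matrixText T₂ ≡
              (H.encodeLTL ψ ++ H.not ∷ opening) ++ matrixText T₁ ++ H.not ∷ matrixText T₂
      texts = sym (Listₚ.++-assoc (H.encodeLTL ψ) (H.not ∷ opening) _)
      matrix≡ : (opening ++ H.encodeLTL ψ ++ H.not ∷ opening ++ matrixText T₁ ++ H.not ∷ matrixText T₂) ▷ m ≡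
                (matrixText T₁ ++ H.not ∷ matrixText T₂) ▷ (opening ++ H.encodeLTL (inst v I (equalT (1 , track# j) (2 , 2))) ++ H.not ∷ opening) ▷ m
      matrix≡ = trans (cong (λ w → (opening ++ w) ▷ m) texts) (trans
        (▷-++ (opening ++ H.encodeLTL ψ ++ H.not ∷ opening) {matrixText T₁ ++ H.not ∷ matrixText T₂})
        (cong (λ χ → (matrixText T₁ ++ H.not ∷ matrixText T₂) ▷ (opening ++ H.encodeLTL χ ++ H.not ∷ opening) ▷ m) (sym (inst-equal v I j 2))))
    main-term (t ⊕ u) eq fits v≤ = main-operation t u A.plus plusTable _⊕_ (λ _ _ → refl) (main-term t) (main-term u) eq fits v≤
      (λ { false false → within _ ; false true → within _
         ; true false → within _ ; true true → within _ })
    main-term (t ⊗ u) eq fits v≤ = main-operation t u A.times timesTable _⊗_ (λ _ _ → refl) (main-term t) (main-term u) eq fits v≤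
      (λ { false false → within _ ; false true → within _
         ; true false → within _ ; true true → within _ })
    main-term (A.var x) {β} {j} {v} {gs} {r} {rest} {p} {m} {c} {τ} eq fits v≤ r′ = weaken (single-cost x c) (at-symbol x refl)
      where
      y : ℕ
      y = find (scope gs) num x
      x≤ : x ≤ b
      x≤ = ℕₚ.≤-trans (ℕₚ.≤-trans (ℕₚ.n≤1+n x) (ℕₚ.≤-trans (ℕₚ.m≤m+n (suc x) r) (ℕₚ.m≤n+m _ 14))) (ℕₚ.≤-trans (names fits) N≤b)
      looked-up : Run b (reference num >> (text mtx (items (equalT (1 , track# j) (2 , 0))) >> (clear X >> clear Y)))
        ⟨ A.encodeIndex x ++ rest , flat gs , p , m , v , 0 ⟩ (28 + (12 * length (items (equalT (1 , track# j) (2 , 0))) + 1 + 4)) tt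
        ⟪ rest , gs , p , H.encodeLTL (inst v y (equalT (1 , track# j) (2 , 0))) ▷ m ⟫
      looked-up = lookup-node num (equalT (1 , track# j) (2 , 0)) x {rest} {gs} {p} {m} {v} v≤ x≤ (stack≤ fits)
      bound : ∀ j → 7 + (2 + (28 + (12 * length (items (equalT (1 , track# j) (2 , 0))) + 1 + 4))) ≤ K
      bound = track-cases (within _) (within _)
      after : Continues ⟪ rest , gs , p , H.encodeLTL (inst v y (equalT (1 , track# j) (2 , 0))) ▷ m ⟫ c τ
      after = from-eq {gs = gs} refl refl (cong (λ χ → H.encodeLTL χ ▷ m) (sym (inst-equal v y j 0))) r′
      -- The first symbol of the index is an end or a stroke; in either case the node pushes it back
      -- and reads the whole index.
      at-symbol : ∀ x′ → x ≡ x′ → Continues ⟪ A.encodeIndex x ++ rest , term β j v ∷ gs , p , m ⟫ (K + c) τ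
      at-symbol zero     refl = term-step {a = A.end} {i = rest} {gs = gs} {p} {m} {β} {j} {v} v≤ (push-run ⨾ looked-up) (bound j) after
      at-symbol (suc x′) refl = term-step {a = A.stroke} {i = A.encodeIndex x′ ++ rest} {gs = gs} {p} {m} {β} {j} {v} v≤ (push-run ⨾ looked-up) (bound j) after

    FormulaRun : A.Formula → Set
    FormulaRun φ = ∀ {β gs r rest p m c τ} → length rest ≡ r → Fits gs (size φ) r →
      let T₁ = tree (scope gs) r φ in Continues ⟪ rest , gs , prefixText β T₁ ▷ p , matrixText T₁ ▷ m ⟫ c τ →
      Continues ⟪ A.encodeFormula φ ++ rest , form β ∷ gs , p , m ⟫ (K * (2 * size φ) + c) τ

    opening-▷ : ∀ w m → (opening ++ w) ▷ m ≡ w ▷ opening ▷ m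
    opening-▷ w m = refl

    main-terms : ∀ t u {β j a gs r rest p m c τ} w ψ-text → (eq : length rest ≡ r) → Fits gs (suc (sizeT t + sizeT u)) r →
      let I = fresh (sizeT t + sizeT u) r ; T₁ = termTree (scope gs) I 0 (sizeT u + r) t ; T₂ = termTree (scope gs) I (track# j) r u in
      formulaNode β a ≡ (freshName toY >> (text pfx (anyItems β) >> (text mtx w >> (pushTerms β j >> clear Y)))) →
      render 0 I w ≡ ψ-text → 3 + (39 + (12 * length (anyItems β) + 1 + (12 * length w + 1 + 32))) ≤ K →
      Continues ⟪ rest , gs , (blockText β (any I) ++ prefixText β T₁ ++ prefixText β T₂) ▷ p , (ψ-text ++ matrixText T₁ ++ H.not ∷ matrixText T₂) ▷ m ⟫ c τ →
      Continues ⟪ (a ∷ A.encodeTerm t ++ A.encodeTerm u) ++ rest , form β ∷ gs , p , m ⟫ (K * (2 * suc (sizeT t + sizeT u)) + c) τ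
    main-terms t u {β} {j} {a} {gs} {r} {rest} {p} {m} {c} w ψ-text eq fits node≡ render≡ cost r′ =
      by (binary-cost (sizeT t) (sizeT u) c)
        (from-eq {gs = form β ∷ gs} (cong (a ∷_) (sym (Listₚ.++-assoc (A.encodeTerm t) (A.encodeTerm u) rest))) refl refl
          (form-step {a = a} {i = i} {gs = gs} {p} {m} {β}
            (same-program node≡ (terms-node β j {p} {m} w ψ-text render≡)) cost
            (pair-run t u (main-term t) (main-term u) {β} {j} {I} {gs} eq fits I≤N
              (from-eq {gs = gs} refl (▷-++ (blockText β (any I))) (▷-++ ψ-text) r′))))
      where
      i : List A.Sym
      i = A.encodeTerm t ++ A.encodeTerm u ++ rest
      i-length : length i ≡ sizeT t + sizeT u + r
      i-length = trans (++-size (A.encodeTerm t) (term-length t) (++-size (A.encodeTerm u) (term-length u) eq)) (sym (ℕₚ.+-assoc (sizeT t) (sizeT u) r))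
      open Node {i} {gs} i-length fits

    main-atom : ∀ α → FormulaRun (atom α)
    main-atom (t ≐ u) {β} {gs} {r} eq fits r′ =
      main-terms t u {β} {false} {A.eq} {gs} (literally opening) opening eq fits refl (render-literally 0 (fresh (sizeT t + sizeT u) r) opening)
        (track-cases {λ β → 3 + (39 + (12 * length (anyItems β) + 1 + (12 * length (literally opening) + 1 + 32))) ≤ K}
          (within _) (within _) β) r′
    main-atom (t ≺ u) {β} {gs} {r} {m = m} eq fits r′ =
      main-terms t u {β} {true} {A.lt} {gs} (conjItems (lessT 2)) (opening ++ H.encodeLTL (lessT I) ++ H.not ∷ opening) eq fits refl (render-conj 0 I (lessT 2))
        (track-cases {λ β → 3 + (39 + (12 * length (anyItems β) + 1 + (12 * length (conjItems (lessT 2)) + 1 + 32))) ≤ K}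
          (within _) (within _) β)
        (from-eq {gs = gs} refl refl (cong (λ w → (opening ++ w) ▷ m) (sym (Listₚ.++-assoc (H.encodeLTL (lessT I)) (H.not ∷ opening) _))) r′)
      where
      I : ℕ
      I = fresh (sizeT t + sizeT u) r
    main-atom (t ∈ˢ x) {β} {gs} {r} {rest} {p} {m} {c} {τ} eq fits r′ = weaken (cost (sizeT t) x c)
        (from-eq {gs = form β ∷ gs} (cong (A.inˢ ∷_) (sym (Listₚ.++-assoc (A.encodeTerm t) (A.encodeIndex x) rest))) refl refl
          (form-step {a = A.inˢ} {i = i} {gs = gs} {p} {m} {β} (member-node β)
            (track-cases {λ β → 3 + (39 + (12 * length (anyItems β) + 1 + (37 + 32))) ≤ K} (within _) (within _) β)
            (main-term t {β} {false} {I} {neg ∷ mem I ∷ gs} (++-size (A.encodeIndex x) (index-length x) eq)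
              (child fits (goal-size {gs} {I} {β} {false} I≤N) (ℕₚ.m≤m+n _ _) (ℕₚ.≤-reflexive (sym (ℕₚ.+-assoc (sizeT t) (suc x) r)))) I≤
              (neg-step {gs = mem I ∷ gs} mem-step))))
      where
      i : List A.Sym
      i = A.encodeTerm t ++ A.encodeIndex x ++ rest
      i-length : length i ≡ sizeT t + suc x + r
      i-length = trans (++-size (A.encodeTerm t) (term-length t) (++-size (A.encodeIndex x) (index-length x) eq)) (sym (ℕₚ.+-assoc (sizeT t) (suc x) r))
      open Node {i} {gs} i-length fits
      T₁ : Tree
      T₁ = termTree (scope gs) I 0 (suc x + r) t
      x≤ : x ≤ b
      x≤ = ℕₚ.≤-trans (ℕₚ.≤-trans (ℕₚ.n≤1+n x) (ℕₚ.≤-trans (ℕₚ.m≤n+m (suc x) (sizeT t)) (ℕₚ.≤-trans (ℕₚ.m≤m+n _ r) (ℕₚ.m≤n+m _ 14)))) I≤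
      y : ℕ
      y = find (scope gs) set x
      after : Continues ⟪ rest , gs , prefixText β T₁ ▷ blockText β (any I) ▷ p , H.encodeLTL (meetT I y) ▷ out H.not ∷ matrixText T₁ ▷ opening ▷ m ⟫ c τ
      after = from-eq {gs = gs} refl
        (trans (cong (λ w → (blockText β (any I) ++ w) ▷ p) (Listₚ.++-identityʳ (prefixText β T₁))) (▷-++ (blockText β (any I))))
        (▷-++ (matrixText T₁)) r′
      p′ m′ : List Γ
      p′ = prefixText β T₁ ▷ blockText β (any I) ▷ p
      m′ = out H.not ∷ matrixText T₁ ▷ opening ▷ m
      mem-step : Continues ⟪ A.encodeIndex x ++ rest , mem I ∷ gs , p′ , m′ ⟫ (K + c) τ
      mem-step = weaken (ℕₚ.+-monoˡ-≤ c (within (1 + (4 + (28 + (12 * length (items (meetT 1 2)) + 1 + 4)) + 1))))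
        (again (pop-just refl ⨾ (readName-run {b} {A.encodeIndex x ++ rest} {flat gs} {p′} {m′} {0} I I≤ ⨾
          lookup-node set (meetT 1 2) x {rest} {gs} {p′} {m′} {I} I≤ x≤ gs≤) ⨾ skip-run) after)
      -- Three iterations besides the term: the node, the negation and the membership goal. The
      -- index of the set variable pays for the last ones.
      cost : ∀ a x c → K + (K * (2 * a) + (K + (K + c))) ≤ K * (2 * suc (a + suc x)) + c
      cost a x c = ℕₚ.≤-trans (ℕₚ.m≤m+n _ (K * (2 * x + 1))) (ℕₚ.≤-reflexive (arrange K a x c))
        where
        arrange : ∀ K a x c → K + (K * (2 * a) + (K + (K + c))) + K * (2 * x + 1) ≡ K * (2 * suc (a + suc x)) + c
        arrange = solve-∀
    main-atom (x ∈ᶠ y) {β} {gs} {r} {rest} {p} {m} {c} {τ} eq fits r′ = weaken (single-cost (suc x + suc y) c)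
        (from-eq {gs = form β ∷ gs} (cong (A.inᶠ ∷_) (sym (Listₚ.++-assoc (A.encodeIndex x) (A.encodeIndex y) rest))) refl refl
          (form-step {a = A.inᶠ} {i = i} {gs = gs} {p} {m} {β} (family-node {x} {y} {rest} {gs} i-length fits x≤ y≤ β)
            (within _)
            (from-eq {gs = gs} refl (cong (_▷ p) (Listₚ.++-identityʳ (blockText β (inside I (find (scope gs) family y))))) refl r′)))
      where
      i : List A.Sym
      i = A.encodeIndex x ++ A.encodeIndex y ++ rest
      i-length : length i ≡ suc x + suc y + r
      i-length = trans (++-size (A.encodeIndex x) (index-length x) (++-size (A.encodeIndex y) (index-length y) eq)) (sym (ℕₚ.+-assoc (suc x) (suc y) r))
      open Node {i} {gs} i-length fits
      x≤ : x ≤ b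
      x≤ = ℕₚ.≤-trans (ℕₚ.≤-trans (ℕₚ.n≤1+n x) (ℕₚ.≤-trans (ℕₚ.m≤m+n (suc x) (suc y)) (ℕₚ.≤-trans (ℕₚ.m≤m+n _ r) (ℕₚ.m≤n+m _ 14)))) I≤
      y≤ : y ≤ b
      y≤ = ℕₚ.≤-trans (ℕₚ.≤-trans (ℕₚ.n≤1+n y) (ℕₚ.≤-trans (ℕₚ.m≤n+m (suc y) (suc x)) (ℕₚ.≤-trans (ℕₚ.m≤m+n _ r) (ℕₚ.m≤n+m _ 14)))) I≤

-- Running the goals for formulas

module LowerProgramTotal (n : ℕ) where

  open Prenexing n
  open TrackFormulas n
  open LowerTranslation n
  open LowerSentence n
  open LowerProgram n
  open LowerProgramCorrectness n
  open LowerProgramLookup n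
  open LowerProgramMain n
  open A using (Sort; num; set; family; Term; _⊕_; _⊗_; Atom; _≐_; _≺_; _∈ˢ_; _∈ᶠ_; atom)
  open Programs A.Sym H.Sym Mark 8

  module Formulas (b N : ℕ) (N≤b : N ≤ b) where

    open Bounded b N N≤b
    open Fits

    bind-size : ∀ {s x I gs} → x ≤ N → I ≤ N → length (flat (bind s x I ∷ gs)) ≤ G + length (flat gs)
    bind-size {s} {x} {I} {gs} x≤ I≤ = subst (_≤ G + length (flat gs)) (sym (trans (bind-length s x I gs) (arrange x I (length (flat gs)))))
      (ℕₚ.+-monoˡ-≤ (length (flat gs)) (ℕₚ.≤-trans (ℕₚ.+-monoʳ-≤ 3 (ℕₚ.+-mono-≤ x≤ I≤)) (ℕₚ.≤-trans (ℕₚ.m≤m+n _ 2) (ℕₚ.≤-reflexive (total N)))))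
      where
      arrange : ∀ x i l → suc (suc x + (suc i + l)) ≡ 3 + (x + i) + l
      arrange = solve-∀
      total : ∀ N → 3 + (N + N) + 2 ≡ 2 * N + 5
      total = solve-∀

    main-formula : ∀ φ → FormulaRun φ
    -- Common to conjunction and disjunction, which differ in the opening text and in whether a
    -- `neg` waits in `gs′` between the subformulas.
    main-connective : ∀ φ χ (w : List H.Sym) (a : A.Sym) (new : Bool → Prog ⊤) → (∀ β → formulaNode β a ≡ (text mtx (literally w) >> new β)) → length w ≤ 3 →
      ∀ {β gs r rest p m c c′ τ} gs′ → length rest ≡ r → Fits gs (suc (size φ + size χ)) r → length (flat gs′) ≤ G + length (flat gs) → scope gs′ ≡ scope gs →
      Run b (new β) ⟪ A.encodeFormula φ ++ A.encodeFormula χ ++ rest , gs , p , w ▷ m ⟫ 6 tt ⟪ A.encodeFormula φ ++ A.encodeFormula χ ++ rest , form β ∷ gs′ , p , w ▷ m ⟫ →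
      let T₁ = tree (scope gs) (size χ + r) φ in
      Continues ⟪ A.encodeFormula χ ++ rest , gs′ , prefixText β T₁ ▷ p , matrixText T₁ ▷ w ▷ m ⟫ c′ τ → K * (2 * size χ) + (K + c) ≡ c′ →
      Continues ⟪ (a ∷ A.encodeFormula φ ++ A.encodeFormula χ) ++ rest , form β ∷ gs , p , m ⟫ (K * (2 * suc (size φ + size χ)) + c) τ
    main-quantifier : ∀ γ s x φ (a : A.Sym) → ∀ {β gs r rest p m c τ} → formulaNode β a ≡ quantifier γ s β → length rest ≡ r → Fits gs (suc (suc x + size φ)) r →
      let I = fresh (suc x + size φ) r ; T₁ = tree ((s , x , I) ∷ scope gs) r φ in
      Continues ⟪ rest , gs , (blockText γ (blockOf s I) ++ prefixText β T₁) ▷ p , matrixText T₁ ▷ m ⟫ c τ →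
      Continues ⟪ (a ∷ A.encodeIndex x ++ A.encodeFormula φ) ++ rest , form β ∷ gs , p , m ⟫ (K * (2 * suc (suc x + size φ)) + c) τ
    main-formula (atom α) = main-atom α
    main-formula (A.not φ) {β} {gs} {r} {rest} {p} {m} {c} eq fits r′ = weaken bound
      (form-step {a = A.Sym.not} {i = A.encodeFormula φ ++ rest} {gs = gs} {p} {m} {β}
        (text-writes mtx (literally (H.not ∷ [])) {A.encodeFormula φ ++ rest} {flat gs} {p} {m} {0} {0} {m} z≤n z≤n refl ⨾ push-run) (within 18)
        (main-formula φ {¬ᵇ β} {gs} eq (child fits (ℕₚ.m≤n+m _ G) ℕₚ.≤-refl ℕₚ.≤-refl) r′))
      where
      bound : K + (K * (2 * size φ) + c) ≤ K * (2 * suc (size φ)) + c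
      bound = ℕₚ.≤-trans (ℕₚ.m≤m+n _ K) (ℕₚ.≤-reflexive (arrange K (size φ) c))
        where
        arrange : ∀ K a c → K + (K * (2 * a) + c) + K ≡ K * (2 * suc a) + c
        arrange = solve-∀
    main-formula (φ A.and χ) {β} {gs} {r} {rest} {p} {m} {c} {τ} eq fits r′ =
      main-connective φ χ opening A.Sym.and (λ β → push Gls (wrk (form β)) >> (push Gls (wrk neg) >> push Gls (wrk (form β)))) (λ _ → refl) ℕₚ.≤-refl
        {c = c} (neg ∷ form β ∷ gs) eq fits (ℕₚ.+-monoˡ-≤ (length (flat gs)) (ℕₚ.≤-trans (s≤s (s≤s z≤n)) (ℕₚ.m≤n+m 5 (2 * N)))) refl
        (push-run ⨾ push-run ⨾ push-run)
        (neg-step {gs = form β ∷ gs} (main-formula χ {β} {gs} eq (child fits (ℕₚ.m≤n+m _ G) (ℕₚ.m≤n+m _ _) (ℕₚ.+-monoˡ-≤ r (ℕₚ.m≤n+m _ (size φ))))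
          (from-eq {gs = gs} refl (▷-++ (prefixText β T₁)) (▷-++ (matrixText T₁)) r′)))
        (arrange K (size χ) c)
      where
      T₁ : Tree
      T₁ = tree (scope gs) (size χ + r) φ
      arrange : ∀ K a c → K * (2 * a) + (K + c) ≡ K + (K * (2 * a) + c)
      arrange = solve-∀
    main-formula (φ A.or χ) {β} {gs} {r} {rest} {p} {m} {c} {τ} eq fits r′ =
      main-connective φ χ (H.or ∷ []) A.Sym.or (λ β → push Gls (wrk (form β)) >> push Gls (wrk (form β))) (λ _ → refl) (s≤s z≤n)
        {c = c} (form β ∷ gs) eq fits (ℕₚ.+-monoˡ-≤ (length (flat gs)) (ℕₚ.≤-trans (s≤s z≤n) (ℕₚ.m≤n+m 5 (2 * N)))) refl
        (weaken (toWitness {a? = 4 ℕₚ.≤? 6} tt) (push-run ⨾ push-run))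
        (weaken (ℕₚ.≤-trans (ℕₚ.m≤n+m _ K) (ℕₚ.≤-reflexive (arrange K (size χ) c)))
          (main-formula χ {β} {gs} eq (child fits (ℕₚ.m≤n+m _ G) (ℕₚ.m≤n+m _ _) (ℕₚ.+-monoˡ-≤ r (ℕₚ.m≤n+m _ (size φ))))
            (from-eq {gs = gs} refl (▷-++ (prefixText β T₁)) (▷-++ (matrixText T₁)) r′)))
        refl
      where
      T₁ : Tree
      T₁ = tree (scope gs) (size χ + r) φ
      arrange : ∀ K a c → K + (K * (2 * a) + c) ≡ K * (2 * a) + (K + c)
      arrange = solve-∀
    main-formula (A.all s x φ) {β} eq fits r′ = main-quantifier (¬ᵇ β) s x φ (A.all s) refl eq fits r′
    main-formula (A.ex s x φ) {β} eq fits r′ = main-quantifier β s x φ (A.ex s) refl eq fits r′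
    main-connective φ χ w a new node≡ w≤ {β} {gs} {r} {rest} {p} {m} {c} gs′ eq fits gs′≤ scope≡ pushes r′ refl =
      by (arrange K (size φ) (size χ) c)
        (from-eq {gs = form β ∷ gs} (cong (a ∷_) (sym (Listₚ.++-assoc (A.encodeFormula φ) (A.encodeFormula χ) rest))) refl refl
          (form-step {a = a} {i = i} {gs = gs} {p} {m} {β}
            (same-program (node≡ β) (text-writes mtx (literally w) {i} {flat gs} {p} {m} {0} {0} {m} z≤n z≤n (render-literally 0 0 w) ⨾ pushes)) cost
            (main-formula φ {β} {gs′} (++-size (A.encodeFormula χ) (formula-length χ) eq)
              (child fits gs′≤ (ℕₚ.m≤m+n _ _) (ℕₚ.≤-reflexive (sym (ℕₚ.+-assoc (size φ) (size χ) r))))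
              (subst (λ ρ → let T₁ = tree ρ (size χ + r) φ in Continues ⟪ A.encodeFormula χ ++ rest , gs′ , prefixText β T₁ ▷ p , matrixText T₁ ▷ w ▷ m ⟫ _ _)
                (sym scope≡) r′))))
      where
      i : List A.Sym
      i = A.encodeFormula φ ++ A.encodeFormula χ ++ rest
      cost : 3 + (12 * length (literally w) + 1 + 6) ≤ K
      cost = ℕₚ.≤-trans (ℕₚ.+-monoʳ-≤ 3 (ℕₚ.+-monoˡ-≤ 6 (ℕₚ.+-monoˡ-≤ 1 (ℕₚ.*-monoʳ-≤ 12 (subst (_≤ 3) (sym (Listₚ.length-map lit w)) w≤)))))
        (within 46)
      arrange : ∀ K a d c → K + (K * (2 * a) + (K * (2 * d) + (K + c))) ≡ K * (2 * suc (a + d)) + c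
      arrange = solve-∀
    main-quantifier γ s x φ a {β} {gs} {r} {rest} {p} {m} {c} node≡ eq fits r′ = weaken bound
        (from-eq {gs = form β ∷ gs} (cong (a ∷_) (sym (Listₚ.++-assoc (A.encodeIndex x) (A.encodeFormula φ) rest))) refl refl
          (form-step {a = a} {i = i} {gs = gs} {p} {m} {β}
            (same-program node≡ (quantifier-node {x} {A.encodeFormula φ ++ rest} {gs} i-length fits (ℕₚ.≤-trans x≤ N≤b) γ s β {p} {m})) (cost γ s)
            (main-formula φ {β} {bind s x I ∷ gs} eq
              (child fits (bind-size {s} {x} {I} {gs} x≤ I≤N) (ℕₚ.m≤n+m _ _) (ℕₚ.+-monoˡ-≤ r (ℕₚ.m≤n+m _ (suc x))))
              (bind-step {gs = gs} (ℕₚ.≤-trans x≤ N≤b) I≤ (from-eq {gs = gs} refl (▷-++ (blockText γ (blockOf s I))) refl r′)))))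
      where
      i : List A.Sym
      i = A.encodeIndex x ++ A.encodeFormula φ ++ rest
      i-length : length i ≡ suc x + size φ + r
      i-length = trans (++-size (A.encodeIndex x) (index-length x) (++-size (A.encodeFormula φ) (formula-length φ) eq)) (sym (ℕₚ.+-assoc (suc x) (size φ) r))
      open Node {i} {gs} i-length fits
      x≤ : x ≤ N
      x≤ = ℕₚ.≤-trans (ℕₚ.≤-trans (ℕₚ.n≤1+n x) (ℕₚ.≤-trans (ℕₚ.m≤m+n (suc x) (size φ)) (ℕₚ.≤-trans (ℕₚ.m≤m+n _ r) (ℕₚ.m≤n+m _ 14)))) I≤N
      cost : ∀ γ s → 3 + (39 + (12 * length (blockItems γ s) + 1 + 28)) ≤ K
      cost γ num    = within _
      cost γ set    = within _
      cost γ family = within _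
      bound : K + (K * (2 * size φ) + (K + c)) ≤ K * (2 * suc (suc x + size φ)) + c
      bound = ℕₚ.≤-trans (ℕₚ.m≤m+n _ (K * (2 * suc x))) (ℕₚ.≤-reflexive (arrange K (size φ) x c))
        where
        arrange : ∀ K a x c → K + (K * (2 * a) + (K + c)) + K * (2 * suc x) ≡ K * (2 * suc (suc x + a)) + c
        arrange = solve-∀

-- Time bound for the lower-bound program, and the two reductions combined

module LowerProgramReduction (n : ℕ) where

  open Prenexing n
  open TrackFormulas n
  open LowerTranslation n
  open LowerSentence n
  open LowerProgram n
  open LowerProgramCorrectness n
  open LowerProgramLookup n
  open LowerProgramMain n
  open A using (Sort; num; set; family; Term; _⊕_; _⊗_; Atom; _≐_; _≺_; _∈ˢ_; _∈ᶠ_; atom)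
  open Programs A.Sym H.Sym Mark 8

  open LowerProgramTotal n

  unloadMtx-run : ∀ m o p → Run 0 (move Mtx Out) ([] ∷ o ∷ [] ∷ [] ∷ p ∷ m ∷ [] ∷ [] ∷ [] ∷ [] ∷ []) (4 * length m + 2) tt
                                  ([] ∷ (m ʳ++ o) ∷ [] ∷ [] ∷ p ∷ [] ∷ [] ∷ [] ∷ [] ∷ [] ∷ [])
  unloadMtx-run []      o p = exit (pop-nothing refl ⨾ skip-run)
  unloadMtx-run (c ∷ m) o p = by (once-more 4 2 (length m)) (again (pop-just refl ⨾ push-run ⨾ skip-run) (unloadMtx-run m (c ∷ o) p))

  unloadPfx-run : ∀ p o → Run 0 (move Pfx Out) ([] ∷ o ∷ [] ∷ [] ∷ p ∷ [] ∷ [] ∷ [] ∷ [] ∷ [] ∷ []) (4 * length p + 2) tt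
                                ([] ∷ (p ʳ++ o) ∷ [] ∷ [] ∷ [] ∷ [] ∷ [] ∷ [] ∷ [] ∷ [] ∷ [])
  unloadPfx-run []      o = exit (pop-nothing refl ⨾ skip-run)
  unloadPfx-run (c ∷ p) o = by (once-more 4 2 (length p)) (again (pop-just refl ⨾ push-run ⨾ skip-run) (unloadPfx-run p (c ∷ o)))

  setup : List H.Sym → List H.Sym → ℕ
  setup u v = (12 * length (literally u) + 1) + ((12 * length (literally v) + 1) + 4)

  -- The unit of time. Names are at most 14 + ℓ, and each of the ℓ symbols may raise the goal stack
  -- by an amount linear in names, hence a quadratic bound.
  bounds : ℕ → ℕ
  bounds ℓ = 14 + (ℓ + 0) + (2 * (14 + (ℓ + 0)) + 5) * ℓ

  factor : ℕ → ℕ → ℕ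
  factor s k = (9 * (s + 2 * k) + 12) * 34

  total : ℕ → ℕ
  total t = t + ((4 * suc t + 2) + (4 * suc t + 2))

  -- Linearly many units, each of quadratic length, give the exponent 3.
  total-cost : ∀ s k ℓ t → t ≡ s + k * (2 * ℓ) → total t * suc (bounds ℓ) ≤ factor s k * suc ℓ ^ 3
  total-cost s k ℓ t refl =
    ℕₚ.≤-trans (ℕₚ.*-mono-≤ (ℕₚ.≤-trans (ℕₚ.m≤m+n (total t) (9 * (s * ℓ) + 18 * k + 12 * ℓ)) (ℕₚ.≤-reflexive (coefficient s k ℓ)))
                            (ℕₚ.≤-trans (ℕₚ.m≤m+n (suc (bounds ℓ)) (19 + 34 * ℓ + 32 * (ℓ * ℓ))) (ℕₚ.≤-reflexive (unit ℓ))))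
      (ℕₚ.≤-reflexive (arrange (9 * (s + 2 * k) + 12) (suc ℓ)))
    where
    coefficient : ∀ s k l → s + k * (2 * l) + (4 * suc (s + k * (2 * l)) + 2 + (4 * suc (s + k * (2 * l)) + 2)) + (9 * (s * l) + 18 * k + 12 * l)
                  ≡ (9 * (s + 2 * k) + 12) * suc l
    coefficient = solve-∀
    unit : ∀ l → suc (14 + (l + 0) + (2 * (14 + (l + 0)) + 5) * l) + (19 + 34 * l + 32 * (l * l)) ≡ 34 * (suc l * suc l)
    unit = solve-∀
    arrange : ∀ F l → F * l * (34 * (l * l)) ≡ F * 34 * (l * (l * (l * 1)))
    arrange = solve-∀

  lower-text : ∀ φ → H.encodeFormula (lowerFormula φ) ≡
    (blocksText tables ++ prefixText true (tree [] 0 φ)) ++ (axiomsText ++ matrixText (tree [] 0 φ))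
  lower-text φ = trans (closeAll-text tables (body φ)) (trans (cong (blocksText tables ++_) (trans (close-text true (tree [] 0 φ) _)
      (cong (prefixText true (tree [] 0 φ) ++_) matrix≡))) (sym (Listₚ.++-assoc (blocksText tables) (prefixText true (tree [] 0 φ)) _)))
    where
    matrix≡ : H.encodeLTL (axioms andL matrix (tree [] 0 φ)) ≡ axiomsText ++ matrixText (tree [] 0 φ)
    matrix≡ = cong (opening ++_) (sym (Listₚ.++-assoc (H.encodeLTL axioms) (H.not ∷ []) (matrixText (tree [] 0 φ))))

  module Reduction (u v : List H.Sym) (φ : A.Formula) where
    private
      ℓ : ℕ
      ℓ = size φ

      w₁ w₂ : List H.Sym
      w₁ = u ++ prefixText true (tree [] 0 φ)
      w₂ = v ++ matrixText (tree [] 0 φ)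

      i₀ : List A.Sym
      i₀ = A.encodeFormula φ

      b : ℕ
      b = bounds ℓ

      open Bounded b (14 + (ℓ + 0)) (ℕₚ.m≤m+n _ _)
      open Formulas b (14 + (ℓ + 0)) (ℕₚ.m≤m+n _ _)

    front-run : Run b (front u v) ⟨ i₀ , [] , [] , [] , 0 , 0 ⟩ (setup u v + K * (2 * ℓ)) tt ⟨ [] , [] , w₁ ▷ [] , w₂ ▷ [] , 0 , 0 ⟩
    front-run = by (arrange (12 * length (literally u) + 1) (12 * length (literally v) + 1) (K * (2 * ℓ)))
      (text-writes pfx (literally u) {i₀} {[]} {[]} {[]} {0} {0} {[]} z≤n z≤n (render-literally 0 0 u) ⨾
       text-writes mtx (literally v) {i₀} {[]} {u ▷ []} {[]} {0} {0} {[]} z≤n z≤n (render-literally 0 0 v) ⨾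
       push-run ⨾
       from-eq {gs = form true ∷ []} (Listₚ.++-identityʳ i₀) refl refl
         (main-formula φ {true} {[]} {0} {[]} refl (record { names = ℕₚ.≤-refl ; goals = ℕₚ.m≤n+m _ (14 + (ℓ + 0)) })
           (from-eq {gs = []} refl (▷-++ u) (▷-++ v) (exit (pop-nothing refl ⨾ skip-run)))))
      where
      arrange : ∀ a d c → a + (d + (2 + (c + 2))) ≡ a + (d + 4) + c
      arrange = solve-∀

    module _ {t : ℕ} (front-t : Run b (front u v) ⟨ i₀ , [] , [] , [] , 0 , 0 ⟩ t tt ⟨ [] , [] , w₁ ▷ [] , w₂ ▷ [] , 0 , 0 ⟩) where

      -- The logs are bounded by the time spent writing them plus the volume of the input, which
      -- fits into one further unit.
      unloaded-size : length (w₁ ▷ []) + (length (w₂ ▷ []) + 0) ≤ suc t * suc b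
      unloaded-size = ℕₚ.≤-trans (Run.grows front-t) (ℕₚ.≤-trans (ℕₚ.+-monoʳ-≤ (t * suc b) small) (ℕₚ.≤-reflexive (ℕₚ.+-comm (t * suc b) (suc b))))
        where
        small : length (map {B = Γ} inp i₀) + 0 ≤ suc b
        small = ℕₚ.≤-trans (ℕₚ.≤-reflexive (trans (ℕₚ.+-identityʳ _) (trans (Listₚ.length-map inp i₀) (formula-length φ))))
          (ℕₚ.≤-trans (ℕₚ.≤-trans (ℕₚ.m≤m+n ℓ 0) (ℕₚ.m≤n+m (ℓ + 0) 14)) (ℕₚ.≤-trans (ℕₚ.m≤m+n (14 + (ℓ + 0)) _) (ℕₚ.n≤1+n b)))

      unload-cost : ∀ l → l ≤ suc t * suc b → (4 * l + 2) * 1 ≤ (4 * suc t + 2) * suc b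
      unload-cost l l≤ = ℕₚ.≤-trans (ℕₚ.≤-reflexive (ℕₚ.*-identityʳ (4 * l + 2))) (ℕₚ.≤-trans (ℕₚ.+-mono-≤ (ℕₚ.*-monoʳ-≤ 4 l≤) (ℕₚ.m≤m*n 2 (suc b)))
        (ℕₚ.≤-reflexive (arrange (suc t) (suc b))))
        where
        arrange : ∀ T b → 4 * (T * b) + 2 * b ≡ (4 * T + 2) * b
        arrange = solve-∀

      unloaded-run : Run 0 (program u v) ⟨ i₀ , [] , [] , [] , 0 , 0 ⟩ (total t * suc b) tt
                         ([] ∷ ((w₁ ▷ []) ʳ++ ((w₂ ▷ []) ʳ++ [])) ∷ [] ∷ [] ∷ [] ∷ [] ∷ [] ∷ [] ∷ [] ∷ [] ∷ [])
      unloaded-run = rescale (ℕₚ.≤-reflexive (sym (ℕₚ.*-identityʳ (total t * suc b))))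
        (front-t ⨾ rescale (unload-cost (length (w₂ ▷ [])) (ℕₚ.≤-trans (ℕₚ.≤-trans (ℕₚ.m≤m+n _ 0) (ℕₚ.m≤n+m _ (length (w₁ ▷ [])))) unloaded-size)) (unloadMtx-run (w₂ ▷ []) [] (w₁ ▷ [])) ⨾
         rescale (unload-cost (length (w₁ ▷ [])) (ℕₚ.≤-trans (ℕₚ.m≤m+n _ _) unloaded-size)) (unloadPfx-run (w₁ ▷ []) ((w₂ ▷ []) ʳ++ [])))

    program-run : ∀ {w} → w ≡ w₁ ++ w₂ → ∃[ c ] ∃[ σ ] Run 0 (program u v) ⟨ i₀ , [] , [] , [] , 0 , 0 ⟩ c tt σ ×
                  lookup σ Out ≡ map out w × c ≤ factor (setup u v) K * suc (length i₀) ^ 3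
    program-run refl = _ , _ , unloaded-run front-run , trans (cong ((w₁ ▷ []) ʳ++_) (▷-ʳ++ w₂)) (trans (▷-ʳ++ w₁)
        (trans (cong (map out w₁ ++_) (Listₚ.++-identityʳ (map out w₂))) (sym (Listₚ.map-++ out w₁ w₂)))) ,
      subst (λ l → total (setup u v + K * (2 * ℓ)) * suc b ≤ factor (setup u v) K * suc l ^ 3) (sym (formula-length φ)) (total-cost (setup u v) K ℓ (setup u v + K * (2 * ℓ)) refl)

  open Compilation {A.Sym} {H.Sym} {Mark} {8} using (polyTime)

  lower-polyTime : PolyTime {A = A.Sentence} (A.encodeFormula ∘ proj₁) (H.encodeFormula ∘ proj₁ ∘ proj₁) (lowerSentence ∘ proj₁)
  lower-polyTime = polyTime (program u v) (A.encodeFormula ∘ proj₁) (H.encodeFormula ∘ proj₁ ∘ proj₁) (lowerSentence ∘ proj₁) (factor (setup u v) K) 3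
    λ (φ , _) → Reduction.program-run u v φ (lower-text φ)
    where
    u v : List H.Sym
    u = blocksText tables
    v = axiomsText

lower-bound : (em : ExcludedMiddle (lsuc 0ℓ)) (ext : Extensionality (lsuc 0ℓ) (lsuc 0ℓ)) (n : ℕ) →
              ThirdOrderArithmeticTruth ≤ₚ FiniteStateSatisfiability (suc n)
lower-bound em ext n = proj₁ ∘ LowerSentence.lowerSentence n ∘ proj₁ , LowerProgramReduction.lower-polyTime n ,
                       LowerSentenceCorrectness.lower-correct em ext n

xaFree-lower-bound : (em : ExcludedMiddle (lsuc 0ℓ)) (ext : Extensionality (lsuc 0ℓ) (lsuc 0ℓ)) (n : ℕ) →
                     ThirdOrderArithmeticTruth ≤ₚ XaFreeFiniteStateSatisfiability (suc n)
xaFree-lower-bound em ext n = LowerSentence.lowerSentence n ∘ proj₁ , LowerProgramReduction.lower-polyTime n ,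
                              LowerSentenceCorrectness.lower-correct em ext n

theorem4p4 : ExcludedMiddle (lsuc 0ℓ) → Extensionality (lsuc 0ℓ) (lsuc 0ℓ) →
  (n : ℕ) →
  (FiniteStateSatisfiability (suc n) ≡ₚ ThirdOrderArithmeticTruth) ×
  (ThirdOrderArithmeticTruth ≤ₚ XaFreeFiniteStateSatisfiability (suc n))
theorem4p4 em ext n = (Upper.upper-bound em ext n , lower-bound em ext n) , xaFree-lower-bound em ext n
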